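{- Let $K\subset\mathbb{R}^d$ be a strictly convex polyhedral cone with apex $v$ and set of generators $W=\{w_1,\dots,w_n\}$, $n\ge d$, and let $p_K$ be the homogeneous polynomial of degree $n-d$ attached to $K$ and $W$ (defined in the context). Let $D=\{w_{i_1},\dots,w_{i_{d-1}}\}$ be a diagonal of $K$, i.e. a $(d-1)$-element subset of $W$, and set $D^*:=[w_{i_1},\dots,w_{i_{d-1}}]$ (generalized cross product). (i) If $D$ is extremal, then $$p_K(D^*)=\varepsilon\prod_{\substack{1\le j\le n\\ w_j\notin D}}\det(w_{i_1},\dots,w_{i_{d-1}},w_j),$$ where $\varepsilon\in\{1,-1\}$ is the common sign of all the nonzero determinants appearing on the right-hand side (if one of the determinants is zero, the right-hand side is $0$). (ii) If $D$ is interior, then $p_K(D^*)=0$.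
   Context: $\langle\cdot,\cdot\rangle$ is the standard inner product on $\mathbb{R}^d$. The cone with apex $v$ and generators $w_1,\dots,w_n$ is $K=\{v+t_1w_1+\dots+t_nw_n : t_1,\dots,t_n>0\}$, where the $w_i$ are distinct nonzero vectors; strictly convex means that $K$ does not contain a line (equivalently, there is $\xi$ with $\langle w_i,\xi\rangle>0$ for all $i$). Generalized cross product: for $x_1,\dots,x_{d-1}\in\mathbb{R}^d$, $[x_1,\dots,x_{d-1}]\in\mathbb{R}^d$ is the unique vector with $\langle[x_1,\dots,x_{d-1}],x\rangle=\det(x_1,\dots,x_{d-1},x)$ for all $x\in\mathbb{R}^d$. The polynomial $p_K$: it is the unique homogeneous polynomial in $\xi=(\xi_1,\dots,\xi_d)$ of degree $n-d$ such that $$\int_K e^{ -\langle x-v,\xi\rangle}\,dx=\frac{p_K(\xi)}{\prod_{i=1}^n\langle w_i,\xi\rangle}$$ for all $\xi\in\mathbb{R}^d$ with $\langle w_i,\xi\rangle>0$ for every $i$. For example, when $n=d$, $p_K$ is the constant $|\det(w_1,\dots,w_d)|$. Diagonals: a diagonal of $K$ is a $(d-1)$-element subset $D$ of $W$, with a fixed ordering $w_{i_1},\dots,w_{i_{d-1}}$ of its elements. It is extremal if the cone $\{v+\sum_{x\in D}t_x x: t_x>0\}$ spanned by $D$ at the apex is contained in the boundary $\partial K$ of $K$, and interior otherwise. -}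

module Defs where

open import Algebra.Bundles using (CommutativeRing; Semiring)
open import Axiom.ExcludedMiddle using (ExcludedMiddle)
open import Data.Bool.Base using (if_then_else_)
open import Data.Fin.Base using (Fin; zero; suc; toℕ)
open import Data.Fin.Properties using (any?; _≟_)
open import Data.List.Base as List using (List; allFin; filter)
open import Data.Nat.Base as ℕ using (ℕ; zero; suc; _≥_)
open import Data.Product.Base using (Σ; ∃; _×_; _,_; proj₁)
open import Data.Sum.Base using (_⊎_)
open import Data.Vec.Base as Vec using (Vec)
open import Data.Vec.Functional using (Vector; []; _∷_; head; tail; removeAt)
open import Level using (0ℓ)
open import Relation.Binary.Core using (Rel)
open import Relation.Binary.Structures using (IsStrictTotalOrder)
open import Relation.Binary.PropositionalEquality.Core using (_≡_)
open import Relation.Nullary.Decidable using (does; ¬?)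
open import Relation.Nullary.Negation using (¬_)
open import Relation.Unary using (Pred)

-- The real numbers, up to isomorphism: a complete ordered field.  A theorem
-- about ℝ is stated for an arbitrary such structure; there are models only
-- in the presence of excluded middle, which users of this record assume.
record CompleteOrderedField : Set₁ where
  infix 4 _<_ _≤_
  infix 8 _⁻¹
  infixl 7 _/_
  field
    commutativeRing : CommutativeRing 0ℓ 0ℓ

  open CommutativeRing commutativeRing public
    using (Carrier; _≈_; _+_; _*_; -_; _-_; 0#; 1#; setoid; semiring)

  field
    _<_                : Rel Carrier 0ℓ
    isStrictTotalOrder : IsStrictTotalOrder _≈_ _<_
    +-monoʳ-<          : ∀ x {y z} → y < z → x + y < x + z
    *-pos              : ∀ {x y} → 0# < x → 0# < y → 0# < x * y
    0<1                : 0# < 1#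
    -- Total for convenience; nothing is said about the value at 0.
    _⁻¹                : Carrier → Carrier
    ⁻¹-cong            : ∀ {x y} → x ≈ y → x ⁻¹ ≈ y ⁻¹
    ⁻¹-inverseʳ        : ∀ {x} → ¬ x ≈ 0# → x * x ⁻¹ ≈ 1#

  _≤_ : Rel Carrier 0ℓ
  x ≤ y = x < y ⊎ x ≈ y

  _/_ : Carrier → Carrier → Carrier
  x / y = x * y ⁻¹

  UpperBound : Pred Carrier 0ℓ → Pred Carrier 0ℓ
  UpperBound P b = ∀ {x} → P x → x ≤ b

  field
    supremum : (P : Pred Carrier 0ℓ) → ∃ P → ∃ (UpperBound P) →
               ∃ λ s → UpperBound P s × (∀ {b} → UpperBound P b → s ≤ b)

module Real (em : ExcludedMiddle 0ℓ) (ℝ : CompleteOrderedField) where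

  open CompleteOrderedField ℝ
  open import Algebra.Definitions.RawSemiring
    (Semiring.rawSemiring semiring)
    using (_^_; sum; product) renaming (_×_ to _·_)
  open import Data.Vec.Functional.Relation.Binary.Equality.Setoid setoid public
    using (_≋_)

  private
    variable
      d m n : ℕ

  fromℕ : ℕ → Carrier
  fromℕ k = k · 1#

  ----------------------------------------------------------------------
  -- Linear algebra.  Points and vectors of ℝᵈ are families Fin d → ℝ.

  ℝ^ : ℕ → Set
  ℝ^ d = Vector Carrier d

  infixl 6 _⊕_
  infixr 7 _⊛_

  0ᵛ : ℝ^ d
  0ᵛ _ = 0#

  _⊕_ : ℝ^ d → ℝ^ d → ℝ^ d
  (x ⊕ y) j = x j + y j

  _⊛_ : Carrier → ℝ^ d → ℝ^ d
  (s ⊛ x) j = s * x j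

  _⊖_ : ℝ^ d → ℝ^ d → ℝ^ d
  (x ⊖ y) j = x j - y j

  ⟨_,_⟩ : ℝ^ d → ℝ^ d → Carrier
  ⟨ x , y ⟩ = sum (λ j → x j * y j)

  combination : (Fin n → Carrier) → (Fin n → ℝ^ d) → ℝ^ d
  combination t w j = sum (λ i → t i * w i j)

  -- Laplace expansion along the first of the d vectors.
  det : Vector (ℝ^ d) d → Carrier
  det {zero}  x = 1#
  det {suc d} x = sum λ j →
    (- 1#) ^ toℕ j * (head x j * det (λ i → removeAt (tail x i) j))

  infixl 5 _∷ʳ_

  _∷ʳ_ : ∀ {A : Set} → Vector A n → A → Vector A (suc n)
  _∷ʳ_ {zero}  xs y = y ∷ []
  _∷ʳ_ {suc n} xs y = head xs ∷ (tail xs ∷ʳ y)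

  IsCrossProduct : Vector (ℝ^ (suc m)) m → ℝ^ (suc m) → Set
  IsCrossProduct xs c = ∀ x → ⟨ c , x ⟩ ≈ det (xs ∷ʳ x)

  ----------------------------------------------------------------------
  -- Limits and the exponential function

  Near : Carrier → Rel Carrier 0ℓ
  Near ε x y = (x - ε < y) × (y < x + ε)

  _⟶_ : (ℕ → Carrier) → Carrier → Set
  s ⟶ l = ∀ {ε} → 0# < ε → ∃ λ N₀ → ∀ {N} → N ≥ N₀ → Near ε l (s N)

  -- exp x = lim (1 + x/k)ᵏ, with k = suc N to avoid dividing by 0.
  IsExp : (Carrier → Carrier) → Set
  IsExp exp = ∀ x → (λ N → (1# + x / fromℕ (suc N)) ^ suc N) ⟶ exp x

  ----------------------------------------------------------------------
  -- The (improper) Riemann integral over ℝᵈ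

  gridSum : ∀ {N} → (Vec (Fin N) d → Carrier) → Carrier
  gridSum {zero}  g = g Vec.[]
  gridSum {suc d} g = sum λ k → gridSum λ ks → g (k Vec.∷ ks)

  module Grid (M N : ℕ) where

    -- The cube [-M,M]ᵈ is cut into (N+1)ᵈ equal closed cubes.
    step : Carrier
    step = (fromℕ M + fromℕ M) / fromℕ (suc N)

    node : ℕ → Carrier
    node k = - fromℕ M + fromℕ k * step

    InCell : Vec (Fin (suc N)) d → ℝ^ d → Set
    InCell k x = ∀ j →
      (node (toℕ (Vec.lookup k j)) ≤ x j) ×
      (x j ≤ node (suc (toℕ (Vec.lookup k j))))

    riemannSum : (ℝ^ d → Carrier) → (Vec (Fin (suc N)) d → ℝ^ d) → Carrier
    riemannSum {d} f tag = gridSum λ k → f (tag k) * step ^ d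

  open Grid

  -- Uniform partitions with arbitrary tags; for these, convergence is the
  -- same as for arbitrary partitions with mesh tending to 0.
  IsIntegralOnCube : (ℝ^ d → Carrier) → ℕ → Carrier → Set
  IsIntegralOnCube {d} f M I =
    ∀ {ε} → 0# < ε → ∃ λ N₀ → ∀ {N} → N ≥ N₀ →
    (tag : Vec (Fin (suc N)) d → ℝ^ d) → (∀ k → InCell M N k (tag k)) →
    Near ε I (riemannSum M N f tag)

  IsIntegral : (ℝ^ d → Carrier) → Carrier → Set
  IsIntegral f I = ∃ λ J → (∀ M → IsIntegralOnCube f M (J M)) × (J ⟶ I)

  _restrictedTo_ : (ℝ^ d → Carrier) → Pred (ℝ^ d) 0ℓ → ℝ^ d → Carrier
  (f restrictedTo K) x = if does (em {P = K x}) then f x else 0#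

  IsIntegralOver : Pred (ℝ^ d) 0ℓ → (ℝ^ d → Carrier) → Carrier → Set
  IsIntegralOver K f I = IsIntegral (f restrictedTo K) I

  ----------------------------------------------------------------------
  -- Homogeneous polynomials of degree k in d variables, as lists of terms
  -- (coefficient, exponents).  The empty list is the zero polynomial.

  Monomial : ℕ → ℕ → Set
  Monomial d k = Σ (Vec ℕ d) λ e → Vec.sum e ≡ k

  HomPoly : ℕ → ℕ → Set
  HomPoly d k = List (Carrier × Monomial d k)

  evalMonomial : ∀ {k} → Monomial d k → ℝ^ d → Carrier
  evalMonomial e ξ = product λ j → ξ j ^ Vec.lookup (proj₁ e) j

  eval : ∀ {k} → HomPoly d k → ℝ^ d → Carrier
  eval p ξ = List.foldr (λ { (c , e) s → c * evalMonomial e ξ + s }) 0# p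

  ----------------------------------------------------------------------
  -- Cones

  Cone : ℝ^ d → (Fin n → ℝ^ d) → Pred (ℝ^ d) 0ℓ
  Cone v w x = ∃ λ t → (∀ i → 0# < t i) × x ≋ (v ⊕ combination t w)

  ContainsLine : Pred (ℝ^ d) 0ℓ → Set
  ContainsLine K = ∃ λ a → ∃ λ b → ¬ b ≋ 0ᵛ × (∀ s → K (a ⊕ s ⊛ b))

  StrictlyConvex : Pred (ℝ^ d) 0ℓ → Set
  StrictlyConvex K = ¬ ContainsLine K

  -- Topological boundary; the neighbourhoods are open boxes.
  Boundary : Pred (ℝ^ d) 0ℓ → Pred (ℝ^ d) 0ℓ
  Boundary K x = ∀ {ε} → 0# < ε →
    (∃ λ y → (∀ j → Near ε (x j) (y j)) × K y) ×
    (∃ λ y → (∀ j → Near ε (x j) (y j)) × ¬ K y)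

  IsConePolynomial : (Carrier → Carrier) → (v : ℝ^ d) (w : Fin n → ℝ^ d) →
                     HomPoly d (n ℕ.∸ d) → Set
  IsConePolynomial exp v w p = ∀ ξ → (∀ i → 0# < ⟨ w i , ξ ⟩) →
    IsIntegralOver (Cone v w) (λ x → exp (- ⟨ x ⊖ v , ξ ⟩))
      (eval p ξ / product (λ i → ⟨ w i , ξ ⟩))

  -- A diagonal is an ordered family of distinct generators w ∘ D, given by
  -- an injective D : Fin m → Fin n, where d = suc m.

  Extremal : ℝ^ (suc m) → (Fin n → ℝ^ (suc m)) → (Fin m → Fin n) → Set
  Extremal v w D = ∀ x → Cone v (λ i → w (D i)) x → Boundary (Cone v w) x

  -- ∏ f j over the j with w j ∉ D; as the generators are distinct, these
  -- are the indices j not in the image of D.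
  productOutside : (Fin m → Fin n) → (Fin n → Carrier) → Carrier
  productOutside {n = n} D f = List.foldr _*_ 1#
    (List.map f (filter (λ j → ¬? (any? λ i → D i ≟ j)) (allFin n)))

  _∉Image_ : Fin n → (Fin m → Fin n) → Set
  j ∉Image D = ¬ ∃ λ i → D i ≡ j

{-# OPTIONS --safe #-}

-- The Laplace transform of K is the sum over the full-dimensional cells σ of a triangulation of |det σ| / ∏_{i∈σ} ⟨w_i, ξ⟩,
-- so p_K(ξ) = Σ_σ |det σ| ∏_{i∉σ} ⟨w_i, ξ⟩ for ξ in the dual cone, and then for all ξ.  As D* is orthogonal to D, at
-- ξ = D* only the cells σ = D ∪ {j} survive, and each of them contributes ± ∏_{i∉D} det(D, w_i).  The triangulation is
-- chosen so as to make these cells visible: every point of the closed cone has a lexicographically largest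
-- representation, where the coefficients of the generators outside D are compared first, and whether a representation
-- is the largest one depends only on its support.  If generators lie strictly on both sides of the hyperplane of D,
-- then no support containing D is optimal; if all of them lie strictly on one side, then exactly one D ∪ {j} is.
--
-- The integral over a simplicial cone is the limit of sums of exponentials over a lattice.  By pivoting on the lattice
-- basis (rounding one integer coordinate) such a sum reduces to geometric series, and the pivots multiply to the
-- determinant.

module Submission where

open import Defs
open import Axiom.ExcludedMiddle using (ExcludedMiddle)
open import Data.Bool.Base using (true; false; if_then_else_)
open import Data.Empty using (⊥; ⊥-elim)
open import Data.Fin.Base using (Fin; zero; suc; toℕ; fromℕ<; inject₁; punchIn; punchOut) renaming (fromℕ to lastFin)
import Data.Fin.Properties as Fin
open import Data.List.Base as List using (List)
open import Data.Nat.Base as ℕ using (ℕ; zero; suc; _∸_; _≥_)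
import Data.Nat.Properties as ℕ
open import Data.Product.Base using (∃; _×_; _,_; proj₁; proj₂)
open import Data.Sum.Base using (_⊎_; inj₁; inj₂; [_,_]′)
open import Function.Base using (_∘_; id; const)
open import Function.Definitions using (Injective)
open import Level using (0ℓ)
open import Relation.Binary.Definitions using (tri<; tri≈; tri>)
open import Relation.Binary.PropositionalEquality.Core as ≡ using (_≡_; _≢_)
open import Relation.Nullary.Decidable using (Dec; yes; no; does; ¬?)
open import Relation.Nullary.Negation using (¬_)
open import Relation.Unary using (Pred)

-- No integral is ever constructed. The hypothesis on `p` already asserts convergence, so the value
-- is pinned down by a single choice of tags, and only sums over grid corners have to be estimated.
--
-- Pivoting does not preserve lattices: rounding displaces every point by a bounded multiple of the
-- mesh. The estimates are therefore proved for perturbed lattices, uniformly in the perturbation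
-- and in the offset.
--
-- The open cone may contain some lower-dimensional faces and miss others. Its indicator is squeezed
-- between the sum over the full-dimensional optimal faces and the sum over all optimal faces, which
-- have the same limit.
--
-- Optimality of a face does not involve ξ, so one set of cells serves the whole dual cone; this
-- makes the formula a polynomial identity, which can be continued to D*. If a generator outside D
-- lies on the hyperplane of D, every term has a zero factor. Extremality enters through the signs
-- of the determinants alone: opposite signs put a point of the cone over D into the interior of K,
-- one strict common sign keeps that cone in the boundary.

-- Ordered fields: the embedded integers, the ring solver, inequalities, the floor.

module OrderedField (em : ExcludedMiddle 0ℓ) (ℝ : CompleteOrderedField) where

  open import Algebra.Bundles using (CommutativeRing; Semiring)
  import Algebra.Definitions.RawSemiring as RawSemiringDefs
  import Algebra.Properties.AbelianGroup
  import Algebra.Properties.Monoid.Mult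
  import Algebra.Properties.Monoid.Mult.TCOptimised
  import Algebra.Properties.Ring
  import Algebra.Properties.Semiring.Mult
  import Algebra.Solver.Ring
  open import Algebra.Solver.Ring.AlmostCommutativeRing using (fromCommutativeRing; _-Raw-AlmostCommutative⟶_)
  open import Data.Integer.Base as ℤ using (ℤ; +_; -[1+_])
  import Data.Integer.Properties as ℤ
  open import Data.Maybe.Base using (Maybe; just; nothing)
  open import Relation.Binary.Bundles using (StrictTotalOrder)
  import Relation.Binary.Properties.StrictTotalOrder
  import Relation.Binary.Reasoning.Setoid

  open CompleteOrderedField ℝ public
  open Real em ℝ public
  open CommutativeRing commutativeRing public
    using ( refl; sym; trans; reflexive; +-cong; +-congˡ; +-congʳ; *-cong; *-congˡ; *-congʳ
          ; +-assoc; +-comm; *-assoc; *-comm; +-identityˡ; +-identityʳ; *-identityˡ; *-identityʳ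
          ; zeroˡ; zeroʳ; distribˡ; distribʳ; -‿cong; -‿inverseˡ; -‿inverseʳ
          ; +-commutativeMonoid; *-commutativeMonoid; commutativeSemiring; +-monoid; +-abelianGroup; ring)

  open RawSemiringDefs (Semiring.rawSemiring semiring) public using (_^_; sum; product) renaming (_×_ to _·_; _×′_ to _·′_)

  strictTotalOrder : StrictTotalOrder 0ℓ 0ℓ 0ℓ
  strictTotalOrder = record { isStrictTotalOrder = isStrictTotalOrder }

  open StrictTotalOrder strictTotalOrder public
    using (compare; _<?_) renaming (trans to <-trans; irrefl to <-irrefl; _≟_ to _≈?_; <-respˡ-≈ to <-respˡ; <-respʳ-≈ to <-respʳ)
  private
    module O = Relation.Binary.Properties.StrictTotalOrder strictTotalOrder
  open O public using ()
    renaming (refl to ≤-refl; trans to ≤-trans; antisym to ≤-antisym; total to ≤-total; ≤-respˡ-≈ to ≤-respˡ; ≤-respʳ-≈ to ≤-respʳ)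

  fromℤ : ℤ → Carrier
  fromℤ (+ n)    = fromℕ n
  fromℤ -[1+ n ] = - fromℕ (suc n)

  module ≈-Reasoning = Relation.Binary.Reasoning.Setoid setoid

  private
    module T = Algebra.Properties.Monoid.Mult.TCOptimised +-monoid
    module M = Algebra.Properties.Monoid.Mult +-monoid
    module SM = Algebra.Properties.Semiring.Mult semiring
    module R = Algebra.Properties.Ring ring
    module AG = Algebra.Properties.AbelianGroup +-abelianGroup

  fromℕ-+ : ∀ m n → fromℕ (m ℕ.+ n) ≈ fromℕ m + fromℕ n
  fromℕ-+ = M.×-homo-+ 1#

  fromℕ-* : ∀ m n → fromℕ (m ℕ.* n) ≈ fromℕ m * fromℕ n
  fromℕ-* = SM.×1-homo-*

  fromℤ-neg : ∀ a → fromℤ (ℤ.- a) ≈ - fromℤ a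
  fromℤ-neg (+ zero)  = sym AG.ε⁻¹≈ε
  fromℤ-neg (+ suc n) = refl
  fromℤ-neg -[1+ n ]  = sym (AG.⁻¹-involutive _)

  fromℤ-⊖ : ∀ m n → fromℤ (m ℤ.⊖ n) ≈ fromℕ m - fromℕ n
  fromℤ-⊖ m zero = sym (trans (+-congˡ AG.ε⁻¹≈ε) (+-identityʳ _))
  fromℤ-⊖ zero (suc n) = sym (+-identityˡ _)
  fromℤ-⊖ (suc m) (suc n) = begin
    fromℤ (suc m ℤ.⊖ suc n) ≡⟨ ≡.cong fromℤ (ℤ.[1+m]⊖[1+n]≡m⊖n m n) ⟩
    fromℤ (m ℤ.⊖ n) ≈⟨ fromℤ-⊖ m n ⟩
    fromℕ m - fromℕ n ≈⟨ +-congʳ (sym (+-identityˡ _)) ⟩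
    (0# + fromℕ m) - fromℕ n ≈⟨ +-congʳ (+-congʳ (sym (-‿inverseʳ 1#))) ⟩
    ((1# - 1#) + fromℕ m) - fromℕ n ≈⟨ +-congʳ (trans (+-assoc _ _ _) (trans (+-congˡ (+-comm _ _)) (sym (+-assoc _ _ _)))) ⟩
    ((1# + fromℕ m) - 1#) - fromℕ n ≈⟨ +-assoc _ _ _ ⟩
    (1# + fromℕ m) + (- 1# - fromℕ n) ≈⟨ +-congˡ (AG.⁻¹-∙-comm _ _) ⟩
    (1# + fromℕ m) - (1# + fromℕ n) ∎
    where open ≈-Reasoning

  fromℤ-+ : ∀ a b → fromℤ (a ℤ.+ b) ≈ fromℤ a + fromℤ b
  fromℤ-+ (+ m) (+ n) = fromℕ-+ m n
  fromℤ-+ (+ m) -[1+ n ] = fromℤ-⊖ m (suc n)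
  fromℤ-+ -[1+ m ] (+ n) = trans (fromℤ-⊖ n (suc m)) (+-comm _ _)
  fromℤ-+ -[1+ m ] -[1+ n ] = begin
    - fromℕ (suc (suc (m ℕ.+ n))) ≡⟨ ≡.cong (λ k → - fromℕ (suc k)) (ℕ.+-suc m n) ⟨
    - fromℕ (suc m ℕ.+ suc n) ≈⟨ -‿cong (fromℕ-+ (suc m) (suc n)) ⟩
    - (fromℕ (suc m) + fromℕ (suc n)) ≈⟨ AG.⁻¹-∙-comm _ _ ⟨
    - fromℕ (suc m) - fromℕ (suc n) ∎
    where open ≈-Reasoning

  fromℤ-* : ∀ a b → fromℤ (a ℤ.* b) ≈ fromℤ a * fromℤ b
  fromℤ-* (+ m) (+ n) = trans (reflexive (≡.cong fromℤ (≡.sym (ℤ.pos-* m n)))) (fromℕ-* m n)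
  fromℤ-* (+ m) -[1+ n ] = begin
    fromℤ (+ m ℤ.* -[1+ n ]) ≡⟨ ≡.cong fromℤ (ℤ.neg-distribʳ-* (+ m) (+ suc n)) ⟨
    fromℤ (ℤ.- (+ m ℤ.* + suc n)) ≈⟨ fromℤ-neg (+ m ℤ.* + suc n) ⟩
    - fromℤ (+ m ℤ.* + suc n) ≈⟨ -‿cong (fromℤ-* (+ m) (+ suc n)) ⟩
    - (fromℕ m * fromℕ (suc n)) ≈⟨ R.-‿distribʳ-* _ _ ⟩
    fromℕ m * - fromℕ (suc n) ∎
    where open ≈-Reasoning
  fromℤ-* -[1+ m ] (+ n) = begin
    fromℤ (-[1+ m ] ℤ.* + n) ≡⟨ ≡.cong fromℤ (ℤ.neg-distribˡ-* (+ suc m) (+ n)) ⟨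
    fromℤ (ℤ.- (+ suc m ℤ.* + n)) ≈⟨ fromℤ-neg (+ suc m ℤ.* + n) ⟩
    - fromℤ (+ suc m ℤ.* + n) ≈⟨ -‿cong (fromℤ-* (+ suc m) (+ n)) ⟩
    - (fromℕ (suc m) * fromℕ n) ≈⟨ R.-‿distribˡ-* _ _ ⟩
    - fromℕ (suc m) * fromℕ n ∎
    where open ≈-Reasoning
  fromℤ-* -[1+ m ] -[1+ n ] = begin
    fromℕ (suc m ℕ.* suc n) ≈⟨ fromℕ-* (suc m) (suc n) ⟩
    fromℕ (suc m) * fromℕ (suc n) ≈⟨ AG.⁻¹-involutive _ ⟨
    - - (fromℕ (suc m) * fromℕ (suc n)) ≈⟨ -‿cong (R.-‿distribˡ-* _ _) ⟩
    - (- fromℕ (suc m) * fromℕ (suc n)) ≈⟨ R.-‿distribʳ-* _ _ ⟩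
    - fromℕ (suc m) * - fromℕ (suc n) ∎
    where open ≈-Reasoning

  private
    -- In the solver the constant 1 must denote 1# itself, not 1# + 0#.
    coeff : ℤ → Carrier
    coeff (+ n)    = n ·′ 1#
    coeff -[1+ n ] = - (suc n ·′ 1#)

    coeff≈ : ∀ a → coeff a ≈ fromℤ a
    coeff≈ (+ n)    = sym (T.×ᵤ≈× n 1#)
    coeff≈ -[1+ n ] = -‿cong (sym (T.×ᵤ≈× (suc n) 1#))

    morphism : CommutativeRing.rawRing ℤ.+-*-commutativeRing -Raw-AlmostCommutative⟶ fromCommutativeRing commutativeRing
    morphism = record
      { ⟦_⟧ = coeff
      ; +-homo = λ a b → trans (coeff≈ (a ℤ.+ b)) (trans (fromℤ-+ a b) (sym (+-cong (coeff≈ a) (coeff≈ b))))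
      ; *-homo = λ a b → trans (coeff≈ (a ℤ.* b)) (trans (fromℤ-* a b) (sym (*-cong (coeff≈ a) (coeff≈ b))))
      ; -‿homo = λ a → trans (coeff≈ (ℤ.- a)) (trans (fromℤ-neg a) (sym (-‿cong (coeff≈ a))))
      ; 0-homo = refl
      ; 1-homo = refl
      }

    _coeff≟_ : ∀ a b → Maybe (coeff a ≈ coeff b)
    a coeff≟ b with a ℤ.≟ b
    ... | yes ≡.refl = just refl
    ... | no _ = nothing

  open Algebra.Solver.Ring (CommutativeRing.rawRing ℤ.+-*-commutativeRing) (fromCommutativeRing commutativeRing) morphism _coeff≟_ public
    using (Polynomial; solve; con; _:=_; _:+_; _:*_; :-_; _:-_)

  :0 :1 :2 : ∀ {k} → Polynomial k
  :0 = con (+ 0)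
  :1 = con (+ 1)
  :2 = con (+ 2)

  abstract
    <⇒≤ : ∀ {x y} → x < y → x ≤ y
    <⇒≤ = inj₁

    ≈⇒≤ : ∀ {x y} → x ≈ y → x ≤ y
    ≈⇒≤ = inj₂

    ≈⇒≥ : ∀ {x y} → x ≈ y → y ≤ x
    ≈⇒≥ = inj₂ ∘ sym

    <-≤-trans : ∀ {x y z} → x < y → y ≤ z → x < z
    <-≤-trans p (inj₁ q) = <-trans p q
    <-≤-trans p (inj₂ q) = <-respʳ q p

    ≤-<-trans : ∀ {x y z} → x ≤ y → y < z → x < z
    ≤-<-trans (inj₁ p) q = <-trans p q
    ≤-<-trans (inj₂ p) q = <-respˡ (sym p) q

    <-or-≥ : ∀ x y → x < y ⊎ y ≤ x
    <-or-≥ x y with compare x y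
    ... | tri< p _ _ = inj₁ p
    ... | tri≈ _ p _ = inj₂ (≈⇒≥ p)
    ... | tri> _ _ p = inj₂ (inj₁ p)

    <⇒≱ : ∀ {x y} → x < y → ¬ y ≤ x
    <⇒≱ p q = <-irrefl refl (<-≤-trans p q)

    ≮⇒≥ : ∀ {x y} → ¬ x < y → y ≤ x
    ≮⇒≥ {x} {y} ¬p = [ ⊥-elim ∘ ¬p , id ]′ (<-or-≥ x y)

    <⇒≉ : ∀ {x y} → x < y → ¬ x ≈ y
    <⇒≉ p e = <-irrefl e p

    >⇒≉ : ∀ {x y} → x < y → ¬ y ≈ x
    >⇒≉ p e = <-irrefl (sym e) p

    ≤∧≉⇒< : ∀ {x y} → x ≤ y → ¬ x ≈ y → x < y
    ≤∧≉⇒< (inj₁ p) _ = p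
    ≤∧≉⇒< (inj₂ p) q = ⊥-elim (q p)

    +-monoˡ-< : ∀ x {y z} → y < z → y + x < z + x
    +-monoˡ-< x p = <-respˡ (+-comm _ _) (<-respʳ (+-comm _ _) (+-monoʳ-< x p))

    +-mono-< : ∀ {x y u v} → x < y → u < v → x + u < y + v
    +-mono-< p q = <-trans (+-monoˡ-< _ p) (+-monoʳ-< _ q)

    +-monoʳ-≤ : ∀ x {y z} → y ≤ z → x + y ≤ x + z
    +-monoʳ-≤ x (inj₁ p) = inj₁ (+-monoʳ-< x p)
    +-monoʳ-≤ x (inj₂ p) = inj₂ (+-congˡ p)

    +-monoˡ-≤ : ∀ x {y z} → y ≤ z → y + x ≤ z + x
    +-monoˡ-≤ x (inj₁ p) = inj₁ (+-monoˡ-< x p)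
    +-monoˡ-≤ x (inj₂ p) = inj₂ (+-congʳ p)

    +-mono-≤ : ∀ {x y u v} → x ≤ y → u ≤ v → x + u ≤ y + v
    +-mono-≤ p q = ≤-trans (+-monoˡ-≤ _ p) (+-monoʳ-≤ _ q)

    +-pos : ∀ {x y} → 0# < x → 0# < y → 0# < x + y
    +-pos p q = <-respˡ (+-identityʳ 0#) (+-mono-< p q)

    +-nonneg : ∀ {x y} → 0# ≤ x → 0# ≤ y → 0# ≤ x + y
    +-nonneg p q = ≤-respˡ (+-identityʳ 0#) (+-mono-≤ p q)

    +-pos-nonneg : ∀ {x y} → 0# < x → 0# ≤ y → 0# < x + y
    +-pos-nonneg {x} p q = <-≤-trans p (≤-respˡ (+-identityʳ x) (+-monoʳ-≤ x q))

    +-nonneg-pos : ∀ {x y} → 0# ≤ x → 0# < y → 0# < x + y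
    +-nonneg-pos p q = <-respʳ (+-comm _ _) (+-pos-nonneg q p)

    *-nonneg : ∀ {x y} → 0# ≤ x → 0# ≤ y → 0# ≤ x * y
    *-nonneg (inj₁ p) (inj₁ q) = inj₁ (*-pos p q)
    *-nonneg (inj₁ p) (inj₂ q) = inj₂ (sym (trans (*-congˡ (sym q)) (zeroʳ _)))
    *-nonneg (inj₂ p) q        = inj₂ (sym (trans (*-congʳ (sym p)) (zeroˡ _)))

    <⇒0< : ∀ {x y} → x < y → 0# < y - x
    <⇒0< {x} p = <-respˡ (-‿inverseʳ x) (+-monoˡ-< (- x) p)

    ≤⇒0≤ : ∀ {x y} → x ≤ y → 0# ≤ y - x
    ≤⇒0≤ {x} p = ≤-respˡ (-‿inverseʳ x) (+-monoˡ-≤ (- x) p)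

    private
      y-x+x : ∀ x y → (y - x) + x ≈ y
      y-x+x = solve 2 (λ x y → (y :- x) :+ x := y) refl

    0<⇒< : ∀ {x y} → 0# < y - x → x < y
    0<⇒< {x} {y} p = <-respˡ (+-identityˡ x) (<-respʳ (y-x+x x y) (+-monoˡ-< x p))

    0≤⇒≤ : ∀ {x y} → 0# ≤ y - x → x ≤ y
    0≤⇒≤ {x} {y} p = ≤-respˡ (+-identityˡ x) (≤-respʳ (y-x+x x y) (+-monoˡ-≤ x p))

    -- Inequalities are proved by exhibiting the difference as a manifestly nonnegative expression.
    ≤-by : ∀ {x y e} → 0# ≤ e → y - x ≈ e → x ≤ y
    ≤-by p eq = 0≤⇒≤ (≤-respʳ (sym eq) p)

    <-by : ∀ {x y e} → 0# < e → y - x ≈ e → x < y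
    <-by p eq = 0<⇒< (<-respʳ (sym eq) p)

    neg-pos : ∀ {x} → x < 0# → 0# < - x
    neg-pos {x} p = <-respʳ (+-identityˡ _) (<⇒0< p)

    *-monoˡ-≤ : ∀ {x y z} → 0# ≤ z → x ≤ y → z * x ≤ z * y
    *-monoˡ-≤ {x} {y} {z} p q = ≤-by (*-nonneg p (≤⇒0≤ q)) (solve 3 (λ x y z → z :* y :- z :* x := z :* (y :- x)) refl x y z)

    *-monoʳ-≤ : ∀ {x y z} → 0# ≤ z → x ≤ y → x * z ≤ y * z
    *-monoʳ-≤ {x} {y} {z} p q = ≤-by (*-nonneg p (≤⇒0≤ q)) (solve 3 (λ x y z → y :* z :- x :* z := z :* (y :- x)) refl x y z)

    *-monoˡ-< : ∀ {x y z} → 0# < z → x < y → z * x < z * y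
    *-monoˡ-< {x} {y} {z} p q = <-by (*-pos p (<⇒0< q)) (solve 3 (λ x y z → z :* y :- z :* x := z :* (y :- x)) refl x y z)

    *-monoʳ-< : ∀ {x y z} → 0# < z → x < y → x * z < y * z
    *-monoʳ-< {x} {y} {z} p q = <-by (*-pos p (<⇒0< q)) (solve 3 (λ x y z → y :* z :- x :* z := z :* (y :- x)) refl x y z)

    *-mono-≤ : ∀ {x y u v} → 0# ≤ x → x ≤ y → 0# ≤ u → u ≤ v → x * u ≤ y * v
    *-mono-≤ p q r s = ≤-trans (*-monoʳ-≤ r q) (*-monoˡ-≤ (≤-trans p q) s)

    *-cancelˡ-≤ : ∀ {x y z} → 0# < z → z * x ≤ z * y → x ≤ y
    *-cancelˡ-≤ {x} {y} p q with <-or-≥ y x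
    ... | inj₁ r = ⊥-elim (<⇒≱ (*-monoˡ-< p r) q)
    ... | inj₂ r = r

    *-cancelˡ-< : ∀ {x y z} → 0# < z → z * x < z * y → x < y
    *-cancelˡ-< {x} {y} p q with <-or-≥ x y
    ... | inj₁ r = r
    ... | inj₂ r = ⊥-elim (<⇒≱ q (*-monoˡ-≤ (<⇒≤ p) r))

    square-nonneg : ∀ x → 0# ≤ x * x
    square-nonneg x with ≤-total 0# x
    ... | inj₁ p = *-nonneg p p
    ... | inj₂ p = ≤-respʳ (solve 1 (λ x → (:0 :- x) :* (:0 :- x) := x :* x) refl x) (*-nonneg (≤⇒0≤ p) (≤⇒0≤ p))

    1≉0 : ¬ 1# ≈ 0#
    1≉0 = >⇒≉ 0<1

    0≤1 : 0# ≤ 1#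
    0≤1 = inj₁ 0<1

    ⁻¹-inverseˡ : ∀ {x} → ¬ x ≈ 0# → x ⁻¹ * x ≈ 1#
    ⁻¹-inverseˡ p = trans (*-comm _ _) (⁻¹-inverseʳ p)

    ⁻¹-pos : ∀ {x} → 0# < x → 0# < x ⁻¹
    ⁻¹-pos {x} p with <-or-≥ 0# (x ⁻¹)
    ... | inj₁ q = q
    ... | inj₂ q = ⊥-elim (<⇒≱ 0<1 (≤-respˡ (⁻¹-inverseʳ (>⇒≉ p)) (≤-respʳ (zeroʳ x) (*-monoˡ-≤ (<⇒≤ p) q))))

    /-pos : ∀ {x y} → 0# < x → 0# < y → 0# < x / y
    /-pos p q = *-pos p (⁻¹-pos q)

    *-cancelˡ-≈ : ∀ {x y z} → ¬ z ≈ 0# → z * x ≈ z * y → x ≈ y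
    *-cancelˡ-≈ {x} {y} {z} p q = begin
      x ≈⟨ *-identityˡ x ⟨
      1# * x ≈⟨ *-congʳ (⁻¹-inverseˡ p) ⟨
      z ⁻¹ * z * x ≈⟨ *-assoc _ _ _ ⟩
      z ⁻¹ * (z * x) ≈⟨ *-congˡ q ⟩
      z ⁻¹ * (z * y) ≈⟨ *-assoc _ _ _ ⟨
      z ⁻¹ * z * y ≈⟨ *-congʳ (⁻¹-inverseˡ p) ⟩
      1# * y ≈⟨ *-identityˡ y ⟩
      y ∎
      where open ≈-Reasoning

    *-≉0 : ∀ {x y} → ¬ x ≈ 0# → ¬ y ≈ 0# → ¬ x * y ≈ 0#
    *-≉0 p q e = q (*-cancelˡ-≈ p (trans e (sym (zeroʳ _))))

    /-*-cancel : ∀ {x y} → ¬ y ≈ 0# → x / y * y ≈ x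
    /-*-cancel {x} {y} p = trans (*-assoc _ _ _) (trans (*-congˡ (⁻¹-inverseˡ p)) (*-identityʳ x))

    *-/-cancel : ∀ {x y} → ¬ y ≈ 0# → y * (x / y) ≈ x
    *-/-cancel p = trans (*-comm _ _) (/-*-cancel p)

    fromℕ-nonneg : ∀ n → 0# ≤ fromℕ n
    fromℕ-nonneg zero = ≤-refl
    fromℕ-nonneg (suc n) = +-nonneg 0≤1 (fromℕ-nonneg n)

    fromℕ-pos : ∀ n → 0# < fromℕ (suc n)
    fromℕ-pos n = +-pos-nonneg 0<1 (fromℕ-nonneg n)

    fromℕ-mono : ∀ {m n} → m ℕ.≤ n → fromℕ m ≤ fromℕ n
    fromℕ-mono {n = n} ℕ.z≤n = fromℕ-nonneg n
    fromℕ-mono (ℕ.s≤s p) = +-monoʳ-≤ 1# (fromℕ-mono p)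

    fromℕ-cancel-< : ∀ {m n} → fromℕ m < fromℕ n → m ℕ.< n
    fromℕ-cancel-< {m} {n} p with m ℕ.<? n
    ... | yes q = q
    ... | no q = ⊥-elim (<⇒≱ p (fromℕ-mono (ℕ.≮⇒≥ q)))

    -- If no natural number exceeded `x`, the natural numbers would have a supremum `s`, and
    -- `s - 1#` would still be an upper bound.
    archimedes : ∀ x → ∃ λ n → x < fromℕ n
    archimedes x with em {P = ∃ λ n → x < fromℕ n}
    ... | yes p = p
    ... | no ¬p = ⊥-elim (<⇒≱ s-1<s (least λ { (n , e) → ≤-respˡ e (<⇒≤ (bound n)) }))
      where
      P : Carrier → Set
      P y = ∃ λ n → fromℕ n ≈ y
      ub : UpperBound P x
      ub {y} (n , e) = ≮⇒≥ λ q → ¬p (n , <-respʳ (sym e) q)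
      S : ∃ λ s → UpperBound P s × (∀ {b} → UpperBound P b → s ≤ b)
      S = supremum P (0# , 0 , refl) (x , ub)
      s : Carrier
      s = proj₁ S
      least : ∀ {b} → UpperBound P b → s ≤ b
      least = proj₂ (proj₂ S)
      s-1<s : s - 1# < s
      s-1<s = <-by 0<1 (solve 2 (λ s i → s :- (s :- i) := i) refl s 1#)
      bound : ∀ n → fromℕ n < s - 1#
      bound n with <-or-≥ (fromℕ n) (s - 1#)
      ... | inj₁ q = q
      ... | inj₂ q = ⊥-elim (<⇒≱ r (≤-trans (proj₁ (proj₂ S) (suc (suc n) , refl)) ≤-refl))
        where
        -- From `s - 1#` ≤ n one only gets `s` ≤ n + 1, which an upper bound allows; the
        -- contradiction needs n + 2.
        r : s < fromℕ (suc (suc n))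
        r = <-by (+-nonneg-pos (≤⇒0≤ q) 0<1)
          (solve 3 (λ s k i → (i :+ (i :+ k)) :- s := (k :- (s :- i)) :+ i) refl s (fromℕ n) 1#)

    archimedes-suc : ∀ x → ∃ λ n → x < fromℕ (suc n)
    archimedes-suc x with archimedes x
    ... | n , p = n , <-≤-trans p (fromℕ-mono (ℕ.n≤1+n n))

    private
      floor⁺ : ∀ n x → 0# ≤ x → x < fromℕ n → ∃ λ k → fromℕ k ≤ x × x < fromℕ (suc k)
      floor⁺ zero x p q = ⊥-elim (<⇒≱ q p)
      floor⁺ (suc n) x p q with <-or-≥ x (fromℕ n)
      ... | inj₁ r = floor⁺ n x p r
      ... | inj₂ r = n , r , q

    -- Adding a natural number above `- x` reduces to positive arguments, where the floor is found
    -- by counting down from an upper bound.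
    floor : ∀ x → ∃ λ z → fromℤ z ≤ x × x < fromℤ z + 1#
    floor x with archimedes (- x)
    ... | n , -x<n with archimedes (x + fromℕ n)
    ...   | k , p with floor⁺ k (x + fromℕ n) (<⇒≤ (<-respʳ (solve 2 (λ n x → n :- (:- x) := x :+ n) refl (fromℕ n) x) (<⇒0< -x<n))) p
    ...     | l , lo , hi = z , lo' , hi'
      where
      z : ℤ
      z = + l ℤ.- + n
      ez : fromℤ z ≈ fromℕ l - fromℕ n
      ez = trans (fromℤ-+ (+ l) (ℤ.- + n)) (+-congˡ (fromℤ-neg (+ n)))
      lo' : fromℤ z ≤ x
      lo' = ≤-by (≤⇒0≤ lo) (trans (+-congˡ (-‿cong ez)) (solve 3 (λ x l n → x :- (l :- n) := (x :+ n) :- l) refl x (fromℕ l) (fromℕ n)))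
      hi' : x < fromℤ z + 1#
      hi' = <-by (<⇒0< hi) (trans (+-congʳ (+-congʳ ez)) (solve 4 (λ x l n i → ((l :- n) :+ i) :- x := (i :+ l) :- (x :+ n)) refl x (fromℕ l) (fromℕ n) 1#))

-- Absolute values and two-sided bounds.

module AbsoluteValue (em : ExcludedMiddle 0ℓ) (ℝ : CompleteOrderedField) where

  open OrderedField em ℝ
  import Algebra.Properties.CommutativeSemiring.Exp
  import Algebra.Properties.Semiring.Exp
  open import Data.Integer.Base as ℤ using (+_)

  open Algebra.Properties.Semiring.Exp semiring public using (^-congˡ; ^-homo-*; ^-assocʳ)
  open Algebra.Properties.CommutativeSemiring.Exp commutativeSemiring public using (^-distrib-*)

  -- Stands for ∣x∣ ≤ b. As a pair of inequalities it can be added, multiplied and rewritten by the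
  -- solver without the case distinction inside `∣_∣`.
  Bnd : Carrier → Carrier → Set
  Bnd x b = (- b ≤ x) × (x ≤ b)

  abstract
    ∣_∣ : Carrier → Carrier
    ∣ x ∣ with <-or-≥ x 0#
    ... | inj₁ _ = - x
    ... | inj₂ _ = x

    ∣∣-cases : ∀ x → (x < 0# × ∣ x ∣ ≈ - x) ⊎ (0# ≤ x × ∣ x ∣ ≈ x)
    ∣∣-cases x with <-or-≥ x 0#
    ... | inj₁ p = inj₁ (p , refl)
    ... | inj₂ p = inj₂ (p , refl)

    ∣∣-nonneg : ∀ x → 0# ≤ ∣ x ∣
    ∣∣-nonneg x with ∣∣-cases x
    ... | inj₁ (p , e) = ≤-respʳ (sym e) (<⇒≤ (neg-pos p))
    ... | inj₂ (p , e) = ≤-respʳ (sym e) p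

    ∣∣-pos : ∀ {x} → ¬ x ≈ 0# → 0# < ∣ x ∣
    ∣∣-pos {x} x≉0 with ∣∣-cases x
    ... | inj₁ (p , e) = <-respʳ (sym e) (neg-pos p)
    ... | inj₂ (inj₁ p , e) = <-respʳ (sym e) p
    ... | inj₂ (inj₂ p , e) = ⊥-elim (x≉0 (sym p))

    ∣∣-of-nonneg : ∀ {x} → 0# ≤ x → ∣ x ∣ ≈ x
    ∣∣-of-nonneg {x} p with ∣∣-cases x
    ... | inj₁ (q , _) = ⊥-elim (<⇒≱ q p)
    ... | inj₂ (_ , e) = e

    ∣∣-of-nonpos : ∀ {x} → x ≤ 0# → ∣ x ∣ ≈ - x
    ∣∣-of-nonpos {x} p with ∣∣-cases x
    ... | inj₁ (_ , e) = e
    ... | inj₂ (q , e) = trans e (trans x≈0 (trans (solve 0 (:0 := :- :0) refl) (-‿cong (sym x≈0))))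
      where
      x≈0 : x ≈ 0#
      x≈0 = ≤-antisym p q

    ∣∣-cong : ∀ {x y} → x ≈ y → ∣ x ∣ ≈ ∣ y ∣
    ∣∣-cong {x} {y} e with ∣∣-cases x
    ... | inj₁ (p , e′) = trans e′ (trans (-‿cong e) (sym (∣∣-of-nonpos (<⇒≤ (<-respˡ e p)))))
    ... | inj₂ (p , e′) = trans e′ (trans e (sym (∣∣-of-nonneg (≤-respʳ e p))))

    ∣∣-* : ∀ x y → ∣ x * y ∣ ≈ ∣ x ∣ * ∣ y ∣
    ∣∣-* x y with ∣∣-cases x | ∣∣-cases y
    ... | inj₁ (p , e) | inj₁ (q , e′) = trans (∣∣-of-nonneg (≤-by (<⇒≤ (*-pos (neg-pos p) (neg-pos q)))
            (solve 2 (λ x y → x :* y :- :0 := (:- x) :* (:- y)) refl x y)))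
            (trans (solve 2 (λ x y → x :* y := (:- x) :* (:- y)) refl x y) (sym (*-cong e e′)))
    ... | inj₁ (p , e) | inj₂ (q , e′) = trans (∣∣-of-nonpos (≤-by (*-nonneg (<⇒≤ (neg-pos p)) q)
            (solve 2 (λ x y → :0 :- x :* y := (:- x) :* y) refl x y)))
            (trans (solve 2 (λ x y → :- (x :* y) := (:- x) :* y) refl x y) (sym (*-cong e e′)))
    ... | inj₂ (p , e) | inj₁ (q , e′) = trans (∣∣-of-nonpos (≤-by (*-nonneg p (<⇒≤ (neg-pos q)))
            (solve 2 (λ x y → :0 :- x :* y := x :* (:- y)) refl x y)))
            (trans (solve 2 (λ x y → :- (x :* y) := x :* (:- y)) refl x y) (sym (*-cong e e′)))
    ... | inj₂ (p , e) | inj₂ (q , e′) = trans (∣∣-of-nonneg (*-nonneg p q)) (sym (*-cong e e′))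

    ∣∣-neg : ∀ x → ∣ - x ∣ ≈ ∣ x ∣
    ∣∣-neg x with ∣∣-cases x
    ... | inj₁ (p , e) = trans (∣∣-of-nonneg (<⇒≤ (neg-pos p))) (sym e)
    ... | inj₂ (p , e) = trans (∣∣-of-nonpos (≤-by p (solve 1 (λ x → :0 :- (:- x) := x) refl x)))
                           (trans (solve 1 (λ x → :- (:- x) := x) refl x) (sym e))

    Bnd-∣∣ : ∀ x → Bnd x ∣ x ∣
    Bnd-∣∣ x with ∣∣-cases x
    ... | inj₁ (p , e) = ≤-by ≤-refl (trans (+-congˡ (-‿cong (-‿cong e))) (solve 1 (λ x → x :- (:- (:- x)) := :0) refl x))
                       , ≤-trans (<⇒≤ (<-trans p (neg-pos p))) (≈⇒≥ e)
    ... | inj₂ (p , e) = ≤-by (+-nonneg p p) (trans (+-congˡ (-‿cong (-‿cong e))) (solve 1 (λ x → x :- (:- x) := x :+ x) refl x))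
                       , ≈⇒≥ e

    Bnd-weaken : ∀ {x a b} → Bnd x a → a ≤ b → Bnd x b
    Bnd-weaken {x} {a} {b} (p , q) r =
      ≤-trans (≤-by (≤⇒0≤ r) (solve 2 (λ a b → (:- a) :- (:- b) := b :- a) refl a b)) p , ≤-trans q r

    Bnd-cong : ∀ {x y a} → x ≈ y → Bnd x a → Bnd y a
    Bnd-cong e (p , q) = ≤-respʳ e p , ≤-respˡ e q

    Bnd-nonneg : ∀ {x a} → Bnd x a → 0# ≤ a
    Bnd-nonneg {x} {a} (p , q) with <-or-≥ a 0#
    ... | inj₂ r = r
    ... | inj₁ r = ⊥-elim (<⇒≱ (<-trans r (neg-pos r)) (≤-trans p q))

    Bnd-+ : ∀ {x y a b} → Bnd x a → Bnd y b → Bnd (x + y) (a + b)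
    Bnd-+ {x} {y} {a} {b} (p , q) (r , s) =
      ≤-respˡ (solve 2 (λ a b → (:- a) :+ (:- b) := :- (a :+ b)) refl a b) (+-mono-≤ p r) , +-mono-≤ q s

    Bnd-neg : ∀ {x a} → Bnd x a → Bnd (- x) a
    Bnd-neg {x} {a} (p , q) =
      ≤-by (≤⇒0≤ q) (solve 2 (λ x a → (:- x) :- (:- a) := a :- x) refl x a) ,
      ≤-by (≤⇒0≤ p) (solve 2 (λ x a → a :- (:- x) := x :- (:- a)) refl x a)

    -- No distinction of signs: 2(ab + xy) = (a - x)(b - y) + (x + a)(y + b), and likewise for ab -
    -- xy. The products on the right have nonnegative factors, and `half` removes the factor two.
    Bnd-* : ∀ {x y a b} → Bnd x a → Bnd y b → Bnd (x * y) (a * b)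
    Bnd-* {x} {y} {a} {b} (p , q) (r , s) =
      half (+-nonneg (*-nonneg (≤⇒0≤ q) (≤⇒0≤ s)) (*-nonneg (≤⇒0≤ p) (≤⇒0≤ r)))
        (solve 4 (λ x y a b → (x :* y :- (:- (a :* b))) :+ (x :* y :- (:- (a :* b)))
           := (a :- x) :* (b :- y) :+ (x :- (:- a)) :* (y :- (:- b))) refl x y a b) ,
      half (+-nonneg (*-nonneg (≤⇒0≤ q) (≤⇒0≤ r)) (*-nonneg (≤⇒0≤ p) (≤⇒0≤ s)))
        (solve 4 (λ x y a b → (a :* b :- x :* y) :+ (a :* b :- x :* y)
           := (a :- x) :* (y :- (:- b)) :+ (x :- (:- a)) :* (b :- y)) refl x y a b)
      where
      half : ∀ {u v e} → 0# ≤ e → (v - u) + (v - u) ≈ e → u ≤ v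
      half {u} {v} {e} p eq with <-or-≥ v u
      ... | inj₂ r = r
      ... | inj₁ r = ⊥-elim (<⇒≱ (+-pos (<⇒0< r) (<⇒0< r))
            (≤-by (≤-respʳ (sym eq) p) (solve 2 (λ u v → :0 :- ((u :- v) :+ (u :- v)) := (v :- u) :+ (v :- u)) refl u v)))

    Bnd-0 : ∀ {a} → 0# ≤ a → Bnd 0# a
    Bnd-0 {a} p = ≤-by p (solve 1 (λ a → :0 :- (:- a) := a) refl a) , p

    Bnd-nonneg-≤ : ∀ {x a} → 0# ≤ x → x ≤ a → Bnd x a
    Bnd-nonneg-≤ {x} {a} p q =
      ≤-by (+-nonneg p (≤-trans p q)) (solve 2 (λ x a → x :- (:- a) := x :+ a) refl x a) , q

    min-pos : ∀ {x y} → 0# < x → 0# < y → ∃ λ z → 0# < z × z ≤ x × z ≤ y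
    min-pos {x} {y} p q with ≤-total x y
    ... | inj₁ r = x , p , ≤-refl , r
    ... | inj₂ r = y , q , r , ≤-refl

-- Limits of sequences and estimates for powers.

module Limits (em : ExcludedMiddle 0ℓ) (ℝ : CompleteOrderedField) where

  open OrderedField em ℝ
  open AbsoluteValue em ℝ

  2# : Carrier
  2# = 1# + 1#

  abstract
    0<2 : 0# < 2#
    0<2 = +-pos 0<1 0<1

    x/2+x/2≈x : ∀ x → x / 2# + x / 2# ≈ x
    x/2+x/2≈x x = trans (solve 1 (λ y → y :+ y := y :* (:1 :+ :1)) refl (x / 2#)) (/-*-cancel (>⇒≉ 0<2))

    halve : ∀ {x} → 0# < x → ∃ λ y → 0# < y × y + y ≈ x
    halve {x} p = x / 2# , /-pos p 0<2 , x/2+x/2≈x x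

    -- δ is the minimum of 1 and ε / (1 + c). The summand 1 makes the last inequality strict and
    -- admits c = 0.
    small : ∀ {ε c} → 0# < ε → 0# ≤ c → ∃ λ δ → 0# < δ × δ ≤ 1# × δ * c < ε
    small {ε} {c} p q with min-pos 0<1 (/-pos p (+-pos-nonneg 0<1 q))
    ... | δ , r , s , t = δ , r , s , <-≤-trans
          (<-by r (solve 2 (λ δ c → δ :* (:1 :+ c) :- δ :* c := δ) refl δ c))
        (≤-trans (*-monoʳ-≤ (<⇒≤ (+-pos-nonneg 0<1 q)) t) (≈⇒≤ (/-*-cancel (>⇒≉ (+-pos-nonneg 0<1 q)))))

    Near⇒Bnd : ∀ {ε x y} → Near ε x y → Bnd (y - x) ε
    Near⇒Bnd {ε} {x} {y} (p , q) =
      <⇒≤ (<-by (<⇒0< p) (solve 3 (λ ε x y → (y :- x) :- (:- ε) := y :- (x :- ε)) refl ε x y)) ,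
      <⇒≤ (<-by (<⇒0< q) (solve 3 (λ ε x y → ε :- (y :- x) := (x :+ ε) :- y) refl ε x y))

    Bnd⇒Near : ∀ {δ ε x y} → δ < ε → Bnd (y - x) δ → Near ε x y
    Bnd⇒Near {δ} {ε} {x} {y} r (p , q) =
      <-by (+-nonneg-pos (≤⇒0≤ p) (<⇒0< r)) (solve 4 (λ δ ε x y → y :- (x :- ε) := ((y :- x) :- (:- δ)) :+ (ε :- δ)) refl δ ε x y) ,
      <-by (+-nonneg-pos (≤⇒0≤ q) (<⇒0< r)) (solve 4 (λ δ ε x y → (x :+ ε) :- y := (δ :- (y :- x)) :+ (ε :- δ)) refl δ ε x y)

    private
      sep : ∀ {a b} → a < b → ∃ λ ε → 0# < ε × (∀ {y} → Near ε a y → Near ε b y → ⊥)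
      sep {a} {b} p with halve (<⇒0< p)
      ... | ε , ε>0 , e = ε , ε>0 , λ { {y} (_ , y<) (<y , _) → <⇒≱ (<-trans <y y<)
            (≈⇒≤ (begin
              a + ε ≈⟨ solve 2 (λ a ε → a :+ ε := a :+ (ε :+ ε) :- ε) refl a ε ⟩
              a + (ε + ε) - ε ≈⟨ +-congʳ (+-congˡ e) ⟩
              a + (b - a) - ε ≈⟨ solve 3 (λ a b ε → a :+ (b :- a) :- ε := b :- ε) refl a b ε ⟩
              b - ε ∎)) }
        where open ≈-Reasoning

    private
      clash : ∀ {s a b} → s ⟶ a → s ⟶ b → ¬ a < b
      clash p q a<b with sep a<b
      ... | ε , ε>0 , apart with p ε>0 | q ε>0
      ...   | M , f | N , g = apart (f (ℕ.m≤m⊔n M N)) (g (ℕ.m≤n⊔m M N))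

    lim-unique : ∀ {s a b} → s ⟶ a → s ⟶ b → a ≈ b
    lim-unique {s} {a} {b} p q with compare a b
    ... | tri≈ _ e _ = e
    ... | tri< r _ _ = ⊥-elim (clash p q r)
    ... | tri> _ _ r = ⊥-elim (clash q p r)

    lim-lower : ∀ {s l c} → s ⟶ l → (∃ λ N₀ → ∀ N → N ℕ.≥ N₀ → c ≤ s N) → c ≤ l
    lim-lower {s} {l} {c} p (N₁ , q) with <-or-≥ l c
    ... | inj₂ r = r
    ... | inj₁ r with p (<⇒0< r)
    ...   | N₀ , f = ⊥-elim (<⇒≱ (proj₂ (f (ℕ.m≤m⊔n N₀ N₁)))
            (≤-trans (≈⇒≤ (solve 2 (λ l c → l :+ (c :- l) := c) refl l c)) (q _ (ℕ.m≤n⊔m N₀ N₁))))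

    lim-cong : ∀ {s t l} → (∀ N → s N ≈ t N) → s ⟶ l → t ⟶ l
    lim-cong e p ε>0 with p ε>0
    ... | N₀ , f = N₀ , λ {N} N≥ → <-respʳ (e N) (proj₁ (f N≥)) , <-respˡ (e N) (proj₂ (f N≥))

    lim-perturb : ∀ {s t l} → s ⟶ l → (λ N → t N - s N) ⟶ 0# → t ⟶ l
    lim-perturb {s} {t} {l} p q {ε} ε>0 with halve ε>0
    ... | δ , δ>0 , e with p δ>0 | q δ>0
    ...   | N₀ , f | N₁ , g = N₀ ℕ.⊔ N₁ , λ {N} N≥ → lem (f (ℕ.≤-trans (ℕ.m≤m⊔n N₀ N₁) N≥)) (g (ℕ.≤-trans (ℕ.m≤n⊔m N₀ N₁) N≥))
      where
      lem : ∀ {x y} → Near δ l x → Near δ 0# (y - x) → Near ε l y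
      lem {x} {y} (a , b) (c , d) =
        <-by (+-pos (<⇒0< a) (<⇒0< c)) (trans (+-congˡ (-‿cong (+-congˡ (-‿cong (sym e)))))
          (solve 4 (λ x y l δ → y :- (l :- (δ :+ δ)) := (x :- (l :- δ)) :+ ((y :- x) :- (:0 :- δ))) refl x y l δ)) ,
        <-by (+-pos (<⇒0< b) (<⇒0< d)) (trans (+-congʳ (+-congˡ (sym e)))
          (solve 4 (λ x y l δ → (l :+ (δ :+ δ)) :- y := ((l :+ δ) :- x) :+ ((:0 :+ δ) :- (y :- x))) refl x y l δ))

    lim-* : ∀ {s t a b} → s ⟶ a → t ⟶ b → (λ N → s N * t N) ⟶ (a * b)
    -- The constant comes from xy - ab = (a + (x - a))(y - b) + (x - a)b, where δ ≤ 1 bounds the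
    -- first factor by ∣a∣ + 1.
    lim-* {s} {t} {a} {b} p q {ε} ε>0 with small ε>0 (+-nonneg (∣∣-nonneg a) (+-nonneg 0≤1 (∣∣-nonneg b)))
    ... | δ , δ>0 , δ≤1 , δc<ε with p δ>0 | q δ>0
    ...   | N₀ , f | N₁ , g = N₀ ℕ.⊔ N₁ , λ {N} N≥ → lem (f (ℕ.≤-trans (ℕ.m≤m⊔n N₀ N₁) N≥)) (g (ℕ.≤-trans (ℕ.m≤n⊔m N₀ N₁) N≥))
      where
      lem : ∀ {x y} → Near δ a x → Near δ b y → Near ε (a * b) (x * y)
      lem {x} {y} n n′ = Bnd⇒Near δc<ε (Bnd-weaken (Bnd-cong eq B) (≈⇒≤ eq′))
        where
        eq : (a + (x - a)) * (y - b) + (x - a) * b ≈ x * y - a * b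
        eq = solve 4 (λ x y a b → (a :+ (x :- a)) :* (y :- b) :+ (x :- a) :* b := x :* y :- a :* b) refl x y a b
        eq′ : (∣ a ∣ + 1#) * δ + δ * ∣ b ∣ ≈ δ * (∣ a ∣ + (1# + ∣ b ∣))
        eq′ = solve 4 (λ a b δ i → (a :+ i) :* δ :+ δ :* b := δ :* (a :+ (i :+ b))) refl ∣ a ∣ ∣ b ∣ δ 1#
        B : Bnd ((a + (x - a)) * (y - b) + (x - a) * b) ((∣ a ∣ + 1#) * δ + δ * ∣ b ∣)
        B = Bnd-+ (Bnd-* (Bnd-+ (Bnd-∣∣ a) (Bnd-weaken (Near⇒Bnd n) δ≤1)) (Near⇒Bnd n′)) (Bnd-* (Near⇒Bnd n) (Bnd-∣∣ b))

    ^-nonneg : ∀ {x} n → 0# ≤ x → 0# ≤ x ^ n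
    ^-nonneg zero p = 0≤1
    ^-nonneg (suc n) p = *-nonneg p (^-nonneg n p)

    1^ : ∀ n → 1# ^ n ≈ 1#
    1^ zero = refl
    1^ (suc n) = trans (*-identityˡ _) (1^ n)

    bernoulli : ∀ {x} n → - 1# ≤ x → 1# + fromℕ n * x ≤ (1# + x) ^ n
    bernoulli {x} zero p = ≈⇒≤ (trans (+-congˡ (zeroˡ x)) (+-identityʳ 1#))
    bernoulli {x} (suc n) p = ≤-trans
      (≤-by (*-nonneg (fromℕ-nonneg n) (square-nonneg x))
        (solve 2 (λ x n → (:1 :+ x) :* (:1 :+ n :* x) :- (:1 :+ (:1 :+ n) :* x) := n :* (x :* x)) refl x (fromℕ n)))
      (*-monoˡ-≤ (≤-by (≤⇒0≤ p) (solve 1 (λ x → (:1 :+ x) :- :0 := x :- (:- :1)) refl x)) (bernoulli n p))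

    Bnd-^ : ∀ {x a} n → Bnd x a → Bnd (x ^ n) (a ^ n)
    Bnd-^ zero p = Bnd-nonneg-≤ 0≤1 ≤-refl
    Bnd-^ (suc n) p = Bnd-* p (Bnd-^ n p)

    -- Induction through u(uⁿ - vⁿ) + (u - v)vⁿ. Since 1 ≤ `R`, the exponent on the right may stay n
    -- instead of n - 1, which spares a case at zero.
    ^-diff : ∀ {u v R e} n → 1# ≤ R → Bnd u R → Bnd v R → Bnd (u - v) e → Bnd (u ^ n - v ^ n) (fromℕ n * e * R ^ n)
    ^-diff {u} {v} {R} {e} zero p q r s = Bnd-cong (sym (-‿inverseʳ _)) (Bnd-0 (≈⇒≥ (trans (*-congʳ (zeroˡ e)) (zeroˡ _))))
    ^-diff {u} {v} {R} {e} (suc n) p q r s = Bnd-weaken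
      (Bnd-cong (solve 4 (λ u v x y → u :* (x :- y) :+ (u :- v) :* y := u :* x :- v :* y) refl u v (u ^ n) (v ^ n))
        (Bnd-+ (Bnd-* q (^-diff n p q r s)) (Bnd-* s (Bnd-^ n r))))
      (≤-by (*-nonneg (*-nonneg (Bnd-nonneg s) (^-nonneg n 0≤R)) (≤⇒0≤ p))
        (solve 4 (λ R e n P → (:1 :+ n) :* e :* (R :* P) :- (R :* (n :* e :* P) :+ e :* P) := e :* P :* (R :- :1)) refl R e (fromℕ n) (R ^ n)))
      where
      0≤R : 0# ≤ R
      0≤R = ≤-trans 0≤1 p

-- The exponential function as the limit of (1 + x/k)ᵏ.

module ExponentialFunction (em : ExcludedMiddle 0ℓ) (ℝ : CompleteOrderedField) where

  open OrderedField em ℝ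
  open AbsoluteValue em ℝ
  open Limits em ℝ

  module Exponential (exp : Carrier → Carrier) (isExp : IsExp exp) where

    private
      K κ : ℕ → Carrier
      K N = fromℕ (suc N)
      κ N = K N ⁻¹

      Kκ : ∀ N → K N * κ N ≈ 1#
      Kκ N = ⁻¹-inverseʳ (>⇒≉ (fromℕ-pos N))

      κ>0 : ∀ N → 0# < κ N
      κ>0 N = ⁻¹-pos (fromℕ-pos N)

      κ≤1 : ∀ N → κ N ≤ 1#
      κ≤1 N = *-cancelˡ-≤ (fromℕ-pos N) (≤-trans (≈⇒≤ (Kκ N))
        (≤-by (fromℕ-nonneg N) (trans (+-congʳ (*-identityʳ _)) (solve 2 (λ i n → (i :+ n) :- i := n) refl 1# (fromℕ N)))))

      e : Carrier → ℕ → Carrier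
      e x N = (1# + x * κ N) ^ suc N

    abstract
      exp-cong : ∀ {x y} → x ≈ y → exp x ≈ exp y
      exp-cong {x} {y} x≈y = lim-unique (lim-cong (λ N → ^-congˡ (suc N) (+-congˡ (*-congʳ x≈y))) (isExp x)) (isExp y)

      exp-0 : exp 0# ≈ 1#
      exp-0 = lim-unique (isExp 0#) λ ε>0 → 0 , λ {N} _ → Bnd⇒Near ε>0
        (Bnd-cong (trans (sym (-‿inverseʳ 1#)) (+-congʳ (sym (trans (^-congˡ (suc N) (trans (+-congˡ (zeroˡ _)) (+-identityʳ 1#))) (1^ (suc N)))))) (Bnd-0 ≤-refl))

      -- Bernoulli's inequality for the approximants. It requires x/(N + 1) ≥ -1, which holds once N
      -- exceeds -x.
      1+x≤exp : ∀ x → 1# + x ≤ exp x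
      1+x≤exp x = lim-lower (isExp x) (N₀ , λ N N≥ → ≤-trans (≈⇒≤ (+-congˡ (eq N))) (bernoulli (suc N) (lower N N≥)))
        where
        eq : ∀ N → x ≈ K N * (x * κ N)
        eq N = sym (trans (solve 3 (λ k x c → k :* (x :* c) := x :* (k :* c)) refl (K N) x (κ N)) (trans (*-congˡ (Kκ N)) (*-identityʳ x)))
        N₀ : ℕ
        N₀ = proj₁ (archimedes (- x))
        lower : ∀ N → N ℕ.≥ N₀ → - 1# ≤ x * κ N
        lower N N≥ = *-cancelˡ-≤ (fromℕ-pos N) (≤-trans
          (≤-by (≤⇒0≤ (≤-trans (<⇒≤ (proj₂ (archimedes (- x)))) (≤-trans (fromℕ-mono N≥) (fromℕ-mono (ℕ.n≤1+n N)))))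
            (trans (+-congˡ (-‿cong (trans (solve 2 (λ k i → k :* (:- i) := :- (k :* i)) refl (K N) 1#) (-‿cong (*-identityʳ (K N))))))
              (solve 2 (λ x k → x :- (:- k) := k :- (:- x)) refl x (K N))))
          (≈⇒≤ (eq N)))

    private
      -- With q = 1/(N + 1), the bases (1 + xq)(1 + yq) and 1 + (x + y)q differ by xyq². By `^-diff`
      -- their powers differ by at most (N + 1)∣xy∣q² times a power of a common bound 1 + Aq. That
      -- power tends to `exp A`, so it is eventually below `exp A + 1#`, and a factor q is left
      -- over.
      exp-+′ : ∀ x y → exp (x + y) ≈ exp x * exp y
      exp-+′ x y = lim-unique (isExp (x + y)) (lim-perturb (lim-* (isExp x) (isExp y)) diff)
        where
        X Y A c : Carrier
        X = ∣ x ∣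
        Y = ∣ y ∣
        -- The product is included so that, for q ≤ 1, 1 + Aq dominates (1 + Xq)(1 + Yq) as well as
        -- 1 + (X + Y)q.
        A = X + Y + X * Y
        c = X * Y * (exp A + 1#)
        0≤X : 0# ≤ X
        0≤X = ∣∣-nonneg x
        0≤Y : 0# ≤ Y
        0≤Y = ∣∣-nonneg y
        0≤A : 0# ≤ A
        0≤A = +-nonneg (+-nonneg 0≤X 0≤Y) (*-nonneg 0≤X 0≤Y)
        module _ (N : ℕ) where
          u v R q : Carrier
          q = κ N
          u = (1# + x * q) * (1# + y * q)
          v = 1# + (x + y) * q
          R = 1# + A * q
          0≤q : 0# ≤ q
          0≤q = <⇒≤ (κ>0 N)
          bq : Bnd q q
          bq = Bnd-nonneg-≤ 0≤q ≤-refl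
          b1 : Bnd 1# 1#
          b1 = Bnd-nonneg-≤ 0≤1 ≤-refl
          1≤R : 1# ≤ R
          1≤R = ≤-by (*-nonneg 0≤A 0≤q) (solve 2 (λ i a → (i :+ a) :- i := a) refl 1# (A * q))
          bu : Bnd u R
          bu = Bnd-weaken (Bnd-* (Bnd-+ b1 (Bnd-* (Bnd-∣∣ x) bq)) (Bnd-+ b1 (Bnd-* (Bnd-∣∣ y) bq)))
            (≤-by (*-nonneg (*-nonneg (*-nonneg 0≤X 0≤Y) 0≤q) (≤⇒0≤ (κ≤1 N)))
              (solve 3 (λ X Y q → (:1 :+ (X :+ Y :+ X :* Y) :* q) :- (:1 :+ X :* q) :* (:1 :+ Y :* q) := X :* Y :* q :* (:1 :- q)) refl X Y q))
          bv : Bnd v R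
          bv = Bnd-weaken (Bnd-+ b1 (Bnd-* (Bnd-+ (Bnd-∣∣ x) (Bnd-∣∣ y)) bq))
            (≤-by (*-nonneg (*-nonneg 0≤X 0≤Y) 0≤q)
              (solve 3 (λ X Y q → (:1 :+ (X :+ Y :+ X :* Y) :* q) :- (:1 :+ (X :+ Y) :* q) := X :* Y :* q) refl X Y q))
          bd : Bnd (v - u) (X * q * (Y * q))
          bd = Bnd-cong eq (Bnd-neg (Bnd-* (Bnd-* (Bnd-∣∣ x) bq) (Bnd-* (Bnd-∣∣ y) bq)))
            where
            eq : - (x * q * (y * q)) ≈ v - u
            eq = solve 3 (λ x y q → :- (x :* q :* (y :* q)) := (:1 :+ (x :+ y) :* q) :- (:1 :+ x :* q) :* (:1 :+ y :* q)) refl x y q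
          bpow : R ^ suc N ≤ exp A + 1# → Bnd (v ^ suc N - u ^ suc N) (q * c)
          bpow le = Bnd-weaken (^-diff (suc N) 1≤R bv bu bd)
            (≤-trans (*-monoˡ-≤ (*-nonneg (fromℕ-nonneg (suc N)) (*-nonneg (*-nonneg 0≤X 0≤q) (*-nonneg 0≤Y 0≤q))) le)
              (≈⇒≤ (begin
                K N * (X * q * (Y * q)) * (exp A + 1#)
                  ≈⟨ solve 5 (λ k X Y q p → k :* (X :* q :* (Y :* q)) :* p := (k :* q) :* (q :* (X :* Y :* p))) refl (K N) X Y q (exp A + 1#) ⟩
                (K N * q) * (q * c) ≈⟨ *-congʳ (Kκ N) ⟩
                1# * (q * c) ≈⟨ *-identityˡ _ ⟩
                q * c ∎)))
            where open ≈-Reasoning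
        diff : (λ N → e (x + y) N - e x N * e y N) ⟶ 0#
        diff {ε} ε>0 = N₀ ℕ.⊔ N₁ , λ {N} N≥ → Bnd⇒Near (qc N (ℕ.≤-trans (ℕ.m≤n⊔m N₀ N₁) N≥))
            (Bnd-cong (eq N)
              (bpow N (<⇒≤ (proj₂ (proj₂ (isExp A 0<1) (ℕ.≤-trans (ℕ.m≤m⊔n N₀ N₁) N≥))))))
          where
          N₀ N₁ : ℕ
          N₀ = proj₁ (isExp A 0<1)
          N₁ = proj₁ (archimedes-suc (c / ε))
          eq : ∀ N → v N ^ suc N - u N ^ suc N ≈ (e (x + y) N - e x N * e y N) - 0#
          eq N = trans (+-congˡ (-‿cong (^-distrib-* _ _ (suc N)))) (solve 2 (λ a b → a :- b := (a :- b) :- :0) refl (e (x + y) N) (e x N * e y N))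
          qc : ∀ N → N ℕ.≥ N₁ → κ N * c < ε
          qc N N≥ = *-cancelˡ-< (fromℕ-pos N)
            (<-respˡ (sym (trans (sym (*-assoc _ _ _)) (trans (*-congʳ (Kκ N)) (*-identityˡ c))))
              (<-respˡ (/-*-cancel (>⇒≉ ε>0))
                (*-monoʳ-< ε>0 (<-≤-trans (proj₂ (archimedes-suc (c / ε))) (fromℕ-mono (ℕ.s≤s N≥))))))

    abstract
      exp-+ : ∀ x y → exp (x + y) ≈ exp x * exp y
      exp-+ = exp-+′

      exp-inverse : ∀ x → exp x * exp (- x) ≈ 1#
      exp-inverse x = trans (sym (exp-+ x (- x))) (trans (exp-cong (-‿inverseʳ x)) exp-0)

      -- By the functional equation, `exp x` is the square of `exp (x / 2#)`.
      exp-nonneg : ∀ x → 0# ≤ exp x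
      exp-nonneg x = ≤-trans (square-nonneg (exp (x / 2#))) (≈⇒≤ (trans (sym (exp-+ _ _)) (exp-cong (x/2+x/2≈x x))))

      exp-pos : ∀ x → 0# < exp x
      exp-pos x = ≤∧≉⇒< (exp-nonneg x) λ p → 1≉0 (trans (sym (exp-inverse x)) (trans (*-congʳ (sym p)) (zeroˡ (exp (- x)))))

      exp-mono : ∀ {x y} → x ≤ y → exp x ≤ exp y
      exp-mono {x} {y} p = ≤-trans (≤-trans (≈⇒≤ (sym (*-identityʳ _)))
          (*-monoˡ-≤ (exp-nonneg x) (≤-trans (≤-by (≤⇒0≤ p) (solve 2 (λ i d → (i :+ d) :- i := d) refl 1# (y - x))) (1+x≤exp (y - x)))))
        (≈⇒≤ (trans (sym (exp-+ x (y - x))) (exp-cong (solve 2 (λ x y → x :+ (y :- x) := y) refl x y))))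

      exp-^ : ∀ x n → exp x ^ n ≈ exp (fromℕ n * x)
      exp-^ x zero = sym (trans (exp-cong (zeroˡ x)) exp-0)
      exp-^ x (suc n) = trans (*-congˡ (exp-^ x n)) (trans (sym (exp-+ _ _))
        (exp-cong (sym (trans (distribʳ x 1# (fromℕ n)) (+-congʳ (*-identityˡ x))))))

-- Alternating multilinear forms and the determinant.

module Determinants (em : ExcludedMiddle 0ℓ) (ℝ : CompleteOrderedField) where

  open OrderedField em ℝ
  import Algebra.Properties.CommutativeMonoid.Sum
  import Algebra.Properties.Semiring.Sum
  open import Data.Fin.Properties using (punchIn-injective)
  open import Data.Unit.Base using (⊤; tt)
  open import Data.Vec.Functional using (Vector; _∷_; head; tail; removeAt; insertAt; updateAt)

  open Algebra.Properties.CommutativeMonoid.Sum +-commutativeMonoid public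
    using (sum-remove; ∑-distrib-+; ∑-comm) renaming (sum-cong-≋ to sum-cong; sum-replicate-zero to sum-replicate-0)
  open Algebra.Properties.CommutativeMonoid.Sum *-commutativeMonoid public
    using () renaming (sum-cong-≋ to product-cong; ∑-distrib-+ to product-distrib-*; sum-remove to product-remove)
  open Algebra.Properties.Semiring.Sum semiring public using (*-distribˡ-sum; *-distribʳ-sum)

  private
    variable
      d n r : ℕ

  sum-zero : {f : Fin n → Carrier} → (∀ i → f i ≈ 0#) → sum f ≈ 0#
  sum-zero {n} p = trans (sum-cong p) (sum-replicate-0 n)

  sum-neg : (f : Fin n → Carrier) → sum (λ i → - f i) ≈ - sum f
  sum-neg {n} f = trans (sum-cong λ i → solve 1 (λ x → :- x := (:- :1) :* x) refl (f i))
    (trans (sym (*-distribˡ-sum (- 1#) f)) (solve 1 (λ x → (:- :1) :* x := :- x) refl (sum f)))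

  e : Fin d → ℝ^ d
  e zero    zero    = 1#
  e zero    (suc j) = 0#
  e (suc i) zero    = 0#
  e (suc i) (suc j) = e i j

  e-diag : (i : Fin d) → e i i ≈ 1#
  e-diag zero = refl
  e-diag (suc i) = e-diag i

  e-off : {i j : Fin d} → i ≢ j → e i j ≈ 0#
  e-off {i = zero} {zero} p = ⊥-elim (p ≡.refl)
  e-off {i = zero} {suc j} p = refl
  e-off {i = suc i} {zero} p = refl
  e-off {i = suc i} {suc j} p = e-off (p ∘ ≡.cong suc)

  e-sym : (i j : Fin d) → e i j ≈ e j i
  e-sym zero zero = refl
  e-sym zero (suc j) = refl
  e-sym (suc i) zero = refl
  e-sym (suc i) (suc j) = e-sym i j

  e-nonneg : (i j : Fin d) → 0# ≤ e i j
  e-nonneg zero zero = 0≤1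
  e-nonneg zero (suc j) = ≤-refl
  e-nonneg (suc i) zero = ≤-refl
  e-nonneg (suc i) (suc j) = e-nonneg i j

  sum-e : (x : ℝ^ d) (j : Fin d) → sum (λ i → x i * e i j) ≈ x j
  sum-e {suc d} x zero = trans (+-cong (*-identityʳ _) (sum-zero λ i → zeroʳ (x (suc i)))) (+-identityʳ _)
  sum-e {suc d} x (suc j) = trans (+-cong (zeroʳ _) (sum-e (tail x) j)) (+-identityˡ _)

  e-punchIn : (j : Fin (suc d)) (i : Fin d) (k : Fin (suc d)) → insertAt (e i) j 0# k ≈ e (punchIn j i) k
  e-punchIn zero i zero = refl
  e-punchIn zero i (suc k) = refl
  e-punchIn (suc j) zero zero = refl
  e-punchIn (suc j) (suc i) zero = refl
  e-punchIn (suc j) zero (suc k) = insert-0 j k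
    where
    insert-0 : ∀ {d} (j k : Fin (suc d)) → insertAt {n = d} (λ _ → 0#) j 0# k ≈ 0#
    insert-0 zero zero = refl
    insert-0 zero (suc k) = refl
    insert-0 {suc d} (suc j) zero = refl
    insert-0 {suc d} (suc j) (suc k) = insert-0 j k
  e-punchIn (suc j) (suc i) (suc k) = e-punchIn j i k

  infix 4 _≋ᶠ_
  _≋ᶠ_ : (x y : Fin r → ℝ^ d) → Set
  x ≋ᶠ y = ∀ i → x i ≋ y i

  infixl 5 _[_]≔_
  _[_]≔_ : ∀ {A : Set} → Vector A n → Fin n → A → Vector A n
  x [ i ]≔ u = updateAt x i (const u)

  module _ {A : Set} where

    upd-same : (x : Vector A n) (i : Fin n) (u : A) → (x [ i ]≔ u) i ≡ u
    upd-same x zero u = ≡.refl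
    upd-same x (suc i) u = upd-same (tail x) i u

    upd-other : (x : Vector A n) {i j : Fin n} (u : A) → i ≢ j → (x [ i ]≔ u) j ≡ x j
    upd-other x {zero} {zero} u p = ⊥-elim (p ≡.refl)
    upd-other x {zero} {suc j} u p = ≡.refl
    upd-other x {suc i} {zero} u p = ≡.refl
    upd-other x {suc i} {suc j} u p = upd-other (tail x) u (p ∘ ≡.cong suc)

    upd-comm : (x : Vector A n) {i j : Fin n} (u v : A) → i ≢ j → ∀ k → ((x [ i ]≔ u) [ j ]≔ v) k ≡ ((x [ j ]≔ v) [ i ]≔ u) k
    upd-comm x {zero} {zero} u v p k = ⊥-elim (p ≡.refl)
    upd-comm x {zero} {suc j} u v p zero = ≡.refl
    upd-comm x {zero} {suc j} u v p (suc k) = ≡.refl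
    upd-comm x {suc i} {zero} u v p zero = ≡.refl
    upd-comm x {suc i} {zero} u v p (suc k) = ≡.refl
    upd-comm x {suc i} {suc j} u v p zero = ≡.refl
    upd-comm x {suc i} {suc j} u v p (suc k) = upd-comm (tail x) u v (p ∘ ≡.cong suc) k

    upd-self : (x : Vector A n) (i : Fin n) → ∀ k → (x [ i ]≔ x i) k ≡ x k
    upd-self x zero zero = ≡.refl
    upd-self x zero (suc k) = ≡.refl
    upd-self x (suc i) zero = ≡.refl
    upd-self x (suc i) (suc k) = upd-self (tail x) i k

    upd-insertAt : (x : Vector A n) (p : Fin (suc n)) (a : A) (i : Fin n) (u : A) →
                   ∀ k → insertAt (x [ i ]≔ u) p a k ≡ (insertAt x p a [ punchIn p i ]≔ u) k
    upd-insertAt x zero a i u zero = ≡.refl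
    upd-insertAt x zero a i u (suc k) = ≡.refl
    upd-insertAt x (suc p) a zero u zero = ≡.refl
    upd-insertAt x (suc p) a (suc i) u zero = ≡.refl
    upd-insertAt x (suc zero) a zero u (suc zero) = ≡.refl
    upd-insertAt x (suc zero) a zero u (suc (suc k)) = ≡.refl
    upd-insertAt x (suc (suc p)) a zero u (suc k) = ≡.refl
    upd-insertAt x (suc p) a (suc i) u (suc k) = upd-insertAt (tail x) p a i u k

    insertAt-punchIn : (x : Vector A n) (p : Fin (suc n)) (a : A) (i : Fin n) → insertAt x p a (punchIn p i) ≡ x i
    insertAt-punchIn x zero a i = ≡.refl
    insertAt-punchIn x (suc p) a zero = ≡.refl
    insertAt-punchIn x (suc p) a (suc i) = insertAt-punchIn (tail x) p a i

    insertAt-same : (x : Vector A n) (p : Fin (suc n)) (a : A) → insertAt x p a p ≡ a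
    insertAt-same x zero a = ≡.refl
    insertAt-same {suc n} x (suc p) a = insertAt-same (tail x) p a

  upd-map : ∀ {A B : Set} (g : A → B) (x : Vector A n) (i : Fin n) (u : A) → ∀ k → g ((x [ i ]≔ u) k) ≡ ((g ∘ x) [ i ]≔ g u) k
  upd-map g x zero u zero = ≡.refl
  upd-map g x zero u (suc k) = ≡.refl
  upd-map g x (suc i) u zero = ≡.refl
  upd-map g x (suc i) u (suc k) = upd-map g (tail x) i u k

  ≡⇒≋ᶠ : {x y : Fin r → ℝ^ d} → (∀ i → x i ≡ y i) → x ≋ᶠ y
  ≡⇒≋ᶠ p i j = reflexive (≡.cong (λ v → v j) (p i))

  upd-cong : {x y : Fin r → ℝ^ d} (i : Fin r) {u v : ℝ^ d} → x ≋ᶠ y → u ≋ v → (x [ i ]≔ u) ≋ᶠ (y [ i ]≔ v)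
  upd-cong zero p q zero = q
  upd-cong zero p q (suc k) = p (suc k)
  upd-cong (suc i) p q zero = p zero
  upd-cong (suc i) p q (suc k) = upd-cong i (p ∘ suc) q k

  insertAt-cong : {x y : Fin r → ℝ^ d} (p : Fin (suc r)) {u v : ℝ^ d} → x ≋ᶠ y → u ≋ v → insertAt x p u ≋ᶠ insertAt y p v
  insertAt-cong zero q s zero = s
  insertAt-cong zero q s (suc k) = q k
  insertAt-cong {suc r} (suc p) q s zero = q zero
  insertAt-cong {suc r} (suc p) q s (suc k) = insertAt-cong p (q ∘ suc) s k

  ∷-η : ∀ {A : Set} (x : Vector A (suc n)) → ∀ i → x i ≡ (head x ∷ tail x) i
  ∷-η x zero = ≡.refl
  ∷-η x (suc i) = ≡.refl

  -- Slots are addressed by updating a family, so that linearity in every slot has one shape. `cong`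
  -- is a field because families of vectors are compared pointwise up to `_≈_`.
  record Alternating {r d : ℕ} (f : (Fin r → ℝ^ d) → Carrier) : Set where
    field
      cong  : ∀ {x y} → x ≋ᶠ y → f x ≈ f y
      add   : ∀ x i u v → f (x [ i ]≔ u ⊕ v) ≈ f (x [ i ]≔ u) + f (x [ i ]≔ v)
      scale : ∀ x i s u → f (x [ i ]≔ s ⊛ u) ≈ s * f (x [ i ]≔ u)
      alt   : ∀ {x i j} → i ≢ j → x i ≋ x j → f x ≈ 0#

    zero-slot : ∀ x i → f (x [ i ]≔ 0ᵛ) ≈ 0#
    zero-slot x i = trans (cong (upd-cong i (λ _ _ → refl) (λ _ → sym (zeroˡ 0#)))) (trans (scale x i 0# 0ᵛ) (zeroˡ _))

    linear : ∀ {k} x i (t : Fin k → Carrier) (v : Fin k → ℝ^ d) →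
             f (x [ i ]≔ combination t v) ≈ sum (λ l → t l * f (x [ i ]≔ v l))
    linear {zero} x i t v = zero-slot x i
    linear {suc k} x i t v = trans (add x i (head t ⊛ head v) (combination (tail t) (tail v)))
      (+-cong (scale x i (head t) (head v)) (linear x i (tail t) (tail v)))

    swap : ∀ x {i j} u v → i ≢ j → f ((x [ i ]≔ u) [ j ]≔ v) ≈ - f ((x [ i ]≔ v) [ j ]≔ u)
    swap x {i} {j} u v i≢j = begin
      B u v ≈⟨ solve 4 (λ a b c d → a := (((b :+ a) :+ (c :+ d)) :- b :- d) :- c) refl (B u v) (B u u) (B v u) (B v v) ⟩
      (((B u u + B u v) + (B v u + B v v)) - B u u - B v v) - B v u
        ≈⟨ +-congʳ (+-cong (+-cong (trans (sym expand) (same w)) (-‿cong (same u))) (-‿cong (same v))) ⟩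
      (0# - 0# - 0#) - B v u ≈⟨ solve 1 (λ c → (:0 :- :0 :- :0) :- c := :- c) refl (B v u) ⟩
      - B v u ∎
      where
      open ≈-Reasoning
      w : ℝ^ d
      w = u ⊕ v
      B : ℝ^ d → ℝ^ d → Carrier
      B a b = f ((x [ i ]≔ a) [ j ]≔ b)
      same : ∀ a → B a a ≈ 0#
      same a = alt i≢j λ k → reflexive (≡.cong (λ z → z k)
        (≡.trans (≡.trans (upd-other (x [ i ]≔ a) a (i≢j ∘ ≡.sym)) (upd-same x i a)) (≡.sym (upd-same (x [ i ]≔ a) j a))))
      comm : ∀ a b → B a b ≈ f ((x [ j ]≔ b) [ i ]≔ a)
      comm a b = cong (≡⇒≋ᶠ (upd-comm x a b i≢j))
      addˡ : ∀ b → B w b ≈ B u b + B v b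
      addˡ b = trans (comm w b) (trans (add (x [ j ]≔ b) i u v) (+-cong (sym (comm u b)) (sym (comm v b))))
      expand : B w w ≈ (B u u + B u v) + (B v u + B v v)
      expand = trans (addˡ w) (+-cong (add (x [ i ]≔ u) j u v) (add (x [ i ]≔ v) j u v))

    shear : ∀ x {i j} s → i ≢ j → f (x [ i ]≔ x i ⊕ s ⊛ x j) ≈ f x
    shear x {i} {j} s i≢j = trans (add x i (x i) (s ⊛ x j)) (trans (+-cong (cong (≡⇒≋ᶠ (upd-self x i)))
      (trans (scale x i s (x j)) (trans (*-congˡ (alt i≢j λ k → reflexive (≡.cong (λ z → z k)
        (≡.trans (upd-same x i (x j)) (≡.sym (upd-other x (x j) i≢j)))))) (zeroʳ s)))) (+-identityʳ _))

  open Alternating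

  fix : {f : (Fin (suc r) → ℝ^ d) → Carrier} → Alternating f → ∀ p a → Alternating (λ z → f (insertAt z p a))
  fix A p a .cong q = cong A (insertAt-cong p q λ _ → refl)
  fix A p a .add x i u v = trans (cong A (≡⇒≋ᶠ (upd-insertAt x p a i _))) (trans (add A (insertAt x p a) (punchIn p i) u v)
    (+-cong (cong A λ k j → sym (≡⇒≋ᶠ (upd-insertAt x p a i u) k j)) (cong A λ k j → sym (≡⇒≋ᶠ (upd-insertAt x p a i v) k j))))
  fix A p a .scale x i s u = trans (cong A (≡⇒≋ᶠ (upd-insertAt x p a i _))) (trans (scale A (insertAt x p a) (punchIn p i) s u)
    (*-congˡ (cong A λ k j → sym (≡⇒≋ᶠ (upd-insertAt x p a i u) k j))))
  fix A p a .alt {x} {i} {j} i≢j q = alt A (i≢j ∘ punchIn-injective p i j) λ k →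
    trans (reflexive (≡.cong (λ z → z k) (insertAt-punchIn x p a i))) (trans (q k) (reflexive (≡.cong (λ z → z k) (≡.sym (insertAt-punchIn x p a j)))))

  ∷≡insertAt : ∀ {A : Set} (a : A) (z : Vector A n) → ∀ k → (a ∷ z) k ≡ insertAt z zero a k
  ∷≡insertAt a z zero = ≡.refl
  ∷≡insertAt a z (suc k) = ≡.refl

  fix₀ : {f : (Fin (suc r) → ℝ^ d) → Carrier} → Alternating f → ∀ a → Alternating (λ z → f (a ∷ z))
  fix₀ {f = f} A a = record
    { cong = λ q → trans (eq _) (trans (cong B q) (sym (eq _)))
    ; add = λ x i u v → trans (eq _) (trans (add B x i u v) (sym (+-cong (eq _) (eq _))))
    ; scale = λ x i s u → trans (eq _) (trans (scale B x i s u) (*-congˡ (sym (eq _))))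
    ; alt = λ p q → trans (eq _) (alt B p q) }
    where
    B = fix A zero a
    eq : ∀ z → f (a ∷ z) ≈ f (insertAt z zero a)
    eq z = cong A (≡⇒≋ᶠ (∷≡insertAt a z))

  -- Induction on the number of sheared vectors: once a vector has been sheared it is frozen in its
  -- slot, and freezing an argument of an alternating form leaves an alternating form in the others.
  shear-all : {f : (Fin (suc r) → ℝ^ d) → Carrier} → Alternating f → ∀ a z (c : Fin r → Carrier) →
              f (a ∷ λ i → z i ⊕ c i ⊛ a) ≈ f (a ∷ z)
  shear-all {zero} A a z c = cong A λ { zero _ → refl }
  shear-all {suc r} {d} {f} A a z c = begin
    f (a ∷ z′) ≈⟨ cong A (λ { zero _ → refl ; (suc zero) _ → refl ; (suc (suc k)) _ → refl }) ⟩
    f (y [ suc zero ]≔ y (suc zero) ⊕ head c ⊛ y zero) ≈⟨ shear A y {suc zero} {zero} (head c) (λ ()) ⟩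
    f y ≈⟨ cong A (λ { zero _ → refl ; (suc zero) _ → refl ; (suc (suc k)) _ → refl }) ⟩
    f (insertAt (a ∷ tail z′) (suc zero) (head z)) ≈⟨ shear-all (fix A (suc zero) (head z)) a (tail z) (tail c) ⟩
    f (insertAt (a ∷ tail z) (suc zero) (head z)) ≈⟨ cong A (λ { zero _ → refl ; (suc zero) _ → refl ; (suc (suc k)) _ → refl }) ⟩
    f (a ∷ z) ∎
    where
    open ≈-Reasoning
    z′ y : Fin _ → ℝ^ d
    z′ i = z i ⊕ c i ⊛ a
    y = a ∷ head z ∷ tail z′

  sign : Fin n → Carrier
  sign i = (- 1#) ^ toℕ i

  to-front : {f : (Fin (suc r) → ℝ^ d) → Carrier} → Alternating f → ∀ x j → f (x j ∷ removeAt x j) ≈ sign j * f x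
  to-front A x zero = trans (cong A (≡⇒≋ᶠ λ { zero → ≡.refl ; (suc i) → ≡.refl })) (sym (*-identityˡ _))
  to-front {suc r} {f = f} A x (suc j) = begin
    f (x (suc j) ∷ removeAt x (suc j)) ≈⟨ cong A (λ { zero _ → refl ; (suc zero) _ → refl ; (suc (suc k)) _ → refl }) ⟩
    f ((y [ zero ]≔ x (suc j)) [ suc zero ]≔ head x) ≈⟨ swap A y {zero} {suc zero} (x (suc j)) (head x) (λ ()) ⟩
    - f ((y [ zero ]≔ head x) [ suc zero ]≔ x (suc j)) ≈⟨ -‿cong (cong A (λ { zero _ → refl ; (suc zero) _ → refl ; (suc (suc k)) _ → refl })) ⟩
    - f (head x ∷ (tail x j ∷ removeAt (tail x) j)) ≈⟨ -‿cong (to-front (fix₀ A (head x)) (tail x) j) ⟩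
    - (sign j * f (head x ∷ tail x)) ≈⟨ -‿cong (*-congˡ (cong A (λ i k → sym (≡⇒≋ᶠ (∷-η x) i k)))) ⟩
    - (sign j * f x) ≈⟨ solve 2 (λ s y → :- (s :* y) := (:- :1) :* s :* y) refl (sign j) (f x) ⟩
    sign (suc j) * f x ∎
    where
    open ≈-Reasoning
    y = x zero ∷ x zero ∷ removeAt (tail x) j

  minor : (Fin (suc d) → ℝ^ (suc d)) → Fin (suc d) → Fin d → ℝ^ d
  minor x j i = removeAt (tail x i) j

  laplace-term : (Fin (suc d) → ℝ^ (suc d)) → Fin (suc d) → Carrier
  laplace-term x j = sign j * (head x j * det (minor x j))

  det-cong : (x y : Fin d → ℝ^ d) → x ≋ᶠ y → det x ≈ det y
  det-cong {zero} x y p = refl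
  det-cong {suc d} x y p = sum-cong {x = laplace-term x} {laplace-term y} λ j →
    *-congˡ (*-cong (p zero j) (det-cong (minor x j) (minor y j) λ i k → p (suc i) (punchIn j k)))

  -- The double Laplace expansion along two equal rows cancels in pairs because the minors are symmetric
  -- in the two removed columns.
  Symmetric : ∀ n → (Fin (suc n) → Fin n → Carrier) → Set
  Symmetric zero G = ⊤
  Symmetric (suc n) G = (∀ k → G zero k ≈ G (suc k) zero) × Symmetric n (λ j k → G (suc j) (suc k))

  Symmetric-cong : ∀ n {G H : Fin (suc n) → Fin n → Carrier} → (∀ j k → G j k ≈ H j k) → Symmetric n G → Symmetric n H
  Symmetric-cong zero p s = tt
  Symmetric-cong (suc n) p (q , s) = (λ k → trans (sym (p zero k)) (trans (q k) (p (suc k) zero))) , Symmetric-cong n (λ j k → p (suc j) (suc k)) s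

  -- If column zero is among the two removed ones, both orders of removal agree definitionally.
  -- Otherwise column zero survives and can be absorbed into `h`; this is why `h` is an arbitrary
  -- function and not the determinant.
  symmetric-minors : ∀ n {r} (y : Fin r → ℝ^ (suc (suc n))) (h : (Fin r → ℝ^ n) → Carrier) → (∀ {x z} → x ≋ᶠ z → h x ≈ h z) →
                     Symmetric (suc n) (λ j k → h (λ i → removeAt (removeAt (y i) j) k))
  symmetric-minors n y h h-cong = (λ k → refl) , rest n y h h-cong
    where
    rest : ∀ n {r} (y : Fin r → ℝ^ (suc (suc n))) (h : (Fin r → ℝ^ n) → Carrier) → (∀ {x z} → x ≋ᶠ z → h x ≈ h z) →
           Symmetric n (λ j k → h (λ i → removeAt (removeAt (y i) (suc j)) (suc k)))
    rest zero y h h-cong = tt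
    rest (suc n) y h h-cong = Symmetric-cong (suc n) {λ j k → h (λ i → y i zero ∷ removeAt (removeAt (tail (y i)) j) k)}
      {λ j k → h (λ i → removeAt (removeAt (y i) (suc j)) (suc k))}
      (λ j k → h-cong (λ { i zero → refl ; i (suc l) → refl }))
      (symmetric-minors n (tail ∘ y) (λ z → h (λ i → y i zero ∷ z i)) (λ {x} {z} p → h-cong {λ i → y i zero ∷ x i} {λ i → y i zero ∷ z i} (λ { i zero → refl ; i (suc l) → p i l })))

  -- The terms that remove column zero first cancel against those that remove it second, by the
  -- first half of `Symmetric`. The rest is the same double sum for `tail a`: both signs shift by
  -- one, and the two changes compensate.
  double-expansion : ∀ n (a : ℝ^ (suc n)) G → Symmetric n G →
                     sum (λ j → sign j * (a j * sum (λ k → sign k * (removeAt a j k * G j k)))) ≈ 0#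
  double-expansion zero a G s = trans (+-identityʳ _) (trans (*-congˡ (zeroʳ (a zero))) (zeroʳ 1#))
  double-expansion (suc n) a G (q , s) = begin
    1# * (a zero * sum P) + sum (λ j → sign (suc j) * (a (suc j) * (1# * (a zero * G (suc j) zero) + sum (λ k → sign (suc k) * (removeAt (tail a) j k * G (suc j) (suc k))))))
      ≈⟨ +-cong (trans (*-identityˡ _) (*-distribˡ-sum (a zero) P)) (trans (sum-cong split) (∑-distrib-+ (λ j → - (a zero * P j)) Q)) ⟩
    sum (λ j → a zero * P j) + (sum (λ j → - (a zero * P j)) + sum Q)
      ≈⟨ +-congˡ (+-cong (sum-neg (λ j → a zero * P j)) (double-expansion n (tail a) G′ s)) ⟩
    sum (λ j → a zero * P j) + (- sum (λ j → a zero * P j) + 0#)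
      ≈⟨ solve 1 (λ x → x :+ ((:- x) :+ :0) := :0) refl (sum (λ j → a zero * P j)) ⟩
    0# ∎
    where
    open ≈-Reasoning
    G′ : Fin (suc n) → Fin n → Carrier
    G′ j k = G (suc j) (suc k)
    P Q : Fin (suc n) → Carrier
    P k = sign k * (a (suc k) * G zero k)
    R S : Fin (suc n) → Fin n → Carrier
    R j k = sign k * (removeAt (tail a) j k * G′ j k)
    S j k = sign (suc k) * (removeAt (tail a) j k * G′ j k)
    Q j = sign j * (a (suc j) * sum (R j))
    S≈-R : ∀ j → sum (S j) ≈ - sum (R j)
    S≈-R j = trans (sum-cong λ k → solve 2 (λ s x → (:- :1) :* s :* x := :- (s :* x)) refl (sign k) (removeAt (tail a) j k * G′ j k)) (sum-neg (R j))
    split : ∀ j → sign (suc j) * (a (suc j) * (1# * (a zero * G (suc j) zero) + sum (S j))) ≈ - (a zero * P j) + Q j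
    split j = trans (*-congˡ (*-congˡ (+-cong (*-congˡ (*-congˡ (sym (q j)))) (S≈-R j))))
      (solve 5 (λ s a b g r → ((:- :1) :* s) :* (b :* (:1 :* (a :* g) :+ :- r)) := (:- (a :* (s :* (b :* g)))) :+ s :* (b :* r))
        refl (sign j) (a zero) (a (suc j)) (G zero j) (sum (R j)))

  -- Induction on the dimension. Multilinearity, and equal vectors beyond the first, concern the
  -- minors. If the first vector equals a later one, a swap among the later vectors, legitimate by
  -- what precedes, brings it to the second place, where `double-expansion` applies.
  det-alternating : ∀ d → Alternating (det {d})

  private
    module _ (d : ℕ) where
      minor-upd : ∀ (x : Fin (suc d) → ℝ^ (suc d)) i u j → minor (x [ suc i ]≔ u) j ≋ᶠ (minor x j [ i ]≔ removeAt u j)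
      minor-upd x i u j = ≡⇒≋ᶠ (upd-map (λ v → removeAt v j) (tail x) i u)

      det-minor-upd : ∀ (x : Fin (suc d) → ℝ^ (suc d)) i u j → det (minor (x [ suc i ]≔ u) j) ≈ det (minor x j [ i ]≔ removeAt u j)
      det-minor-upd x i u j = det-cong (minor (x [ suc i ]≔ u) j) (minor x j [ i ]≔ removeAt u j) (minor-upd x i u j)

      det-add : ∀ (x : Fin (suc d) → ℝ^ (suc d)) i u v → det (x [ i ]≔ u ⊕ v) ≈ det (x [ i ]≔ u) + det (x [ i ]≔ v)
      det-add x zero u v = trans (sum-cong {x = laplace-term (x [ zero ]≔ u ⊕ v)} {λ j → laplace-term (x [ zero ]≔ u) j + laplace-term (x [ zero ]≔ v) j} λ j →
          solve 4 (λ s u v m → s :* ((u :+ v) :* m) := s :* (u :* m) :+ s :* (v :* m)) refl (sign j) (u j) (v j) (det (minor x j)))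
        (∑-distrib-+ (laplace-term (x [ zero ]≔ u)) (laplace-term (x [ zero ]≔ v)))
      det-add x (suc i) u v = trans (sum-cong {x = laplace-term (x [ suc i ]≔ u ⊕ v)} {λ j → laplace-term (x [ suc i ]≔ u) j + laplace-term (x [ suc i ]≔ v) j} λ j → trans (*-congˡ (*-congˡ
          (trans (det-minor-upd x i (u ⊕ v) j) (trans (add (det-alternating d) (minor x j) i (removeAt u j) (removeAt v j))
            (sym (+-cong (det-minor-upd x i u j) (det-minor-upd x i v j)))))))
          (solve 4 (λ s a m n → s :* (a :* (m :+ n)) := s :* (a :* m) :+ s :* (a :* n)) refl (sign j) (head x j) (det (minor (x [ suc i ]≔ u) j)) (det (minor (x [ suc i ]≔ v) j))))
        (∑-distrib-+ (laplace-term (x [ suc i ]≔ u)) (laplace-term (x [ suc i ]≔ v)))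

      det-scale : ∀ (x : Fin (suc d) → ℝ^ (suc d)) i s u → det (x [ i ]≔ s ⊛ u) ≈ s * det (x [ i ]≔ u)
      det-scale x zero s u = trans (sum-cong {x = laplace-term (x [ zero ]≔ s ⊛ u)} {λ j → s * laplace-term (x [ zero ]≔ u) j} λ j →
          solve 4 (λ c s u m → c :* ((s :* u) :* m) := s :* (c :* (u :* m))) refl (sign j) s (u j) (det (minor x j)))
        (sym (*-distribˡ-sum s (laplace-term (x [ zero ]≔ u))))
      det-scale x (suc i) s u = trans (sum-cong {x = laplace-term (x [ suc i ]≔ s ⊛ u)} {λ j → s * laplace-term (x [ suc i ]≔ u) j} λ j → trans (*-congˡ (*-congˡ
          (trans (det-minor-upd x i (s ⊛ u) j) (trans (scale (det-alternating d) (minor x j) i s (removeAt u j))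
            (*-congˡ (sym (det-minor-upd x i u j)))))))
          (solve 4 (λ c s a m → c :* (a :* (s :* m)) := s :* (c :* (a :* m))) refl (sign j) s (head x j) (det (minor (x [ suc i ]≔ u) j))))
        (sym (*-distribˡ-sum s (laplace-term (x [ suc i ]≔ u))))

      det-alt-tail : ∀ (x : Fin (suc d) → ℝ^ (suc d)) {i j} → i ≢ j → x (suc i) ≋ x (suc j) → det x ≈ 0#
      det-alt-tail x i≢j p = sum-zero {f = laplace-term x} λ j →
        trans (*-congˡ (trans (*-congˡ (alt (det-alternating d) {minor x j} i≢j λ k → p (punchIn j k))) (zeroʳ (head x j)))) (zeroʳ (sign j))

      det-tail : ∀ (a : ℝ^ (suc d)) → Alternating (λ z → det (a ∷ z))
      det-tail a = record
        { cong = λ {x} {y} p → det-cong (a ∷ x) (a ∷ y) λ { zero _ → refl ; (suc i) → p i }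
        ; add = λ x i u v → trans (eq x i (u ⊕ v)) (trans (det-add (a ∷ x) (suc i) u v) (sym (+-cong (eq x i u) (eq x i v))))
        ; scale = λ x i s u → trans (eq x i (s ⊛ u)) (trans (det-scale (a ∷ x) (suc i) s u) (*-congˡ (sym (eq x i u))))
        ; alt = λ {x} p q → det-alt-tail (a ∷ x) p q }
        where
        eq : ∀ x i u → det (a ∷ (x [ i ]≔ u)) ≈ det ((a ∷ x) [ suc i ]≔ u)
        eq x i u = det-cong (a ∷ (x [ i ]≔ u)) ((a ∷ x) [ suc i ]≔ u) (≡⇒≋ᶠ λ { zero → ≡.refl ; (suc k) → ≡.refl })

    det-alt₀₁ : ∀ d (x : Fin (suc (suc d)) → ℝ^ (suc (suc d))) → x zero ≋ x (suc zero) → det x ≈ 0#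
    det-alt₀₁ d x p = trans
      (sum-cong {x = laplace-term x} {λ j → sign j * (head x j * sum (inner j))} λ j → *-congˡ (*-congˡ
        (sum-cong {x = laplace-term (minor x j)} {inner j} λ k → *-congˡ (*-congʳ (sym (p (punchIn j k)))))))
      (double-expansion (suc d) (head x) (λ j k → det (minor (minor x j) k)) (symmetric-minors d (tail (tail x)) det (λ {y} {z} → det-cong y z)))
      where
      inner : Fin (suc (suc d)) → Fin (suc d) → Carrier
      inner j k = sign k * (removeAt (head x) j k * det (minor (minor x j) k))

    det-alt₀ : ∀ d (x : Fin (suc d) → ℝ^ (suc d)) j → x zero ≋ x (suc j) → det x ≈ 0#
    det-alt₀ (suc d) x zero p = det-alt₀₁ d x p
    det-alt₀ (suc d) x (suc j) p = begin
      det x ≈⟨ det-cong x (head x ∷ ((t [ zero ]≔ t zero) [ suc j ]≔ t (suc j))) (≡⇒≋ᶠ λ { zero → ≡.refl ; (suc zero) → ≡.refl ; (suc (suc k)) → ≡.sym (upd-self (tail (tail x)) j k) }) ⟩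
      det (head x ∷ ((t [ zero ]≔ t zero) [ suc j ]≔ t (suc j))) ≈⟨ swap (det-tail (suc d) (head x)) t {zero} {suc j} (t zero) (t (suc j)) (λ ()) ⟩
      - det (head x ∷ ((t [ zero ]≔ t (suc j)) [ suc j ]≔ t zero)) ≈⟨ -‿cong (det-alt₀₁ d (head x ∷ ((t [ zero ]≔ t (suc j)) [ suc j ]≔ t zero)) p) ⟩
      - 0# ≈⟨ solve 0 (:- :0 := :0) refl ⟩
      0# ∎
      where
      open ≈-Reasoning
      t = tail x

    det-alt : ∀ d (x : Fin d → ℝ^ d) {i j} → i ≢ j → x i ≋ x j → det x ≈ 0#
    det-alt (suc d) x {i = zero} {zero} i≢j p = ⊥-elim (i≢j ≡.refl)
    det-alt (suc d) x {i = zero} {suc j} i≢j p = det-alt₀ d x j p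
    det-alt (suc d) x {i = suc i} {zero} i≢j p = det-alt₀ d x i λ k → sym (p k)
    det-alt (suc d) x {i = suc i} {suc j} i≢j p = det-alt-tail d x (i≢j ∘ ≡.cong suc) p

  det-alternating zero = record { cong = λ _ → refl ; add = λ { _ () } ; scale = λ { _ () } ; alt = λ { {i = ()} } }
  det-alternating (suc d) = record { cong = λ {x} {y} → det-cong x y ; add = det-add d ; scale = det-scale d ; alt = λ {x} → det-alt (suc d) x }

  insertAt-cong₀ : (j : Fin (suc d)) {z z′ : ℝ^ d} → z ≋ z′ → insertAt z j 0# ≋ insertAt z′ j 0#
  insertAt-cong₀ zero p zero = refl
  insertAt-cong₀ zero p (suc k) = p k
  insertAt-cong₀ {suc d} (suc j) p zero = p zero
  insertAt-cong₀ {suc d} (suc j) p (suc k) = insertAt-cong₀ j (p ∘ suc) k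

  insertAt-⊕ : (j : Fin (suc d)) (u v : ℝ^ d) → insertAt (u ⊕ v) j 0# ≋ insertAt u j 0# ⊕ insertAt v j 0#
  insertAt-⊕ zero u v zero = sym (+-identityˡ 0#)
  insertAt-⊕ zero u v (suc k) = refl
  insertAt-⊕ {suc d} (suc j) u v zero = refl
  insertAt-⊕ {suc d} (suc j) u v (suc k) = insertAt-⊕ j (tail u) (tail v) k

  insertAt-⊛ : (j : Fin (suc d)) (s : Carrier) (u : ℝ^ d) → insertAt (s ⊛ u) j 0# ≋ s ⊛ insertAt u j 0#
  insertAt-⊛ zero s u zero = sym (zeroʳ s)
  insertAt-⊛ zero s u (suc k) = refl
  insertAt-⊛ {suc d} (suc j) s u zero = refl
  insertAt-⊛ {suc d} (suc j) s u (suc k) = insertAt-⊛ j s (tail u) k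

  insert-remove : (j : Fin (suc d)) (z : ℝ^ (suc d)) → insertAt (removeAt z j) j 0# ≋ z ⊕ (- z j) ⊛ e j
  insert-remove zero z zero = solve 1 (λ a → :0 := a :+ (:- a) :* :1) refl (z zero)
  insert-remove zero z (suc k) = solve 2 (λ a b → b := b :+ (:- a) :* :0) refl (z zero) (z (suc k))
  insert-remove {suc d} (suc j) z zero = solve 2 (λ a b → b := b :+ (:- a) :* :0) refl (z (suc j)) (z zero)
  insert-remove {suc d} (suc j) z (suc k) = insert-remove j (tail z) k

  pullback : ∀ {d d′} {f : (Fin r → ℝ^ d′) → Carrier} → Alternating f → (φ : ℝ^ d → ℝ^ d′) →
             (∀ {u v} → u ≋ v → φ u ≋ φ v) → (∀ u v → φ (u ⊕ v) ≋ φ u ⊕ φ v) → (∀ s u → φ (s ⊛ u) ≋ s ⊛ φ u) →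
             Alternating (λ x → f (φ ∘ x))
  pullback {f = f} A φ φ-cong φ-⊕ φ-⊛ = record
    { cong = λ p → cong A λ i → φ-cong (p i)
    ; add = λ x i u v → trans (eq x i (u ⊕ v)) (trans (cong A (upd-cong i (λ _ _ → refl) (φ-⊕ u v)))
        (trans (add A (φ ∘ x) i (φ u) (φ v)) (sym (+-cong (eq x i u) (eq x i v)))))
    ; scale = λ x i s u → trans (eq x i (s ⊛ u)) (trans (cong A (upd-cong i (λ _ _ → refl) (φ-⊛ s u)))
        (trans (scale A (φ ∘ x) i s (φ u)) (*-congˡ (sym (eq x i u)))))
    ; alt = λ p q → alt A p (φ-cong q) }
    where
    eq : ∀ x i u → f (φ ∘ (x [ i ]≔ u)) ≈ f ((φ ∘ x) [ i ]≔ φ u)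
    eq x i u = cong A (≡⇒≋ᶠ (upd-map φ x i u))

  -- The first vector is expanded in the standard basis. With `e j` in the first slot, the remaining
  -- vectors may be sheared until their j-th entries vanish, and what is left is an alternating form
  -- in one dimension less, evaluated at the minor.
  alternating-unique : ∀ d {f : (Fin d → ℝ^ d) → Carrier} → Alternating f → ∀ x → f x ≈ f e * det x
  alternating-unique zero A x = trans (cong A λ ()) (sym (*-identityʳ _))
  alternating-unique (suc d) {f} A x = begin
    f x ≈⟨ cong A (λ { zero k → sym (sum-e (head x) k) ; (suc i) _ → refl }) ⟩
    f (x [ zero ]≔ combination (head x) e) ≈⟨ linear A x zero (head x) e ⟩
    sum (λ j → head x j * f (x [ zero ]≔ e j)) ≈⟨ sum-cong expand ⟩
    sum (λ j → f e * (sign j * (head x j * det (minor x j)))) ≈⟨ *-distribˡ-sum (f e) (λ j → sign j * (head x j * det (minor x j))) ⟨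
    f e * det x ∎
    where
    open ≈-Reasoning
    expand : ∀ j → head x j * f (x [ zero ]≔ e j) ≈ f e * (sign j * (head x j * det (minor x j)))
    expand j = begin
      head x j * f (x [ zero ]≔ e j) ≈⟨ *-congˡ (cong A λ { zero _ → refl ; (suc i) _ → refl }) ⟩
      head x j * f (e j ∷ tail x) ≈⟨ *-congˡ (sym (shear-all A (e j) (tail x) (λ i → - tail x i j))) ⟩
      head x j * f (e j ∷ λ i → tail x i ⊕ (- tail x i j) ⊛ e j) ≈⟨ *-congˡ (cong A λ { zero _ → refl ; (suc i) k → sym (insert-remove j (tail x i) k) }) ⟩
      head x j * g (minor x j) ≈⟨ *-congˡ (alternating-unique d g-alternating (minor x j)) ⟩
      head x j * (g e * det (minor x j)) ≈⟨ *-congˡ (*-congʳ (trans (cong A λ { zero _ → refl ; (suc i) k → e-punchIn j i k }) (to-front A e j))) ⟩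
      head x j * (sign j * f e * det (minor x j)) ≈⟨ solve 4 (λ a s f m → a :* (s :* f :* m) := f :* (s :* (a :* m))) refl (head x j) (sign j) (f e) (det (minor x j)) ⟩
      f e * (sign j * (head x j * det (minor x j))) ∎
      where
      g : (Fin d → ℝ^ d) → Carrier
      g z = f (e j ∷ λ i → insertAt (z i) j 0#)
      g-alternating : Alternating g
      g-alternating = pullback (fix₀ A (e j)) (λ z → insertAt z j 0#) (insertAt-cong₀ j) (insertAt-⊕ j) (insertAt-⊛ j)

-- Cramer's rule, coordinates and the exchange lemma.

module LinearAlgebra (em : ExcludedMiddle 0ℓ) (ℝ : CompleteOrderedField) where

  open OrderedField em ℝ
  open Determinants em ℝ
  open import Algebra.Bundles using (CommutativeMonoid)
  import Algebra.Properties.CommutativeMonoid.Sum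
  open import Data.Fin.Properties using (_≟_; punchInᵢ≢i; punchIn-injective; punchIn-punchOut; punchOut-injective; suc-injective)
  open import Data.Vec.Functional using (_∷_; head; tail; removeAt)

  private
    variable
      d n k : ℕ

  open Alternating

  sum-off : {f : Fin n → Carrier} (i : Fin n) → (∀ l → l ≢ i → f l ≈ 0#) → sum f ≈ f i
  sum-off {f = f} i p = trans (sum-cong pointwise) (sum-e f i)
    where
    pointwise : ∀ l → f l ≈ f l * e l i
    pointwise l with l ≟ i
    ... | yes ≡.refl = sym (trans (*-congˡ (e-diag l)) (*-identityʳ _))
    ... | no q = trans (p l q) (sym (trans (*-congˡ (e-off q)) (zeroʳ _)))

  sum-off₂ : {f : Fin n → Carrier} {i j : Fin n} → i ≢ j → (∀ l → l ≢ i → l ≢ j → f l ≈ 0#) → sum f ≈ f i + f j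
  sum-off₂ {f = f} {i} {j} i≢j p = trans (trans (sum-cong pointwise) (∑-distrib-+ (λ l → f l * e l i) (λ l → f l * e l j))) (+-cong (sum-e f i) (sum-e f j))
    where
    pointwise : ∀ l → f l ≈ f l * e l i + f l * e l j
    pointwise l with l ≟ i | l ≟ j
    ... | yes ≡.refl | yes ≡.refl = ⊥-elim (i≢j ≡.refl)
    ... | yes ≡.refl | no r = sym (trans (+-cong (*-congˡ (e-diag l)) (*-congˡ (e-off r))) (solve 1 (λ x → x :* :1 :+ x :* :0 := x) refl (f l)))
    ... | no q | yes ≡.refl = sym (trans (+-cong (*-congˡ (e-off q)) (*-congˡ (e-diag l))) (solve 1 (λ x → x :* :0 :+ x :* :1 := x) refl (f l)))
    ... | no q | no r = trans (p l q r) (sym (trans (+-cong (*-congˡ (e-off q)) (*-congˡ (e-off r))) (solve 1 (λ x → x :* :0 :+ x :* :0 := :0) refl (f l))))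

  module Reindex {c ℓ} (M : CommutativeMonoid c ℓ) where
    open CommutativeMonoid M renaming (Carrier to A; _≈_ to _≈ᴹ_; trans to transᴹ; sym to symᴹ; refl to reflᴹ; reflexive to reflexiveᴹ)
    open Algebra.Properties.CommutativeMonoid.Sum M using (sum-cong-≋; sum-replicate-zero) renaming (sum to sumᴹ; sum-remove to sum-removeᴹ)

    reindex : (π : Fin k → Fin n) → Injective _≡_ _≡_ π → (f : Fin n → A) → (∀ l → l ∉Image π → f l ≈ᴹ ε) → sumᴹ f ≈ᴹ sumᴹ (f ∘ π)
    reindex {zero} {n} π inj f p = transᴹ (sum-cong-≋ λ l → p l λ ()) (sum-replicate-zero n)
    reindex {suc k} {zero} π inj f p with () ← π zero
    reindex {suc k} {suc n} π inj f p = transᴹ (sum-removeᴹ {i = π zero} f) (∙-congˡ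
      (transᴹ (reindex π′ inj′ (removeAt f (π zero)) p′) (sum-cong-≋ λ i → reflexiveᴹ (≡.cong f (punchIn-punchOut (q i))))))
      where
      q : ∀ i → π zero ≢ π (suc i)
      q i eq with () ← inj eq
      π′ : Fin k → Fin n
      π′ i = punchOut (q i)
      inj′ : Injective _≡_ _≡_ π′
      inj′ {i} {j} eq = suc-injective (inj (punchOut-injective (q i) (q j) eq))
      p′ : ∀ l → l ∉Image π′ → removeAt f (π zero) l ≈ᴹ ε
      p′ l l∉ = p (punchIn (π zero) l) λ
        { (zero , eq) → punchInᵢ≢i (π zero) l (≡.sym eq)
        ; (suc i , eq) → l∉ (i , punchIn-injective (π zero) (π′ i) l (≡.trans (punchIn-punchOut (q i)) eq)) }

  open Reindex +-commutativeMonoid public using () renaming (reindex to sum-reindex)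
  open Reindex *-commutativeMonoid public using () renaming (reindex to product-reindex)

  det-e : ∀ d → det (e {d}) ≈ 1#
  det-e zero = refl
  det-e (suc d) = trans (+-cong first rest) (+-identityʳ 1#)
    where
    first : 1# * (1# * det (minor (e {suc d}) zero)) ≈ 1#
    first = trans (*-identityˡ _) (trans (*-identityˡ _) (det-e d))
    rest : sum (λ j → sign (suc j) * (0# * det (minor (e {suc d}) (suc j)))) ≈ 0#
    rest = sum-zero λ j → trans (*-congˡ (zeroˡ (det (minor (e {suc d}) (suc j))))) (zeroʳ (sign (suc j)))

  private
    module _ {d} (x : ℝ^ d) (k : Fin d) where
      A = det-alternating d

      -- A term of Cramer's expansion of the k-th entry of `x`, seen as a function of the basis. The
      -- terms are multilinear; in general only their sum is alternating, because the terms at two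
      -- equal basis vectors cancel each other.
      T : (Fin d → ℝ^ d) → Fin d → Carrier
      T B l = det (B [ l ]≔ x) * B l k

      upd-upd : (B : Fin d → ℝ^ d) (i : Fin d) (u v : ℝ^ d) → ((B [ i ]≔ u) [ i ]≔ v) ≋ᶠ (B [ i ]≔ v)
      upd-upd B zero u v zero _ = refl
      upd-upd B zero u v (suc l) _ = refl
      upd-upd B (suc i) u v l j = reflexive (≡.cong (λ z → z j) (go B (suc i) l))
        where
        go : ∀ {n} (B : Fin n → ℝ^ d) i l → ((B [ i ]≔ u) [ i ]≔ v) l ≡ (B [ i ]≔ v) l
        go B zero zero = ≡.refl
        go B zero (suc l) = ≡.refl
        go B (suc i) zero = ≡.refl
        go B (suc i) (suc l) = go (tail B) i l

      T-same : ∀ B i u → T (B [ i ]≔ u) i ≈ det (B [ i ]≔ x) * u k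
      T-same B i u = *-cong (det-cong ((B [ i ]≔ u) [ i ]≔ x) (B [ i ]≔ x) (upd-upd B i u x)) (reflexive (≡.cong (λ z → z k) (upd-same B i u)))

      T-other : ∀ B {i l} u → l ≢ i → T (B [ i ]≔ u) l ≈ det ((B [ l ]≔ x) [ i ]≔ u) * B l k
      T-other B {i} {l} u l≢i = *-cong (det-cong ((B [ i ]≔ u) [ l ]≔ x) ((B [ l ]≔ x) [ i ]≔ u) (≡⇒≋ᶠ (upd-comm B u x (l≢i ∘ ≡.sym))))
        (reflexive (≡.cong (λ z → z k) (upd-other B u (l≢i ∘ ≡.sym))))

      T-add : ∀ B i u v l → T (B [ i ]≔ u ⊕ v) l ≈ T (B [ i ]≔ u) l + T (B [ i ]≔ v) l
      T-add B i u v l with l ≟ i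
      ... | yes ≡.refl = trans (T-same B i (u ⊕ v)) (trans (distribˡ _ (u k) (v k)) (sym (+-cong (T-same B i u) (T-same B i v))))
      ... | no q = trans (T-other B (u ⊕ v) q) (trans (*-congʳ (add A (B [ l ]≔ x) i u v)) (trans (distribʳ (B l k) _ _)
                     (sym (+-cong (T-other B u q) (T-other B v q)))))

      T-scale : ∀ B i s u l → T (B [ i ]≔ s ⊛ u) l ≈ s * T (B [ i ]≔ u) l
      T-scale B i s u l with l ≟ i
      ... | yes ≡.refl = trans (T-same B i (s ⊛ u)) (trans (solve 3 (λ d s u → d :* (s :* u) := s :* (d :* u)) refl (det (B [ i ]≔ x)) s (u k)) (*-congˡ (sym (T-same B i u))))
      ... | no q = trans (T-other B (s ⊛ u) q) (trans (*-congʳ (scale A (B [ l ]≔ x) i s u)) (trans (*-assoc s _ _) (*-congˡ (sym (T-other B u q)))))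

      T-alt : ∀ B {i j} → i ≢ j → B i ≋ B j → sum (T B) ≈ 0#
      T-alt B {i} {j} i≢j p = trans (sum-off₂ {f = T B} i≢j off) (trans (+-cong (*-congʳ eqᵢ) (*-cong eqⱼ (sym (p k))))
        (solve 2 (λ d b → (:- d) :* b :+ d :* b := :0) refl (det ((B [ i ]≔ B i) [ j ]≔ x)) (B i k)))
        where
        off : ∀ l → l ≢ i → l ≢ j → T B l ≈ 0#
        off l l≢i l≢j = trans (*-congʳ (alt A {B [ l ]≔ x} i≢j λ c → trans (reflexive (≡.cong (λ z → z c) (upd-other B x l≢i)))
          (trans (p c) (reflexive (≡.cong (λ z → z c) (≡.sym (upd-other B x l≢j))))))) (zeroˡ _)
        eqⱼ : det (B [ j ]≔ x) ≈ det ((B [ i ]≔ B i) [ j ]≔ x)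
        eqⱼ = det-cong (B [ j ]≔ x) ((B [ i ]≔ B i) [ j ]≔ x) (upd-cong j (λ l c → reflexive (≡.cong (λ z → z c) (≡.sym (upd-self B i l)))) (λ _ → refl))
        eqᵢ : det (B [ i ]≔ x) ≈ - det ((B [ i ]≔ B i) [ j ]≔ x)
        eqᵢ = trans (det-cong (B [ i ]≔ x) ((B [ i ]≔ x) [ j ]≔ B i) λ l c → trans
            (reflexive (≡.cong (λ z → z c) (≡.sym (upd-self (B [ i ]≔ x) j l))))
            (upd-cong {x = B [ i ]≔ x} j (λ _ _ → refl) (λ c → trans (reflexive (≡.cong (λ z → z c) (upd-other B x i≢j))) (sym (p c))) l c))
          (swap A B x (B i) i≢j)

      cramer-form : Alternating (λ B → sum (T B))
      cramer-form = record
        { cong = λ {B} {C} p → sum-cong {x = T B} {T C} λ l → *-cong (det-cong (B [ l ]≔ x) (C [ l ]≔ x) (upd-cong l p (λ _ → refl))) (p l k)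
        ; add = λ B i u v → trans (sum-cong {x = T (B [ i ]≔ u ⊕ v)} {λ l → T (B [ i ]≔ u) l + T (B [ i ]≔ v) l} (T-add B i u v)) (∑-distrib-+ (T (B [ i ]≔ u)) (T (B [ i ]≔ v)))
        ; scale = λ B i s u → trans (sum-cong {x = T (B [ i ]≔ s ⊛ u)} {λ l → s * T (B [ i ]≔ u) l} (T-scale B i s u)) (sym (*-distribˡ-sum s (T (B [ i ]≔ u))))
        ; alt = λ {B} → T-alt B }

      det-e-upd : ∀ i → det (e [ i ]≔ x) ≈ x i
      det-e-upd i = begin
        det (e [ i ]≔ x) ≈⟨ det-cong (e [ i ]≔ x) (e [ i ]≔ combination x e) (upd-cong {x = e} i (λ _ _ → refl) λ c → sym (sum-e x c)) ⟩
        det (e [ i ]≔ combination x e) ≈⟨ linear A e i x e ⟩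
        sum (λ l → x l * det (e [ i ]≔ e l)) ≈⟨ sum-off {f = λ l → x l * det (e [ i ]≔ e l)} i (λ l l≢i → trans (*-congˡ (alt A {e [ i ]≔ e l} (l≢i ∘ ≡.sym) λ c →
             reflexive (≡.cong (λ z → z c) (≡.trans (upd-same e i (e l)) (≡.sym (upd-other e (e l) (l≢i ∘ ≡.sym))))))) (zeroʳ (x l))) ⟩
        x i * det (e [ i ]≔ e i) ≈⟨ *-congˡ (trans (det-cong (e [ i ]≔ e i) e (≡⇒≋ᶠ (upd-self e i))) (det-e d)) ⟩
        x i * 1# ≈⟨ *-identityʳ (x i) ⟩
        x i ∎
        where open ≈-Reasoning

  -- The left side is alternating in `B`, hence a multiple of `det B`; the factor is read off at the
  -- standard basis.
  cramer : (B : Fin d → ℝ^ d) (x : ℝ^ d) (k : Fin d) → sum (λ i → det (B [ i ]≔ x) * B i k) ≈ x k * det B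
  cramer {d} B x k = trans (alternating-unique d (cramer-form x k) B)
    (*-congʳ (trans (sum-cong {x = λ i → det (e [ i ]≔ x) * e i k} {λ i → x i * e i k} λ i → *-congʳ (det-e-upd x k i)) (sum-e x k)))

  combination-cong : {t u : Fin n → Carrier} {w : Fin n → ℝ^ d} → (∀ i → t i ≈ u i) → combination t w ≋ combination u w
  combination-cong p j = sum-cong λ i → *-congʳ (p i)

  combination-e : (w : Fin n → ℝ^ d) (i : Fin n) → combination (e i) w ≋ w i
  combination-e w i j = trans (sum-cong λ l → trans (*-congʳ (e-sym i l)) (*-comm _ _)) (sum-e (λ l → w l j) i)

  combination-+ : (t u : Fin n → Carrier) (w : Fin n → ℝ^ d) → combination (λ i → t i + u i) w ≋ combination t w ⊕ combination u w
  combination-+ t u w j = trans (sum-cong λ i → distribʳ (w i j) (t i) (u i)) (∑-distrib-+ (λ i → t i * w i j) (λ i → u i * w i j))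

  combination-* : (s : Carrier) (t : Fin n → Carrier) (w : Fin n → ℝ^ d) → combination (λ i → s * t i) w ≋ s ⊛ combination t w
  combination-* s t w j = trans (sum-cong λ i → *-assoc s (t i) (w i j)) (sym (*-distribˡ-sum s (λ i → t i * w i j)))

  combination-reindex : (π : Fin k → Fin n) → Injective _≡_ _≡_ π → (t : Fin n → Carrier) (w : Fin n → ℝ^ d) →
                        (∀ l → l ∉Image π → t l ≈ 0#) → combination t w ≋ combination (t ∘ π) (w ∘ π)
  combination-reindex π inj t w p j = sum-reindex π inj (λ i → t i * w i j) λ l l∉ → trans (*-congʳ (p l l∉)) (zeroˡ _)

  inner-combination : (t : Fin n → Carrier) (w : Fin n → ℝ^ d) (ξ : ℝ^ d) → ⟨ combination t w , ξ ⟩ ≈ sum (λ i → t i * ⟨ w i , ξ ⟩)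
  inner-combination t w ξ = begin
    sum (λ j → sum (λ i → t i * w i j) * ξ j) ≈⟨ sum-cong (λ j → trans (*-distribʳ-sum (ξ j) (λ i → t i * w i j)) (sum-cong λ i → *-assoc (t i) (w i j) (ξ j))) ⟩
    sum (λ j → sum (λ i → t i * (w i j * ξ j))) ≈⟨ ∑-comm (λ j i → t i * (w i j * ξ j)) ⟩
    sum (λ i → sum (λ j → t i * (w i j * ξ j))) ≈⟨ sum-cong (λ i → sym (*-distribˡ-sum (t i) (λ j → w i j * ξ j))) ⟩
    sum (λ i → t i * ⟨ w i , ξ ⟩) ∎
    where open ≈-Reasoning

  inner-cong : {x y : ℝ^ d} (ξ : ℝ^ d) → x ≋ y → ⟨ x , ξ ⟩ ≈ ⟨ y , ξ ⟩
  inner-cong ξ p = sum-cong λ j → *-congʳ (p j)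

  inner-comm : (x y : ℝ^ d) → ⟨ x , y ⟩ ≈ ⟨ y , x ⟩
  inner-comm x y = sum-cong λ j → *-comm (x j) (y j)

  inner-⊕ : (x y ξ : ℝ^ d) → ⟨ x ⊕ y , ξ ⟩ ≈ ⟨ x , ξ ⟩ + ⟨ y , ξ ⟩
  inner-⊕ x y ξ = trans (sum-cong λ j → distribʳ (ξ j) (x j) (y j)) (∑-distrib-+ (λ j → x j * ξ j) (λ j → y j * ξ j))

  inner-⊛ : (s : Carrier) (x ξ : ℝ^ d) → ⟨ s ⊛ x , ξ ⟩ ≈ s * ⟨ x , ξ ⟩
  inner-⊛ s x ξ = trans (sum-cong λ j → *-assoc s (x j) (ξ j)) (sym (*-distribˡ-sum s (λ j → x j * ξ j)))

  module Coordinates {d} (B : Fin d → ℝ^ d) (det≉0 : ¬ det B ≈ 0#) where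

    coord : ℝ^ d → ℝ^ d
    coord x i = det (B [ i ]≔ x) / det B

    coord-cong : ∀ {x y} → x ≋ y → coord x ≋ coord y
    coord-cong {x} {y} p i = *-congʳ (det-cong (B [ i ]≔ x) (B [ i ]≔ y) (upd-cong {x = B} i (λ _ _ → refl) p))

    coord-⊕ : ∀ x y → coord (x ⊕ y) ≋ coord x ⊕ coord y
    coord-⊕ x y i = trans (*-congʳ (add (det-alternating d) B i x y)) (distribʳ _ _ _)

    coord-⊛ : ∀ s x → coord (s ⊛ x) ≋ s ⊛ coord x
    coord-⊛ s x i = trans (*-congʳ (scale (det-alternating d) B i s x)) (*-assoc s _ _)

    coord-combination : ∀ {n} (t : Fin n → Carrier) (v : Fin n → ℝ^ d) → coord (combination t v) ≋ combination t (coord ∘ v)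
    coord-combination t v i = trans (*-congʳ (linear (det-alternating d) B i t v)) (trans (*-distribʳ-sum (det B ⁻¹) (λ l → t l * det (B [ i ]≔ v l)))
      (sum-cong λ l → *-assoc (t l) _ _))

    coord-B : ∀ j → coord (B j) ≋ e j
    coord-B j i with j ≟ i
    ... | yes ≡.refl = trans (*-congʳ (det-cong (B [ i ]≔ B i) B (≡⇒≋ᶠ (upd-self B i)))) (trans (⁻¹-inverseʳ det≉0) (sym (e-diag i)))
    ... | no q = trans (*-congʳ (alt (det-alternating d) {B [ i ]≔ B j} (q ∘ ≡.sym) λ c →
          reflexive (≡.cong (λ z → z c) (≡.trans (upd-same B i (B j)) (≡.sym (upd-other B (B j) (q ∘ ≡.sym))))))) (trans (zeroˡ _) (sym (e-off q)))

    coord-spans : ∀ x → x ≋ combination (coord x) B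
    coord-spans x k = *-cancelˡ-≈ det≉0 (begin
      det B * x k ≈⟨ trans (*-comm _ _) (sym (cramer B x k)) ⟩
      sum (λ i → det (B [ i ]≔ x) * B i k) ≈⟨ sum-cong {x = λ i → det (B [ i ]≔ x) * B i k} {λ i → det B * (coord x i * B i k)} (λ i → sym (trans (sym (*-assoc _ _ _)) (*-congʳ (*-/-cancel det≉0)))) ⟩
      sum (λ i → det B * (coord x i * B i k)) ≈⟨ *-distribˡ-sum (det B) (λ i → coord x i * B i k) ⟨
      det B * combination (coord x) B k ∎)
      where open ≈-Reasoning

    coord-unique : ∀ {x} t → x ≋ combination t B → coord x ≋ t
    coord-unique {x} t p i = trans (coord-cong p i) (trans (coord-combination t B i)
      (trans (sum-cong λ l → *-congˡ (coord-B l i)) (sum-e t i)))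

    -- `det` after `coord` is an alternating form with value 1 at `B`; uniqueness of the determinant
    -- expresses this value through `det B`.
    det-coord-e : det (coord ∘ e) * det B ≈ 1#
    det-coord-e = trans (sym (alternating-unique d (pullback (det-alternating d) coord coord-cong coord-⊕ coord-⊛) B))
      (trans (det-cong (coord ∘ B) e coord-B) (det-e d))

    exchange : ∀ x i → ¬ coord x i ≈ 0# → ¬ det (B [ i ]≔ x) ≈ 0#
    exchange x i p q = p (trans (*-congʳ q) (zeroˡ _))

  Independent : (Fin k → ℝ^ d) → Set
  Independent u = ∀ t → combination t u ≋ 0ᵛ → ∀ i → t i ≈ 0#

  abstract
    -- The exchange lemma. `P` is carried along because the completed basis will have to stay in the
    -- half-space where a linear form is positive. The new vector has a nonzero coordinate at a
    -- place not yet taken, since otherwise it would depend on the vectors already exchanged.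
    steinitz : (P : ℝ^ d → Set) (B₀ : Fin d → ℝ^ d) → ¬ det B₀ ≈ 0# → (∀ i → P (B₀ i)) → (u : Fin k → ℝ^ d) → (∀ i → P (u i)) → Independent u →
               ∃ λ (B : Fin d → ℝ^ d) → ¬ det B ≈ 0# × (∀ i → P (B i)) × ∃ λ (π : Fin k → Fin d) → Injective _≡_ _≡_ π × (∀ i → B (π i) ≡ u i)
    steinitz {k = zero} P B₀ det≉0 PB₀ u Pu ind = B₀ , det≉0 , PB₀ , (λ ()) , (λ { {()} }) , λ ()
    steinitz {d} {suc k} P B₀ det₀≉0 PB₀ u Pu ind
      with steinitz P B₀ det₀≉0 PB₀ (tail u) (Pu ∘ suc) (λ t p i → ind (0# ∷ t) (λ j → trans (+-cong (zeroˡ _) (p j)) (+-identityˡ 0#)) (suc i))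
    ... | B , det≉0 , PB , π , inj , eq = result (em {P = ∃ λ q → q ∉Image π × ¬ coord (head u) q ≈ 0#})
      where
      open Coordinates B det≉0
      result : Dec (∃ λ q → q ∉Image π × ¬ coord (head u) q ≈ 0#) →
               ∃ λ (B : Fin d → ℝ^ d) → ¬ det B ≈ 0# × (∀ i → P (B i)) × ∃ λ (π : Fin (suc k) → Fin d) → Injective _≡_ _≡_ π × (∀ i → B (π i) ≡ u i)
      result (yes (q , q∉ , c≉0)) = (B [ q ]≔ head u) , exchange (head u) q c≉0 , PB′ , (q ∷ π) , inj′ , eq′
        where
        PB′ : ∀ i → P ((B [ q ]≔ head u) i)
        PB′ i with q ≟ i
        ... | yes ≡.refl = ≡.subst P (≡.sym (upd-same B q (head u))) (Pu zero)
        ... | no r = ≡.subst P (≡.sym (upd-other B (head u) r)) (PB i)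
        inj′ : Injective _≡_ _≡_ (q ∷ π)
        inj′ {zero} {zero} p = ≡.refl
        inj′ {zero} {suc j} p = ⊥-elim (q∉ (j , ≡.sym p))
        inj′ {suc i} {zero} p = ⊥-elim (q∉ (i , p))
        inj′ {suc i} {suc j} p = ≡.cong suc (inj p)
        eq′ : ∀ i → (B [ q ]≔ head u) ((q ∷ π) i) ≡ u i
        eq′ zero = upd-same B q (head u)
        eq′ (suc i) = ≡.trans (upd-other B (head u) (λ p → q∉ (i , ≡.sym p))) (eq i)
      result (no none) = ⊥-elim (1≉0 (trans (solve 0 (:1 := :- (:- :1)) refl) (trans (-‿cong (ind t rel zero)) (solve 0 (:- :0 := :0) refl))))
        where
        c : ℝ^ d
        c = coord (head u)
        off : ∀ l → l ∉Image π → c l ≈ 0#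
        off l l∉ with c l ≈? 0#
        ... | yes p = p
        ... | no p = ⊥-elim (none (l , l∉ , p))
        t : Fin (suc k) → Carrier
        t = (- 1#) ∷ (c ∘ π)
        rel : combination t u ≋ 0ᵛ
        rel j = begin
          - 1# * u zero j + sum (λ i → c (π i) * u (suc i) j) ≈⟨ +-cong (solve 1 (λ x → (:- :1) :* x := :- x) refl (u zero j))
              (sum-cong λ i → *-congˡ (reflexive (≡.cong (λ z → z j) (≡.sym (eq i))))) ⟩
          - u zero j + combination (c ∘ π) (B ∘ π) j ≈⟨ +-congˡ (sym (combination-reindex π inj c B off j)) ⟩
          - u zero j + combination c B j ≈⟨ +-congˡ (sym (coord-spans (head u) j)) ⟩
          - u zero j + u zero j ≈⟨ -‿inverseˡ _ ⟩
          0# ∎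
          where open ≈-Reasoning

  abstract
    -- All but one of the standard basis vectors are pushed into the half-space by multiples of `s`.
    -- The omitted index is one where `s` has a nonzero entry; as shears preserve the determinant,
    -- it is that entry up to sign.
    positive-basis : (ξ s : ℝ^ d) → 0# < ⟨ s , ξ ⟩ → ∃ λ (B : Fin d → ℝ^ d) → ¬ det B ≈ 0# × (∀ i → 0# < ⟨ B i , ξ ⟩)
    positive-basis {zero} ξ s p = ⊥-elim (<-irrefl refl p)
    positive-basis {suc d} ξ s p with em {P = ∃ λ q → ¬ s q ≈ 0#}
    ... | no none = ⊥-elim (>⇒≉ p (sum-zero {f = λ j → s j * ξ j} λ j → trans (*-congʳ (s≈0 j)) (zeroˡ (ξ j))))
      where
      s≈0 : ∀ j → s j ≈ 0#
      s≈0 j with s j ≈? 0#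
      ... | yes r = r
      ... | no r = ⊥-elim (none (j , r))
    ... | yes (q , sq≉0) = B , det≉0 , pos
      where
      shift : ∀ y → ∃ λ c → 0# < y + c * ⟨ s , ξ ⟩
      -- The multiple is chosen to make the inner product equal to 1.
      shift y = (1# - y) / ⟨ s , ξ ⟩ , <-respʳ (sym (trans (+-congˡ (/-*-cancel (>⇒≉ p))) (solve 1 (λ y → y :+ (:1 :- y) := :1) refl y))) 0<1
      c : Fin d → Carrier
      c i = proj₁ (shift ⟨ removeAt e q i , ξ ⟩)
      B : Fin (suc d) → ℝ^ (suc d)
      B = s ∷ λ i → removeAt e q i ⊕ c i ⊛ s
      pos : ∀ i → 0# < ⟨ B i , ξ ⟩
      pos zero = p
      pos (suc i) = <-respʳ (sym (trans (inner-⊕ (removeAt e q i) (c i ⊛ s) ξ) (+-congˡ (inner-⊛ (c i) s ξ)))) (proj₂ (shift ⟨ removeAt e q i , ξ ⟩))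
      E : Fin (suc d) → ℝ^ (suc d)
      E = e [ q ]≔ s
      front : det (E q ∷ removeAt E q) ≈ sign q * det E
      front = to-front (det-alternating (suc d)) E q
      eq : det B ≈ sign q * s q
      eq = trans (shear-all (det-alternating (suc d)) s (removeAt e q) c) (trans
        (det-cong (s ∷ removeAt e q) (E q ∷ removeAt E q) (≡⇒≋ᶠ λ { zero → ≡.sym (upd-same e q s) ; (suc i) → ≡.sym (upd-other e s (punchInᵢ≢i q i ∘ ≡.sym)) }))
        (trans front (*-congˡ (det-e-upd s q q))))
      sign≉0 : ∀ {n} (i : Fin n) → ¬ sign i ≈ 0#
      sign≉0 zero = 1≉0
      sign≉0 (suc i) = *-≉0 (λ r → 1≉0 (trans (solve 0 (:1 := :- (:- :1)) refl) (trans (-‿cong r) (solve 0 (:- :0 := :0) refl)))) (sign≉0 i)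
      det≉0 : ¬ det B ≈ 0#
      det≉0 r = *-≉0 (sign≉0 q) sq≉0 (trans (sym eq) r)

-- Sums over lists and exponential sums over arithmetic progressions.

module Progressions (em : ExcludedMiddle 0ℓ) (ℝ : CompleteOrderedField) where

  open OrderedField em ℝ
  open AbsoluteValue em ℝ
  open Limits em ℝ
  open ExponentialFunction em ℝ
  open Determinants em ℝ
  open LinearAlgebra em ℝ
  import Algebra.Properties.AbelianGroup
  open import Data.Integer.Base as ℤ using (ℤ; +_; -[1+_])
  import Data.Integer.Properties as ℤ
  open import Data.List.Base using ([]; _∷_; _++_)
  open import Data.List.Membership.Propositional using (_∈_)
  open import Data.List.Membership.Propositional.Properties using (∈-∃++; ∈-++⁻; ∈-++⁺ˡ; ∈-++⁺ʳ; ∈-map⁺; ∈-map⁻; ∈-upTo⁺; ∈-upTo⁻)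
  open import Data.List.Relation.Unary.All as All using (All; []; _∷_)
  open import Data.List.Relation.Unary.Any using (here; there)
  open import Data.List.Relation.Unary.AllPairs using ([]; _∷_)
  open import Data.List.Relation.Unary.Unique.Propositional using (Unique)
  import Data.List.Relation.Unary.Unique.Propositional.Properties as Unique

  private
    variable
      A B : Set

  sumᴸ : List A → (A → Carrier) → Carrier
  sumᴸ [] f = 0#
  sumᴸ (x ∷ xs) f = f x + sumᴸ xs f

  sumᴸ-++ : (xs ys : List A) (f : A → Carrier) → sumᴸ (xs ++ ys) f ≈ sumᴸ xs f + sumᴸ ys f
  sumᴸ-++ [] ys f = sym (+-identityˡ _)
  sumᴸ-++ (x ∷ xs) ys f = trans (+-congˡ (sumᴸ-++ xs ys f)) (sym (+-assoc _ _ _))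

  sumᴸ-map : (g : A → B) (xs : List A) (f : B → Carrier) → sumᴸ (List.map g xs) f ≈ sumᴸ xs (f ∘ g)
  sumᴸ-map g [] f = refl
  sumᴸ-map g (x ∷ xs) f = +-congˡ (sumᴸ-map g xs f)

  sumᴸ-cong : (xs : List A) {f g : A → Carrier} → (∀ x → f x ≈ g x) → sumᴸ xs f ≈ sumᴸ xs g
  sumᴸ-cong [] p = refl
  sumᴸ-cong (x ∷ xs) p = +-cong (p x) (sumᴸ-cong xs p)

  sumᴸ-mono-∈ : (xs : List A) {f g : A → Carrier} → (∀ {x} → x ∈ xs → f x ≤ g x) → sumᴸ xs f ≤ sumᴸ xs g
  sumᴸ-mono-∈ [] p = ≤-refl
  sumᴸ-mono-∈ (x ∷ xs) p = +-mono-≤ (p (here ≡.refl)) (sumᴸ-mono-∈ xs (p ∘ there))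

  sumᴸ-mono : (xs : List A) {f g : A → Carrier} → (∀ x → f x ≤ g x) → sumᴸ xs f ≤ sumᴸ xs g
  sumᴸ-mono xs p = sumᴸ-mono-∈ xs λ {x} _ → p x

  sumᴸ-nonneg : (xs : List A) {f : A → Carrier} → (∀ x → 0# ≤ f x) → 0# ≤ sumᴸ xs f
  sumᴸ-nonneg [] p = ≤-refl
  sumᴸ-nonneg (x ∷ xs) p = +-nonneg (p x) (sumᴸ-nonneg xs p)

  sumᴸ-* : (c : Carrier) (xs : List A) (f : A → Carrier) → sumᴸ xs (λ x → c * f x) ≈ c * sumᴸ xs f
  sumᴸ-* c [] f = sym (zeroʳ c)
  sumᴸ-* c (x ∷ xs) f = trans (+-congˡ (sumᴸ-* c xs f)) (sym (distribˡ c _ _))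

  sumᴸ-concatMap : (g : A → List B) (xs : List A) (f : B → Carrier) → sumᴸ (List.concatMap g xs) f ≈ sumᴸ xs (λ x → sumᴸ (g x) f)
  sumᴸ-concatMap g [] f = refl
  sumᴸ-concatMap g (x ∷ xs) f = trans (sumᴸ-++ (g x) (List.concatMap g xs) f) (+-congˡ (sumᴸ-concatMap g xs f))

  -- Replaces reindexing by bijections in the comparison of sums over lattice points and over faces:
  -- `ys` may be too large or contain repetitions, and may omit points where `f` vanishes.
  sumᴸ-unique : (xs ys : List A) {f : A → Carrier} → (∀ x → 0# ≤ f x) → Unique xs → (∀ {x} → x ∈ xs → f x ≈ 0# ⊎ x ∈ ys) → sumᴸ xs f ≤ sumᴸ ys f
  sumᴸ-unique [] ys f≥0 u p = sumᴸ-nonneg ys f≥0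
  sumᴸ-unique (x ∷ xs) ys {f} f≥0 (x∉ ∷ u) p with p (here ≡.refl)
  ... | inj₁ fx≈0 = ≤-trans (≈⇒≤ (trans (+-congʳ fx≈0) (+-identityˡ _))) (sumᴸ-unique xs ys f≥0 u (p ∘ there))
  ... | inj₂ x∈ys with ∈-∃++ x∈ys
  ...   | as , bs , ≡.refl = ≤-trans (+-monoʳ-≤ (f x) (sumᴸ-unique xs (as ++ bs) f≥0 u p′))
          (≈⇒≤ (trans (+-congˡ (sumᴸ-++ as bs f)) (trans (solve 3 (λ x a b → x :+ (a :+ b) := a :+ (x :+ b)) refl (f x) (sumᴸ as f) (sumᴸ bs f))
            (sym (sumᴸ-++ as (x ∷ bs) f)))))
    where
    p′ : ∀ {y} → y ∈ xs → f y ≈ 0# ⊎ y ∈ as ++ bs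
    p′ {y} y∈ with p (there y∈)
    ... | inj₁ q = inj₁ q
    ... | inj₂ q with ∈-++⁻ as q
    ...   | inj₁ r = inj₂ (∈-++⁺ˡ r)
    ...   | inj₂ (here y≡x) = ⊥-elim (All.lookup x∉ y∈ (≡.sym y≡x))
    ...   | inj₂ (there r) = inj₂ (∈-++⁺ʳ as r)

  Bnd-sum : ∀ {n} {f g : Fin n → Carrier} → (∀ i → Bnd (f i) (g i)) → Bnd (sum f) (sum g)
  Bnd-sum {zero} p = Bnd-0 ≤-refl
  Bnd-sum {suc n} p = Bnd-+ (p zero) (Bnd-sum (p ∘ suc))

  abstract
    -- Error factors are distributed multiplicatively over the steps of an estimate, hence
    -- approximate square roots. The constant 3 comes from (1 + δ)² ≤ 1 + 3δ for δ ≤ 1.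
    square-below : ∀ {ρ} → 1# < ρ → ∃ λ r → 1# < r × r * r ≤ ρ
    square-below {ρ} p = let δ , δ>0 , δ≤1 , q = small {ρ - 1#} {1# + 1# + 1#} (<⇒0< p) (+-nonneg (+-nonneg 0≤1 0≤1) 0≤1) in
      1# + δ , <-by δ>0 (solve 1 (λ d → (:1 :+ d) :- :1 := d) refl δ) ,
      ≤-by (+-nonneg (≤⇒0≤ (<⇒≤ q)) (*-nonneg (<⇒≤ δ>0) (≤⇒0≤ δ≤1)))
        (solve 2 (λ r d → r :- (:1 :+ d) :* (:1 :+ d) := (r :- :1 :- d :* (:1 :+ :1 :+ :1)) :+ d :* (:1 :- d)) refl ρ δ)

    square-above : ∀ {θ} → θ < 1# → ∃ λ s → 0# ≤ s × s < 1# × θ ≤ s * s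
    square-above {θ} p = let δ , δ>0 , δ≤1 , q = small {1# - θ} {1# + 1#} (<⇒0< p) (+-nonneg 0≤1 0≤1) in
      1# - δ , ≤⇒0≤ δ≤1 , <-by δ>0 (solve 1 (λ d → :1 :- (:1 :- d) := d) refl δ) ,
      ≤-by (+-nonneg (≤⇒0≤ (<⇒≤ q)) (square-nonneg δ))
        (solve 2 (λ t d → (:1 :- d) :* (:1 :- d) :- t := (:1 :- t :- d :* (:1 :+ :1)) :+ d :* d) refl θ δ)

    linear-small : ∀ {ρ c} → 1# < ρ → 0# ≤ c → ∃ λ h₀ → 0# < h₀ × (∀ {h} → 0# < h → h ≤ h₀ → 1# + c * h ≤ ρ)
    linear-small {ρ} {c} p q = let δ , δ>0 , _ , r = small (<⇒0< p) q in
      δ , δ>0 , λ {h} h>0 h≤δ → ≤-by (+-nonneg (≤⇒0≤ (<⇒≤ r)) (*-nonneg q (≤⇒0≤ h≤δ)))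
        (solve 4 (λ ρ c δ h → ρ :- (:1 :+ c :* h) := (ρ :- :1 :- δ :* c) :+ c :* (δ :- h)) refl ρ c δ h)

    bounded-family : ∀ {n} (f : Fin n → Carrier) → ∃ λ G → 0# ≤ G × (∀ i → Bnd (f i) G)
    bounded-family {zero} f = 0# , ≤-refl , λ ()
    bounded-family {suc n} f = let G , G≥0 , b = bounded-family (f ∘ suc) in
      ∣ f zero ∣ + G , +-nonneg (∣∣-nonneg _) G≥0 , λ
        { zero → Bnd-weaken (Bnd-∣∣ (f zero)) (≤-by G≥0 (solve 2 (λ x g → (x :+ g) :- x := g) refl ∣ f zero ∣ G))
        ; (suc i) → Bnd-weaken (b i) (≤-by (∣∣-nonneg (f zero)) (solve 2 (λ x g → (x :+ g) :- g := x) refl ∣ f zero ∣ G)) }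

  module Decay (exp : Carrier → Carrier) (isExp : IsExp exp) where
    open Exponential exp isExp public

    abstract
      -- Continuity of `exp` at 0 in quantitative form. As exp(-x) ≥ 1 - x, multiplying ρ(1 - x) ≥ 1
      -- by exp x gives exp x ≤ ρ.
      exp-small : ∀ {ρ c} → 1# < ρ → 0# ≤ c → ∃ λ h₀ → 0# < h₀ × (∀ {h} → 0# < h → h ≤ h₀ → exp (c * h) ≤ ρ)
      exp-small {ρ} {c} p q = let δ , δ>0 , _ , r = small (<⇒0< p) (*-nonneg ρ≥0 q) in
        δ , δ>0 , λ {h} h>0 h≤δ → bound (c * h)
          (≤-by (+-nonneg (≤⇒0≤ (<⇒≤ r)) (*-nonneg (*-nonneg ρ≥0 q) (≤⇒0≤ h≤δ)))
            (solve 4 (λ ρ c δ h → ρ :* (:1 :- c :* h) :- :1 := (ρ :- :1 :- δ :* (ρ :* c)) :+ ρ :* c :* (δ :- h)) refl ρ c δ h))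
        where
        ρ≥0 : 0# ≤ ρ
        ρ≥0 = ≤-trans 0≤1 (<⇒≤ p)
        bound : ∀ x → 1# ≤ ρ * (1# - x) → exp x ≤ ρ
        bound x le = ≤-trans (≤-respˡ (*-identityʳ _) (*-monoˡ-≤ (exp-nonneg x) le))
          (≤-respʳ (trans (*-congˡ (exp-inverse x)) (*-identityʳ ρ))
            (≤-respˡ (solve 3 (λ E r x → r :* (E :* (:1 :- x)) := E :* (r :* (:1 :- x))) refl (exp x) ρ x)
              (*-monoˡ-≤ ρ≥0 (*-monoˡ-≤ (exp-nonneg x) (1+x≤exp (- x))))))

      exp-neg-small : ∀ {θ c} → θ < 1# → 0# ≤ c → ∃ λ h₀ → 0# < h₀ × (∀ {h} → 0# < h → h ≤ h₀ → θ ≤ exp (- (c * h)))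
      exp-neg-small {θ} {c} p q = let δ , δ>0 , _ , r = small (<⇒0< p) q in
        δ , δ>0 , λ {h} h>0 h≤δ → ≤-trans (≤-by (+-nonneg (≤⇒0≤ (<⇒≤ r)) (*-nonneg q (≤⇒0≤ h≤δ)))
            (solve 4 (λ θ c δ h → (:1 :+ (:- (c :* h))) :- θ := (:1 :- θ :- δ :* c) :+ c :* (δ :- h)) refl θ c δ h))
          (1+x≤exp (- (c * h)))

      -- With aL = 1/ε this is exp(1/ε) ≥ 1/ε.
      exp-vanishes : ∀ {a ε} → 0# < a → 0# < ε → ∃ λ L → 0# < L × exp (- (a * L)) ≤ ε
      exp-vanishes {a} {ε} p q = L , /-pos (⁻¹-pos q) p , ≤-trans (≈⇒≤ (exp-cong (-‿cong (*-/-cancel (>⇒≉ p)))))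
        (*-cancelˡ-≤ (exp-pos (ε ⁻¹)) (≤-trans (≈⇒≤ (exp-inverse (ε ⁻¹)))
          (≤-trans (≈⇒≤ (sym (⁻¹-inverseˡ (>⇒≉ q)))) (*-monoʳ-≤ (<⇒≤ q) (≤-trans (≤-by 0≤1 (solve 1 (λ x → (:1 :+ x) :- x := :1) refl (ε ⁻¹))) (1+x≤exp (ε ⁻¹)))))))
        where
        L : Carrier
        L = ε ⁻¹ / a

    -- The integrand on the half-line, extended by zero; its integral over the line is 1/a. The
    -- value at 0 is immaterial in the limit, but putting it to 1 makes the function suitable for
    -- upper bounds on closed cones.
    E₁ : Carrier → Carrier → Carrier
    E₁ a y = [ (λ _ → 0#) , (λ _ → exp (- (a * y))) ]′ (<-or-≥ y 0#)

    abstract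
      E₁-pos : ∀ {a y} → 0# ≤ y → E₁ a y ≈ exp (- (a * y))
      E₁-pos {a} {y} p with <-or-≥ y 0#
      ... | inj₁ q = ⊥-elim (<⇒≱ q p)
      ... | inj₂ q = refl

      E₁-neg : ∀ {a y} → y < 0# → E₁ a y ≈ 0#
      E₁-neg {a} {y} p with <-or-≥ y 0#
      ... | inj₁ q = refl
      ... | inj₂ q = ⊥-elim (<⇒≱ p q)

      E₁-nonneg : ∀ a y → 0# ≤ E₁ a y
      E₁-nonneg a y = [ (λ q → ≈⇒≥ (E₁-neg q)) , (λ q → ≤-trans (exp-nonneg _) (≈⇒≥ (E₁-pos q))) ]′ (<-or-≥ y 0#)

      E₁-cong : ∀ {a y z} → y ≈ z → E₁ a y ≈ E₁ a z
      E₁-cong {a} {y} {z} p = [ (λ q → trans (E₁-neg q) (sym (E₁-neg (<-respˡ p q))))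
                            , (λ q → trans (E₁-pos q) (trans (exp-cong (-‿cong (*-congˡ p))) (sym (E₁-pos (≤-respʳ p q))))) ]′ (<-or-≥ y 0#)

      -- Moving the argument to the right cannot leave the support, so at most a factor exp(ac) is
      -- lost. Upper estimates therefore replace points by points further right, and lower estimates
      -- by points further left which are still nonnegative.
      E₁-upper : ∀ {a y z c} → 0# ≤ a → y ≤ z → z ≤ y + c → E₁ a y ≤ exp (a * c) * E₁ a z
      E₁-upper {a} {y} {z} {c} a≥0 y≤z z≤y+c = [ (λ q → ≤-trans (≈⇒≤ (E₁-neg q)) (*-nonneg (exp-nonneg _) (E₁-nonneg a z))) , (λ q →
        ≤-trans (≈⇒≤ (E₁-pos q)) (≤-trans (exp-mono (≤-by (*-nonneg a≥0 (≤⇒0≤ z≤y+c)) (solve 4 (λ a y z c → (a :* c :+ :- (a :* z)) :- (:- (a :* y)) := a :* ((y :+ c) :- z)) refl a y z c)))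
          (≈⇒≤ (trans (exp-+ _ _) (*-congˡ (sym (E₁-pos (≤-trans q y≤z)))))))) ]′ (<-or-≥ y 0#)

      E₁-lower : ∀ {a y z c} → 0# ≤ a → 0# ≤ z → z ≤ y → y ≤ z + c → exp (- (a * c)) * E₁ a z ≤ E₁ a y
      E₁-lower {a} {y} {z} {c} a≥0 z≥0 z≤y y≤z+c = ≤-trans (≈⇒≤ (trans (*-congˡ (E₁-pos z≥0)) (sym (exp-+ _ _))))
        (≤-trans (exp-mono (≤-by (*-nonneg a≥0 (≤⇒0≤ y≤z+c)) (solve 4 (λ a y z c → (:- (a :* y)) :- (:- (a :* c) :+ :- (a :* z)) := a :* ((z :+ c) :- y)) refl a y z c)))
          (≈⇒≥ (E₁-pos (≤-trans z≥0 z≤y))))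

    geometric : ∀ q n → (1# - q) * sumᴸ (List.upTo n) (q ^_) ≈ 1# - q ^ n
    geometric q n = trans (go q n id 1# (λ i → sym (*-identityˡ _))) (*-identityˡ _)
      where
      -- `upTo` unfolds to `applyUpTo id`, so the induction has to allow a shifted index function,
      -- with the accumulated power in `c`.
      go : ∀ q n (f : ℕ → ℕ) c → (∀ i → q ^ f i ≈ c * q ^ i) → (1# - q) * sumᴸ (List.applyUpTo f n) (q ^_) ≈ c * (1# - q ^ n)
      go q zero f c p = solve 2 (λ q c → (:1 :- q) :* :0 := c :* (:1 :- :1)) refl q c
      go q (suc n) f c p = trans (distribˡ _ _ _) (trans (+-cong (*-congˡ (trans (p 0) (*-identityʳ c))) (go q n (f ∘ suc) (c * q) (λ i → trans (p (suc i)) (sym (*-assoc c q _)))))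
        (solve 3 (λ q c r → (:1 :- q) :* c :+ c :* q :* (:1 :- r) := c :* (:1 :- q :* r)) refl q c (q ^ n)))

    private
      module Progression {a μ} (a>0 : 0# < a) (μ>0 : 0# < μ) (t : Carrier) where
        Y : ℤ → Carrier
        Y m = fromℤ m * μ + t

        q : Carrier
        q = exp (- (a * μ))

        abstract
          q≤ : (1# + a * μ) * q ≤ 1#
          q≤ = ≤-trans (*-monoʳ-≤ (exp-nonneg _) (1+x≤exp (a * μ))) (≈⇒≤ (exp-inverse (a * μ)))

          1-q≤ : 1# - q ≤ a * μ
          1-q≤ = ≤-by (≤⇒0≤ (1+x≤exp (- (a * μ)))) (solve 2 (λ x q → x :- (:1 :- q) := q :- (:1 :+ :- x)) refl (a * μ) q)

          q≥0 : 0# ≤ q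
          q≥0 = exp-nonneg _

          q^ : ∀ n → q ^ n ≈ exp (- (a * (fromℕ n * μ)))
          q^ n = trans (exp-^ (- (a * μ)) n) (exp-cong (solve 3 (λ n a m → n :* (:- (a :* m)) := :- (a :* (n :* m))) refl (fromℕ n) a μ))

          Y-step : ∀ k z → Y (k ℤ.+ z) ≈ Y k + fromℤ z * μ
          Y-step k z = trans (+-congʳ (*-congʳ (fromℤ-+ k z))) (solve 4 (λ k z m t → (k :+ z) :* m :+ t := k :* m :+ t :+ z :* m) refl (fromℤ k) (fromℤ z) μ t)

          -- The terms that do not vanish are dominated by a geometric series with ratio `q`. The
          -- inequality aμ ≤ (1 + aμ)(1 - q), a form of exp(aμ) ≥ 1 + aμ, turns the weight `a * μ`
          -- into the denominator of that series.
          upper : ∀ ms → Unique ms → a * μ * sumᴸ ms (λ m → E₁ a (Y m)) ≤ 1# + a * μ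
          upper ms u = ≤-trans (*-monoˡ-≤ aμ≥0 (≤-trans (sumᴸ-unique ms (List.map k+ (List.upTo n)) (λ m → E₁-nonneg a (Y m)) u inside)
              (≤-trans (≈⇒≤ (sumᴸ-map k+ (List.upTo n) (λ m → E₁ a (Y m)))) (sumᴸ-mono (List.upTo n) term))))
            (≤-trans (*-monoʳ-≤ S≥0 aμ≤) (≤-trans (≈⇒≤ (*-assoc _ _ _))
              (≤-trans (*-monoˡ-≤ (+-nonneg 0≤1 aμ≥0) (≤-trans (≈⇒≤ (geometric q n)) (≤-by (^-nonneg n q≥0) (solve 1 (λ x → :1 :- (:1 :- x) := x) refl (q ^ n)))))
                (≈⇒≤ (*-identityʳ _)))))
            where
            aμ≥0 : 0# ≤ a * μ
            aμ≥0 = <⇒≤ (*-pos a>0 μ>0)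
            fl : ∃ λ z → fromℤ z ≤ t / μ × t / μ < fromℤ z + 1#
            fl = floor (t / μ)
            -- The index where the progression enters the half-line: 0 ≤ `Y k` < μ.
            k : ℤ
            k = ℤ.- proj₁ fl
            k+ : ℕ → ℤ
            k+ i = k ℤ.+ + i
            Yk : Y k ≈ t - fromℤ (proj₁ fl) * μ
            Yk = trans (+-congʳ (*-congʳ (fromℤ-neg (proj₁ fl)))) (solve 3 (λ z m t → (:- z) :* m :+ t := t :- z :* m) refl (fromℤ (proj₁ fl)) μ t)
            t/μ : t / μ * μ ≈ t
            t/μ = /-*-cancel (>⇒≉ μ>0)
            Yk≥0 : 0# ≤ Y k
            Yk≥0 = ≤-respʳ (sym Yk) (≤⇒0≤ (≤-respʳ t/μ (*-monoʳ-≤ (<⇒≤ μ>0) (proj₁ (proj₂ fl)))))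
            Yk<μ : Y k < μ
            Yk<μ = <-respˡ (sym Yk) (<-by (<⇒0< (<-respˡ t/μ (*-monoʳ-< μ>0 (proj₂ (proj₂ fl))))) (solve 3 (λ z m t → m :- (t :- z :* m) := (z :+ :1) :* m :- t) refl (fromℤ (proj₁ fl)) μ t))
            bound : ∀ ms → ∃ λ n → ∀ {m} → m ∈ ms → ℤ.∣ m ℤ.- k ∣ ℕ.< n
            bound [] = 0 , λ ()
            bound (m ∷ ms) = let n , p = bound ms in suc ℤ.∣ m ℤ.- k ∣ ℕ.⊔ n ,
              λ { (here ≡.refl) → ℕ.m≤m⊔n _ n ; (there r) → ℕ.≤-trans (p r) (ℕ.m≤n⊔m (suc ℤ.∣ m ℤ.- k ∣) n) }
            n : ℕ
            n = proj₁ (bound ms)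
            m≡ : ∀ m → k ℤ.+ (m ℤ.- k) ≡ m
            m≡ m = ≡.trans (ℤ.+-comm k (m ℤ.- k)) (≡.trans (ℤ.+-assoc m (ℤ.- k) k) (≡.trans (≡.cong (λ z → m ℤ.+ z) (ℤ.+-inverseˡ k)) (ℤ.+-identityʳ m)))
            case : ∀ m z → m ≡ k ℤ.+ z → ℤ.∣ z ∣ ℕ.< n → E₁ a (Y m) ≈ 0# ⊎ m ∈ List.map k+ (List.upTo n)
            case m (+ i) ≡.refl lt = inj₂ (∈-map⁺ k+ (∈-upTo⁺ lt))
            case m -[1+ i ] ≡.refl lt = inj₁ (E₁-neg (<-respˡ (sym (Y-step k -[1+ i ]))
              (<-by (+-pos-nonneg (<⇒0< Yk<μ) (*-nonneg (fromℕ-nonneg i) (<⇒≤ μ>0))) (solve 3 (λ y i m → :0 :- (y :+ (:- (:1 :+ i)) :* m) := (m :- y) :+ i :* m) refl (Y k) (fromℕ i) μ))))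
            inside : ∀ {m} → m ∈ ms → E₁ a (Y m) ≈ 0# ⊎ m ∈ List.map k+ (List.upTo n)
            inside {m} m∈ = case m (m ℤ.- k) (≡.sym (m≡ m)) (proj₂ (bound ms) m∈)
            term : ∀ i → E₁ a (Y (k+ i)) ≤ q ^ i
            term i = ≤-trans (≈⇒≤ (E₁-cong (Y-step k (+ i)))) (≤-trans (≈⇒≤ (E₁-pos (+-nonneg Yk≥0 (*-nonneg (fromℕ-nonneg i) (<⇒≤ μ>0)))))
              (≤-trans (exp-mono (≤-by (*-nonneg (<⇒≤ a>0) Yk≥0) (solve 4 (λ a y i m → (:- (a :* (i :* m))) :- (:- (a :* (y :+ i :* m))) := a :* y) refl a (Y k) (fromℕ i) μ))) (≈⇒≥ (q^ i))))
            S≥0 : 0# ≤ sumᴸ (List.upTo n) (q ^_)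
            S≥0 = sumᴸ-nonneg (List.upTo n) λ i → ^-nonneg i q≥0
            aμ≤ : a * μ ≤ (1# + a * μ) * (1# - q)
            aμ≤ = ≤-by (≤⇒0≤ q≤) (solve 2 (λ x q → (:1 :+ x) :* (:1 :- q) :- x := :1 :- (:1 :+ x) :* q) refl (a * μ) q)

          -- Here the progression is entered at 0 < `Y k` ≤ μ, strictly, because the points found
          -- must end up in an open cone. The offset of at most μ costs the factor exp(-aμ), and
          -- stopping after length about `L` costs the factor 1 - exp(-aL).
          lower : ∀ {L} → 0# < L → ∃ λ ms → Unique ms × (∀ {m} → m ∈ ms → 0# < Y m × Y m ≤ L + μ) ×
                  exp (- (a * μ)) * (1# - exp (- (a * L))) ≤ a * μ * sumᴸ ms (λ m → E₁ a (Y m))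
          lower {L} L>0 = List.map k+ (List.upTo n) , Unique.map⁺ (λ p → ℤ.+-injective (Algebra.Properties.AbelianGroup.∙-cancelˡ ℤ.+-0-abelianGroup k _ _ p)) (Unique.upTo⁺ n) , range , bound
            where
            fl : ∃ λ z → fromℤ z ≤ - t / μ × - t / μ < fromℤ z + 1#
            fl = floor (- t / μ)
            k : ℤ
            k = ℤ.suc (proj₁ fl)
            k+ : ℕ → ℤ
            k+ i = k ℤ.+ + i
            fk : fromℤ k ≈ 1# + fromℤ (proj₁ fl)
            fk = trans (fromℤ-+ (+ 1) (proj₁ fl)) (+-congʳ (+-identityʳ 1#))
            t/μ : - t / μ * μ ≈ - t
            t/μ = /-*-cancel (>⇒≉ μ>0)
            Yk>0 : 0# < Y k
            Yk>0 = <-by (<⇒0< (<-respˡ t/μ (*-monoʳ-< μ>0 (proj₂ (proj₂ fl)))))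
              (trans (+-congʳ (+-congʳ (*-congʳ fk))) (solve 3 (λ z m t → ((:1 :+ z) :* m :+ t) :- :0 := (z :+ :1) :* m :- (:- t)) refl (fromℤ (proj₁ fl)) μ t))
            Yk≤μ : Y k ≤ μ
            Yk≤μ = ≤-by (≤⇒0≤ (≤-respʳ t/μ (*-monoʳ-≤ (<⇒≤ μ>0) (proj₁ (proj₂ fl)))))
              (trans (+-congˡ (-‿cong (+-congʳ (*-congʳ fk)))) (solve 3 (λ z m t → m :- ((:1 :+ z) :* m :+ t) := (:- t) :- z :* m) refl (fromℤ (proj₁ fl)) μ t))
            nf : ∃ λ z → fromℤ z ≤ L / μ × L / μ < fromℤ z + 1#
            nf = floor (L / μ)
            L/μ : L / μ * μ ≈ L
            L/μ = /-*-cancel (>⇒≉ μ>0)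
            count : ∀ z → fromℤ z ≤ L / μ → L / μ < fromℤ z + 1# → ∃ λ n → (∀ {i} → i ℕ.< n → fromℕ i * μ ≤ L) × L ≤ fromℕ n * μ
            count (+ z) p r = suc z ,
              (λ { (ℕ.s≤s i≤z) → ≤-trans (*-monoʳ-≤ (<⇒≤ μ>0) (≤-trans (fromℕ-mono i≤z) p)) (≈⇒≤ L/μ) }) ,
              ≤-trans (≈⇒≥ L/μ) (*-monoʳ-≤ (<⇒≤ μ>0) (≤-trans (<⇒≤ r) (≈⇒≤ (+-comm _ _))))
            count -[1+ z ] p r = ⊥-elim (<⇒≱ r (≤-trans (≤-by (fromℕ-nonneg z) (solve 1 (λ z → :0 :- ((:- (:1 :+ z)) :+ :1) := z) refl (fromℕ z))) (<⇒≤ (/-pos L>0 μ>0))))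
            ct : ∃ λ n → (∀ {i} → i ℕ.< n → fromℕ i * μ ≤ L) × L ≤ fromℕ n * μ
            ct = count (proj₁ nf) (proj₁ (proj₂ nf)) (proj₂ (proj₂ nf))
            n : ℕ
            n = proj₁ ct
            Yi>0 : ∀ i → 0# < Y k + fromℕ i * μ
            Yi>0 i = +-pos-nonneg Yk>0 (*-nonneg (fromℕ-nonneg i) (<⇒≤ μ>0))
            range : ∀ {m} → m ∈ List.map k+ (List.upTo n) → 0# < Y m × Y m ≤ L + μ
            range m∈ = let i , i∈ , eq = ∈-map⁻ k+ m∈ in ≡.subst (λ m → 0# < Y m × Y m ≤ L + μ) (≡.sym eq)
              (<-respʳ (sym (Y-step k (+ i))) (Yi>0 i) ,
               ≤-trans (≈⇒≤ (trans (Y-step k (+ i)) (+-comm _ _))) (+-mono-≤ (proj₁ (proj₂ ct) (∈-upTo⁻ i∈)) Yk≤μ))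
            term : ∀ i → q * q ^ i ≤ E₁ a (Y (k+ i))
            term i = ≤-trans (≈⇒≤ (trans (*-congˡ (q^ i)) (sym (exp-+ _ _))))
              (≤-trans (exp-mono (≤-by (*-nonneg (<⇒≤ a>0) (≤⇒0≤ Yk≤μ)) (solve 4 (λ a y i m → (:- (a :* (y :+ i :* m))) :- (:- (a :* m) :+ :- (a :* (i :* m))) := a :* (m :- y)) refl a (Y k) (fromℕ i) μ)))
                (≈⇒≤ (sym (trans (E₁-cong (Y-step k (+ i))) (E₁-pos (<⇒≤ (Yi>0 i)))))))
            bound : exp (- (a * μ)) * (1# - exp (- (a * L))) ≤ a * μ * sumᴸ (List.map k+ (List.upTo n)) (λ m → E₁ a (Y m))
            bound = ≤-trans (*-monoˡ-≤ q≥0 (≤-trans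
                  (≤-by (≤⇒0≤ (≤-trans (≈⇒≤ (q^ n)) (exp-mono (≤-by (*-nonneg (<⇒≤ a>0) (≤⇒0≤ (proj₂ (proj₂ ct)))) (solve 3 (λ a l n → (:- (a :* l)) :- (:- (a :* n)) := a :* (n :- l)) refl a L (fromℕ n * μ))))))
                    (solve 2 (λ x y → (:1 :- x) :- (:1 :- y) := y :- x) refl (q ^ n) (exp (- (a * L)))))
                  (≤-trans (≈⇒≥ (geometric q n)) (*-monoʳ-≤ (sumᴸ-nonneg (List.upTo n) λ i → ^-nonneg i q≥0) 1-q≤))))
              (≤-trans (≈⇒≤ (trans (solve 3 (λ q x s → q :* (x :* s) := x :* (q :* s)) refl q (a * μ) (sumᴸ (List.upTo n) (q ^_))) (*-congˡ (sym (sumᴸ-* q (List.upTo n) (q ^_))))))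
                (*-monoˡ-≤ (<⇒≤ (*-pos a>0 μ>0)) (≤-trans (sumᴸ-mono (List.upTo n) term) (≈⇒≥ (sumᴸ-map k+ (List.upTo n) (λ m → E₁ a (Y m)))))))

      neg-Y : ∀ m μ t → fromℤ (ℤ.- m) * - μ + t ≈ fromℤ m * μ + t
      neg-Y m μ t = +-congʳ (trans (*-congʳ (fromℤ-neg m)) (solve 2 (λ x y → (:- x) :* (:- y) := x :* y) refl (fromℤ m) μ))

    abstract
      progression-upper : ∀ {a μ} → 0# < a → ¬ μ ≈ 0# → ∀ t ms → Unique ms →
                          a * ∣ μ ∣ * sumᴸ ms (λ m → E₁ a (fromℤ m * μ + t)) ≤ 1# + a * ∣ μ ∣
      progression-upper {a} {μ} a>0 μ≉0 t ms u = [ negative , positive ]′ (∣∣-cases μ)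
        where
        positive : 0# ≤ μ × ∣ μ ∣ ≈ μ → a * ∣ μ ∣ * sumᴸ ms (λ m → E₁ a (fromℤ m * μ + t)) ≤ 1# + a * ∣ μ ∣
        positive (p , e) = ≤-trans (≈⇒≤ (*-congʳ (*-congˡ e))) (≤-trans (Progression.upper a>0 (≤∧≉⇒< p (μ≉0 ∘ sym)) t ms u) (≈⇒≥ (+-congˡ (*-congˡ e))))
        negative : μ < 0# × ∣ μ ∣ ≈ - μ → a * ∣ μ ∣ * sumᴸ ms (λ m → E₁ a (fromℤ m * μ + t)) ≤ 1# + a * ∣ μ ∣
        negative (p , e) = ≤-trans (≈⇒≤ (*-cong (*-congˡ e) (trans (sumᴸ-cong ms λ m → E₁-cong (sym (neg-Y m μ t))) (sym (sumᴸ-map ℤ.-_ ms (λ m → E₁ a (fromℤ m * - μ + t)))))))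
          (≤-trans (Progression.upper a>0 (neg-pos p) t (List.map ℤ.-_ ms) (Unique.map⁺ ℤ.neg-injective u)) (≈⇒≥ (+-congˡ (*-congˡ e))))

      progression-lower : ∀ {a μ L} → 0# < a → ¬ μ ≈ 0# → 0# < L → ∀ t → ∃ λ ms → Unique ms ×
                          (∀ {m} → m ∈ ms → 0# < fromℤ m * μ + t × fromℤ m * μ + t ≤ L + ∣ μ ∣) ×
                          exp (- (a * ∣ μ ∣)) * (1# - exp (- (a * L))) ≤ a * ∣ μ ∣ * sumᴸ ms (λ m → E₁ a (fromℤ m * μ + t))
      progression-lower {a} {μ} {L} a>0 μ≉0 L>0 t = [ negative , positive ]′ (∣∣-cases μ)
        where
        Goal : Set
        Goal = ∃ λ ms → Unique ms × (∀ {m} → m ∈ ms → 0# < fromℤ m * μ + t × fromℤ m * μ + t ≤ L + ∣ μ ∣) ×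
                          exp (- (a * ∣ μ ∣)) * (1# - exp (- (a * L))) ≤ a * ∣ μ ∣ * sumᴸ ms (λ m → E₁ a (fromℤ m * μ + t))
        positive : 0# ≤ μ × ∣ μ ∣ ≈ μ → Goal
        positive (p , e) = let ms , u , r , b = Progression.lower a>0 (≤∧≉⇒< p (μ≉0 ∘ sym)) t L>0 in
          ms , u , (λ m∈ → proj₁ (r m∈) , ≤-trans (proj₂ (r m∈)) (≈⇒≥ (+-congˡ e))) ,
          ≤-trans (≈⇒≤ (*-congʳ (exp-cong (-‿cong (*-congˡ e))))) (≤-trans b (≈⇒≥ (*-congʳ (*-congˡ e))))
        negative : μ < 0# × ∣ μ ∣ ≈ - μ → Goal
        negative (p , e) = let ms , u , r , b = Progression.lower a>0 (neg-pos p) t L>0 in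
          List.map ℤ.-_ ms , Unique.map⁺ ℤ.neg-injective u ,
          (λ m∈ → let m , m∈′ , eq = ∈-map⁻ ℤ.-_ m∈ in ≡.subst (λ m → 0# < fromℤ m * μ + t × fromℤ m * μ + t ≤ L + ∣ μ ∣) (≡.sym eq)
            (<-respʳ (Y≈ m) (proj₁ (r m∈′)) , ≤-trans (≈⇒≥ (Y≈ m)) (≤-trans (proj₂ (r m∈′)) (≈⇒≥ (+-congˡ e))))) ,
          ≤-trans (≈⇒≤ (*-congʳ (exp-cong (-‿cong (*-congˡ e))))) (≤-trans b (≈⇒≤ (*-cong (*-congˡ (sym e))
            (trans (sumᴸ-cong ms λ m → E₁-cong (Y≈ m)) (sym (sumᴸ-map ℤ.-_ ms (λ m → E₁ a (fromℤ m * μ + t))))))))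
          where
          Y≈ : ∀ m → fromℤ m * - μ + t ≈ fromℤ (ℤ.- m) * μ + t
          Y≈ m = +-congʳ (trans (solve 2 (λ x y → x :* (:- y) := (:- x) :* y) refl (fromℤ m) μ) (*-congʳ (sym (fromℤ-neg m))))

-- Exponential sums over perturbed lattices.

module LatticePoints (em : ExcludedMiddle 0ℓ) (ℝ : CompleteOrderedField) where

  open OrderedField em ℝ
  open AbsoluteValue em ℝ
  open Limits em ℝ
  open Determinants em ℝ
  open LinearAlgebra em ℝ
  open Progressions em ℝ
  import Algebra.Properties.AbelianGroup
  open import Data.Integer.Base as ℤ using (ℤ; +_)
  import Data.Integer.Properties as ℤ
  open import Data.List.Base using ([]; _∷_)
  open import Data.List.Membership.Propositional using (_∈_; lose)
  open import Data.List.Membership.Propositional.Properties using (∈-map⁺; ∈-map⁻; ∈-concatMap⁺; ∈-concatMap⁻; ∈-deduplicate⁺)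
  open import Data.List.Relation.Unary.All as All using (All; []; _∷_)
  open import Data.List.Relation.Unary.Any as Any using (here; there)
  open import Data.List.Relation.Unary.AllPairs using ([]; _∷_)
  open import Data.List.Relation.Unary.Unique.Propositional using (Unique)
  import Data.List.Relation.Unary.Unique.Propositional.Properties as Unique
  import Data.List.Relation.Unary.Unique.DecPropositional.Properties as DecUnique
  open import Data.Vec.Base as Vec using (Vec; lookup)
  import Data.Vec.Properties as Vec
  import Data.Vec.Functional as F

  private
    variable
      A B : Set

  det-zero-column : ∀ d (x : Fin (suc d) → ℝ^ (suc d)) → (∀ i → x i zero ≈ 0#) → det x ≈ 0#
  det-zero-column d x p = sum-zero {f = laplace-term x} term
    where
    term : ∀ l → laplace-term x l ≈ 0#
    term zero = trans (*-congˡ (trans (*-congʳ (p zero)) (zeroˡ _))) (zeroʳ _)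
    term (suc l) = trans (*-congˡ (trans (*-congˡ (minor-zero x p l)) (zeroʳ _))) (zeroʳ _)
      where
      minor-zero : ∀ {d} (x : Fin (suc d) → ℝ^ (suc d)) (p : ∀ i → x i zero ≈ 0#) (l : Fin d) → det (minor x (suc l)) ≈ 0#
      minor-zero {suc d} x p l = det-zero-column d (minor x (suc l)) (p ∘ suc)

  product-nonneg : ∀ {n} (f : Fin n → Carrier) → (∀ i → 0# ≤ f i) → 0# ≤ product f
  product-nonneg {zero} f p = 0≤1
  product-nonneg {suc n} f p = *-nonneg (p zero) (product-nonneg (f ∘ suc) (p ∘ suc))

  product-pos : ∀ {n} (f : Fin n → Carrier) → (∀ i → 0# < f i) → 0# < product f
  product-pos {zero} f p = 0<1
  product-pos {suc n} f p = *-pos (p zero) (product-pos (f ∘ suc) (p ∘ suc))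

  ∣sign∣ : ∀ {n} (i : Fin n) → ∣ sign i ∣ ≈ 1#
  ∣sign∣ zero = ∣∣-of-nonneg 0≤1
  ∣sign∣ (suc i) = trans (∣∣-* (- 1#) (sign i)) (trans (*-cong (trans (∣∣-neg 1#) (∣∣-of-nonneg 0≤1)) (∣sign∣ i)) (*-identityˡ 1#))

  unique-concatMap : (g : A → List B) {xs : List A} → Unique xs → (∀ x → Unique (g x)) →
                     (∀ {x x′ y} → y ∈ g x → y ∈ g x′ → x ≡ x′) → Unique (List.concatMap g xs)
  unique-concatMap g [] u p = []
  unique-concatMap g {x ∷ xs} (x∉ ∷ uxs) u p = Unique.++⁺ (u x) (unique-concatMap g uxs u p) λ { (y∈ , y∈′) →
    let x′ , x′∈ , y∈gx′ = find (∈-concatMap⁻ g y∈′) in All.lookup x∉ x′∈ (p y∈ y∈gx′) }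
    where
    find : ∀ {y xs} → Any.Any (λ x → y ∈ g x) xs → ∃ λ x → x ∈ xs × y ∈ g x
    find (here q) = _ , here ≡.refl , q
    find (there q) = let x , x∈ , r = find q in x , there x∈ , r

  lattice : ∀ {n d} → (Fin n → ℝ^ d) → Carrier → Vec ℤ n → ℝ^ d
  lattice γ h k = combination (λ i → h * fromℤ (lookup k i)) γ

  -- Elimination of the first coordinate by the basis vector `γ j`: `η` consists of the other basis
  -- vectors, sheared so that their first coordinates vanish, and `γ̂` drops this coordinate.
  module Pivot {d} (γ : Fin (suc d) → ℝ^ (suc d)) (j : Fin (suc d)) (pivot≉0 : ¬ γ j zero ≈ 0#) where

    ℓ : Carrier
    ℓ = γ j zero

    β : Fin d → Carrier
    β i = γ (punchIn j i) zero / ℓ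

    η : Fin d → ℝ^ (suc d)
    η i = γ (punchIn j i) ⊕ (- β i) ⊛ γ j

    γ̂ : Fin d → ℝ^ d
    γ̂ i = η i ∘ suc

    η₀ : ∀ i → η i zero ≈ 0#
    η₀ i = trans (solve 3 (λ x b l → x :+ (:- b) :* l := x :- b :* l) refl (γ (punchIn j i) zero) (β i) ℓ)
      (trans (+-congˡ (-‿cong (/-*-cancel pivot≉0))) (-‿inverseʳ _))

    det-pivot : ∣ det γ ∣ ≈ ∣ ℓ ∣ * ∣ det γ̂ ∣
    det-pivot = begin
      ∣ det γ ∣ ≈⟨ trans (sym (*-identityˡ _)) (*-congʳ (sym (∣sign∣ j))) ⟩
      ∣ sign j ∣ * ∣ det γ ∣ ≈⟨ ∣∣-* (sign j) (det γ) ⟨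
      ∣ sign j * det γ ∣ ≈⟨ ∣∣-cong (to-front (det-alternating (suc d)) γ j) ⟨
      ∣ det (γ j F.∷ F.removeAt γ j) ∣ ≈⟨ ∣∣-cong (shear-all (det-alternating (suc d)) (γ j) (F.removeAt γ j) (λ i → - β i)) ⟨
      ∣ det x ∣ ≈⟨ ∣∣-cong expand ⟩
      ∣ ℓ * det γ̂ ∣ ≈⟨ ∣∣-* ℓ (det γ̂) ⟩
      ∣ ℓ ∣ * ∣ det γ̂ ∣ ∎
      where
      open ≈-Reasoning
      x : Fin (suc d) → ℝ^ (suc d)
      x = γ j F.∷ η
      other : ∀ {d} (x : Fin (suc d) → ℝ^ (suc d)) → (∀ i → x (suc i) zero ≈ 0#) → ∀ l → laplace-term x (suc l) ≈ 0#
      other {suc d} x p l = trans (*-congˡ (trans (*-congˡ (det-zero-column d (minor x (suc l)) p)) (zeroʳ _))) (zeroʳ _)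
      expand : det x ≈ ℓ * det γ̂
      expand = trans (sum-off {f = laplace-term x} zero λ { zero q → ⊥-elim (q ≡.refl) ; (suc l) _ → other x η₀ l }) (*-identityˡ _)

    det-γ̂ : ¬ det γ ≈ 0# → ¬ det γ̂ ≈ 0#
    det-γ̂ p q = >⇒≉ (∣∣-pos p) (trans det-pivot (trans (*-congˡ (trans (∣∣-cong q) (∣∣-of-nonneg ≤-refl))) (zeroʳ _)))

    -- Passing from `η` back to `γ`, the lattice point with index r needs this multiple of `γ j`. It
    -- is not an integer, hence the floor, and the fractional part `φ` is the source of the
    -- perturbation.
    s : Vec ℤ d → Carrier
    s r = sum (λ i → β i * fromℤ (lookup r i))

    ⌊s⌋ : Vec ℤ d → ℤ
    ⌊s⌋ r = proj₁ (floor (s r))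

    -- Because of the rounding in ψ, the first coordinate of the lattice point with index ψ m r is m times the pivot, up
    -- to a bounded error which does not depend on r.
    ψ : ℤ → Vec ℤ d → Vec ℤ (suc d)
    ψ m r = Vec.insertAt r j (m ℤ.- ⌊s⌋ r)

    first : Vec ℤ (suc d) → ℤ
    first k = lookup k j ℤ.+ ⌊s⌋ (Vec.removeAt k j)

    private
      module ℤG = Algebra.Properties.AbelianGroup ℤ.+-0-abelianGroup

    ψ-first : ∀ k → ψ (first k) (Vec.removeAt k j) ≡ k
    ψ-first k = ≡.trans (≡.cong (Vec.insertAt (Vec.removeAt k j) j) (ℤG.//-rightDividesʳ (⌊s⌋ (Vec.removeAt k j)) (lookup k j))) (Vec.insertAt-removeAt k j)

    ψ-injective₂ : ∀ {m m′ r r′} → ψ m r ≡ ψ m′ r′ → r ≡ r′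
    ψ-injective₂ {m} {m′} {r} {r′} p = ≡.trans (≡.sym (Vec.removeAt-insertAt r j _)) (≡.trans (≡.cong (λ k → Vec.removeAt k j) p) (Vec.removeAt-insertAt r′ j _))

    ψ-injective₁ : ∀ {m m′ r r′} → ψ m r ≡ ψ m′ r′ → m ≡ m′
    ψ-injective₁ {m} {m′} {r} {r′} p with ψ-injective₂ {m} {m′} {r} {r′} p
    ... | ≡.refl = ℤG.∙-cancelʳ (ℤ.- ⌊s⌋ r) m m′ (≡.trans (≡.sym (Vec.insertAt-lookup r j _)) (≡.trans (≡.cong (λ k → lookup k j) p) (Vec.insertAt-lookup r j _)))

    φ : Vec ℤ d → Carrier
    φ r = s r - fromℤ (⌊s⌋ r)

    Bnd-φ : ∀ r → Bnd (φ r) 1#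
    Bnd-φ r = Bnd-nonneg-≤ (≤⇒0≤ (proj₁ (proj₂ (floor (s r)))))
      (≤-by (≤⇒0≤ (<⇒≤ (proj₂ (proj₂ (floor (s r)))))) (solve 2 (λ s z → :1 :- (s :- z) := (z :+ :1) :- s) refl (s r) (fromℤ (⌊s⌋ r))))

    lattice-ψ : ∀ h m r i → lattice γ h (ψ m r) i ≈ lattice η h r i + fromℤ m * (h * γ j i) + h * φ r * γ j i
    lattice-ψ h m r i = begin
      lattice γ h (ψ m r) i ≈⟨ sum-remove {i = j} (λ l → h * fromℤ (lookup (ψ m r) l) * γ l i) ⟩
      h * fromℤ (lookup (ψ m r) j) * g + sum (λ l → h * fromℤ (lookup (ψ m r) (punchIn j l)) * γ (punchIn j l) i)
        ≈⟨ +-cong (*-congʳ (*-congˡ (trans (reflexive (≡.cong fromℤ (Vec.insertAt-lookup r j _))) (trans (fromℤ-+ m (ℤ.- ⌊s⌋ r)) (+-congˡ (fromℤ-neg (⌊s⌋ r)))))))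
             (trans (sum-cong split) (trans (∑-distrib-+ (λ l → h * fromℤ (lookup r l) * η l i) (λ l → h * g * (β l * fromℤ (lookup r l)))) (+-congˡ (sym (*-distribˡ-sum (h * g) (λ l → β l * fromℤ (lookup r l))))))) ⟩
      h * (fromℤ m - fromℤ (⌊s⌋ r)) * g + (lattice η h r i + h * g * s r)
        ≈⟨ solve 6 (λ h m f g e s → h :* (m :- f) :* g :+ (e :+ h :* g :* s) := e :+ m :* (h :* g) :+ h :* (s :- f) :* g) refl h (fromℤ m) (fromℤ (⌊s⌋ r)) g (lattice η h r i) (s r) ⟩
      lattice η h r i + fromℤ m * (h * g) + h * φ r * g ∎
      where
      open ≈-Reasoning
      g : Carrier
      g = γ j i
      split : ∀ l → h * fromℤ (lookup (ψ m r) (punchIn j l)) * γ (punchIn j l) i ≈ h * fromℤ (lookup r l) * η l i + h * g * (β l * fromℤ (lookup r l))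
      split l = trans (*-congʳ (*-congˡ (reflexive (≡.cong fromℤ (Vec.insertAt-punchIn r j _ l)))))
        (solve 5 (λ h z x b g → h :* z :* x := h :* z :* (x :+ (:- b) :* g) :+ h :* g :* (b :* z)) refl h (fromℤ (lookup r l)) (γ (punchIn j l) i) (β l) g)

  -- A class of point families stable under pivoting. One pivot adds the rounding error
  -- `h * φ r * γ j i`, at most Gh, so `C` becomes C + G and stays independent of the mesh.
  Approx : ∀ {d} → (Fin d → ℝ^ d) → Carrier → ℝ^ d → Carrier → (Vec ℤ d → ℝ^ d) → Set
  Approx γ h t C y = ∀ k i → Bnd (y k i - (lattice γ h k i + t i)) (C * h)

  module PivotApprox {d} (γ : Fin (suc d) → ℝ^ (suc d)) (j : Fin (suc d)) (pivot≉0 : ¬ γ j zero ≈ 0#)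
                     {G} (Bnd-γ : ∀ i → Bnd (γ j i) G) {h t C y} (h≥0 : 0# ≤ h) (approx : Approx γ h t C y) where
    open Pivot γ j pivot≉0

    private
      Bnd-h : Bnd h h
      Bnd-h = Bnd-nonneg-≤ h≥0 ≤-refl

      near : ∀ m r i → Bnd (y (ψ m r) i - (lattice η h r i + (fromℤ m * (h * γ j i) + t i))) ((C + G) * h)
      near m r i = Bnd-weaken
        (Bnd-cong (trans (+-congʳ (+-congˡ (-‿cong (+-congʳ (lattice-ψ h m r i)))))
            (solve 5 (λ y e a f t → (y :- ((e :+ a :+ f) :+ t)) :+ f := y :- (e :+ (a :+ t))) refl (y (ψ m r) i) (lattice η h r i) (fromℤ m * (h * γ j i)) (h * φ r * γ j i) (t i)))
          (Bnd-+ (approx (ψ m r) i) (Bnd-* (Bnd-* Bnd-h (Bnd-φ r)) (Bnd-γ i))))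
        (≈⇒≤ (solve 3 (λ C h G → C :* h :+ h :* :1 :* G := (C :+ G) :* h) refl C h G))

    tail-approx : ∀ m → Approx γ̂ h (λ i → fromℤ m * (h * γ j (suc i)) + t (suc i)) (C + G) (λ r i → y (ψ m r) (suc i))
    tail-approx m r i = near m r (suc i)

    head-approx : ∀ m r → Bnd (y (ψ m r) zero - (fromℤ m * (h * ℓ) + t zero)) ((C + G) * h)
    head-approx m r = Bnd-cong (+-congˡ (-‿cong (trans (+-congʳ (sum-zero λ l → trans (*-congˡ (η₀ l)) (zeroʳ _))) (+-identityˡ _)))) (near m r zero)

  module LatticeSums (exp : Carrier → Carrier) (isExp : IsExp exp) where
    open Decay exp isExp public

    E : ∀ {d} → (Fin d → Carrier) → ℝ^ d → Carrier
    E a y = product (λ i → E₁ (a i) (y i))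

    E-nonneg : ∀ {d} (a : Fin d → Carrier) y → 0# ≤ E a y
    E-nonneg a y = product-nonneg (λ i → E₁ (a i) (y i)) λ i → E₁-nonneg (a i) (y i)

    -- The reciprocal of the expected sum: `∣ det γ ∣ * h ^ d` is the covolume of the lattice, and 1
    -- / `product a` is the integral of `E a`.
    weight : ∀ {d} → (Fin d → ℝ^ d) → (Fin d → Carrier) → Carrier → Carrier
    weight {d} γ a h = product a * ∣ det γ ∣ * h ^ d

    -- The bound `h₀` precedes `t` and `y`, because the induction applies the estimate to all slices
    -- of a lattice at once. In the lower estimate the points also lie in a box of size `L`
    -- independent of `h`; a fixed cube will thus contain them.
    UpperSums LowerSums : ∀ {d} → (Fin d → ℝ^ d) → (Fin d → Carrier) → Carrier → Carrier → Set
    UpperSums γ a C ρ = ∃ λ h₀ → 0# < h₀ × (∀ {h t y} → 0# < h → h ≤ h₀ → Approx γ h t C y →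
      ∀ ks → Unique ks → weight γ a h * sumᴸ ks (E a ∘ y) ≤ ρ)
    LowerSums γ a C θ = ∃ λ h₀ → 0# < h₀ × ∃ λ L → 0# ≤ L × (∀ {h t y} → 0# < h → h ≤ h₀ → Approx γ h t C y →
      ∃ λ ks → Unique ks × (∀ {k} → k ∈ ks → ∀ i → 0# < y k i × y k i ≤ L) × θ ≤ weight γ a h * sumᴸ ks (E a ∘ y))

    private
      module _ {d} (γ : Fin (suc d) → ℝ^ (suc d)) (det≉0 : ¬ det γ ≈ 0#) (a : Fin (suc d) → Carrier) (a>0 : ∀ i → 0# < a i)
               {C} (C≥0 : 0# ≤ C) (j : Fin (suc d)) (pivot≉0 : ¬ γ j zero ≈ 0#) {G} (G≥0 : 0# ≤ G) (Bnd-γ : ∀ i → Bnd (γ j i) G) where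
        open Pivot γ j pivot≉0

        private
          a₀ C′ c : Carrier
          a₀ = a zero
          a′ : Fin d → Carrier
          a′ = a ∘ suc
          C′ = C + G
          c = a₀ * (C′ + C′)

          C′≥0 : 0# ≤ C′
          C′≥0 = +-nonneg C≥0 G≥0

          c≥0 : 0# ≤ c
          c≥0 = *-nonneg (<⇒≤ (a>0 zero)) (+-nonneg C′≥0 C′≥0)

          ∣ℓ∣>0 : 0# < ∣ ℓ ∣
          ∣ℓ∣>0 = ∣∣-pos pivot≉0

          a∣ℓ∣≥0 : 0# ≤ a₀ * ∣ ℓ ∣
          a∣ℓ∣≥0 = <⇒≤ (*-pos (a>0 zero) ∣ℓ∣>0)

          module _ {h} (h>0 : 0# < h) where
            μ≉0 : ¬ h * ℓ ≈ 0#
            μ≉0 = *-≉0 (>⇒≉ h>0) pivot≉0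

            ∣μ∣ : ∣ h * ℓ ∣ ≈ h * ∣ ℓ ∣
            ∣μ∣ = trans (∣∣-* h ℓ) (*-congʳ (∣∣-of-nonneg (<⇒≤ h>0)))

            W′ : Carrier
            W′ = weight γ̂ a′ h

            W′≥0 : 0# ≤ W′
            W′≥0 = *-nonneg (*-nonneg (product-nonneg a′ (λ i → <⇒≤ (a>0 (suc i)))) (∣∣-nonneg (det γ̂))) (^-nonneg d (<⇒≤ h>0))

            weight-split : weight γ a h ≈ a₀ * ∣ h * ℓ ∣ * W′
            weight-split = trans (*-congʳ (*-congˡ det-pivot)) (trans
              (solve 6 (λ a p l g h H → a :* p :* (l :* g) :* (h :* H) := a :* (h :* l) :* (p :* g :* H)) refl a₀ (product a′) ∣ ℓ ∣ ∣ det γ̂ ∣ h (h ^ d))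
              (*-congʳ (*-congˡ (sym ∣μ∣))))

        -- The error is split as ρ₂ ρ₁ ρ₂ ≤ ρ₁² ≤ ρ: ρ₁ for the slices, one ρ₂ for the displacement
        -- of the first coordinate, the other ρ₂ for the progression of the slices.
        upper-step : ∀ {ρ} → 1# < ρ → (∀ {ρ′} → 1# < ρ′ → UpperSums γ̂ a′ C′ ρ′) → UpperSums γ a C ρ
        upper-step {ρ} ρ>1 IH = h₀ , h₀>0 , bound
          where
          S₁ : ∃ λ r → 1# < r × r * r ≤ ρ
          S₁ = square-below ρ>1
          ρ₁ : Carrier
          ρ₁ = proj₁ S₁
          S₂ : ∃ λ r → 1# < r × r * r ≤ ρ₁
          S₂ = square-below (proj₁ (proj₂ S₁))
          ρ₂ : Carrier
          ρ₂ = proj₁ S₂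
          ρ₂>1 : 1# < ρ₂
          ρ₂>1 = proj₁ (proj₂ S₂)
          IH₁ : UpperSums γ̂ a′ C′ ρ₁
          IH₁ = IH (proj₁ (proj₂ S₁))
          H₁ : ∃ λ h₀ → 0# < h₀ × (∀ {h} → 0# < h → h ≤ h₀ → exp (c * h) ≤ ρ₂)
          H₁ = exp-small ρ₂>1 c≥0
          H₂ : ∃ λ h₀ → 0# < h₀ × (∀ {h} → 0# < h → h ≤ h₀ → 1# + a₀ * ∣ ℓ ∣ * h ≤ ρ₂)
          H₂ = linear-small ρ₂>1 a∣ℓ∣≥0
          M₁ : ∃ λ z → 0# < z × z ≤ proj₁ H₁ × z ≤ proj₁ H₂
          M₁ = min-pos (proj₁ (proj₂ H₁)) (proj₁ (proj₂ H₂))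
          M₂ : ∃ λ z → 0# < z × z ≤ proj₁ IH₁ × z ≤ proj₁ M₁
          M₂ = min-pos (proj₁ (proj₂ IH₁)) (proj₁ (proj₂ M₁))
          h₀ : Carrier
          h₀ = proj₁ M₂
          h₀>0 : 0# < h₀
          h₀>0 = proj₁ (proj₂ M₂)
          bound : ∀ {h t y} → 0# < h → h ≤ h₀ → Approx γ h t C y → ∀ ks → Unique ks → weight γ a h * sumᴸ ks (E a ∘ y) ≤ ρ
          bound {h} {t} {y} h>0 h≤h₀ approx ks u = conclusion
            where
            open PivotApprox γ j pivot≉0 Bnd-γ (<⇒≤ h>0) approx
            -- The index set is enlarged to a product of values of `first` and remaining indices.
            -- The terms are nonnegative, and over a product the sum can be taken slice by slice.
            ms : List ℤ
            ms = List.deduplicate ℤ._≟_ (List.map first ks)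
            rs : List (Vec ℤ d)
            rs = List.deduplicate (Vec.≡-dec ℤ._≟_) (List.map (λ k → Vec.removeAt k j) ks)
            ums : Unique ms
            ums = DecUnique.deduplicate-! ℤ._≟_ (List.map first ks)
            urs : Unique rs
            urs = DecUnique.deduplicate-! (Vec.≡-dec ℤ._≟_) (List.map (λ k → Vec.removeAt k j) ks)
            f : Vec ℤ (suc d) → Carrier
            f = E a ∘ y
            f′ : ℤ → Vec ℤ d → Carrier
            f′ m r = E a′ (λ i → y (ψ m r) (suc i))
            μ T X : Carrier
            μ = h * ℓ
            -- Shifted by the maximal error, so that the progression lies to the right of the actual
            -- first coordinates, by at most 2C′h.
            T = t zero + C′ * h
            X = exp (c * h)
            g : ℤ → Carrier
            g m = E₁ a₀ (fromℤ m * μ + T)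
            covered : ∀ {k} → k ∈ ks → f k ≈ 0# ⊎ k ∈ List.concatMap (λ m → List.map (ψ m) rs) ms
            covered {k} k∈ = inj₂ (≡.subst (_∈ List.concatMap (λ m → List.map (ψ m) rs) ms) (ψ-first k)
              (∈-concatMap⁺ (λ m → List.map (ψ m) rs) (lose (∈-deduplicate⁺ ℤ._≟_ (∈-map⁺ first k∈))
                (∈-map⁺ (ψ (first k)) (∈-deduplicate⁺ (Vec.≡-dec ℤ._≟_) (∈-map⁺ (λ k → Vec.removeAt k j) k∈))))))
            term : ∀ m r → f (ψ m r) ≤ X * g m * f′ m r
            term m r = *-monoʳ-≤ (E-nonneg a′ (λ i → y (ψ m r) (suc i))) (≤-trans
              (E₁-upper {c = (C′ + C′) * h} (<⇒≤ (a>0 zero))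
                (≤-by (≤⇒0≤ (proj₂ (head-approx m r))) (solve 4 (λ y m t e → (m :+ (t :+ e)) :- y := e :- (y :- (m :+ t))) refl (y (ψ m r) zero) (fromℤ m * μ) (t zero) (C′ * h)))
                (≤-by (≤⇒0≤ (proj₁ (head-approx m r))) (solve 5 (λ y m t C h → (y :+ (C :+ C) :* h) :- (m :+ (t :+ C :* h)) := (y :- (m :+ t)) :- (:- (C :* h))) refl (y (ψ m r) zero) (fromℤ m * μ) (t zero) C′ h)))
              (≈⇒≤ (*-congʳ (exp-cong (sym (*-assoc a₀ (C′ + C′) h))))))
            h≤ : ∀ {z} → proj₁ M₁ ≤ z → h ≤ z
            h≤ p = ≤-trans h≤h₀ (≤-trans (proj₂ (proj₂ (proj₂ M₂))) p)
            inner : ∀ m → W′ h>0 * sumᴸ (List.map (ψ m) rs) f ≤ X * ρ₁ * g m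
            inner m = ≤-trans (*-monoˡ-≤ (W′≥0 h>0) (≤-trans (≈⇒≤ (sumᴸ-map (ψ m) rs f)) (≤-trans (sumᴸ-mono rs (term m)) (≈⇒≤ (sumᴸ-* (X * g m) rs (f′ m))))))
              (≤-trans (≈⇒≤ (solve 3 (λ w x s → w :* (x :* s) := x :* (w :* s)) refl (W′ h>0) (X * g m) (sumᴸ rs (f′ m))))
                (≤-trans (*-monoˡ-≤ (*-nonneg (exp-nonneg _) (E₁-nonneg a₀ _)) (proj₂ (proj₂ IH₁) h>0 (≤-trans h≤h₀ (proj₁ (proj₂ (proj₂ M₂)))) (tail-approx m) rs urs))
                  (≈⇒≤ (solve 3 (λ x g r → x :* g :* r := x :* r :* g) refl X (g m) ρ₁))))
            ρ₁≥0 : 0# ≤ ρ₁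
            ρ₁≥0 = ≤-trans 0≤1 (<⇒≤ (proj₁ (proj₂ S₁)))
            A≥0 : 0# ≤ a₀ * ∣ μ ∣
            A≥0 = *-nonneg (<⇒≤ (a>0 zero)) (∣∣-nonneg μ)
            1+A≤ : 1# + a₀ * ∣ μ ∣ ≤ ρ₂
            1+A≤ = ≤-trans (≈⇒≤ (+-congˡ (trans (*-congˡ (∣μ∣ h>0)) (solve 3 (λ a h l → a :* (h :* l) := a :* l :* h) refl a₀ h ∣ ℓ ∣)))) (proj₂ (proj₂ H₂) h>0 (h≤ (proj₂ (proj₂ (proj₂ M₁)))))
            conclusion : weight γ a h * sumᴸ ks f ≤ ρ
            conclusion = ≤-trans (≈⇒≤ (trans (*-congʳ (weight-split h>0)) (*-assoc _ _ _)))
              (≤-trans (*-monoˡ-≤ A≥0 (≤-trans (*-monoˡ-≤ (W′≥0 h>0) (≤-trans (sumᴸ-unique ks _ (λ k → E-nonneg a (y k)) u covered) (≈⇒≤ (sumᴸ-concatMap (λ m → List.map (ψ m) rs) ms f))))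
                  (≤-trans (≈⇒≤ (sym (sumᴸ-* (W′ h>0) ms (λ m → sumᴸ (List.map (ψ m) rs) f)))) (≤-trans (sumᴸ-mono ms inner) (≈⇒≤ (sumᴸ-* (X * ρ₁) ms g))))))
              (≤-trans (≈⇒≤ (solve 3 (λ a x s → a :* (x :* s) := x :* (a :* s)) refl (a₀ * ∣ μ ∣) (X * ρ₁) (sumᴸ ms g)))
              (≤-trans (*-mono-≤ (*-nonneg (exp-nonneg _) ρ₁≥0) (*-monoʳ-≤ ρ₁≥0 (proj₂ (proj₂ H₁) h>0 (h≤ (proj₁ (proj₂ (proj₂ M₁))))))
                  (*-nonneg A≥0 (sumᴸ-nonneg ms λ m → E₁-nonneg a₀ _)) (≤-trans (progression-upper (a>0 zero) (μ≉0 h>0) T ms ums) 1+A≤))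
              (≤-trans (≈⇒≤ (solve 2 (λ x y → x :* y :* x := y :* (x :* x)) refl ρ₂ ρ₁))
              (≤-trans (*-monoˡ-≤ ρ₁≥0 (proj₂ (proj₂ S₂))) (proj₂ (proj₂ S₁)))))))

        -- The budget is again split in three: θ₁ for the slices, one θ₂ for the displacement
        -- together with the offset of the progression, the other θ₂ for its truncation at `L₁`.
        lower-step : ∀ {θ} → θ < 1# → (∀ {θ′} → θ′ < 1# → LowerSums γ̂ a′ C′ θ′) → LowerSums γ a C θ
        lower-step {θ} θ<1 IH = h₀ , h₀>0 , L , L≥0 , bound
          where
          S₁ : ∃ λ s → 0# ≤ s × s < 1# × θ ≤ s * s
          S₁ = square-above θ<1
          θ₁ : Carrier
          θ₁ = proj₁ S₁
          θ₁≥0 : 0# ≤ θ₁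
          θ₁≥0 = proj₁ (proj₂ S₁)
          S₂ : ∃ λ s → 0# ≤ s × s < 1# × θ₁ ≤ s * s
          S₂ = square-above (proj₁ (proj₂ (proj₂ S₁)))
          θ₂ : Carrier
          θ₂ = proj₁ S₂
          θ₂≥0 : 0# ≤ θ₂
          θ₂≥0 = proj₁ (proj₂ S₂)
          θ₂<1 : θ₂ < 1#
          θ₂<1 = proj₁ (proj₂ (proj₂ S₂))
          IH₁ : LowerSums γ̂ a′ C′ θ₁
          IH₁ = IH (proj₁ (proj₂ (proj₂ S₁)))
          L₀ : Carrier
          L₀ = proj₁ (proj₂ (proj₂ IH₁))
          L₀≥0 : 0# ≤ L₀
          L₀≥0 = proj₁ (proj₂ (proj₂ (proj₂ IH₁)))
          H₁ : ∃ λ h₀ → 0# < h₀ × (∀ {h} → 0# < h → h ≤ h₀ → θ₂ ≤ exp (- ((a₀ * ∣ ℓ ∣ + c) * h)))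
          H₁ = exp-neg-small θ₂<1 (+-nonneg a∣ℓ∣≥0 c≥0)
          V : ∃ λ L → 0# < L × exp (- (a₀ * L)) ≤ 1# - θ₂
          V = exp-vanishes (a>0 zero) (<⇒0< θ₂<1)
          L₁ : Carrier
          L₁ = proj₁ V
          M₁ : ∃ λ z → 0# < z × z ≤ proj₁ H₁ × z ≤ 1#
          M₁ = min-pos (proj₁ (proj₂ H₁)) 0<1
          M₂ : ∃ λ z → 0# < z × z ≤ proj₁ IH₁ × z ≤ proj₁ M₁
          M₂ = min-pos (proj₁ (proj₂ IH₁)) (proj₁ (proj₂ M₁))
          h₀ L : Carrier
          h₀ = proj₁ M₂
          -- `L₀` bounds the later coordinates. The first coordinate is at most L₁ + h∣ℓ∣ + 2C′h,
          -- and h ≤ 1.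
          L = L₀ + (L₁ + (∣ ℓ ∣ + (C′ + C′)))
          h₀>0 : 0# < h₀
          h₀>0 = proj₁ (proj₂ M₂)
          rest≥0 : 0# ≤ L₁ + (∣ ℓ ∣ + (C′ + C′))
          rest≥0 = +-nonneg (<⇒≤ (proj₁ (proj₂ V))) (+-nonneg (∣∣-nonneg ℓ) (+-nonneg C′≥0 C′≥0))
          L≥0 : 0# ≤ L
          L≥0 = +-nonneg L₀≥0 rest≥0
          bound : ∀ {h t y} → 0# < h → h ≤ h₀ → Approx γ h t C y →
            ∃ λ ks → Unique ks × (∀ {k} → k ∈ ks → ∀ i → 0# < y k i × y k i ≤ L) × θ ≤ weight γ a h * sumᴸ ks (E a ∘ y)
          bound {h} {t} {y} h>0 h≤h₀ approx = List.concatMap blk ms , uks , range , final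
            where
            open PivotApprox γ j pivot≉0 Bnd-γ (<⇒≤ h>0) approx
            h≤ : ∀ {z} → proj₁ M₁ ≤ z → h ≤ z
            h≤ p = ≤-trans h≤h₀ (≤-trans (proj₂ (proj₂ (proj₂ M₂))) p)
            f : Vec ℤ (suc d) → Carrier
            f = E a ∘ y
            f′ : ℤ → Vec ℤ d → Carrier
            f′ m r = E a′ (λ i → y (ψ m r) (suc i))
            μ T X : Carrier
            μ = h * ℓ
            -- Shifted to the left this time: where the progression is positive, so is the actual
            -- first coordinate.
            T = t zero - C′ * h
            X = exp (- (c * h))
            Y g : ℤ → Carrier
            Y m = fromℤ m * μ + T
            g m = E₁ a₀ (Y m)
            P : ∃ λ ms → Unique ms × (∀ {m} → m ∈ ms → 0# < Y m × Y m ≤ L₁ + ∣ μ ∣) × exp (- (a₀ * ∣ μ ∣)) * (1# - exp (- (a₀ * L₁))) ≤ a₀ * ∣ μ ∣ * sumᴸ ms g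
            P = progression-lower (a>0 zero) (μ≉0 h>0) (proj₁ (proj₂ V)) T
            ms : List ℤ
            ms = proj₁ P
            R : ∀ m → ∃ λ rs → Unique rs × (∀ {r} → r ∈ rs → ∀ i → 0# < y (ψ m r) (suc i) × y (ψ m r) (suc i) ≤ L₀) × θ₁ ≤ weight γ̂ a′ h * sumᴸ rs (f′ m)
            R m = proj₂ (proj₂ (proj₂ (proj₂ IH₁))) h>0 (≤-trans h≤h₀ (proj₁ (proj₂ (proj₂ M₂)))) (tail-approx m)
            blk : ℤ → List (Vec ℤ (suc d))
            blk m = List.map (ψ m) (proj₁ (R m))
            uks : Unique (List.concatMap blk ms)
            uks = unique-concatMap blk (proj₁ (proj₂ P)) (λ m → Unique.map⁺ (ψ-injective₂ {m} {m}) (proj₁ (proj₂ (R m))))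
              λ {m} {m′} k∈ k∈′ → let r , _ , eq = ∈-map⁻ (ψ m) k∈ ; r′ , _ , eq′ = ∈-map⁻ (ψ m′) k∈′ in
                ψ-injective₁ {m} {m′} {r} {r′} (≡.trans (≡.sym eq) eq′)
            Y≤y : ∀ m r → Y m ≤ y (ψ m r) zero
            Y≤y m r = ≤-by (≤⇒0≤ (proj₁ (head-approx m r))) (solve 4 (λ y m t e → y :- (m :+ (t :- e)) := (y :- (m :+ t)) :- (:- e)) refl (y (ψ m r) zero) (fromℤ m * μ) (t zero) (C′ * h))
            y≤Y : ∀ m r → y (ψ m r) zero ≤ Y m + (C′ + C′) * h
            y≤Y m r = ≤-by (≤⇒0≤ (proj₂ (head-approx m r))) (solve 5 (λ y m t C h → (m :+ (t :- C :* h) :+ (C :+ C) :* h) :- y := C :* h :- (y :- (m :+ t))) refl (y (ψ m r) zero) (fromℤ m * μ) (t zero) C′ h)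
            h≤1 : h ≤ 1#
            h≤1 = h≤ (proj₂ (proj₂ (proj₂ M₁)))
            shrink : ∀ {z} → 0# ≤ z → h * z ≤ z
            shrink {z} z≥0 = ≤-by (*-nonneg z≥0 (≤⇒0≤ h≤1)) (solve 2 (λ h z → z :- h :* z := z :* (:1 :- h)) refl h z)
            head≤ : ∀ {m} → m ∈ ms → ∀ r → y (ψ m r) zero ≤ L
            head≤ {m} m∈ r = ≤-trans (y≤Y m r) (≤-trans (+-mono-≤ (≤-trans (proj₂ (proj₁ (proj₂ (proj₂ P)) m∈)) (≈⇒≤ (+-congˡ (∣μ∣ h>0)))) (≈⇒≤ (*-comm _ _)))
              (≤-trans (+-mono-≤ (+-monoʳ-≤ L₁ (shrink (∣∣-nonneg ℓ))) (shrink (+-nonneg C′≥0 C′≥0)))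
                (≤-by L₀≥0 (solve 4 (λ x y z w → (x :+ (y :+ (z :+ w))) :- ((y :+ z) :+ w) := x) refl L₀ L₁ ∣ ℓ ∣ (C′ + C′)))))
            inBlk : ∀ {k ms′} → Any.Any (λ m → k ∈ blk m) ms′ → ∃ λ m → m ∈ ms′ × ∃ λ r → r ∈ proj₁ (R m) × k ≡ ψ m r
            inBlk (here {x = m} q) = m , here ≡.refl , ∈-map⁻ (ψ m) q
            inBlk (there q) = let m , m∈ , r = inBlk q in m , there m∈ , r
            range : ∀ {k} → k ∈ List.concatMap blk ms → ∀ i → 0# < y k i × y k i ≤ L
            range k∈ i = let m , m∈ , r , r∈ , eq = inBlk (∈-concatMap⁻ blk {ms} k∈) in
              ≡.subst (λ k → 0# < y k i × y k i ≤ L) (≡.sym eq) (at m∈ r∈ i)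
              where
              at : ∀ {m r} → m ∈ ms → r ∈ proj₁ (R m) → ∀ i → 0# < y (ψ m r) i × y (ψ m r) i ≤ L
              at {m} {r} m∈ r∈ zero = <-≤-trans (proj₁ (proj₁ (proj₂ (proj₂ P)) m∈)) (Y≤y m r) , head≤ m∈ r
              at {m} {r} m∈ r∈ (suc i) = let p , q = proj₁ (proj₂ (proj₂ (R m))) r∈ i in
                p , ≤-trans q (≤-by rest≥0 (solve 2 (λ x y → (x :+ y) :- x := y) refl L₀ (L₁ + (∣ ℓ ∣ + (C′ + C′)))))
            term : ∀ {m} → m ∈ ms → ∀ r → X * g m * f′ m r ≤ f (ψ m r)
            term {m} m∈ r = *-monoʳ-≤ (E-nonneg a′ (λ i → y (ψ m r) (suc i))) (≤-trans
              (≈⇒≤ (*-congʳ (exp-cong (-‿cong (*-assoc a₀ (C′ + C′) h)))))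
              (E₁-lower (<⇒≤ (a>0 zero)) (<⇒≤ (proj₁ (proj₁ (proj₂ (proj₂ P)) m∈))) (Y≤y m r) (y≤Y m r)))
            inner : ∀ {m} → m ∈ ms → X * θ₁ * g m ≤ W′ h>0 * sumᴸ (blk m) f
            inner {m} m∈ = ≤-trans (≈⇒≤ (solve 3 (λ x r g → x :* r :* g := x :* g :* r) refl X θ₁ (g m)))
              (≤-trans (*-monoˡ-≤ (*-nonneg (exp-nonneg _) (E₁-nonneg a₀ _)) (proj₂ (proj₂ (proj₂ (R m)))))
                (≤-trans (≈⇒≤ (solve 3 (λ w x s → x :* (w :* s) := w :* (x :* s)) refl (W′ h>0) (X * g m) (sumᴸ (proj₁ (R m)) (f′ m))))
                  (*-monoˡ-≤ (W′≥0 h>0) (≤-trans (≈⇒≥ (sumᴸ-* (X * g m) (proj₁ (R m)) (f′ m)))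
                    (≤-trans (sumᴸ-mono (proj₁ (R m)) (term m∈)) (≈⇒≥ (sumᴸ-map (ψ m) (proj₁ (R m)) f)))))))
            A≥0 : 0# ≤ a₀ * ∣ μ ∣
            A≥0 = *-nonneg (<⇒≤ (a>0 zero)) (∣∣-nonneg μ)
            one-dim : θ₁ ≤ X * (a₀ * ∣ μ ∣ * sumᴸ ms g)
            one-dim = ≤-trans (proj₂ (proj₂ (proj₂ S₂))) (≤-trans (*-mono-≤ θ₂≥0 (proj₂ (proj₂ H₁) h>0 (h≤ (proj₁ (proj₂ (proj₂ M₁)))))
                  θ₂≥0 (≤-by (≤⇒0≤ (proj₂ (proj₂ V))) (solve 2 (λ e t → (:1 :- e) :- t := (:1 :- t) :- e) refl (exp (- (a₀ * L₁))) θ₂)))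
              (≤-trans (≈⇒≤ (trans (*-congʳ (trans (exp-cong eq) (exp-+ _ _))) (*-assoc _ _ _))) (*-monoˡ-≤ (exp-nonneg _) (proj₂ (proj₂ (proj₂ P))))))
              where
              eq : - ((a₀ * ∣ ℓ ∣ + c) * h) ≈ - (c * h) + - (a₀ * ∣ μ ∣)
              eq = trans (solve 4 (λ a l c h → :- ((a :* l :+ c) :* h) := :- (c :* h) :+ :- (a :* (h :* l))) refl a₀ ∣ ℓ ∣ c h) (+-congˡ (-‿cong (*-congˡ (sym (∣μ∣ h>0)))))
            final : θ ≤ weight γ a h * sumᴸ (List.concatMap blk ms) f
            final = ≤-trans (proj₂ (proj₂ (proj₂ S₁))) (≤-trans (*-monoˡ-≤ θ₁≥0 one-dim)
              (≤-trans (≈⇒≤ (trans (solve 4 (λ t x a s → t :* (x :* (a :* s)) := a :* (x :* t :* s)) refl θ₁ X (a₀ * ∣ μ ∣) (sumᴸ ms g)) (*-congˡ (sym (sumᴸ-* (X * θ₁) ms g)))))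
              (≤-trans (*-monoˡ-≤ A≥0 (≤-trans (sumᴸ-mono-∈ ms inner) (≈⇒≤ (trans (sumᴸ-* (W′ h>0) ms (λ m → sumᴸ (blk m) f)) (*-congˡ (sym (sumᴸ-concatMap blk ms f)))))))
                (≈⇒≤ (trans (sym (*-assoc _ _ _)) (*-congʳ (sym (weight-split h>0))))))))

      find-pivot : ∀ {d} (γ : Fin (suc d) → ℝ^ (suc d)) → ¬ det γ ≈ 0# → ∃ λ j → ¬ γ j zero ≈ 0#
      find-pivot {d} γ det≉0 with em {P = ∃ λ j → ¬ γ j zero ≈ 0#}
      ... | yes p = p
      ... | no none = ⊥-elim (det≉0 (det-zero-column d γ zero-column))
        where
        zero-column : ∀ i → γ i zero ≈ 0#
        zero-column i with γ i zero ≈? 0#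
        ... | yes p = p
        ... | no p = ⊥-elim (none (i , p))

      single : ∀ (ks : List (Vec ℤ 0)) → Unique ks → sumᴸ ks (λ _ → 1#) ≤ 1#
      single [] u = 0≤1
      single (Vec.[] ∷ []) u = ≈⇒≤ (+-identityʳ 1#)
      single (Vec.[] ∷ Vec.[] ∷ ks) ((p ∷ _) ∷ u) = ⊥-elim (p ≡.refl)

      weight₀ : ∀ h (a : Fin 0 → Carrier) (γ : Fin 0 → ℝ^ 0) → weight γ a h ≈ 1#
      weight₀ h a γ = trans (*-identityʳ _) (trans (*-identityˡ _) (∣∣-of-nonneg 0≤1))

    abstract
      upper-sums : ∀ d (γ : Fin d → ℝ^ d) → ¬ det γ ≈ 0# → (a : Fin d → Carrier) → (∀ i → 0# < a i) → ∀ {C} → 0# ≤ C → ∀ {ρ} → 1# < ρ → UpperSums γ a C ρ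
      upper-sums zero γ det≉0 a a>0 C≥0 {ρ} ρ>1 = 1# , 0<1 , λ {h} _ _ _ ks u →
        ≤-trans (≈⇒≤ (trans (*-congʳ (weight₀ h a γ)) (*-identityˡ _))) (≤-trans (single ks u) (<⇒≤ ρ>1))
      upper-sums (suc d) γ det≉0 a a>0 C≥0 ρ>1 = let j , pivot≉0 = find-pivot γ det≉0 ; G , G≥0 , B = bounded-family (γ j) in
        upper-step γ det≉0 a a>0 C≥0 j pivot≉0 G≥0 B ρ>1 λ ρ′>1 →
          upper-sums d (Pivot.γ̂ γ j pivot≉0) (Pivot.det-γ̂ γ j pivot≉0 det≉0) (a ∘ suc) (a>0 ∘ suc) (+-nonneg C≥0 G≥0) ρ′>1

      lower-sums : ∀ d (γ : Fin d → ℝ^ d) → ¬ det γ ≈ 0# → (a : Fin d → Carrier) → (∀ i → 0# < a i) → ∀ {C} → 0# ≤ C → ∀ {θ} → θ < 1# → LowerSums γ a C θ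
      lower-sums zero γ det≉0 a a>0 C≥0 {θ} θ<1 = 1# , 0<1 , 0# , ≤-refl , λ {h} _ _ _ →
        (Vec.[] ∷ []) , ([] ∷ []) , (λ _ ()) , ≤-trans (<⇒≤ θ<1) (≈⇒≥ (trans (*-congʳ (weight₀ h a γ)) (trans (*-identityˡ _) (+-identityʳ 1#))))
      lower-sums (suc d) γ det≉0 a a>0 C≥0 θ<1 = let j , pivot≉0 = find-pivot γ det≉0 ; G , G≥0 , B = bounded-family (γ j) in
        lower-step γ det≉0 a a>0 C≥0 j pivot≉0 G≥0 B θ<1 λ θ′<1 →
          lower-sums d (Pivot.γ̂ γ j pivot≉0) (Pivot.det-γ̂ γ j pivot≉0 det≉0) (a ∘ suc) (a>0 ∘ suc) (+-nonneg C≥0 G≥0) θ′<1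

-- Riemann sums and the integral over a simplicial cone.

module Integration (em : ExcludedMiddle 0ℓ) (ℝ : CompleteOrderedField) where

  open OrderedField em ℝ
  open AbsoluteValue em ℝ
  open Limits em ℝ
  open Determinants em ℝ
  open LinearAlgebra em ℝ
  open Progressions em ℝ
  open LatticePoints em ℝ
  open import Data.List.Relation.Unary.Any using (here)
  open import Data.Integer.Base as ℤ using (ℤ; +_; -[1+_])
  import Data.Integer.Properties as ℤ
  open import Data.List.Base using ([]; _∷_)
  open import Data.List.Membership.Propositional using (_∈_; lose)
  open import Data.List.Membership.Propositional.Properties using (∈-map⁺; ∈-map⁻; ∈-concatMap⁺; ∈-allFin)
  open import Data.List.Relation.Unary.Unique.Propositional using (Unique; []; _∷_)
  import Data.List.Relation.Unary.All as All
  import Data.List.Relation.Unary.Unique.Propositional.Properties as Unique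
  open import Data.Vec.Base as Vec using (Vec; lookup)
  import Data.Vec.Properties as Vec

  -- Iterated limit, first in the mesh and then in the size of the cube. The inner limits are not
  -- named: for the indicator of a single face only the closeness of the sums to `l` is established,
  -- not the existence of integrals over cubes.
  Lim₂ : (ℕ → ℕ → Carrier) → Carrier → Set
  Lim₂ s l = ∀ {ε} → 0# < ε → ∃ λ M₀ → ∀ {M} → M ℕ.≥ M₀ → ∃ λ N₀ → ∀ {N} → N ℕ.≥ N₀ → Bnd (s M N - l) ε

  abstract
    Bnd-all⇒≈0 : ∀ {x} → (∀ {ε} → 0# < ε → Bnd x ε) → x ≈ 0#
    Bnd-all⇒≈0 {x} p with compare x 0#
    ... | tri≈ _ q _ = q
    ... | tri< q _ _ = ⊥-elim (no-neg q)
      where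
      no-neg : ¬ x < 0#
      no-neg q = let y , y>0 , e = halve (neg-pos q) in
        <⇒≱ y>0 (≤-by (≤⇒0≤ (proj₁ (p y>0))) (trans (solve 1 (λ y → :0 :- y := :- (y :+ y) :- (:- y)) refl y) (+-congʳ (trans (-‿cong e) (solve 1 (λ x → :- (:- x) := x) refl x)))))
    ... | tri> _ _ q = ⊥-elim (no-pos q)
      where
      no-pos : ¬ 0# < x
      no-pos q = let y , y>0 , e = halve q in
        <⇒≱ y>0 (≤-by (≤⇒0≤ (proj₂ (p y>0))) (trans (solve 1 (λ y → :0 :- y := y :- (y :+ y)) refl y) (+-congˡ (-‿cong e))))

    lim₂-unique : ∀ {s a b} → Lim₂ s a → Lim₂ s b → a ≈ b
    lim₂-unique {s} {a} {b} p q = trans (solve 2 (λ a b → a := (a :- b) :+ b) refl a b) (trans (+-congʳ (Bnd-all⇒≈0 close)) (+-identityˡ b))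
      where
      close : ∀ {ε} → 0# < ε → Bnd (a - b) ε
      close {ε} ε>0 =
        let δ , δ>0 , δ+δ = halve ε>0
            M₁ , f = p δ>0
            M₂ , g = q δ>0
            N₁ , f′ = f (ℕ.m≤m⊔n M₁ M₂)
            N₂ , g′ = g (ℕ.m≤n⊔m M₁ M₂)
            x = f′ (ℕ.m≤m⊔n N₁ N₂)
            y = g′ (ℕ.m≤n⊔m N₁ N₂)
            z = s (M₁ ℕ.⊔ M₂) (N₁ ℕ.⊔ N₂)
        in Bnd-weaken (Bnd-cong (solve 3 (λ z a b → (z :- b) :+ (:- (z :- a)) := a :- b) refl z a b) (Bnd-+ y (Bnd-neg x))) (≈⇒≤ δ+δ)

    lim₂-+ : ∀ {s t a b} → Lim₂ s a → Lim₂ t b → Lim₂ (λ M N → s M N + t M N) (a + b)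
    lim₂-+ {s} {t} {a} {b} p q ε>0 =
      let δ , δ>0 , δ+δ = halve ε>0
          M₁ , f = p δ>0
          M₂ , g = q δ>0
      in M₁ ℕ.⊔ M₂ , λ {M} M≥ →
        let N₁ , f′ = f (ℕ.≤-trans (ℕ.m≤m⊔n M₁ M₂) M≥)
            N₂ , g′ = g (ℕ.≤-trans (ℕ.m≤n⊔m M₁ M₂) M≥)
        in N₁ ℕ.⊔ N₂ , λ {N} N≥ →
          Bnd-weaken (Bnd-cong (solve 4 (λ x y a b → (x :- a) :+ (y :- b) := (x :+ y) :- (a :+ b)) refl (s M N) (t M N) a b)
            (Bnd-+ (f′ (ℕ.≤-trans (ℕ.m≤m⊔n N₁ N₂) N≥)) (g′ (ℕ.≤-trans (ℕ.m≤n⊔m N₁ N₂) N≥)))) (≈⇒≤ δ+δ)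

    lim₂-neg : ∀ {s a} → Lim₂ s a → Lim₂ (λ M N → - s M N) (- a)
    lim₂-neg {s} {a} p ε>0 = let M₁ , f = p ε>0 in M₁ , λ {M} M≥ → let N₁ , f′ = f M≥ in N₁ , λ {N} N≥ →
      Bnd-cong (solve 2 (λ x a → :- (x :- a) := (:- x) :- (:- a)) refl (s M N) a) (Bnd-neg (f′ N≥))

    lim₂-cong : ∀ {s t a b} → (∀ M N → s M N ≈ t M N) → a ≈ b → Lim₂ s a → Lim₂ t b
    lim₂-cong e a≈b p ε>0 = let M₁ , f = p ε>0 in M₁ , λ {M} M≥ → let N₁ , f′ = f M≥ in N₁ , λ {N} N≥ →
      Bnd-cong (+-cong (e M N) (-‿cong a≈b)) (f′ N≥)

    lim₂-zero : Lim₂ (λ _ _ → 0#) 0#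
    lim₂-zero ε>0 = 0 , λ _ → 0 , λ _ → Bnd-cong (sym (-‿inverseʳ 0#)) (Bnd-0 (<⇒≤ ε>0))

    lim₂-squeeze : ∀ {s lo hi l} → (∀ M N → lo M N ≤ s M N) → (∀ M N → s M N ≤ hi M N) → Lim₂ lo l → Lim₂ hi l → Lim₂ s l
    lim₂-squeeze p q P Q ε>0 =
      let M₁ , f = P ε>0
          M₂ , g = Q ε>0
      in M₁ ℕ.⊔ M₂ , λ {M} M≥ →
        let N₁ , f′ = f (ℕ.≤-trans (ℕ.m≤m⊔n M₁ M₂) M≥)
            N₂ , g′ = g (ℕ.≤-trans (ℕ.m≤n⊔m M₁ M₂) M≥)
        in N₁ ℕ.⊔ N₂ , λ {N} N≥ →
          ≤-trans (proj₁ (f′ (ℕ.≤-trans (ℕ.m≤m⊔n N₁ N₂) N≥))) (+-monoˡ-≤ _ (p M N)) ,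
          ≤-trans (+-monoˡ-≤ _ (q M N)) (proj₂ (g′ (ℕ.≤-trans (ℕ.m≤n⊔m N₁ N₂) N≥)))

  module _ (M N : ℕ) where
    open Grid M N using (step)

    corner : ∀ {d} → Vec ℤ d → ℝ^ d
    corner k j = - fromℕ M + fromℤ (lookup k j) * step

  gridList : ∀ d N → List (Vec (Fin N) d)
  gridList zero N = Vec.[] ∷ []
  gridList (suc d) N = List.concatMap (λ i → List.map (i Vec.∷_) (gridList d N)) (List.allFin N)

  sumᴸ-tabulate : ∀ {A : Set} {n} (g : Fin n → A) (f : A → Carrier) → sumᴸ (List.tabulate g) f ≈ sum (f ∘ g)
  sumᴸ-tabulate {n = zero} g f = refl
  sumᴸ-tabulate {n = suc n} g f = +-congˡ (sumᴸ-tabulate (g ∘ suc) f)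

  gridSum≈ : ∀ d N (g : Vec (Fin N) d → Carrier) → gridSum g ≈ sumᴸ (gridList d N) g
  gridSum≈ zero N g = sym (+-identityʳ _)
  gridSum≈ (suc d) N g = sym (trans (sumᴸ-concatMap (λ i → List.map (i Vec.∷_) (gridList d N)) (List.allFin N) g)
    (trans (sumᴸ-tabulate id (λ i → sumᴸ (List.map (i Vec.∷_) (gridList d N)) g))
      (sum-cong λ i → trans (sumᴸ-map (i Vec.∷_) (gridList d N) g) (sym (gridSum≈ d N (λ ks → g (i Vec.∷ ks)))))))

  gridList-complete : ∀ {d N} (k : Vec (Fin N) d) → k ∈ gridList d N
  gridList-complete Vec.[] = here ≡.refl
  gridList-complete (i Vec.∷ k) = ∈-concatMap⁺ (λ i → List.map (i Vec.∷_) (gridList _ _)) (lose (∈-allFin i) (∈-map⁺ (i Vec.∷_) (gridList-complete k)))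

  gridList-unique : ∀ d N → Unique (gridList d N)
  gridList-unique zero N = All.[] ∷ []
  gridList-unique (suc d) N = unique-concatMap _ (Unique.allFin⁺ N) (λ i → Unique.map⁺ Vec.∷-injectiveʳ (gridList-unique d N))
    λ {i} {i′} p q → let _ , _ , e = ∈-map⁻ (i Vec.∷_) p ; _ , _ , e′ = ∈-map⁻ (i′ Vec.∷_) q in Vec.∷-injectiveˡ (≡.trans (≡.sym e) e′)

  toℤ : ∀ {N} → Fin N → ℤ
  toℤ i = + toℕ i

  indices : ∀ d N → List (Vec ℤ d)
  indices d N = List.map (Vec.map toℤ) (gridList d (suc N))

  indices-unique : ∀ d N → Unique (indices d N)
  indices-unique d N = Unique.map⁺ (map-injective _ _) (gridList-unique d (suc N))
    where
    map-injective : ∀ {d} (xs ys : Vec (Fin (suc N)) d) → Vec.map toℤ xs ≡ Vec.map toℤ ys → xs ≡ ys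
    map-injective Vec.[] Vec.[] _ = ≡.refl
    map-injective (x Vec.∷ xs) (y Vec.∷ ys) p = ≡.cong₂ Vec._∷_ (Fin.toℕ-injective (ℤ.+-injective (Vec.∷-injectiveˡ p))) (map-injective xs ys (Vec.∷-injectiveʳ p))

  ∈-indices : ∀ d N (k : Vec ℤ d) → (∀ j → ∃ λ (i : Fin (suc N)) → lookup k j ≡ toℤ i) → k ∈ indices d N
  ∈-indices d N k p = ≡.subst (_∈ indices d N) (≡.trans (≡.sym (Vec.tabulate-∘ toℤ (proj₁ ∘ p))) (≡.trans (Vec.tabulate-cong (λ j → ≡.sym (proj₂ (p j)))) (Vec.tabulate∘lookup k)))
    (∈-map⁺ (Vec.map toℤ) (gridList-complete (Vec.tabulate (proj₁ ∘ p))))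

  -- With lower corners as tags the tags form part of an affine lattice. An integral in the sense of
  -- the definitions controls all tags, so these sums determine it.
  cornerSum : ∀ {d} → (ℝ^ d → Carrier) → ℕ → ℕ → Carrier
  cornerSum {d} f M N = Grid.step M N ^ d * sumᴸ (indices d N) (f ∘ corner M N)

  abstract
    step-nonneg : ∀ M N → 0# ≤ Grid.step M N
    step-nonneg M N = *-nonneg (+-nonneg (fromℕ-nonneg M) (fromℕ-nonneg M)) (<⇒≤ (⁻¹-pos (fromℕ-pos N)))

    step-pos : ∀ M N → 0# < Grid.step (suc M) N
    step-pos M N = *-pos (+-pos (fromℕ-pos M) (fromℕ-pos M)) (⁻¹-pos (fromℕ-pos N))

    step-* : ∀ M N → Grid.step M N * fromℕ (suc N) ≈ fromℕ M + fromℕ M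
    step-* M N = /-*-cancel (>⇒≉ (fromℕ-pos N))

    step-small : ∀ M {h₀} → 0# < h₀ → ∃ λ N₀ → ∀ {N} → N ℕ.≥ N₀ → Grid.step M N ≤ h₀
    step-small M {h₀} h₀>0 = let N₀ , p = archimedes-suc ((fromℕ M + fromℕ M) / h₀) in N₀ , λ {N} N≥ →
      *-cancelˡ-≤ (fromℕ-pos N) (≤-trans (≈⇒≤ (trans (*-comm _ _) (step-* M N))) (≤-trans (≈⇒≥ (/-*-cancel (>⇒≉ h₀>0)))
        (*-monoʳ-≤ (<⇒≤ h₀>0) (<⇒≤ (<-≤-trans p (fromℕ-mono (ℕ.s≤s N≥)))))))

    riemann-corner : ∀ {d} (f : ℝ^ d → Carrier) M N → Grid.riemannSum M N f (corner M N ∘ Vec.map toℤ) ≈ cornerSum f M N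
    riemann-corner {d} f M N = trans (gridSum≈ d (suc N) _) (trans (sumᴸ-cong (gridList d (suc N)) λ k → *-comm (f (corner M N (Vec.map toℤ k))) _)
      (trans (sumᴸ-* (Grid.step M N ^ d) (gridList d (suc N)) (f ∘ corner M N ∘ Vec.map toℤ)) (*-congˡ (sym (sumᴸ-map (Vec.map toℤ) (gridList d (suc N)) (f ∘ corner M N))))))

    corner-in-cell : ∀ {d} M N (k : Vec (Fin (suc N)) d) → Grid.InCell M N k (corner M N (Vec.map toℤ k))
    corner-in-cell M N k j = ≈⇒≤ (sym eq) , ≤-trans (≈⇒≤ eq)
        (≤-by (step-nonneg M N) (solve 3 (λ m k h → ((:- m) :+ (:1 :+ k) :* h) :- ((:- m) :+ k :* h) := h) refl (fromℕ M) (fromℕ (toℕ (lookup k j))) (Grid.step M N)))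
      where
      eq : corner M N (Vec.map toℤ k) j ≈ Grid.node M N (toℕ (lookup k j))
      eq = +-congˡ (*-congʳ (reflexive (≡.cong fromℤ (Vec.lookup-map j toℤ k))))

    integral⇒lim₂ : ∀ {d} {f : ℝ^ d → Carrier} {I} → IsIntegral f I → Lim₂ (cornerSum f) I
    integral⇒lim₂ {d} {f} {I} (J , onCube , J⟶I) ε>0 =
      let δ , δ>0 , δ+δ = halve ε>0
          M₀ , p = J⟶I δ>0
      in M₀ , λ {M} M≥ → let N₀ , q = onCube M δ>0 in N₀ , λ {N} N≥ →
        Bnd-weaken (Bnd-cong (trans (solve 3 (λ r j i → (r :- j) :+ (j :- i) := r :- i) refl (Grid.riemannSum M N f (corner M N ∘ Vec.map toℤ)) (J M) I) (+-congʳ (riemann-corner f M N)))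
          (Bnd-+ (Near⇒Bnd (q N≥ (corner M N ∘ Vec.map toℤ) (corner-in-cell M N))) (Near⇒Bnd (p M≥)))) (≈⇒≤ δ+δ)

    cornerSum-mono : ∀ {d} {f g : ℝ^ d → Carrier} → (∀ x → f x ≤ g x) → ∀ M N → cornerSum f M N ≤ cornerSum g M N
    cornerSum-mono {d} {f} {g} p M N = *-monoˡ-≤ (^-nonneg d (step-nonneg M N)) (sumᴸ-mono (indices d N) (p ∘ corner M N))

    cornerSum-+ : ∀ {d} (f g : ℝ^ d → Carrier) M N → cornerSum (λ x → f x + g x) M N ≈ cornerSum f M N + cornerSum g M N
    cornerSum-+ {d} f g M N = trans (*-congˡ (go (indices d N))) (distribˡ _ _ _)
      where
      go : ∀ ks → sumᴸ ks ((λ x → f x + g x) ∘ corner M N) ≈ sumᴸ ks (f ∘ corner M N) + sumᴸ ks (g ∘ corner M N)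
      go [] = sym (+-identityˡ 0#)
      go (k ∷ ks) = trans (+-congˡ (go ks)) (solve 4 (λ a b c d → (a :+ b) :+ (c :+ d) := (a :+ c) :+ (b :+ d)) refl (f (corner M N k)) (g (corner M N k)) (sumᴸ ks (f ∘ corner M N)) (sumᴸ ks (g ∘ corner M N)))

    cornerSum-0 : ∀ {d} M N → cornerSum {d} (λ _ → 0#) M N ≈ 0#
    cornerSum-0 {d} M N = trans (*-congˡ (go (indices d N))) (zeroʳ _)
      where
      go : ∀ (ks : List (Vec ℤ d)) → sumᴸ ks (λ _ → 0#) ≈ 0#
      go [] = refl
      go (k ∷ ks) = trans (+-identityˡ _) (go ks)

  module Simplicial (exp : Carrier → Carrier) (isExp : IsExp exp) {d} (v ξ : ℝ^ d) (B : Fin d → ℝ^ d) (det≉0 : ¬ det B ≈ 0#)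
                    (B>0 : ∀ i → 0# < ⟨ B i , ξ ⟩) where
    open LatticeSums exp isExp
    open Coordinates B det≉0

    a : Fin d → Carrier
    a i = ⟨ B i , ξ ⟩

    y : ℝ^ d → ℝ^ d
    y x = coord (x ⊖ v)

    E-exp : ∀ {d} (a y : Fin d → Carrier) → (∀ i → 0# ≤ y i) → E a y ≈ exp (- sum (λ i → y i * a i))
    E-exp {zero} a y p = sym (trans (exp-cong (solve 0 (:- :0 := :0) refl)) exp-0)
    E-exp {suc d} a y p = trans (*-cong (E₁-pos (p zero)) (E-exp (a ∘ suc) (y ∘ suc) (p ∘ suc))) (trans (sym (exp-+ _ _))
      (exp-cong (solve 3 (λ a y s → (:- (a :* y)) :+ (:- s) := :- (y :* a :+ s)) refl (a zero) (y zero) (sum (λ i → y (suc i) * a (suc i))))))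

    E-on-cone : ∀ x → (∀ i → 0# ≤ y x i) → E a (y x) ≈ exp (- ⟨ x ⊖ v , ξ ⟩)
    E-on-cone x p = trans (E-exp a (y x) p) (exp-cong (-‿cong (sym (trans (inner-cong ξ (coord-spans (x ⊖ v))) (inner-combination (y x) B ξ)))))

    -- The expected integral of the exponential over the simplicial cone: a product of the half-line
    -- integrals 1 / `a i`, times the Jacobian of the coordinates.
    volume : Carrier
    volume = ∣ det B ∣ / product a

    private
      -- In the coordinates of the cone, grid corners form a translate of the lattice with basis `h`
      -- times `γ`. Its covolume contributes 1 / `∣ det B ∣`, which is how the determinant enters
      -- without a change of variables.
      γ : Fin d → ℝ^ d
      γ j = coord (e j)

      a>0 : 0# < product a
      a>0 = product-pos a B>0

      det-γ : ∣ det γ ∣ * ∣ det B ∣ ≈ 1#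
      det-γ = trans (sym (∣∣-* _ _)) (trans (∣∣-cong det-coord-e) (∣∣-of-nonneg 0≤1))

      γ≉0 : ¬ det γ ≈ 0#
      γ≉0 p = 1≉0 (trans (sym det-coord-e) (trans (*-congʳ p) (zeroˡ _)))

      w : Carrier
      w = product a * ∣ det γ ∣

      w>0 : 0# < w
      w>0 = *-pos a>0 (∣∣-pos γ≉0)

      w*volume : w * volume ≈ 1#
      w*volume = trans (solve 4 (λ p g b q → p :* g :* (b :* q) := (p :* q) :* (g :* b)) refl (product a) ∣ det γ ∣ ∣ det B ∣ (product a ⁻¹))
        (trans (*-cong (⁻¹-inverseʳ (>⇒≉ a>0)) det-γ) (*-identityˡ 1#))

      volume-nonneg : 0# ≤ volume
      volume-nonneg = *-nonneg (∣∣-nonneg (det B)) (<⇒≤ (⁻¹-pos a>0))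

      cancel-w : ∀ x → x ≈ w * (x * volume)
      cancel-w x = sym (trans (solve 3 (λ w x v → w :* (x :* v) := x :* (w :* v)) refl w x volume) (trans (*-congˡ w*volume) (*-identityʳ x)))

      module _ (M N : ℕ) where
        h : Carrier
        h = Grid.step M N

        offset t : ℝ^ d
        offset j = - fromℕ M - v j
        t = coord offset

        Y : Vec ℤ d → ℝ^ d
        Y k = y (corner M N k)

        Y-lattice : ∀ k → Y k ≋ (λ i → lattice γ h k i + t i)
        Y-lattice k i = trans (coord-cong split i) (trans (coord-⊕ (combination c e) offset i) (+-congʳ (coord-combination c e i)))
          where
          c : Fin d → Carrier
          c j = h * fromℤ (lookup k j)
          split : (corner M N k ⊖ v) ≋ (combination c e ⊕ offset)
          split j = trans (solve 4 (λ m k h v → ((:- m) :+ k :* h) :- v := h :* k :+ ((:- m) :- v)) refl (fromℕ M) (fromℤ (lookup k j)) h (v j)) (+-congʳ (sym (sum-e c j)))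

        approx : Approx γ h t 0# Y
        approx k i = Bnd-cong (sym (trans (+-congʳ (Y-lattice k i)) (-‿inverseʳ _))) (Bnd-0 (≈⇒≥ (zeroˡ h)))

      -- A point with bounded coordinates lies in a fixed cube. Strictness on one side matters: a
      -- grid point with an entry equal to M is not the lower corner of a cell of the cube.
      cube-bound : ∀ L → 0# ≤ L → ∃ λ M₀ → ∀ x → (∀ i → 0# < y x i × y x i ≤ L) → ∀ j → Bnd (x j) (fromℕ M₀) × x j < fromℕ M₀
      cube-bound L L≥0 = M₀ , λ x p j → Bnd-weaken (near x p j) (<⇒≤ (K< j)) , ≤-<-trans (proj₂ (near x p j)) (K< j)
        where
        K : Fin d → Carrier
        K j = sum (λ i → L * ∣ B i j ∣) + ∣ v j ∣
        bf : ∃ λ G → 0# ≤ G × (∀ i → Bnd (K i) G)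
        bf = bounded-family K
        M₀ : ℕ
        M₀ = proj₁ (archimedes (proj₁ bf))
        K< : ∀ j → K j < fromℕ M₀
        K< j = ≤-<-trans (proj₂ (proj₂ (proj₂ bf) j)) (proj₂ (archimedes (proj₁ bf)))
        near : ∀ x → (∀ i → 0# < y x i × y x i ≤ L) → ∀ j → Bnd (x j) (K j)
        near x p j = Bnd-cong (trans (+-congʳ (sym (coord-spans (x ⊖ v) j))) (solve 2 (λ x v → (x :- v) :+ v := x) refl (x j) (v j)))
          (Bnd-+ (Bnd-sum λ i → Bnd-* (Bnd-nonneg-≤ (<⇒≤ (proj₁ (p i))) (proj₂ (p i))) (Bnd-∣∣ (B i j))) (Bnd-∣∣ (v j)))

      in-range : ∀ {M N} → 0# < h M N → ∀ z → Bnd (- fromℕ M + fromℤ z * h M N) (fromℕ M) → - fromℕ M + fromℤ z * h M N < fromℕ M → ∃ λ (i : Fin (suc N)) → z ≡ toℤ i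
      in-range {M} {N} h>0 (+ n) _ p = fromℕ< n< , ≡.cong +_ (≡.sym (Fin.toℕ-fromℕ< n<))
        where
        n< : n ℕ.< suc N
        n< = fromℕ-cancel-< (*-cancelˡ-< h>0 (<-by (<⇒0< p) (trans (+-congʳ (step-* M N)) (solve 3 (λ m n h → (m :+ m) :- h :* n := m :- ((:- m) :+ n :* h)) refl (fromℕ M) (fromℕ n) (h M N)))))
      in-range {M} {N} h>0 -[1+ n ] (q , _) _ = ⊥-elim (<⇒≱ (*-pos (fromℕ-pos n) h>0)
        (≤-by (≤⇒0≤ q) (solve 3 (λ m n h → :0 :- n :* h := ((:- m) :+ (:- n) :* h) :- (:- m)) refl (fromℕ M) (fromℕ (suc n)) (h M N))))

      module _ {F : ℝ^ d → Carrier} (F≥0 : ∀ x → 0# ≤ F x) (F≤E : ∀ x → F x ≤ E a (y x)) (E≤F : ∀ x → (∀ i → 0# < y x i) → E a (y x) ≤ F x) where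

        -- Stated for `suc M` because the step vanishes at M = 0 and the lattice estimates assume a
        -- positive mesh.
        upper-bound : ∀ {ρ} → 1# < ρ → ∀ M → ∃ λ N₀ → ∀ {N} → N ℕ.≥ N₀ → cornerSum F (suc M) N ≤ ρ * volume
        upper-bound {ρ} ρ>1 M =
          let h₀ , h₀>0 , U = upper-sums d γ γ≉0 a B>0 ≤-refl ρ>1
              N₀ , small-step = step-small (suc M) h₀>0
          in N₀ , λ {N} N≥ → *-cancelˡ-≤ w>0 (≤-trans (*-monoˡ-≤ (<⇒≤ w>0) (cornerSum-mono F≤E (suc M) N))
            (≤-trans (≈⇒≤ (sym (*-assoc _ _ _))) (≤-trans (U (step-pos M N) (small-step N≥) (approx (suc M) N) (indices d N) (indices-unique d N)) (≈⇒≤ (cancel-w ρ)))))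

        lower-bound : ∀ {θ} → θ < 1# → ∃ λ M₀ → ∀ {M} → M ℕ.≥ M₀ → ∃ λ N₀ → ∀ {N} → N ℕ.≥ N₀ → θ * volume ≤ cornerSum F (suc M) N
        lower-bound {θ} θ<1 =
          let h₀ , h₀>0 , L , L≥0 , U = lower-sums d γ γ≉0 a B>0 ≤-refl θ<1
              M₀ , in-cube = cube-bound L L≥0
          in M₀ , λ {M} M≥ →
            let N₀ , small-step = step-small (suc M) h₀>0
            in N₀ , λ {N} N≥ →
              let ks , uks , range , bound = U (step-pos M N) (small-step N≥) (approx (suc M) N)
                  M₀≤ = fromℕ-mono (ℕ.≤-trans M≥ (ℕ.n≤1+n M))
              in *-cancelˡ-≤ w>0 (≤-trans (≈⇒≥ (cancel-w θ)) (≤-trans bound (≤-trans (≈⇒≤ (*-assoc _ _ _)) (*-monoˡ-≤ (<⇒≤ w>0)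
                (*-monoˡ-≤ (^-nonneg d (step-nonneg (suc M) N)) (≤-trans (sumᴸ-mono-∈ ks λ {k} k∈ → E≤F (corner (suc M) N k) (λ i → proj₁ (range k∈ i)))
                  (sumᴸ-unique ks (indices d N) (F≥0 ∘ corner (suc M) N) uks λ {k} k∈ → inj₂ (∈-indices d N k λ j →
                    let b , lt = in-cube (corner (suc M) N k) (range k∈) j
                    in in-range {suc M} {N} (step-pos M N) (lookup k j) (Bnd-weaken b M₀≤) (<-≤-trans lt M₀≤)))))))))

        limit′ : Lim₂ (λ M N → cornerSum F M N) volume
        limit′ {ε} ε>0 =
          let δ , δ>0 , δ≤1 , q = small ε>0 volume-nonneg
              M₀ , lo = lower-bound {1# - δ} (<-by δ>0 (solve 1 (λ d → :1 :- (:1 :- d) := d) refl δ))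
          in suc M₀ , λ { {suc M} (ℕ.s≤s M≥) →
            let N₁ , lo′ = lo M≥
                N₂ , hi′ = upper-bound {1# + δ} (<-by δ>0 (solve 1 (λ d → (:1 :+ d) :- :1 := d) refl δ)) M
            in N₁ ℕ.⊔ N₂ , λ {N} N≥ →
              ≤-by (+-nonneg (≤⇒0≤ (lo′ (ℕ.≤-trans (ℕ.m≤m⊔n N₁ N₂) N≥))) (≤⇒0≤ (<⇒≤ q))) (solve 4 (λ s v e d → (s :- v) :- (:- e) := (s :- (:1 :- d) :* v) :+ (e :- d :* v)) refl (cornerSum F (suc M) N) volume ε δ) ,
              ≤-by (+-nonneg (≤⇒0≤ (hi′ (ℕ.≤-trans (ℕ.m≤n⊔m N₁ N₂) N≥))) (≤⇒0≤ (<⇒≤ q))) (solve 4 (λ s v e d → e :- (s :- v) := ((:1 :+ d) :* v :- s) :+ (e :- d :* v)) refl (cornerSum F (suc M) N) volume ε δ) }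

    -- Nothing is assumed about F on the boundary of the cone, so that lower-dimensional faces will be negligible.
    abstract
      simplicial-limit : {F : ℝ^ d → Carrier} → (∀ x → 0# ≤ F x) → (∀ x → F x ≤ E a (y x)) → (∀ x → (∀ i → 0# < y x i) → E a (y x) ≤ F x) → Lim₂ (cornerSum F) volume
      simplicial-limit F≥0 F≤E E≤F = limit′ F≥0 F≤E E≤F

-- Lexicographically optimal faces.

module OptimalFaces (em : ExcludedMiddle 0ℓ) (ℝ : CompleteOrderedField) where

  open OrderedField em ℝ
  open Determinants em ℝ
  open LinearAlgebra em ℝ
  open Progressions em ℝ
  open import Data.Fin.Properties using (suc-injective)
  open import Data.Fin.Subset using (Subset; inside; outside; _⊂_) renaming (_∈_ to _∈ˢ_; _∉_ to _∉ˢ_)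
  open import Data.Fin.Subset.Properties using (_∈?_) renaming (⊆-antisym to ⊆ˢ-antisym)
  open import Data.Fin.Subset.Induction using (⊂-wellFounded)
  open import Data.List.Base using ([]; _∷_; _++_)
  open import Data.List.Membership.Propositional using (_∈_)
  open import Data.List.Membership.Propositional.Properties using (∈-map⁺; ∈-map⁻; ∈-++⁺ˡ; ∈-++⁺ʳ)
  open import Data.List.Relation.Unary.Any using (here; there)
  open import Data.List.Relation.Unary.Unique.Propositional using (Unique; []; _∷_)
  import Data.List.Relation.Unary.All as All
  import Data.List.Relation.Unary.Unique.Propositional.Properties as Unique
  open import Data.Vec.Base as Vec using (Vec)
  open import Data.Vec.Base using (here; there)
  import Data.Vec.Properties as Vec
  open import Induction.WellFounded using (Acc; acc)

  private
    variable
      d n : ℕ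

  subsets : ∀ n → List (Subset n)
  subsets zero = Vec.[] ∷ []
  subsets (suc n) = List.map (outside Vec.∷_) (subsets n) ++ List.map (inside Vec.∷_) (subsets n)

  subsets-complete : (σ : Subset n) → σ ∈ subsets n
  subsets-complete Vec.[] = here ≡.refl
  subsets-complete (false Vec.∷ σ) = ∈-++⁺ˡ (∈-map⁺ (outside Vec.∷_) (subsets-complete σ))
  subsets-complete {suc n} (true Vec.∷ σ) = ∈-++⁺ʳ (List.map (outside Vec.∷_) (subsets n)) (∈-map⁺ (inside Vec.∷_) (subsets-complete σ))

  subsets-unique : ∀ n → Unique (subsets n)
  subsets-unique zero = All.[] ∷ []
  subsets-unique (suc n) = Unique.++⁺ (Unique.map⁺ Vec.∷-injectiveʳ (subsets-unique n)) (Unique.map⁺ Vec.∷-injectiveʳ (subsets-unique n))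
    λ { (p , q) → clash (∈-map⁻ (outside Vec.∷_) p) (∈-map⁻ (inside Vec.∷_) q) }
    where
    clash : ∀ {v : Subset (suc n)} → (∃ λ x → x ∈ subsets n × v ≡ outside Vec.∷ x) → (∃ λ x → x ∈ subsets n × v ≡ inside Vec.∷ x) → ⊥
    clash (_ , _ , ≡.refl) (_ , _ , ())

  Enumerates : ∀ {k} → (Fin k → Fin n) → Subset n → Set
  Enumerates π σ = Injective _≡_ _≡_ π × (∀ q → π q ∈ˢ σ) × (∀ {i} → i ∈ˢ σ → ∃ λ q → π q ≡ i)

  enumerate : (σ : Subset n) → ∃ λ k → ∃ λ (π : Fin k → Fin n) → Enumerates π σ
  enumerate Vec.[] = 0 , (λ ()) , (λ { {()} }) , (λ ()) , λ ()
  enumerate (false Vec.∷ σ) = let k , π , inj , into , onto = enumerate σ in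
    k , suc ∘ π , inj ∘ suc-injective , (λ q → there (into q)) , λ { (there i∈) → let q , eq = onto i∈ in q , ≡.cong suc eq }
  enumerate (true Vec.∷ σ) = let k , π , inj , into , onto = enumerate σ in
    suc k , Data.Vec.Functional._∷_ zero (suc ∘ π) ,
    (λ { {zero} {zero} _ → ≡.refl ; {zero} {suc j} () ; {suc i} {zero} () ; {suc i} {suc j} p → ≡.cong suc (inj (suc-injective p)) }) ,
    (λ { zero → here ; (suc q) → there (into q) }) ,
    λ { here → zero , ≡.refl ; (there i∈) → let q , eq = onto i∈ in suc q , ≡.cong suc eq }
    where import Data.Vec.Functional

  -- The list may repeat indices: a later occurrence is consulted only if the entry is zero, so it
  -- decides nothing.
  LexPos : List (Fin n) → (Fin n → Carrier) → Set
  LexPos [] κ = ⊥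
  LexPos (i ∷ is) κ = 0# < κ i ⊎ (κ i ≈ 0# × LexPos is κ)

  lex-cong : ∀ is {κ κ′ : Fin n → Carrier} → (∀ i → κ i ≈ κ′ i) → LexPos is κ → LexPos is κ′
  lex-cong (i ∷ is) p (inj₁ q) = inj₁ (<-respʳ (p i) q)
  lex-cong (i ∷ is) p (inj₂ (q , r)) = inj₂ (trans (sym (p i)) q , lex-cong is p r)

  lex-+ : ∀ is {κ κ′ : Fin n → Carrier} → LexPos is κ → LexPos is κ′ → LexPos is (λ i → κ i + κ′ i)
  lex-+ (i ∷ is) (inj₁ p) (inj₁ q) = inj₁ (+-pos p q)
  lex-+ (i ∷ is) (inj₁ p) (inj₂ (q , _)) = inj₁ (+-pos-nonneg p (≈⇒≥ q))
  lex-+ (i ∷ is) (inj₂ (p , _)) (inj₁ q) = inj₁ (+-nonneg-pos (≈⇒≥ p) q)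
  lex-+ (i ∷ is) (inj₂ (p , p′)) (inj₂ (q , q′)) = inj₂ (trans (+-cong p q) (+-identityʳ 0#) , lex-+ is p′ q′)

  lex-* : ∀ is {κ : Fin n → Carrier} {s} → 0# < s → LexPos is κ → LexPos is (λ i → s * κ i)
  lex-* (i ∷ is) s>0 (inj₁ p) = inj₁ (*-pos s>0 p)
  lex-* (i ∷ is) s>0 (inj₂ (p , q)) = inj₂ (trans (*-congˡ p) (zeroʳ _) , lex-* is s>0 q)

  lex-nonzero : ∀ is {κ : Fin n → Carrier} → LexPos is κ → ¬ (∀ i → κ i ≈ 0#)
  lex-nonzero (i ∷ is) (inj₁ p) q = >⇒≉ p (q i)
  lex-nonzero (i ∷ is) (inj₂ (_ , p)) q = lex-nonzero is p q

  lex-trichotomy : ∀ is (κ : Fin n → Carrier) → LexPos is κ ⊎ LexPos is (λ i → - κ i) ⊎ (∀ {i} → i ∈ is → κ i ≈ 0#)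
  lex-trichotomy [] κ = inj₂ (inj₂ λ ())
  lex-trichotomy (i ∷ is) κ with compare (κ i) 0# | lex-trichotomy is κ
  ... | tri< p _ _ | _ = inj₂ (inj₁ (inj₁ (neg-pos p)))
  ... | tri> _ _ p | _ = inj₁ (inj₁ p)
  ... | tri≈ _ p _ | inj₁ q = inj₁ (inj₂ (p , q))
  ... | tri≈ _ p _ | inj₂ (inj₁ q) = inj₂ (inj₁ (inj₂ (trans (-‿cong p) (solve 0 (:- :0 := :0) refl) , q)))
  ... | tri≈ _ p _ | inj₂ (inj₂ q) = inj₂ (inj₂ λ { (here ≡.refl) → p ; (there r) → q r })

  lex-maximal : ∀ is (t : Fin n → Carrier) ts → ∃ λ t* → t* ∈ t ∷ ts × (∀ {t′} → t′ ∈ t ∷ ts → ¬ LexPos is (λ i → t′ i - t* i))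
  lex-maximal is t [] = t , here ≡.refl , λ { (here ≡.refl) p → lex-nonzero is p λ i → -‿inverseʳ _ ; (there ()) }
  lex-maximal is t (u ∷ ts) with lex-maximal is u ts
  ... | m , m∈ , best with lex-trichotomy is (λ i → m i - t i)
  ...   | inj₁ p = m , there m∈ , λ
          { (here ≡.refl) q → lex-nonzero is (lex-+ is p q) λ i → solve 2 (λ m t → (m :- t) :+ (t :- m) := :0) refl (m i) (t i)
          ; (there r) q → best r q }
  ...   | inj₂ (inj₁ p) = t , here ≡.refl , λ
          { (here ≡.refl) q → lex-nonzero is q λ i → -‿inverseʳ _
          ; {t′} (there r) q → best r (lex-cong is (λ i → solve 3 (λ x t m → (x :- t) :+ (:- (m :- t)) := x :- m) refl (t′ i) (t i) (m i)) (lex-+ is q p)) }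
  ...   | inj₂ (inj₂ z) = t , here ≡.refl , λ
          { (here ≡.refl) q → lex-nonzero is q λ i → -‿inverseʳ _
          ; (there r) q → best r (transfer is q z) }
    where
    transfer : ∀ is {t′ : Fin _ → Carrier} → LexPos is (λ i → t′ i - t i) → (∀ {i} → i ∈ is → m i - t i ≈ 0#) → LexPos is (λ i → t′ i - m i)
    transfer (i ∷ is) {t′} p z = [ (λ q → inj₁ (<-respʳ shift q)) , (λ { (q , r) → inj₂ (trans (sym shift) q , transfer is r (z ∘ there)) }) ]′ p
      where
      shift : t′ i - t i ≈ t′ i - m i
      shift = trans (solve 3 (λ x t m → x :- t := (x :- m) :+ (m :- t)) refl (t′ i) (t i) (m i)) (trans (+-congˡ (z (here ≡.refl))) (+-identityʳ _))

  -- The ratio test of the simplex method: the longest step along κ that keeps all coefficients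
  -- nonnegative, together with an index that becomes zero. The last hypothesis makes the step
  -- positive.
  ratio-test : (t κ : Fin n → Carrier) → (∀ i → 0# ≤ t i) → (∀ i → κ i < 0# → 0# < t i) →
               (∀ i → 0# ≤ κ i) ⊎ ∃ λ s → 0# < s × (∀ i → 0# ≤ t i + s * κ i) × ∃ λ i → κ i < 0# × t i + s * κ i ≈ 0#
  ratio-test {zero} t κ t≥0 p = inj₁ λ ()
  ratio-test {suc n} t κ t≥0 p with <-or-≥ (κ zero) 0# | ratio-test (t ∘ suc) (κ ∘ suc) (t≥0 ∘ suc) (p ∘ suc)
  ... | inj₂ κ₀≥0 | inj₁ q = inj₁ λ { zero → κ₀≥0 ; (suc i) → q i }
  ... | inj₂ κ₀≥0 | inj₂ (s , s>0 , q , i , κ<0 , e) =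
        inj₂ (s , s>0 , (λ { zero → +-nonneg (t≥0 zero) (*-nonneg (<⇒≤ s>0) κ₀≥0) ; (suc i) → q i }) , suc i , κ<0 , e)
  ... | inj₁ κ₀<0 | r = combine r
    where
    s₀ : Carrier
    s₀ = t zero / (- κ zero)
    s₀>0 : 0# < s₀
    s₀>0 = /-pos (p zero κ₀<0) (neg-pos κ₀<0)
    e₀ : t zero + s₀ * κ zero ≈ 0#
    e₀ = trans (solve 3 (λ t s k → t :+ s :* k := t :- s :* (:- k)) refl (t zero) s₀ (κ zero))
      (trans (+-congˡ (-‿cong (/-*-cancel (>⇒≉ (neg-pos κ₀<0))))) (-‿inverseʳ _))
    shrink : ∀ {t κ s s′} → 0# ≤ t → 0# < s′ → s′ ≤ s → 0# ≤ t + s * κ → 0# ≤ t + s′ * κ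
    shrink {t} {κ} {s} {s′} t≥0 s′>0 s′≤s q with <-or-≥ κ 0#
    ... | inj₂ κ≥0 = +-nonneg t≥0 (*-nonneg (<⇒≤ s′>0) κ≥0)
    ... | inj₁ κ<0 = ≤-trans q (≤-by (*-nonneg (≤⇒0≤ s′≤s) (<⇒≤ (neg-pos κ<0))) (solve 4 (λ t k s r → (t :+ r :* k) :- (t :+ s :* k) := (s :- r) :* (:- k)) refl t κ s s′))
    combine : ((∀ i → 0# ≤ κ (suc i)) ⊎ ∃ λ s → 0# < s × (∀ i → 0# ≤ t (suc i) + s * κ (suc i)) × ∃ λ i → κ (suc i) < 0# × t (suc i) + s * κ (suc i) ≈ 0#) →
              (∀ i → 0# ≤ κ i) ⊎ ∃ λ s → 0# < s × (∀ i → 0# ≤ t i + s * κ i) × ∃ λ i → κ i < 0# × t i + s * κ i ≈ 0#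
    combine (inj₁ q) = inj₂ (s₀ , s₀>0 , (λ { zero → ≈⇒≥ e₀ ; (suc i) → +-nonneg (t≥0 (suc i)) (*-nonneg (<⇒≤ s₀>0) (q i)) }) , zero , κ₀<0 , e₀)
    combine (inj₂ (s , s>0 , q , i , κ<0 , e)) with ≤-total s₀ s
    ... | inj₁ s₀≤s = inj₂ (s₀ , s₀>0 , (λ { zero → ≈⇒≥ e₀ ; (suc i) → shrink (t≥0 (suc i)) s₀>0 s₀≤s (q i) }) , zero , κ₀<0 , e₀)
    ... | inj₂ s≤s₀ = inj₂ (s , s>0 , (λ { zero → shrink (t≥0 zero) s>0 s≤s₀ (≈⇒≥ e₀) ; (suc i) → q i }) , suc i , κ<0 , e)

  sum-nonneg : {f : Fin n → Carrier} → (∀ i → 0# ≤ f i) → 0# ≤ sum f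
  sum-nonneg {zero} p = ≤-refl
  sum-nonneg {suc n} p = +-nonneg (p zero) (sum-nonneg (p ∘ suc))

  sum-nonneg-zero : {f : Fin n → Carrier} → (∀ i → 0# ≤ f i) → sum f ≈ 0# → ∀ i → f i ≈ 0#
  sum-nonneg-zero {suc n} {f} p e zero = ≤-antisym (≤-trans (≤-by (sum-nonneg (p ∘ suc)) (solve 2 (λ x s → (x :+ s) :- x := s) refl (f zero) (sum (f ∘ suc)))) (≈⇒≤ e)) (p zero)
  sum-nonneg-zero {suc n} {f} p e (suc i) = sum-nonneg-zero (p ∘ suc)
    (≤-antisym (≤-trans (≤-by (p zero) (solve 2 (λ x s → (x :+ s) :- s := x) refl (f zero) (sum (f ∘ suc)))) (≈⇒≤ e)) (sum-nonneg (p ∘ suc))) i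

  Supported : (Fin n → Carrier) → Subset n → Set
  Supported t σ = (∀ {i} → i ∈ˢ σ → 0# < t i) × (∀ {i} → i ∉ˢ σ → t i ≈ 0#)

  RelOpen : (Fin n → ℝ^ d) → Subset n → ℝ^ d → Set
  RelOpen w σ z = ∃ λ t → Supported t σ × z ≋ combination t w

  Relation : (Fin n → ℝ^ d) → (Fin n → Carrier) → Set
  Relation w κ = combination κ w ≋ 0ᵛ

  supp : (Fin n → Carrier) → Subset n
  supp t = Vec.tabulate λ i → does (0# <? t i)

  ∈-supp⁺ : (t : Fin n → Carrier) {i : Fin n} → 0# < t i → i ∈ˢ supp t
  ∈-supp⁺ t {i} p = Vec.lookup⇒[]= i (supp t) (≡.trans (Vec.lookup∘tabulate _ i) (is-true (0# <? t i)))
    where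
    is-true : (q : Dec (0# < t i)) → does q ≡ true
    is-true (yes _) = ≡.refl
    is-true (no q) = ⊥-elim (q p)

  ∈-supp⁻ : (t : Fin n → Carrier) {i : Fin n} → i ∈ˢ supp t → 0# < t i
  ∈-supp⁻ t {i} p = is-true (0# <? t i) (≡.trans (≡.sym (Vec.lookup∘tabulate _ i)) (Vec.[]=⇒lookup p))
    where
    is-true : (q : Dec (0# < t i)) → does q ≡ true → 0# < t i
    is-true (yes q) _ = q

  supported : (t : Fin n → Carrier) → (∀ i → 0# ≤ t i) → Supported t (supp t)
  supported t t≥0 = ∈-supp⁻ t , λ {i} i∉ → [ (λ p → ⊥-elim (i∉ (∈-supp⁺ t p))) , sym ]′ (t≥0 i)

  supported⇒nonneg : {t : Fin n → Carrier} {σ : Subset n} → Supported t σ → ∀ i → 0# ≤ t i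
  supported⇒nonneg {σ = σ} (p , q) i with i ∈? σ
  ... | yes i∈ = <⇒≤ (p i∈)
  ... | no i∉ = ≈⇒≥ (q i∉)

  -- The closed cone generated by w is the disjoint union of the relatively open cones over the optimal faces: every
  -- point has a unique lexicographically largest representation, and optimality depends only on its support.
  module Triangulation {n d} (w : Fin n → ℝ^ d) (ξ : ℝ^ d) (w>0 : ∀ i → 0# < ⟨ w i , ξ ⟩) (priority : List (Fin n)) (all-∈ : ∀ i → i ∈ priority) where

    -- The relations that are nonnegative off σ are the directions in which a representation with
    -- support exactly σ can be moved a little. The condition mentions neither the coefficients of
    -- that representation nor ξ.
    Optimal : Subset n → Set
    Optimal σ = ∀ κ → Relation w κ → (∀ {i} → i ∉ˢ σ → 0# ≤ κ i) → ¬ LexPos priority κ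

    Indep : Subset n → Set
    Indep σ = ∀ κ → Relation w κ → (∀ {i} → i ∉ˢ σ → κ i ≈ 0#) → ∀ i → κ i ≈ 0#

    relation-neg : ∀ {κ} → Relation w κ → Relation w (λ i → - κ i)
    relation-neg {κ} r j = trans (combination-cong {w = w} (λ i → solve 1 (λ x → :- x := (:- :1) :* x) refl (κ i)) j) (trans (combination-* (- 1#) κ w j) (trans (*-congˡ (r j)) (zeroʳ _)))

    difference-relation : ∀ {t t′} → combination t w ≋ combination t′ w → Relation w (λ i → t i - t′ i)
    difference-relation {t} {t′} p j = trans (combination-+ t (λ i → - t′ i) w j) (trans (+-cong (p j)
      (trans (combination-cong {w = w} (λ i → solve 1 (λ x → :- x := (:- :1) :* x) refl (t′ i)) j) (combination-* (- 1#) t′ w j)))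
      (solve 1 (λ x → x :+ (:- :1) :* x := :0) refl (combination t′ w j)))

    shift-combination : ∀ t κ s → Relation w κ → combination (λ i → t i + s * κ i) w ≋ combination t w
    shift-combination t κ s r j = trans (combination-+ t (λ i → s * κ i) w j) (trans (+-congˡ (trans (combination-* s κ w j) (trans (*-congˡ (r j)) (zeroʳ s)))) (+-identityʳ _))

    -- Pairing the relation with ξ gives a vanishing sum of nonnegative terms.
    pointed : ∀ {κ} → Relation w κ → (∀ i → 0# ≤ κ i) → ∀ i → κ i ≈ 0#
    pointed {κ} r p i = *-cancelˡ-≈ (>⇒≉ (w>0 i)) (trans (*-comm _ _) (trans (sum-nonneg-zero (λ i → *-nonneg (p i) (<⇒≤ (w>0 i))) sum≈0 i) (sym (zeroʳ _))))
      where
      sum≈0 : sum (λ i → κ i * ⟨ w i , ξ ⟩) ≈ 0#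
      sum≈0 = trans (sym (inner-combination κ w ξ)) (sum-zero λ j → trans (*-congʳ (r j)) (zeroˡ (ξ j)))

    optimal-indep : ∀ {σ} → Optimal σ → Indep σ
    optimal-indep opt κ r off i with lex-trichotomy priority κ
    ... | inj₁ p = ⊥-elim (opt κ r (λ i∉ → ≈⇒≥ (off i∉)) p)
    ... | inj₂ (inj₁ p) = ⊥-elim (opt (λ i → - κ i) (relation-neg r) (λ i∉ → ≈⇒≥ (trans (-‿cong (off i∉)) (solve 0 (:- :0 := :0) refl))) p)
    ... | inj₂ (inj₂ p) = p (all-∈ i)

    -- The difference of the two representations, taken in either direction, is nonnegative off the
    -- support of the one subtracted. Optimality of both faces excludes that either difference is
    -- lexicographically positive.
    optimal-unique : ∀ {σ σ′ t t′} → Optimal σ → Optimal σ′ → Supported t σ → Supported t′ σ′ → combination t w ≋ combination t′ w → σ ≡ σ′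
    optimal-unique {σ} {σ′} {t} {t′} opt opt′ s s′ p = ⊆ˢ-antisym (⊆ s s′ t≈t′) (⊆ s′ s (sym ∘ t≈t′))
      where
      t≈t′ : ∀ i → t i ≈ t′ i
      t≈t′ i with lex-trichotomy priority (λ i → t i - t′ i)
      ... | inj₁ q = ⊥-elim (opt′ (λ i → t i - t′ i) (difference-relation p) (λ {i} i∉ → ≤⇒0≤ (≤-trans (≈⇒≤ (proj₂ s′ i∉)) (supported⇒nonneg s i))) q)
      ... | inj₂ (inj₁ q) = ⊥-elim (opt (λ i → t′ i - t i) (difference-relation (λ j → sym (p j))) (λ {i} i∉ → ≤⇒0≤ (≤-trans (≈⇒≤ (proj₂ s i∉)) (supported⇒nonneg s′ i)))
              (lex-cong priority (λ i → solve 2 (λ x y → :- (x :- y) := y :- x) refl (t i) (t′ i)) q))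
      ... | inj₂ (inj₂ q) = trans (solve 2 (λ x y → x := (x :- y) :+ y) refl (t i) (t′ i)) (trans (+-congʳ (q (all-∈ i))) (+-identityˡ _))
      ⊆ : ∀ {σ σ′ t t′} → Supported t σ → Supported t′ σ′ → (∀ i → t i ≈ t′ i) → ∀ {i} → i ∈ˢ σ → i ∈ˢ σ′
      ⊆ {σ′ = σ′} s s′ e {i} i∈ with i ∈? σ′
      ... | yes q = q
      ... | no q = ⊥-elim (>⇒≉ (proj₁ s i∈) (trans (e i) (proj₂ s′ q)))

    LexGeq : (t t′ : Fin n → Carrier) → Set
    LexGeq t t′ = LexPos priority (λ i → t i - t′ i) ⊎ (∀ i → t i ≈ t′ i)

    private
      Feasible : ℝ^ d → (Fin n → Carrier) → Set
      Feasible z t = (∀ i → 0# ≤ t i) × z ≋ combination t w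

      -- A lexicographically positive relation is nonzero, so by `pointed` it has a negative entry
      -- and the ratio test must stop the motion.
      improve : ∀ {z t} → Feasible z t → ∀ κ → Relation w κ → LexPos priority κ → (∀ i → κ i < 0# → 0# < t i) →
                ∃ λ s → 0# < s × Feasible z (λ i → t i + s * κ i) × ∃ λ i → κ i < 0# × t i + s * κ i ≈ 0#
      improve {z} {t} (t≥0 , zt) κ r pos neg = [ (λ κ≥0 → ⊥-elim (lex-nonzero priority pos (pointed r κ≥0)))
        , (λ { (s , s>0 , p , q) → s , s>0 , (p , λ j → trans (zt j) (sym (shift-combination t κ s r j))) , q }) ]′ (ratio-test t κ t≥0 neg)

      lex-shift : ∀ (t : Fin n → Carrier) {κ s} → 0# < s → LexPos priority κ → LexPos priority (λ i → t i + s * κ i - t i)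
      lex-shift t {κ} {s} s>0 p = lex-cong priority (λ i → solve 2 (λ t x → x := t :+ x :- t) refl (t i) (s * κ i)) (lex-* priority s>0 p)

      geq-trans : ∀ {t t′ t″ : Fin n → Carrier} → LexGeq t t′ → LexPos priority (λ i → t′ i - t″ i) → LexPos priority (λ i → t i - t″ i)
      geq-trans {t} {t′} {t″} (inj₁ p) q = lex-cong priority (λ i → solve 3 (λ x y z → (x :- y) :+ (y :- z) := x :- z) refl (t i) (t′ i) (t″ i)) (lex-+ priority p q)
      geq-trans (inj₂ e) q = lex-cong priority (λ i → +-congʳ (sym (e i))) q

      -- Carathéodory's reduction, moving only lexicographically upwards. Of a dependency inside the
      -- support or its negative, one is lexicographically positive, and following it removes an
      -- index from the support.
      reduce : ∀ {z} t → Feasible z t → Acc _⊂_ (supp t) → ∃ λ t′ → Feasible z t′ × Indep (supp t′) × LexGeq t′ t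
      reduce {z} t feas (acc rec) with em {P = ∃ λ κ → Relation w κ × (∀ {i} → i ∉ˢ supp t → κ i ≈ 0#) × LexPos priority κ}
      ... | no none = t , feas , indep , inj₂ λ _ → refl
        where
        indep : Indep (supp t)
        indep κ r off i with lex-trichotomy priority κ
        ... | inj₁ p = ⊥-elim (none (κ , r , off , p))
        ... | inj₂ (inj₁ p) = ⊥-elim (none ((λ i → - κ i) , relation-neg r , (λ i∉ → trans (-‿cong (off i∉)) (solve 0 (:- :0 := :0) refl)) , p))
        ... | inj₂ (inj₂ p) = p (all-∈ i)
      ... | yes (κ , r , off , pos) = conclude (improve feas κ r pos neg)
        where
        in-supp : ∀ {i} → κ i < 0# → i ∈ˢ supp t
        in-supp {i} κ<0 with i ∈? supp t
        ... | yes p = p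
        ... | no p = ⊥-elim (<⇒≉ κ<0 (off p))
        neg : ∀ i → κ i < 0# → 0# < t i
        neg i κ<0 = ∈-supp⁻ t (in-supp κ<0)
        conclude : (∃ λ s → 0# < s × Feasible z (λ i → t i + s * κ i) × ∃ λ i → κ i < 0# × t i + s * κ i ≈ 0#) →
                   ∃ λ t′ → Feasible z t′ × Indep (supp t′) × LexGeq t′ t
        conclude (s , s>0 , feas′ , i₀ , κ<0 , e) =
          let t″ , feas″ , indep , geq = reduce t′ feas′ (rec (sub , i₀ , in-supp κ<0 , λ p → >⇒≉ (∈-supp⁻ t′ p) e))
          in t″ , feas″ , indep , inj₁ (geq-trans {t″} {t′} {t} geq (lex-shift t s>0 pos))
          where
          t′ : Fin n → Carrier
          t′ i = t i + s * κ i
          sub : ∀ {i} → i ∈ˢ supp t′ → i ∈ˢ supp t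
          sub {i} p with i ∈? supp t
          ... | yes q = q
          ... | no q = ⊥-elim (>⇒≉ (∈-supp⁻ t′ p) (trans (+-cong (proj₂ (supported t (proj₁ feas)) q) (trans (*-congˡ (off q)) (zeroʳ s))) (+-identityʳ 0#)))

      module _ (z : ℝ^ d) where
        Candidate : (Fin n → Carrier) → Set
        Candidate t = Feasible z t × Indep (supp t)

        -- A representation of `z` with independent support is determined by the support. One choice
        -- per subset thus gives a finite list that contains all of them up to `_≈_`, and a maximum
        -- is obtained without compactness.
        candidates : List (Subset n) → List (Fin n → Carrier)
        candidates [] = []
        candidates (σ ∷ σs) with em {P = ∃ λ t → Candidate t × supp t ≡ σ}
        ... | yes (t , _) = t ∷ candidates σs
        ... | no _ = candidates σs

        candidates-sound : ∀ σs {t} → t ∈ candidates σs → Candidate t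
        candidates-sound (σ ∷ σs) t∈ with em {P = ∃ λ t → Candidate t × supp t ≡ σ}
        candidates-sound (σ ∷ σs) (here ≡.refl) | yes (t , c , _) = c
        candidates-sound (σ ∷ σs) (there t∈) | yes _ = candidates-sound σs t∈
        ... | no _ = candidates-sound σs t∈

        indep-unique : ∀ {t t′} → Candidate t → Candidate t′ → supp t ≡ supp t′ → ∀ i → t i ≈ t′ i
        indep-unique {t} {t′} ((t≥0 , zt) , ind) ((t′≥0 , zt′) , _) e i = trans (solve 2 (λ x y → x := (x :- y) :+ y) refl (t i) (t′ i))
          (trans (+-congʳ (ind (λ i → t i - t′ i) (difference-relation (λ j → trans (sym (zt j)) (zt′ j)))
            (λ {l} l∉ → trans (+-cong (proj₂ (supported t t≥0) l∉) (-‿cong (proj₂ (supported t′ t′≥0) (≡.subst (l ∉ˢ_) e l∉)))) (solve 0 (:0 :- :0 := :0) refl)) i)) (+-identityˡ _))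

        candidates-complete : ∀ σs {t} → Candidate t → supp t ∈ σs → ∃ λ t′ → t′ ∈ candidates σs × (∀ i → t i ≈ t′ i)
        candidates-complete (σ ∷ σs) c σ∈ with em {P = ∃ λ t → Candidate t × supp t ≡ σ}
        candidates-complete (σ ∷ σs) c (here e) | yes (t′ , c′ , e′) = t′ , here ≡.refl , indep-unique c c′ (≡.trans e (≡.sym e′))
        candidates-complete (σ ∷ σs) c (there σ∈) | yes _ = let t′ , t′∈ , q = candidates-complete σs c σ∈ in t′ , there t′∈ , q
        candidates-complete (σ ∷ σs) {t} c (here e) | no none = ⊥-elim (none (t , c , e))
        candidates-complete (σ ∷ σs) c (there σ∈) | no _ = candidates-complete σs c σ∈

        best : ∀ ts {t} → t ∈ ts → ∃ λ t* → t* ∈ ts × (∀ {t′} → t′ ∈ ts → ¬ LexPos priority (λ i → t′ i - t* i))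
        best (t ∷ ts) _ = lex-maximal priority t ts

        -- The largest candidate has an optimal support: a lexicographically positive admissible
        -- direction would lead to a larger representation, and `reduce` would turn that into a
        -- larger candidate.
        existence : ∀ t → Feasible z t → ∃ λ σ → Optimal σ × RelOpen w σ z
        existence t feas = supp t* , optimal , t* , supported t* (proj₁ (proj₁ c*)) , proj₂ (proj₁ c*)
          where
          R : ∃ λ t′ → Feasible z t′ × Indep (supp t′) × LexGeq t′ t
          R = reduce t feas (⊂-wellFounded (supp t))
          start : ∃ λ t′ → t′ ∈ candidates (subsets n) × (∀ i → proj₁ R i ≈ t′ i)
          start = candidates-complete (subsets n) (proj₁ (proj₂ R) , proj₁ (proj₂ (proj₂ R))) (subsets-complete (supp (proj₁ R)))
          top : ∃ λ t* → t* ∈ candidates (subsets n) × (∀ {t′} → t′ ∈ candidates (subsets n) → ¬ LexPos priority (λ i → t′ i - t* i))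
          top = best (candidates (subsets n)) (proj₁ (proj₂ start))
          t* : Fin n → Carrier
          t* = proj₁ top
          c* : Candidate t*
          c* = candidates-sound (subsets n) (proj₁ (proj₂ top))
          optimal : Optimal (supp t*)
          optimal κ r off pos = conclude (improve (proj₁ c*) κ r pos neg)
            where
            neg : ∀ i → κ i < 0# → 0# < t* i
            neg i κ<0 with i ∈? supp t*
            ... | yes p = ∈-supp⁻ t* p
            ... | no p = ⊥-elim (<⇒≱ κ<0 (off p))
            conclude : ¬ (∃ λ s → 0# < s × Feasible z (λ i → t* i + s * κ i) × ∃ λ i → κ i < 0# × t* i + s * κ i ≈ 0#)
            conclude (s , s>0 , feas′ , _) =
              let u , feas″ , ind , geq = reduce (λ i → t* i + s * κ i) feas′ (⊂-wellFounded (supp (λ i → t* i + s * κ i)))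
                  u′ , u′∈ , e = candidates-complete (subsets n) (feas″ , ind) (subsets-complete (supp u))
              in proj₂ (proj₂ top) u′∈ (lex-cong priority (λ i → +-congʳ (e i)) (geq-trans {u} {λ i → t* i + s * κ i} {t*} geq (lex-shift t* s>0 pos)))

    abstract
      optimal-exists : ∀ {z} t → (∀ i → 0# ≤ t i) → z ≋ combination t w → ∃ λ σ → Optimal σ × RelOpen w σ z
      optimal-exists {z} t t≥0 p = existence z t (t≥0 , p)

-- The integral over the cone as a sum over optimal faces.

module ConeIntegrals (em : ExcludedMiddle 0ℓ) (ℝ : CompleteOrderedField) where

  open OrderedField em ℝ
  open AbsoluteValue em ℝ
  open Limits em ℝ
  open Determinants em ℝ
  open LinearAlgebra em ℝ
  open Progressions em ℝ
  open LatticePoints em ℝ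
  open Integration em ℝ
  open OptimalFaces em ℝ
  open import Data.Fin.Properties using (_≟_; any?)
  open import Data.Fin.Subset using (Subset) renaming (_∈_ to _∈ˢ_; _∉_ to _∉ˢ_)
  open import Data.Fin.Subset.Properties using (_∈?_)
  open import Data.List.Base using ([]; _∷_)
  open import Data.List.Membership.Propositional using (_∈_)
  open import Data.List.Relation.Unary.Any using (here)
  open import Data.List.Relation.Unary.Unique.Propositional using ([]; _∷_)
  import Data.List.Relation.Unary.All as All

  private
    variable
      d n k : ℕ

  productIn productOut : Subset n → (Fin n → Carrier) → Carrier
  productIn σ f = product λ i → if does (i ∈? σ) then f i else 1#
  productOut σ f = product λ i → if does (i ∈? σ) then 1# else f i

  productIn*productOut : (σ : Subset n) (f : Fin n → Carrier) → productIn σ f * productOut σ f ≈ product f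
  productIn*productOut σ f = trans (sym (product-distrib-* (λ i → if does (i ∈? σ) then f i else 1#) (λ i → if does (i ∈? σ) then 1# else f i)))
    (product-cong λ i → split (does (i ∈? σ)) (f i))
    where
    split : ∀ b x → (if b then x else 1#) * (if b then 1# else x) ≈ x
    split true x = *-identityʳ x
    split false x = *-identityˡ x

  productIn-enumerated : {π : Fin k → Fin n} {σ : Subset n} → Enumerates π σ → (f : Fin n → Carrier) → productIn σ f ≈ product (f ∘ π)
  productIn-enumerated {π = π} {σ} (inj , into , onto) f = trans (product-reindex π inj (λ i → if does (i ∈? σ) then f i else 1#) outside-one)
    (product-cong λ q → inside-f (into q))
    where
    outside-one : ∀ l → l ∉Image π → (if does (l ∈? σ) then f l else 1#) ≈ 1#
    outside-one l l∉ with l ∈? σ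
    ... | yes p = ⊥-elim (l∉ (onto p))
    ... | no _ = refl
    inside-f : ∀ {i} → i ∈ˢ σ → (if does (i ∈? σ) then f i else 1#) ≈ f i
    inside-f {i} p with i ∈? σ
    ... | yes _ = refl
    ... | no q = ⊥-elim (q p)

  productOut-zero : (σ : Subset n) (f : Fin n → Carrier) {i : Fin n} → i ∉ˢ σ → f i ≈ 0# → productOut σ f ≈ 0#
  productOut-zero {suc n} σ f {i} i∉ p = trans (product-remove {i = i} (λ i → if does (i ∈? σ) then 1# else f i)) (trans (*-congʳ (at-i (i ∈? σ))) (zeroˡ _))
    where
    at-i : (q : Dec (i ∈ˢ σ)) → (if does q then 1# else f i) ≈ 0#
    at-i (yes q) = ⊥-elim (i∉ q)
    at-i (no _) = p

  spread : (Fin k → Fin n) → (Fin k → Carrier) → Fin n → Carrier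
  spread π y l = sum λ q → y q * e (π q) l

  spread-at : (π : Fin k → Fin n) → Injective _≡_ _≡_ π → (y : Fin k → Carrier) → ∀ q → spread π y (π q) ≈ y q
  spread-at π inj y q = trans (sum-off {f = λ p → y p * e (π p) (π q)} q (λ l l≢q → trans (*-congˡ (e-off (l≢q ∘ inj))) (zeroʳ (y l))))
    (trans (*-congˡ (e-diag (π q))) (*-identityʳ (y q)))

  spread-off : (π : Fin k → Fin n) (y : Fin k → Carrier) → ∀ l → l ∉Image π → spread π y l ≈ 0#
  spread-off π y l l∉ = sum-zero {f = λ p → y p * e (π p) l} λ p → trans (*-congˡ (e-off λ eq → l∉ (p , eq))) (zeroʳ (y p))

  spread-combination : (π : Fin k → Fin n) → Injective _≡_ _≡_ π → (y : Fin k → Carrier) (w : Fin n → ℝ^ d) →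
                       combination (spread π y) w ≋ combination y (w ∘ π)
  spread-combination π inj y w j = trans (combination-reindex π inj (spread π y) w (spread-off π y) j)
    (combination-cong {w = w ∘ π} (spread-at π inj y) j)

  spread-cases : (π : Fin k → Fin n) → Injective _≡_ _≡_ π → (y : Fin k → Carrier) → ∀ l →
                 (∃ λ q → π q ≡ l × spread π y l ≈ y q) ⊎ (l ∉Image π × spread π y l ≈ 0#)
  spread-cases π inj y l with any? (λ q → π q ≟ l)
  ... | yes (q , eq) = inj₁ (q , eq , trans (reflexive (≡.cong (spread π y) (≡.sym eq))) (spread-at π inj y q))
  ... | no l∉ = inj₂ (l∉ , spread-off π y l l∉)

  spread-nonneg : (π : Fin k → Fin n) → Injective _≡_ _≡_ π → {y : Fin k → Carrier} → (∀ q → 0# ≤ y q) → ∀ l → 0# ≤ spread π y l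
  spread-nonneg π inj {y} p l = [ (λ { (q , _ , eq) → ≤-trans (p q) (≈⇒≥ eq) }) , (λ { (_ , eq) → ≈⇒≥ eq }) ]′ (spread-cases π inj y l)

  abstract
    positive-minimum : (y : Fin k → Carrier) → (∀ q → 0# < y q) → ∃ λ m → 0# < m × (∀ q → m ≤ y q)
    positive-minimum {zero} y p = 1# , 0<1 , λ ()
    positive-minimum {suc k} y p = let m , m>0 , m≤ = positive-minimum (y ∘ suc) (p ∘ suc) ; l , l>0 , l≤m , l≤y = min-pos m>0 (p zero) in
      l , l>0 , λ { zero → l≤y ; (suc q) → ≤-trans l≤m (m≤ q) }

    -- The form in which openness is used throughout: finitely many strict inequalities survive a
    -- small move in a given direction.
    small-step : (y c : Fin k → Carrier) → (∀ q → 0# < y q) → ∃ λ δ → 0# < δ × (∀ {s} → 0# ≤ s → s ≤ δ → ∀ q → 0# < y q - s * c q)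
    small-step y c p =
      let m , m>0 , m≤ = positive-minimum y p
          G , G≥0 , b = bounded-family c
          δ , δ>0 , _ , lt = small m>0 G≥0
      in δ , δ>0 , λ s≥0 s≤δ q → <⇒0< (≤-<-trans (*-monoˡ-≤ s≥0 (proj₂ (b q))) (≤-<-trans (*-monoʳ-≤ G≥0 s≤δ) (<-≤-trans lt (m≤ q))))

  Full : (Fin n → ℝ^ d) → Subset n → (Fin d → Fin n) → Set
  Full w σ π = Enumerates π σ × ¬ det (w ∘ π) ≈ 0#

  module _ {d} (f : ℝ^ d → Carrier) (K : Pred (ℝ^ d) 0ℓ) where
    restricted-in : ∀ {x} → K x → (f restrictedTo K) x ≈ f x
    restricted-in {x} p with em {P = K x}
    ... | yes _ = refl
    ... | no q = ⊥-elim (q p)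

    restricted-out : ∀ {x} → ¬ K x → (f restrictedTo K) x ≈ 0#
    restricted-out {x} p with em {P = K x}
    ... | yes q = ⊥-elim (p q)
    ... | no _ = refl

    restricted-cases : ∀ x → (K x × (f restrictedTo K) x ≈ f x) ⊎ (¬ K x × (f restrictedTo K) x ≈ 0#)
    restricted-cases x with em {P = K x}
    ... | yes p = inj₁ (p , refl)
    ... | no p = inj₂ (p , refl)

  module Decomposition (exp : Carrier → Carrier) (isExp : IsExp exp) {n d} (v : ℝ^ d) (w : Fin n → ℝ^ d)
                       (ξ : ℝ^ d) (w>0 : ∀ i → 0# < ⟨ w i , ξ ⟩) (i₀ : Fin n) (priority : List (Fin n)) (all-∈ : ∀ i → i ∈ priority) where
    open LatticeSums exp isExp
    open Triangulation w ξ w>0 priority all-∈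

    f : ℝ^ d → Carrier
    f x = exp (- ⟨ x ⊖ v , ξ ⟩)

    face : Subset n → Pred (ℝ^ d) 0ℓ
    face σ x = RelOpen w σ (x ⊖ v)

    χ : Subset n → ℝ^ d → Carrier
    χ σ = f restrictedTo face σ

    restricted-nonneg : (K : Pred (ℝ^ d) 0ℓ) → ∀ x → 0# ≤ (f restrictedTo K) x
    restricted-nonneg K x = [ (λ { (_ , q) → ≤-trans (exp-nonneg _) (≈⇒≥ q) }) , (λ { (_ , q) → ≈⇒≥ q }) ]′ (restricted-cases f K x)

    full-coordinates : ∀ {σ π} → Full w σ π → (det≉0 : ¬ det (w ∘ π) ≈ 0#) → ∀ {z} → RelOpen w σ z → ∀ q → 0# < Coordinates.coord (w ∘ π) det≉0 z q
    full-coordinates {σ} {π} ((inj , into , onto) , _) det≉0 {z} (t , (t>0 , t≈0) , zt) q = <-respʳ (sym (coord-unique (t ∘ π) (λ j → trans (zt j) (combination-reindex π inj t w off j)) q)) (t>0 (into q))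
      where
      open Coordinates (w ∘ π) det≉0
      off : ∀ l → l ∉Image π → t l ≈ 0#
      off l l∉ = t≈0 (l∉ ∘ onto)

    full-open : ∀ {σ π} → Full w σ π → (y : Fin d → Carrier) → (∀ q → 0# < y q) → RelOpen w σ (combination y (w ∘ π))
    full-open {σ} {π} ((inj , into , onto) , _) y y>0 = spread π y , (pos , off) , λ j → sym (spread-combination π inj y w j)
      where
      pos : ∀ {i} → i ∈ˢ σ → 0# < spread π y i
      pos i∈ with onto i∈
      ... | q , ≡.refl = <-respʳ (sym (spread-at π inj y q)) (y>0 q)
      off : ∀ {i} → i ∉ˢ σ → spread π y i ≈ 0#
      off {i} i∉ = spread-off π y i λ { (q , ≡.refl) → i∉ (into q) }

    relOpen-cong : ∀ {σ z z′} → z ≋ z′ → RelOpen w σ z → RelOpen w σ z′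
    relOpen-cong e (t , s , p) = t , s , λ j → trans (sym (e j)) (p j)

    abstract
      full-limit : ∀ {σ π} → Full w σ π → Lim₂ (cornerSum (χ σ)) (∣ det (w ∘ π) ∣ / product (λ q → ⟨ w (π q) , ξ ⟩))
      full-limit {σ} {π} full@(_ , det≉0) = S.simplicial-limit (restricted-nonneg (face σ)) below above
        where
        module S = Simplicial exp isExp v ξ (w ∘ π) det≉0 (w>0 ∘ π)
        module C = Coordinates (w ∘ π) det≉0
        below : ∀ x → χ σ x ≤ E S.a (S.y x)
        below x = [ (λ { (p , q) → ≈⇒≤ (trans q (sym (S.E-on-cone x (λ i → <⇒≤ (full-coordinates full det≉0 p i))))) })
                  , (λ { (_ , q) → ≤-trans (≈⇒≤ q) (E-nonneg S.a (S.y x)) }) ]′ (restricted-cases f (face σ) x)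
        above : ∀ x → (∀ i → 0# < S.y x i) → E S.a (S.y x) ≤ χ σ x
        above x p = ≈⇒≤ (trans (S.E-on-cone x (λ i → <⇒≤ (p i))) (sym (restricted-in f (face σ)
          (relOpen-cong (λ j → sym (C.coord-spans (x ⊖ v) j)) (full-open full (S.y x) p)))))

      -- χ σ and the indicator of the open cone over a basis extending σ have disjoint supports; their sum and the latter
      -- alone satisfy the hypotheses of simplicial-limit, with the same limit.
      lower-limit : ∀ {σ} → Indep σ → ¬ (∃ λ π → Full w σ π) → Lim₂ (cornerSum (χ σ)) 0#
      lower-limit {σ} indep not-full = result (em {P = ∀ i → ∃ λ q → ρ q ≡ i})
        where
        en : ∃ λ k → ∃ λ (π : Fin k → Fin n) → Enumerates π σ
        en = enumerate σ
        size : ℕ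
        size = proj₁ en
        π : Fin size → Fin n
        π = proj₁ (proj₂ en)
        inj : Injective _≡_ _≡_ π
        inj = proj₁ (proj₂ (proj₂ en))
        into : ∀ q → π q ∈ˢ σ
        into = proj₁ (proj₂ (proj₂ (proj₂ en)))
        onto : ∀ {i} → i ∈ˢ σ → ∃ λ q → π q ≡ i
        onto = proj₂ (proj₂ (proj₂ (proj₂ en)))
        independent : Independent (w ∘ π)
        independent t p q = trans (sym (spread-at π inj t q)) (indep (spread π t) (λ j → trans (spread-combination π inj t w j) (p j))
          (λ {i} i∉ → spread-off π t i λ { (q , ≡.refl) → i∉ (into q) }) (π q))
        B₀ : ∃ λ (B : Fin d → ℝ^ d) → ¬ det B ≈ 0# × (∀ i → 0# < ⟨ B i , ξ ⟩)
        B₀ = positive-basis ξ (w i₀) (w>0 i₀)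
        -- The completed basis stays in the half-space where ξ is positive, so that
        -- `simplicial-limit` applies to its cone.
        St : ∃ λ (B : Fin d → ℝ^ d) → ¬ det B ≈ 0# × (∀ i → 0# < ⟨ B i , ξ ⟩) × ∃ λ (ρ : Fin size → Fin d) → Injective _≡_ _≡_ ρ × (∀ i → B (ρ i) ≡ w (π i))
        St = steinitz (λ u → 0# < ⟨ u , ξ ⟩) (proj₁ B₀) (proj₁ (proj₂ B₀)) (proj₂ (proj₂ B₀)) (w ∘ π) (w>0 ∘ π) independent
        B : Fin d → ℝ^ d
        B = proj₁ St
        det≉0 : ¬ det B ≈ 0#
        det≉0 = proj₁ (proj₂ St)
        B>0 : ∀ i → 0# < ⟨ B i , ξ ⟩
        B>0 = proj₁ (proj₂ (proj₂ St))
        ρ : Fin size → Fin d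
        ρ = proj₁ (proj₂ (proj₂ (proj₂ St)))
        ρ-inj : Injective _≡_ _≡_ ρ
        ρ-inj = proj₁ (proj₂ (proj₂ (proj₂ (proj₂ St))))
        Bρ : ∀ q → B (ρ q) ≡ w (π q)
        Bρ = proj₂ (proj₂ (proj₂ (proj₂ (proj₂ St))))
        module S = Simplicial exp isExp v ξ B det≉0 B>0
        module C = Coordinates B det≉0
        coordinates : ∀ {z} → ((t , _) : RelOpen w σ z) → C.coord z ≋ spread ρ (t ∘ π)
        coordinates {z} (t , (t>0 , t≈0) , zt) = C.coord-unique (spread ρ (t ∘ π)) λ j → begin
          z j ≈⟨ zt j ⟩
          combination t w j ≈⟨ combination-reindex π inj t w (λ l l∉ → t≈0 (l∉ ∘ onto)) j ⟩
          combination (t ∘ π) (w ∘ π) j ≈⟨ sum-cong (λ q → *-congˡ {t (π q)} (reflexive (≡.cong (λ u → u j) (≡.sym (Bρ q))))) ⟩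
          combination (t ∘ π) (B ∘ ρ) j ≈⟨ spread-combination ρ ρ-inj (t ∘ π) B j ⟨
          combination (spread ρ (t ∘ π)) B j ∎
          where open ≈-Reasoning
        result : Dec (∀ i → ∃ λ q → ρ q ≡ i) → Lim₂ (cornerSum (χ σ)) 0#
        result (yes sur) = ⊥-elim (not-full (π′ , (inj′ , (λ i → into (proj₁ (sur i))) , onto′) , det′))
          where
          π′ : Fin d → Fin n
          π′ i = π (proj₁ (sur i))
          inj′ : Injective _≡_ _≡_ π′
          inj′ {i} {j} p = ≡.trans (≡.sym (proj₂ (sur i))) (≡.trans (≡.cong ρ (inj p)) (proj₂ (sur j)))
          onto′ : ∀ {i} → i ∈ˢ σ → ∃ λ q → π′ q ≡ i
          onto′ i∈ = let q , eq = onto i∈ in ρ q , ≡.trans (≡.cong π (ρ-inj (proj₂ (sur (ρ q))))) eq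
          det′ : ¬ det (w ∘ π′) ≈ 0#
          det′ p = det≉0 (trans (det-cong B (w ∘ π′) (≡⇒≋ᶠ λ i → ≡.trans (≡.cong B (≡.sym (proj₂ (sur i)))) (Bρ (proj₁ (sur i))))) p)
        result (no not-sur) = lim₂-cong (λ M N → trans (+-congʳ (cornerSum-+ (χ σ) χ° M N)) (solve 2 (λ x y → (x :+ y) :+ (:- y) := x) refl (cornerSum (χ σ) M N) (cornerSum χ° M N)))
            (-‿inverseʳ S.volume) (lim₂-+ both (lim₂-neg open-limit))
          where
          missing : ∃ λ i → ¬ ∃ λ q → ρ q ≡ i
          missing with em {P = ∃ λ i → ¬ ∃ λ q → ρ q ≡ i}
          ... | yes p = p
          ... | no none = ⊥-elim (not-sur λ i → hit i (any? (λ q → ρ q ≟ i)))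
            where
            hit : ∀ i → Dec (∃ λ q → ρ q ≡ i) → ∃ λ q → ρ q ≡ i
            hit i (yes p) = p
            hit i (no p) = ⊥-elim (none (i , p))
          open-cone : Pred (ℝ^ d) 0ℓ
          open-cone x = ∀ i → 0# < S.y x i
          χ° : ℝ^ d → Carrier
          χ° = f restrictedTo open-cone
          not-open : ∀ {x} → face σ x → ¬ open-cone x
          not-open r p = >⇒≉ (p (proj₁ missing)) (trans (coordinates r (proj₁ missing)) (spread-off ρ _ (proj₁ missing) (proj₂ missing)))
          closed : ∀ {x} → face σ x → ∀ i → 0# ≤ S.y x i
          closed r@(t , (t>0 , _) , _) i = ≤-trans (spread-nonneg ρ ρ-inj (λ q → <⇒≤ (t>0 (into q))) i) (≈⇒≥ (coordinates r i))
          χ°≤E : ∀ x → χ° x ≤ E S.a (S.y x)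
          χ°≤E x = [ (λ { (p , q) → ≈⇒≤ (trans q (sym (S.E-on-cone x (λ i → <⇒≤ (p i))))) })
                   , (λ { (_ , q) → ≤-trans (≈⇒≤ q) (E-nonneg S.a (S.y x)) }) ]′ (restricted-cases f open-cone x)
          E≤χ° : ∀ x → open-cone x → E S.a (S.y x) ≤ χ° x
          E≤χ° x p = ≈⇒≤ (trans (S.E-on-cone x (λ i → <⇒≤ (p i))) (sym (restricted-in f open-cone p)))
          open-limit : Lim₂ (cornerSum χ°) S.volume
          open-limit = S.simplicial-limit (restricted-nonneg open-cone) χ°≤E E≤χ°
          both : Lim₂ (cornerSum (λ x → χ σ x + χ° x)) S.volume
          both = S.simplicial-limit (λ x → +-nonneg (restricted-nonneg (face σ) x) (restricted-nonneg open-cone x))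
            (λ x → [ (λ { (p , q) → ≈⇒≤ (trans (+-cong q (restricted-out f open-cone (not-open p))) (trans (+-identityʳ _) (sym (S.E-on-cone x (closed p))))) })
                   , (λ { (_ , q) → ≤-trans (≈⇒≤ (trans (+-congʳ q) (+-identityˡ _))) (χ°≤E x) }) ]′ (restricted-cases f (face σ) x))
            (λ x p → ≤-trans (E≤χ° x p) (≤-by (restricted-nonneg (face σ) x) (solve 2 (λ x y → (x :+ y) :- y := x) refl (χ σ x) (χ° x))))

      -- A cell of full dimension is open, so a small multiple of the sum of all generators can be
      -- subtracted from `x ⊖ v` without leaving it. Adding this multiple back makes every
      -- coefficient positive.
      full⊆cone : ∀ {σ π} → Full w σ π → ∀ {x} → face σ x → Cone v w x
      full⊆cone {σ} {π} full@((inj , _) , det≉0) {x} r = t , t>0 , eq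
        where
        open Coordinates (w ∘ π) det≉0
        one : Fin n → Carrier
        one _ = 1#
        y c : Fin d → Carrier
        y = coord (x ⊖ v)
        c = coord (combination one w)
        step : ∃ λ δ → 0# < δ × (∀ {s} → 0# ≤ s → s ≤ δ → ∀ q → 0# < y q - s * c q)
        step = small-step y c (full-coordinates full det≉0 r)
        δ : Carrier
        δ = proj₁ step
        u : Fin d → Carrier
        u q = y q - δ * c q
        t : Fin n → Carrier
        t i = δ * 1# + spread π u i
        t>0 : ∀ i → 0# < t i
        t>0 i = +-pos-nonneg (<-respʳ (sym (*-identityʳ δ)) (proj₁ (proj₂ step))) (spread-nonneg π inj (λ q → <⇒≤ (proj₂ (proj₂ step) (<⇒≤ (proj₁ (proj₂ step))) ≤-refl q)) i)
        eq : x ≋ (v ⊕ combination t w)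
        eq j = sym (begin
          v j + combination t w j ≈⟨ +-congˡ (combination-+ (λ i → δ * 1#) (spread π u) w j) ⟩
          v j + (combination (λ i → δ * 1#) w j + combination (spread π u) w j) ≈⟨ +-congˡ (+-cong (combination-* δ one w j) (spread-combination π inj u w j)) ⟩
          v j + (δ * combination one w j + combination u (w ∘ π) j) ≈⟨ +-congˡ (+-cong (*-congˡ (coord-spans (combination one w) j)) (combination-cong {w = w ∘ π} (λ q → solve 3 (λ y δ c → y :- δ :* c := y :+ (:- δ) :* c) refl (y q) δ (c q)) j)) ⟩
          v j + (δ * combination c (w ∘ π) j + combination (λ q → y q + (- δ) * c q) (w ∘ π) j)
            ≈⟨ +-congˡ (+-congˡ (trans (combination-+ y (λ q → (- δ) * c q) (w ∘ π) j) (+-cong (sym (coord-spans (x ⊖ v) j)) (combination-* (- δ) c (w ∘ π) j)))) ⟩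
          v j + (δ * combination c (w ∘ π) j + ((x j - v j) + (- δ) * combination c (w ∘ π) j))
            ≈⟨ solve 4 (λ v d c x → v :+ (d :* c :+ ((x :- v) :+ (:- d) :* c)) := x) refl (v j) δ (combination c (w ∘ π) j) (x j) ⟩
          x j ∎)
          where open ≈-Reasoning

    -- `V` is specified and not defined: an absolute determinant requires an ordering of the face,
    -- and the choice is left open so that it can be adapted to a diagonal and made independent of
    -- ξ.
    module _ (V : Subset n → Carrier)
             (V-spec : ∀ σ → (Optimal σ × ∃ λ π → Full w σ π × V σ ≈ ∣ det (w ∘ π) ∣) ⊎ (¬ (Optimal σ × ∃ λ π → Full w σ π) × V σ ≈ 0#)) where

      private
        a : Fin n → Carrier
        a i = ⟨ w i , ξ ⟩

        contribution : Subset n → Carrier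
        contribution σ = V σ / productIn σ a

        -- The decision is an argument, so that proofs can match on it in place of the opaque `em`.
        gate : (P : Set) → Dec P → Carrier → Carrier
        gate P (yes _) x = x
        gate P (no _) x = 0#

        -- Every point of the open cone lies in some optimal face, possibly of lower dimension, so
        -- `upper` counts all of them. Faces of lower dimension need not lie in the open cone, so
        -- `lower` counts the full ones only. The two differ by terms with limit zero.
        upper lower : Subset n → ℝ^ d → Carrier
        upper σ x = gate (Optimal σ) em (χ σ x)
        lower σ x = gate (Optimal σ × ∃ λ π → Full w σ π) em (χ σ x)

        productIn≉0 : ∀ σ → ¬ productIn σ a ≈ 0#
        productIn≉0 σ = >⇒≉ (product-pos (λ i → if does (i ∈? σ) then a i else 1#) λ i → pos (does (i ∈? σ)) i)
          where
          pos : ∀ b i → 0# < (if b then a i else 1#)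
          pos true i = w>0 i
          pos false i = 0<1

        full-contribution : ∀ {σ π} → Full w σ π → V σ ≈ ∣ det (w ∘ π) ∣ → Lim₂ (cornerSum (χ σ)) (contribution σ)
        full-contribution {σ} {π} full p = lim₂-cong (λ _ _ → refl) (*-cong (sym p) (⁻¹-cong (sym (productIn-enumerated (proj₁ full) a)))) (full-limit full)

        zero-contribution : ∀ {σ} → V σ ≈ 0# → 0# ≈ contribution σ
        zero-contribution p = sym (trans (*-congʳ p) (zeroˡ _))

        cornerSum-zero : ∀ M N → 0# ≈ cornerSum {d} (λ _ → 0#) M N
        cornerSum-zero M N = sym (cornerSum-0 {d} M N)

        upper-limit : ∀ σ → Lim₂ (cornerSum (upper σ)) (contribution σ)
        upper-limit σ with em {P = Optimal σ} | V-spec σ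
        ... | yes opt | inj₁ (_ , π , full , p) = full-contribution full p
        ... | yes opt | inj₂ (no-full , p) = lim₂-cong (λ _ _ → refl) (zero-contribution p) (lower-limit (optimal-indep opt) (λ q → no-full (opt , q)))
        ... | no not-opt | inj₁ (opt , _) = ⊥-elim (not-opt opt)
        ... | no _ | inj₂ (_ , p) = lim₂-cong cornerSum-zero (zero-contribution p) lim₂-zero

        lower-limit′ : ∀ σ → Lim₂ (cornerSum (lower σ)) (contribution σ)
        lower-limit′ σ with em {P = Optimal σ × ∃ λ π → Full w σ π} | V-spec σ
        ... | yes _ | inj₁ (_ , π , full , p) = full-contribution full p
        ... | yes q | inj₂ (no-full , _) = ⊥-elim (no-full q)
        ... | no q | inj₁ (opt , π , full , _) = ⊥-elim (q (opt , π , full))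
        ... | no _ | inj₂ (_ , p) = lim₂-cong cornerSum-zero (zero-contribution p) lim₂-zero

        sum-limit : (g : Subset n → ℝ^ d → Carrier) → (∀ σ → Lim₂ (cornerSum (g σ)) (contribution σ)) → ∀ σs →
                    Lim₂ (cornerSum (λ x → sumᴸ σs (λ σ → g σ x))) (sumᴸ σs contribution)
        sum-limit g p [] = lim₂-cong cornerSum-zero refl lim₂-zero
        sum-limit g p (σ ∷ σs) = lim₂-cong (λ M N → sym (cornerSum-+ (g σ) (λ x → sumᴸ σs (λ σ → g σ x)) M N)) refl (lim₂-+ (p σ) (sum-limit g p σs))

        gate-nonneg : ∀ P (q : Dec P) {x} → 0# ≤ x → 0# ≤ gate P q x
        gate-nonneg P (yes _) p = p
        gate-nonneg P (no _) p = ≤-refl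

        fK : ℝ^ d → Carrier
        fK = f restrictedTo Cone v w

        cone-face : ∀ {x} → Cone v w x → ∃ λ σ → Optimal σ × face σ x
        cone-face {x} (t , t>0 , p) = optimal-exists t (λ i → <⇒≤ (t>0 i)) λ j → trans (+-congʳ (p j)) (solve 2 (λ v c → (v :+ c) :- v := c) refl (v j) (combination t w j))

        above : ∀ x → fK x ≤ sumᴸ (subsets n) (λ σ → upper σ x)
        above x = [ (λ { (p , q) → ≤-trans (≈⇒≤ q) (in-cone (cone-face p)) })
                  , (λ { (_ , q) → ≤-trans (≈⇒≤ q) (sumᴸ-nonneg (subsets n) λ σ → gate-nonneg _ em (restricted-nonneg (face σ) x)) }) ]′ (restricted-cases f (Cone v w) x)
          where
          in-cone : (∃ λ σ → Optimal σ × face σ x) → f x ≤ sumᴸ (subsets n) (λ σ → upper σ x)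
          in-cone (σ , opt , r) = ≤-trans (≈⇒≤ (sym (trans (+-identityʳ _) (at em))))
            (sumᴸ-unique (σ ∷ []) (subsets n) (λ σ → gate-nonneg _ em (restricted-nonneg (face σ) x)) (All.[] ∷ []) λ { (here ≡.refl) → inj₂ (subsets-complete σ) })
            where
            at : (q : Dec (Optimal σ)) → gate (Optimal σ) q (χ σ x) ≈ f x
            at (yes _) = restricted-in f (face σ) r
            at (no q) = ⊥-elim (q opt)

        below : ∀ x → sumᴸ (subsets n) (λ σ → lower σ x) ≤ fK x
        below x with em {P = ∃ λ σ → Optimal σ × (∃ λ π → Full w σ π) × face σ x}
        ... | no none = ≤-trans (sumᴸ-unique (subsets n) [] (λ σ → gate-nonneg _ em (restricted-nonneg (face σ) x)) (subsets-unique n) λ {σ} _ → inj₁ (vanishes em)) (restricted-nonneg (Cone v w) x)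
          where
          vanishes : ∀ {σ} (q : Dec (Optimal σ × ∃ λ π → Full w σ π)) → gate _ q (χ σ x) ≈ 0#
          vanishes {σ} (yes (opt , full)) = restricted-out f (face σ) λ r → none (σ , opt , full , r)
          vanishes (no _) = refl
        ... | yes (σ₀ , opt₀ , (π₀ , full₀) , r₀) = ≤-trans (sumᴸ-unique (subsets n) (σ₀ ∷ []) (λ σ → gate-nonneg _ em (restricted-nonneg (face σ) x)) (subsets-unique n) λ {σ} _ → others σ em)
              (≤-trans (≈⇒≤ (+-identityʳ _)) (≤-trans (at em) (≈⇒≥ (restricted-in f (Cone v w) (full⊆cone full₀ r₀)))))
          where
          at : (q : Dec (Optimal σ₀ × ∃ λ π → Full w σ₀ π)) → gate _ q (χ σ₀ x) ≤ f x
          at (yes _) = ≈⇒≤ (restricted-in f (face σ₀) r₀)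
          at (no _) = exp-nonneg _
          others : ∀ σ (q : Dec (Optimal σ × ∃ λ π → Full w σ π)) → gate _ q (χ σ x) ≈ 0# ⊎ σ ∈ σ₀ ∷ []
          others σ (no _) = inj₁ refl
          others σ (yes (opt , _)) = [ (λ { ((t , s , p) , _) → inj₂ (here (same t s p r₀)) }) , (λ { (_ , q) → inj₁ q }) ]′ (restricted-cases f (face σ) x)
            where
            same : ∀ t → Supported t σ → (x ⊖ v) ≋ combination t w → face σ₀ x → σ ≡ σ₀
            same t s p (t₀ , s₀ , p₀) = optimal-unique opt opt₀ s s₀ λ j → trans (sym (p j)) (p₀ j)

      abstract
        cone-limit : Lim₂ (cornerSum (f restrictedTo Cone v w)) (sumᴸ (subsets n) (λ σ → V σ / productIn σ (λ i → ⟨ w i , ξ ⟩)))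
        cone-limit = lim₂-squeeze (cornerSum-mono below) (cornerSum-mono above) (sum-limit lower lower-limit′ (subsets n)) (sum-limit upper upper-limit (subsets n))

        cone-polynomial-value : ∀ {P} → IsIntegralOver (Cone v w) f (P / product (λ i → ⟨ w i , ξ ⟩)) →
                                P ≈ sumᴸ (subsets n) (λ σ → V σ * productOut σ (λ i → ⟨ w i , ξ ⟩))
        cone-polynomial-value {P} integral = begin
          P ≈⟨ /-*-cancel Π≉0 ⟨
          P / Π * Π ≈⟨ *-congʳ (lim₂-unique (integral⇒lim₂ {f = fK} integral) cone-limit) ⟩
          sumᴸ (subsets n) contribution * Π ≈⟨ *-comm _ _ ⟩
          Π * sumᴸ (subsets n) contribution ≈⟨ sumᴸ-* Π (subsets n) contribution ⟨
          sumᴸ (subsets n) (λ σ → Π * contribution σ) ≈⟨ sumᴸ-cong (subsets n) term ⟩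
          sumᴸ (subsets n) (λ σ → V σ * productOut σ a) ∎
          where
          open ≈-Reasoning
          Π : Carrier
          Π = product a
          Π≉0 : ¬ Π ≈ 0#
          Π≉0 = >⇒≉ (product-pos a w>0)
          term : ∀ σ → Π * contribution σ ≈ V σ * productOut σ a
          term σ = trans (*-congʳ (sym (productIn*productOut σ a))) (trans (solve 4 (λ i o v r → i :* o :* (v :* r) := v :* o :* (i :* r)) refl (productIn σ a) (productOut σ a) (V σ) (productIn σ a ⁻¹))
            (trans (*-congˡ (⁻¹-inverseʳ (productIn≉0 σ))) (*-identityʳ _)))

-- Gordan's alternative and the signs that decide extremality.

module ConvexCones (em : ExcludedMiddle 0ℓ) (ℝ : CompleteOrderedField) where

  open OrderedField em ℝ
  open AbsoluteValue em ℝ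
  open Limits em ℝ
  open Determinants em ℝ
  open LinearAlgebra em ℝ
  open Progressions em ℝ
  open OptimalFaces em ℝ
  open ConeIntegrals em ℝ
  open import Data.Vec.Functional using (Vector; _∷_; head; tail)

  private
    variable
      d n m k : ℕ

  inner-self : (u : ℝ^ d) → ¬ u ≋ 0ᵛ → 0# < ⟨ u , u ⟩
  inner-self u u≉0 = ≤∧≉⇒< (sum-nonneg λ j → square-nonneg (u j)) λ p → u≉0 λ j → root (sum-nonneg-zero {f = λ j → u j * u j} (λ j → square-nonneg (u j)) (sym p) j)
    where
    root : ∀ {x} → x * x ≈ 0# → x ≈ 0#
    root {x} p with x ≈? 0#
    ... | yes q = q
    ... | no q = ⊥-elim (*-≉0 q q p)

  inner-⊕ʳ : (u x y : ℝ^ d) → ⟨ u , x ⊕ y ⟩ ≈ ⟨ u , x ⟩ + ⟨ u , y ⟩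
  inner-⊕ʳ u x y = trans (inner-comm u (x ⊕ y)) (trans (inner-⊕ x y u) (+-cong (inner-comm x u) (inner-comm y u)))

  inner-⊛ʳ : (s : Carrier) (u x : ℝ^ d) → ⟨ u , s ⊛ x ⟩ ≈ s * ⟨ u , x ⟩
  inner-⊛ʳ s u x = trans (inner-comm u (s ⊛ x)) (trans (inner-⊛ s x u) (*-congˡ (inner-comm x u)))

  Positive Dependent : (Fin n → ℝ^ d) → Set
  Positive w = ∃ λ ξ → ∀ i → 0# < ⟨ w i , ξ ⟩
  Dependent w = ∃ λ t → (∀ i → 0# ≤ t i) × (∃ λ i → 0# < t i) × Relation w t

  private
    module Gordan {n d} (u : ℝ^ d) (w : Fin n → ℝ^ d) (ξ : ℝ^ d) (w>0 : ∀ i → 0# < ⟨ w i , ξ ⟩) (u≤0 : ⟨ u , ξ ⟩ ≤ 0#) where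
      β : Carrier
      β = - ⟨ u , ξ ⟩

      β≥0 : 0# ≤ β
      β≥0 = ≤-by (≤⇒0≤ u≤0) (solve 1 (λ x → (:- x) :- :0 := :0 :- x) refl ⟨ u , ξ ⟩)

      α : Fin n → Carrier
      α i = ⟨ w i , ξ ⟩

      -- The combination of u and w i which is orthogonal to ξ.
      w′ : Fin n → ℝ^ d
      w′ i = α i ⊛ u ⊕ β ⊛ w i

      inner-w′ : ∀ i η → ⟨ w′ i , η ⟩ ≈ α i * ⟨ u , η ⟩ + β * ⟨ w i , η ⟩
      inner-w′ i η = trans (inner-⊕ (α i ⊛ u) (β ⊛ w i) η) (+-cong (inner-⊛ (α i) u η) (inner-⊛ β (w i) η))

      dependent : Dependent w′ → Dependent (u ∷ w)
      dependent (t , t≥0 , (i , ti>0) , r) = c , c≥0 , (zero , c₀>0) , rel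
        where
        c : Fin (suc n) → Carrier
        c = sum (λ i → t i * α i) ∷ λ i → β * t i
        c₀≥0 : 0# ≤ sum (λ i → t i * α i)
        c₀≥0 = sum-nonneg λ i → *-nonneg (t≥0 i) (<⇒≤ (w>0 i))
        c≥0 : ∀ i → 0# ≤ c i
        c≥0 zero = c₀≥0
        c≥0 (suc i) = *-nonneg β≥0 (t≥0 i)
        c₀>0 : 0# < sum (λ i → t i * α i)
        c₀>0 = ≤∧≉⇒< c₀≥0 λ p → >⇒≉ (*-pos ti>0 (w>0 i)) (sum-nonneg-zero {f = λ i → t i * α i} (λ i → *-nonneg (t≥0 i) (<⇒≤ (w>0 i))) (sym p) i)
        rel : Relation (u ∷ w) c
        rel j = begin
          sum (λ i → t i * α i) * u j + sum (λ i → β * t i * w i j)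
            ≈⟨ +-congʳ (*-distribʳ-sum (u j) (λ i → t i * α i)) ⟩
          sum (λ i → t i * α i * u j) + sum (λ i → β * t i * w i j)
            ≈⟨ ∑-distrib-+ (λ i → t i * α i * u j) (λ i → β * t i * w i j) ⟨
          sum (λ i → t i * α i * u j + β * t i * w i j)
            ≈⟨ sum-cong (λ i → solve 5 (λ t a u b w → t :* a :* u :+ b :* t :* w := t :* (a :* u :+ b :* w)) refl (t i) (α i) (u j) β (w i j)) ⟩
          combination t w′ j ≈⟨ r j ⟩
          0# ∎
          where open ≈-Reasoning

      positive : (Fin n) → Positive w′ → Positive (u ∷ w)
      positive i₀ (ξ′ , w′>0) = [ β>0-case , β≈0-case ]′ β≥0
        where
        pos : ∀ i → 0# < α i * ⟨ u , ξ′ ⟩ + β * ⟨ w i , ξ′ ⟩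
        pos i = <-respʳ (inner-w′ i ξ′) (w′>0 i)
        -- `ξ′ ⊕ S ⊛ ξ` is orthogonal to `u` and still positive on `w`. Subtracting δ times ξ keeps
        -- it positive on `w` for small δ and gives the value δβ at `u`.
        β>0-case : 0# < β → Positive (u ∷ w)
        β>0-case β>0 = ξ′ ⊕ (S - δ) ⊛ ξ , result
          where
          S : Carrier
          S = ⟨ u , ξ′ ⟩ / β
          y : Fin n → Carrier
          y i = ⟨ w i , ξ′ ⟩ + S * α i
          y>0 : ∀ i → 0# < y i
          y>0 i = *-cancelˡ-< β>0 (<-respˡ (sym (zeroʳ β)) (<-respʳ (trans (+-congʳ (*-congˡ (sym (/-*-cancel (>⇒≉ β>0)))))
            (solve 4 (λ a s b w → a :* (s :* b) :+ b :* w := b :* (w :+ s :* a)) refl (α i) S β ⟨ w i , ξ′ ⟩)) (pos i)))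
          st : ∃ λ δ → 0# < δ × (∀ {s} → 0# ≤ s → s ≤ δ → ∀ q → 0# < y q - s * α q)
          st = small-step y α y>0
          δ : Carrier
          δ = proj₁ st
          eval-at : ∀ v → ⟨ v , ξ′ ⊕ (S - δ) ⊛ ξ ⟩ ≈ ⟨ v , ξ′ ⟩ + (S - δ) * ⟨ v , ξ ⟩
          eval-at v = trans (inner-⊕ʳ v ξ′ ((S - δ) ⊛ ξ)) (+-congˡ (inner-⊛ʳ (S - δ) v ξ))
          result : ∀ i → 0# < ⟨ (u ∷ w) i , ξ′ ⊕ (S - δ) ⊛ ξ ⟩
          result zero = <-respʳ (sym (trans (eval-at u) (trans (+-congʳ (sym (/-*-cancel (>⇒≉ β>0))))
            (solve 3 (λ s d x → s :* (:- x) :+ (s :- d) :* x := d :* (:- x)) refl S δ ⟨ u , ξ ⟩)))) (*-pos (proj₁ (proj₂ st)) β>0)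
          result (suc i) = <-respʳ (sym (trans (eval-at (w i)) (solve 4 (λ w s d a → w :+ (s :- d) :* a := w :+ s :* a :- d :* a) refl ⟨ w i , ξ′ ⟩ S δ (α i))))
            (proj₂ (proj₂ st) (<⇒≤ (proj₁ (proj₂ st))) ≤-refl i)
        -- Now `u` is orthogonal to ξ, and `w′ i` is a positive multiple of `u`; hence ξ′ is
        -- positive at `u`, and ξ is perturbed in its direction.
        β≈0-case : 0# ≈ β → Positive (u ∷ w)
        β≈0-case β≈0 = ξ ⊕ δ ⊛ ξ′ , result
          where
          st : ∃ λ δ → 0# < δ × (∀ {s} → 0# ≤ s → s ≤ δ → ∀ q → 0# < α q - s * (- ⟨ w q , ξ′ ⟩))
          st = small-step α (λ q → - ⟨ w q , ξ′ ⟩) w>0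
          δ : Carrier
          δ = proj₁ st
          u>0 : 0# < ⟨ u , ξ′ ⟩
          u>0 = *-cancelˡ-< (w>0 i₀) (<-respˡ (sym (zeroʳ (α i₀))) (<-respʳ (trans (+-congˡ (trans (*-congʳ (sym β≈0)) (zeroˡ ⟨ w i₀ , ξ′ ⟩))) (+-identityʳ _)) (pos i₀)))
          eval-at : ∀ v → ⟨ v , ξ ⊕ δ ⊛ ξ′ ⟩ ≈ ⟨ v , ξ ⟩ + δ * ⟨ v , ξ′ ⟩
          eval-at v = trans (inner-⊕ʳ v ξ (δ ⊛ ξ′)) (+-congˡ (inner-⊛ʳ δ v ξ′))
          u≈0 : ⟨ u , ξ ⟩ ≈ 0#
          u≈0 = trans (solve 1 (λ x → x := :- (:- x)) refl ⟨ u , ξ ⟩) (trans (-‿cong (sym β≈0)) (solve 0 (:- :0 := :0) refl))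
          result : ∀ i → 0# < ⟨ (u ∷ w) i , ξ ⊕ δ ⊛ ξ′ ⟩
          result zero = <-respʳ (sym (trans (eval-at u) (trans (+-congʳ u≈0) (+-identityˡ _)))) (*-pos (proj₁ (proj₂ st)) u>0)
          result (suc i) = <-respʳ (sym (trans (eval-at (w i)) (solve 3 (λ a d x → a :+ d :* x := a :- d :* (:- x)) refl (α i) δ ⟨ w i , ξ′ ⟩)))
            (proj₂ (proj₂ st) (<⇒≤ (proj₁ (proj₂ st))) ≤-refl i)

    gordan-single : (u : ℝ^ d) (w : Fin 0 → ℝ^ d) → Positive (u ∷ w) ⊎ Dependent (u ∷ w)
    gordan-single u w with em {P = u ≋ 0ᵛ}
    ... | yes u≈0 = inj₂ ((λ _ → 1#) , (λ _ → 0≤1) , (zero , 0<1) , λ j → trans (+-identityʳ _) (trans (*-identityˡ _) (u≈0 j)))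
    ... | no u≉0 = inj₁ (u , λ { zero → inner-self u u≉0 })

  abstract
    -- Gordan's theorem by induction on the number of vectors. If the form found for the tail is not
    -- positive at the head, all vectors are combined with the head into vectors orthogonal to that
    -- form, one fewer in number, and the induction hypothesis for these is translated back.
    gordan : ∀ n (w : Fin n → ℝ^ d) → Positive w ⊎ Dependent w
    gordan zero w = inj₁ (0ᵛ , λ ())
    gordan {d} (suc n) w = [ extend , (λ { (t , t≥0 , (i , p) , r) → inj₂ ((0# ∷ t) , (λ { zero → ≤-refl ; (suc i) → t≥0 i }) , (suc i , p) ,
        λ j → trans (+-cong (zeroˡ _) (r j)) (+-identityˡ 0#)) }) ]′ (gordan n (tail w))
      where
      lift : Positive (head w ∷ tail w) ⊎ Dependent (head w ∷ tail w) → Positive w ⊎ Dependent w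
      lift (inj₁ (ξ , p)) = inj₁ (ξ , λ { zero → p zero ; (suc i) → p (suc i) })
      lift (inj₂ (t , t≥0 , q , r)) = inj₂ (t , t≥0 , q , r)
      step : ∀ n (u : ℝ^ d) (w : Fin n → ℝ^ d) ξ → (∀ i → 0# < ⟨ w i , ξ ⟩) → ⟨ u , ξ ⟩ ≤ 0# → (∀ (w′ : Fin n → ℝ^ d) → Positive w′ ⊎ Dependent w′) → Positive (u ∷ w) ⊎ Dependent (u ∷ w)
      step zero u w ξ p q IH = gordan-single u w
      step (suc n) u w ξ p q IH = [ inj₁ ∘ Gordan.positive u w ξ p q zero , inj₂ ∘ Gordan.dependent u w ξ p q ]′ (IH (Gordan.w′ u w ξ p q))
      extend : Positive (tail w) → Positive w ⊎ Dependent w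
      extend (ξ , p) = [ (λ q → inj₁ (ξ , λ { zero → q ; (suc i) → p i })) , (λ q → lift (step n (head w) (tail w) ξ p q (gordan n))) ]′ (<-or-≥ 0# ⟨ head w , ξ ⟩)

    -- A nontrivial nonnegative relation with a positive coefficient at `w i₀` makes `- w i₀` a
    -- nonnegative combination of the generators. The line through `v ⊕ combination one w` in the
    -- direction `w i₀` then stays in the cone on both sides.
    strictly-convex⇒positive : (v : ℝ^ d) (w : Fin n → ℝ^ d) → (∀ i → ¬ w i ≋ 0ᵛ) → StrictlyConvex (Cone v w) → Positive w
    strictly-convex⇒positive {d} {n} v w w≉0 convex = [ id , (λ p → ⊥-elim (convex (line p))) ]′ (gordan n w)
      where
      one : Fin n → Carrier
      one _ = 1#
      line : Dependent w → ContainsLine (Cone v w)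
      line (t , t≥0 , (i₀ , t₀>0) , r) = v ⊕ combination one w , w i₀ , w≉0 i₀ , λ s → [ (λ s<0 → negative s s<0) , (λ s≥0 → nonnegative s s≥0) ]′ (<-or-≥ s 0#)
        where
        member : ∀ s (c : Fin n → Carrier) → (∀ i → 0# ≤ s * e i₀ i + c i) → Relation w c → Cone v w (v ⊕ combination one w ⊕ s ⊛ w i₀)
        member s c p q = (λ i → one i + (s * e i₀ i + c i)) , (λ i → +-pos-nonneg 0<1 (p i)) , λ j → sym (begin
          v j + combination (λ i → one i + (s * e i₀ i + c i)) w j
            ≈⟨ +-congˡ (trans (combination-+ one (λ i → s * e i₀ i + c i) w j) (+-congˡ (combination-+ (λ i → s * e i₀ i) c w j))) ⟩
          v j + (combination one w j + (combination (λ i → s * e i₀ i) w j + combination c w j))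
            ≈⟨ +-congˡ (+-congˡ (+-cong (trans (combination-* s (e i₀) w j) (*-congˡ (combination-e w i₀ j))) (q j))) ⟩
          v j + (combination one w j + (s * w i₀ j + 0#))
            ≈⟨ solve 3 (λ v c s → v :+ (c :+ (s :+ :0)) := v :+ c :+ s) refl (v j) (combination one w j) (s * w i₀ j) ⟩
          v j + combination one w j + s * w i₀ j ∎)
          where open ≈-Reasoning
        nonnegative : ∀ s → 0# ≤ s → Cone v w (v ⊕ combination one w ⊕ s ⊛ w i₀)
        nonnegative s s≥0 = member s (λ _ → 0#) (λ i → +-nonneg (*-nonneg s≥0 (e-nonneg i₀ i)) ≤-refl) (λ j → sum-zero {f = λ i → 0# * w i j} λ i → zeroˡ (w i j))
        negative : ∀ s → s < 0# → Cone v w (v ⊕ combination one w ⊕ s ⊛ w i₀)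
        negative s s<0 = member s (λ i → c * t i) nonneg (λ j → trans (combination-* c t w j) (trans (*-congˡ (r j)) (zeroʳ c)))
          where
          c : Carrier
          c = - s / t i₀
          nonneg : ∀ i → 0# ≤ s * e i₀ i + c * t i
          nonneg i with i₀ Fin.≟ i
          ... | yes ≡.refl = ≈⇒≥ (trans (+-cong (*-congˡ (e-diag i₀)) (/-*-cancel (>⇒≉ t₀>0))) (solve 1 (λ s → s :* :1 :+ (:- s) := :0) refl s))
          ... | no q = +-nonneg (≈⇒≥ (trans (*-congˡ (e-off q)) (zeroʳ s))) (*-nonneg (<⇒≤ (/-pos (neg-pos s<0) t₀>0)) (t≥0 i))

  ∷ʳ-inject₁ : {A : Set} (xs : Vector A m) (y : A) (q : Fin m) → (xs ∷ʳ y) (inject₁ q) ≡ xs q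
  ∷ʳ-inject₁ {suc m} xs y zero = ≡.refl
  ∷ʳ-inject₁ {suc m} xs y (suc q) = ∷ʳ-inject₁ (tail xs) y q

  ∷ʳ-last : {A : Set} (xs : Vector A m) (y : A) → (xs ∷ʳ y) (lastFin m) ≡ y
  ∷ʳ-last {zero} xs y = ≡.refl
  ∷ʳ-last {suc m} xs y = ∷ʳ-last (tail xs) y

  ∷ʳ-map : {A B : Set} (g : A → B) (xs : Vector A m) (y : A) → ∀ p → ((g ∘ xs) ∷ʳ g y) p ≡ g ((xs ∷ʳ y) p)
  ∷ʳ-map {zero} g xs y zero = ≡.refl
  ∷ʳ-map {suc m} g xs y zero = ≡.refl
  ∷ʳ-map {suc m} g xs y (suc p) = ∷ʳ-map g (tail xs) y p

  ∷ʳ-update-last : (xs : Vector (ℝ^ d) m) (y x : ℝ^ d) → ∀ p → ((xs ∷ʳ y) [ lastFin m ]≔ x) p ≡ (xs ∷ʳ x) p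
  ∷ʳ-update-last {m = zero} xs y x zero = ≡.refl
  ∷ʳ-update-last {m = suc m} xs y x zero = ≡.refl
  ∷ʳ-update-last {m = suc m} xs y x (suc p) = ∷ʳ-update-last (tail xs) y x p

  data LastView {m} : Fin (suc m) → Set where
    last  : LastView (lastFin m)
    inner : ∀ q → LastView (inject₁ q)

  last-view : (p : Fin (suc m)) → LastView p
  last-view {zero} zero = last
  last-view {suc m} zero = inner zero
  last-view {suc m} (suc p) with last-view p
  ... | last = last
  ... | inner q = inner (suc q)

  ∷ʳ-injective : {D : Fin m → Fin n} → Injective _≡_ _≡_ D → {a : Fin n} → a ∉Image D → Injective _≡_ _≡_ (D ∷ʳ a)
  ∷ʳ-injective {D = D} inj {a} a∉ {p} {p′} eq with last-view p | last-view p′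
  ... | last | last = ≡.refl
  ... | last | inner q = ⊥-elim (a∉ (q , ≡.trans (≡.sym (∷ʳ-inject₁ D a q)) (≡.trans (≡.sym eq) (∷ʳ-last D a))))
  ... | inner q | last = ⊥-elim (a∉ (q , ≡.trans (≡.sym (∷ʳ-inject₁ D a q)) (≡.trans eq (∷ʳ-last D a))))
  ... | inner q | inner q′ = ≡.cong inject₁ (inj (≡.trans (≡.sym (∷ʳ-inject₁ D a q)) (≡.trans eq (∷ʳ-inject₁ D a q′))))

  module Diagonal {m n} (v : ℝ^ (suc m)) (w : Fin n → ℝ^ (suc m)) (D : Fin m → Fin n) (D-inj : Injective _≡_ _≡_ D)
                  (D* : ℝ^ (suc m)) (D*-cross : IsCrossProduct (λ i → w (D i)) D*) where

    c : Fin n → Carrier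
    c j = det ((w ∘ D) ∷ʳ w j)

    c≈ : ∀ j → c j ≈ ⟨ w j , D* ⟩
    c≈ j = trans (sym (D*-cross (w j))) (inner-comm D* (w j))

    det-∷ʳ : ∀ j → det (w ∘ (D ∷ʳ j)) ≈ c j
    det-∷ʳ j = det-cong (w ∘ (D ∷ʳ j)) ((w ∘ D) ∷ʳ w j) (≡⇒≋ᶠ λ p → ≡.sym (∷ʳ-map w D j p))

    c-D : ∀ i → c (D i) ≈ 0#
    c-D i = Alternating.alt (det-alternating (suc m)) {(w ∘ D) ∷ʳ w (D i)} {inject₁ i} {lastFin m} (Fin.fromℕ≢inject₁ ∘ ≡.sym)
      λ j → reflexive (≡.cong (λ u → u j) (≡.trans (∷ʳ-inject₁ (w ∘ D) (w (D i)) i) (≡.sym (∷ʳ-last (w ∘ D) (w (D i))))))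

    c≉0⇒∉ : ∀ {j} → ¬ c j ≈ 0# → j ∉Image D
    c≉0⇒∉ c≉0 (i , ≡.refl) = c≉0 (c-D i)

    module _ {a} (ca≉0 : ¬ c a ≈ 0#) where
      π : Fin (suc m) → Fin n
      π = D ∷ʳ a

      π-inj : Injective _≡_ _≡_ π
      π-inj = ∷ʳ-injective D-inj (c≉0⇒∉ ca≉0)

      basis≉0 : ¬ det (w ∘ π) ≈ 0#
      basis≉0 p = ca≉0 (trans (sym (det-∷ʳ a)) p)

      open Coordinates (w ∘ π) basis≉0 public

      -- Cramer's rule: replacing the last vector of the basis (D, a) by `x` leaves the determinant
      -- that defines `D*`.
      coord-last : ∀ x → coord x (lastFin m) * c a ≈ ⟨ D* , x ⟩
      coord-last x = trans (*-congˡ (sym (det-∷ʳ a))) (trans (/-*-cancel basis≉0) (trans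
        (det-cong ((w ∘ π) [ lastFin m ]≔ x) ((w ∘ D) ∷ʳ x) (λ p j → trans
          (upd-cong {x = w ∘ π} (lastFin m) (≡⇒≋ᶠ λ p → ≡.sym (∷ʳ-map w D a p)) (λ _ → refl) p j)
          (reflexive (≡.cong (λ u → u j) (∷ʳ-update-last (w ∘ D) (w a) x p)))))
        (sym (D*-cross x))))

      last-zero : ∀ {x} → ⟨ D* , x ⟩ ≈ 0# → coord x (lastFin m) ≈ 0#
      last-zero {x} p = *-cancelˡ-≈ ca≉0 (trans (*-comm _ _) (trans (coord-last x) (trans p (sym (zeroʳ _)))))

      spread-coord : ∀ x → combination (spread π (coord x)) w ≋ x
      spread-coord x j = trans (spread-combination π π-inj (coord x) w j) (sym (coord-spans x j))

      -- The coordinate along `w a` vanishes on the hyperplane orthogonal to `D*`, which is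
      -- therefore spanned by D. Relations among generators are built by expanding vectors of this
      -- hyperplane.
      spread-coord-off : ∀ {x} → ⟨ D* , x ⟩ ≈ 0# → ∀ {l} → l ∉Image D → spread π (coord x) l ≈ 0#
      spread-coord-off {x} p {l} l∉ with l Fin.≟ a
      ... | yes ≡.refl = trans (reflexive (≡.cong (spread π (coord x)) (≡.sym (∷ʳ-last D a)))) (trans (spread-at π π-inj (coord x) (lastFin m)) (last-zero p))
      ... | no l≢a = spread-off π (coord x) l λ { (p , eq) → not-in p eq (last-view p) }
        where
        not-in : ∀ p → π p ≡ l → LastView p → ⊥
        not-in .(lastFin m) eq last = l≢a (≡.trans (≡.sym eq) (∷ʳ-last D a))
        not-in .(inject₁ q) eq (inner q) = l∉ (q , ≡.trans (≡.sym (∷ʳ-inject₁ D a q)) eq)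

    inner-combination-D* : ∀ t → ⟨ D* , combination t w ⟩ ≈ sum (λ i → t i * c i)
    inner-combination-D* t = trans (inner-comm D* (combination t w)) (trans (inner-combination t w D*) (sum-cong λ i → *-congˡ (sym (c≈ i))))

    abstract
      -- An interior point is exhibited in the cone over D. Some `u` on the hyperplane of D has all
      -- coefficients at least 1. For small δ, subtracting δ`u` from `combination one (w ∘ D)`
      -- leaves nonnegative coefficients, so `x` has a representation in which every generator has
      -- coefficient at least δ. This margin absorbs any small displacement.
      opposite-signs⇒¬extremal : ∀ {a b} → 0# < c a → c b < 0# → ¬ Extremal v w D
      opposite-signs⇒¬extremal {a} {b} ca>0 cb<0 extremal = proj₂ (proj₂ nearby) inside
        where
        one : ∀ {k} → Fin k → Carrier
        one _ = 1#
        x : ℝ^ (suc m)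
        x = v ⊕ combination one (w ∘ D)
        ca≉0 : ¬ c a ≈ 0#
        ca≉0 = >⇒≉ ca>0
        -- α and γ solve C + α c(a) + γ c(b) = 0 with both nonnegative, whatever the sign of C: the
        -- sum reads C + ∣C∣ - (C + ∣C∣).
        C α γ : Carrier
        C = sum c
        α = ∣ C ∣ / c a
        γ = (C + ∣ C ∣) / (- c b)
        s : Fin n → Carrier
        s i = 1# + (α * e a i + γ * e b i)
        s≥1 : ∀ i → 1# ≤ s i
        s≥1 i = ≤-by (+-nonneg (*-nonneg (*-nonneg (∣∣-nonneg C) (<⇒≤ (⁻¹-pos ca>0))) (e-nonneg a i))
                   (*-nonneg (*-nonneg (≤-by (≤⇒0≤ (proj₁ (Bnd-∣∣ C))) (solve 2 (λ c d → (c :+ d) :- :0 := c :- (:- d)) refl C ∣ C ∣)) (<⇒≤ (⁻¹-pos (neg-pos cb<0)))) (e-nonneg b i)))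
                 (solve 1 (λ x → (:1 :+ x) :- :1 := x) refl (α * e a i + γ * e b i))
        u : ℝ^ (suc m)
        u = combination s w
        u⊥ : ⟨ D* , u ⟩ ≈ 0#
        u⊥ = begin
          ⟨ D* , u ⟩ ≈⟨ inner-combination-D* s ⟩
          sum (λ i → s i * c i) ≈⟨ sum-cong (λ i → solve 5 (λ α γ x y c → (:1 :+ (α :* x :+ γ :* y)) :* c := c :+ (α :* (c :* x) :+ γ :* (c :* y))) refl α γ (e a i) (e b i) (c i)) ⟩
          sum (λ i → c i + (α * (c i * e a i) + γ * (c i * e b i)))
            ≈⟨ trans (∑-distrib-+ c (λ i → α * (c i * e a i) + γ * (c i * e b i))) (+-congˡ (∑-distrib-+ (λ i → α * (c i * e a i)) (λ i → γ * (c i * e b i)))) ⟩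
          C + (sum (λ i → α * (c i * e a i)) + sum (λ i → γ * (c i * e b i))) ≈⟨ +-congˡ (+-cong (pick α a) (pick γ b)) ⟩
          C + (α * c a + γ * c b) ≈⟨ +-congˡ (+-cong (/-*-cancel ca≉0) (trans (solve 2 (λ g x → g :* x := :- (g :* (:- x))) refl γ (c b)) (-‿cong (/-*-cancel (>⇒≉ (neg-pos cb<0)))))) ⟩
          C + (∣ C ∣ + - (C + ∣ C ∣)) ≈⟨ solve 2 (λ x y → x :+ (y :+ (:- (x :+ y))) := :0) refl C ∣ C ∣ ⟩
          0# ∎
          where
          open ≈-Reasoning
          pick : ∀ α a → sum (λ i → α * (c i * e a i)) ≈ α * c a
          pick α a = trans (sym (*-distribˡ-sum α (λ i → c i * e a i))) (*-congˡ (trans (sum-cong λ i → *-congˡ (e-sym a i)) (sum-e c a)))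
        y : Fin (suc m) → Carrier
        y = coord ca≉0 u
        st : ∃ λ δ → 0# < δ × (∀ {s} → 0# ≤ s → s ≤ δ → ∀ q → 0# < one q - s * y (inject₁ q))
        st = small-step one (y ∘ inject₁) (λ _ → 0<1)
        δ : Carrier
        δ = proj₁ st
        δ>0 : 0# < δ
        δ>0 = proj₁ (proj₂ st)
        ρ : Fin (suc m) → Fin n
        ρ = π ca≉0
        t : Fin n → Carrier
        t i = spread D one i - δ * spread ρ y i
        t≥0 : ∀ i → 0# ≤ t i
        t≥0 i = [ on-D , off-D ]′ (spread-cases D D-inj one i)
          where
          on-D : (∃ λ q → D q ≡ i × spread D one i ≈ 1#) → 0# ≤ t i
          on-D (q , eq , one≈) = <⇒≤ (<-respʳ (sym (+-cong one≈ (-‿cong (*-congˡ (trans (reflexive (≡.cong (spread ρ y) (≡.trans (≡.sym eq) (≡.sym (∷ʳ-inject₁ D a q)))))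
            (spread-at ρ (π-inj ca≉0) y (inject₁ q))))))) (proj₂ (proj₂ st) (<⇒≤ δ>0) ≤-refl q))
          off-D : i ∉Image D × spread D one i ≈ 0# → 0# ≤ t i
          off-D (i∉ , zero≈) = ≈⇒≥ (trans (+-cong zero≈ (-‿cong (*-congˡ (spread-coord-off ca≉0 u⊥ i∉)))) (solve 1 (λ d → :0 :- d :* :0 := :0) refl δ))
        t-combination : combination t w ≋ (combination one (w ∘ D) ⊕ (- δ) ⊛ u)
        t-combination j = trans (combination-cong {w = w} (λ i → solve 3 (λ x d z → x :- d :* z := x :+ (:- d) :* z) refl (spread D one i) δ (spread ρ y i)) j)
          (trans (combination-+ (spread D one) (λ i → (- δ) * spread ρ y i) w j)
            (+-cong (spread-combination D D-inj one w j) (trans (combination-* (- δ) (spread ρ y) w j) (*-congˡ (spread-coord ca≉0 u j)))))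
        -- A bound for the coordinates in terms of the largest entry; with εG < δ the coefficients
        -- of the displacement stay below the margin.
        G : ∃ λ G → 0# ≤ G × (∀ p → Bnd (sum (λ j → ∣ coord ca≉0 (e j) p ∣)) G)
        G = bounded-family (λ p → sum (λ j → ∣ coord ca≉0 (e j) p ∣))
        ε-choice : ∃ λ ε → 0# < ε × ε ≤ 1# × ε * proj₁ G < δ
        ε-choice = small δ>0 (proj₁ (proj₂ G))
        ε : Carrier
        ε = proj₁ ε-choice
        nearby : ∃ λ z → (∀ j → Near ε (x j) (z j)) × ¬ Cone v w z
        nearby = proj₂ (extremal x (one , (λ _ → 0<1) , λ _ → refl) (proj₁ (proj₂ ε-choice)))
        z Δ : ℝ^ (suc m)
        z = proj₁ nearby
        Δ = z ⊖ x
        κ : Fin (suc m) → Carrier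
        κ = coord ca≉0 Δ
        κ-bound : ∀ p → Bnd (κ p) (ε * proj₁ G)
        κ-bound p = Bnd-weaken (Bnd-cong (sym (trans (coord-cong ca≉0 (λ j → sym (sum-e Δ j)) p) (coord-combination ca≉0 Δ e p)))
            (Bnd-sum λ j → Bnd-* (Near⇒Bnd (proj₁ (proj₂ nearby) j)) (Bnd-∣∣ (coord ca≉0 (e j) p))))
          (≤-trans (≈⇒≥ (*-distribˡ-sum ε (λ j → ∣ coord ca≉0 (e j) p ∣))) (*-monoˡ-≤ (<⇒≤ (proj₁ (proj₂ ε-choice))) (proj₂ (proj₂ (proj₂ G) p))))
        spread-bound : ∀ i → Bnd (spread ρ κ i) (ε * proj₁ G)
        spread-bound i = [ (λ { (q , _ , eq) → Bnd-cong (sym eq) (κ-bound q) })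
                         , (λ { (_ , eq) → Bnd-cong (sym eq) (Bnd-0 (*-nonneg (<⇒≤ (proj₁ (proj₂ ε-choice))) (proj₁ (proj₂ G)))) }) ]′ (spread-cases ρ (π-inj ca≉0) κ i)
        coefficients : Fin n → Carrier
        coefficients i = t i + (δ * s i + spread ρ κ i)
        positive : ∀ i → 0# < coefficients i
        positive i = +-nonneg-pos (t≥0 i) (<-by
          (+-nonneg-pos (+-nonneg (*-nonneg (<⇒≤ δ>0) (≤⇒0≤ (s≥1 i))) (≤⇒0≤ (proj₁ (spread-bound i)))) (<⇒0< (proj₂ (proj₂ (proj₂ ε-choice)))))
          (solve 4 (λ d s k g → (d :* s :+ k) :- :0 := d :* (s :- :1) :+ (k :- (:- g)) :+ (d :- g)) refl δ (s i) (spread ρ κ i) (ε * proj₁ G)))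
        inside : Cone v w z
        inside = coefficients , positive , λ j → sym (begin
          v j + combination coefficients w j ≈⟨ +-congˡ (trans (combination-+ t (λ i → δ * s i + spread ρ κ i) w j) (+-congˡ (combination-+ (λ i → δ * s i) (spread ρ κ) w j))) ⟩
          v j + (combination t w j + (combination (λ i → δ * s i) w j + combination (spread ρ κ) w j))
            ≈⟨ +-congˡ (+-cong (t-combination j) (+-cong (combination-* δ s w j) (spread-coord ca≉0 Δ j))) ⟩
          v j + ((combination one (w ∘ D) j + (- δ) * u j) + (δ * u j + (z j - (v j + combination one (w ∘ D) j))))
            ≈⟨ solve 5 (λ v b d u z → v :+ ((b :+ (:- d) :* u) :+ (d :* u :+ (z :- (v :+ b)))) := z) refl (v j) (combination one (w ∘ D) j) δ (u j) (z j) ⟩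
          z j ∎)
          where open ≈-Reasoning

      -- The linear form of `D*`, multiplied by ε, is nonnegative on the cone and zero on D.
      -- Stepping from `x` against `w j₁` makes it negative, which leaves the cone; stepping along
      -- the sum of all generators enters the cone.
      same-sign⇒extremal : ∀ {ε j₁} → j₁ ∉Image D → (∀ {j} → j ∉Image D → 0# < ε * c j) → Extremal v w D
      same-sign⇒extremal {ε} {j₁} j₁∉ same x (t , t>0 , xt) {η} η>0 = near-inside , near-outside
        where
        one : Fin n → Carrier
        one _ = 1#
        close : (u : ℝ^ (suc m)) → ∃ λ δ → 0# < δ × (∀ j → Near η (x j) (x j + δ * u j) × Near η (x j) (x j - δ * u j))
        close u =
          let G , G≥0 , b = bounded-family u
              δ , δ>0 , _ , lt = small η>0 G≥0
              Bδ = Bnd-nonneg-≤ (<⇒≤ δ>0) ≤-refl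
          in δ , δ>0 , λ j →
            Bnd⇒Near lt (Bnd-cong (solve 2 (λ x y → y := (x :+ y) :- x) refl (x j) (δ * u j)) (Bnd-* Bδ (b j))) ,
            Bnd⇒Near lt (Bnd-cong (solve 2 (λ x y → :- y := (x :- y) :- x) refl (x j) (δ * u j)) (Bnd-neg (Bnd-* Bδ (b j))))
        near-inside : ∃ λ y → (∀ j → Near η (x j) (y j)) × Cone v w y
        near-inside = let δ , δ>0 , near = close (combination one w) in
          (λ j → x j + δ * combination one w j) , (λ j → proj₁ (near j)) ,
          (λ i → δ * one i + spread D t i) ,
          (λ i → +-pos-nonneg (*-pos δ>0 0<1) (spread-nonneg D D-inj (λ q → <⇒≤ (t>0 q)) i)) ,
          λ j → trans (+-congʳ (xt j)) (trans (solve 3 (λ v a b → (v :+ a) :+ b := v :+ (b :+ a)) refl (v j) (combination t (w ∘ D) j) (δ * combination one w j))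
            (+-congˡ (sym (trans (combination-+ (λ i → δ * one i) (spread D t) w j) (+-cong (combination-* δ one w j) (spread-combination D D-inj t w j))))))
        height-D : sum (λ i → spread D t i * c i) ≈ 0#
        height-D = sum-zero {f = λ i → spread D t i * c i} λ i → vanish i (Fin.any? (λ q → D q Fin.≟ i))
          where
          vanish : ∀ i → Dec (∃ λ q → D q ≡ i) → spread D t i * c i ≈ 0#
          vanish i (yes (q , ≡.refl)) = trans (*-congˡ (c-D q)) (zeroʳ _)
          vanish i (no i∉) = trans (*-congʳ (spread-off D t i i∉)) (zeroˡ _)
        near-outside : ∃ λ y → (∀ j → Near η (x j) (y j)) × ¬ Cone v w y
        near-outside = let δ , δ>0 , near = close (w j₁) in
          (λ j → x j - δ * w j₁ j) , (λ j → proj₂ (near j)) , not-in δ δ>0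
          where
          not-in : ∀ δ → 0# < δ → ¬ Cone v w (λ j → x j - δ * w j₁ j)
          not-in δ δ>0 (s , s>0 , ys) = <⇒≱ (*-pos δ>0 (same j₁∉)) (≤-by nonneg (+-identityˡ _))
            where
            eq : combination s w ≋ (combination (spread D t) w ⊕ (- δ) ⊛ w j₁)
            eq j = trans (solve 2 (λ v b → b := (v :+ b) :- v) refl (v j) (combination s w j)) (trans (+-congʳ (trans (sym (ys j)) (+-congʳ (xt j))))
              (trans (solve 4 (λ v b d u → ((v :+ b) :- d :* u) :- v := b :+ (:- d) :* u) refl (v j) (combination t (w ∘ D) j) δ (w j₁ j)) (+-congʳ (sym (spread-combination D D-inj t w j)))))
            lhs : sum (λ i → s i * c i) ≈ - (δ * c j₁)
            lhs = begin
              sum (λ i → s i * c i) ≈⟨ inner-combination-D* s ⟨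
              ⟨ D* , combination s w ⟩ ≈⟨ trans (inner-comm D* (combination s w)) (trans (inner-cong D* eq) (inner-comm (combination (spread D t) w ⊕ (- δ) ⊛ w j₁) D*)) ⟩
              ⟨ D* , combination (spread D t) w ⊕ (- δ) ⊛ w j₁ ⟩ ≈⟨ inner-⊕ʳ D* (combination (spread D t) w) ((- δ) ⊛ w j₁) ⟩
              ⟨ D* , combination (spread D t) w ⟩ + ⟨ D* , (- δ) ⊛ w j₁ ⟩
                ≈⟨ +-cong (trans (inner-combination-D* (spread D t)) height-D) (trans (inner-⊛ʳ (- δ) D* (w j₁)) (*-congˡ (D*-cross (w j₁)))) ⟩
              0# + (- δ) * c j₁ ≈⟨ solve 2 (λ d c → :0 :+ (:- d) :* c := :- (d :* c)) refl δ (c j₁) ⟩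
              - (δ * c j₁) ∎
              where open ≈-Reasoning
            terms : ∀ i → 0# ≤ s i * (ε * c i)
            terms i with Fin.any? (λ q → D q Fin.≟ i)
            ... | yes (q , ≡.refl) = ≈⇒≥ (trans (*-congˡ (trans (*-congˡ (c-D q)) (zeroʳ ε))) (zeroʳ _))
            ... | no i∉ = <⇒≤ (*-pos (s>0 i) (same i∉))
            nonneg : 0# ≤ - (δ * (ε * c j₁))
            nonneg = ≤-trans (sum-nonneg terms) (≈⇒≤ (trans (sum-cong λ i → solve 3 (λ s e c → s :* (e :* c) := e :* (s :* c)) refl (s i) ε (c i))
              (trans (sym (*-distribˡ-sum ε (λ i → s i * c i))) (trans (*-congˡ lhs) (solve 3 (λ e d c → e :* (:- (d :* c)) := :- (d :* (e :* c))) refl ε δ (c j₁))))))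

-- Polynomial functions of one variable and the extension of identities.

module PolynomialFunctions (em : ExcludedMiddle 0ℓ) (ℝ : CompleteOrderedField) where

  open OrderedField em ℝ
  open AbsoluteValue em ℝ
  open Limits em ℝ
  open Determinants em ℝ
  open LinearAlgebra em ℝ
  open Progressions em ℝ
  open LatticePoints em ℝ
  open ConeIntegrals em ℝ
  open ConvexCones em ℝ
  open import Data.Fin.Subset using (Subset)
  open import Data.Fin.Subset.Properties using (_∈?_)
  open import Data.List.Base using ([]; _∷_)
  open import Data.Vec.Base as Vec using (lookup)

  private
    variable
      d n m k : ℕ

  -- Functions of degree at most n in Horner form. As a property of functions it requires no normal
  -- form of polynomials and no comparison of coefficients.
  Poly : ℕ → (Carrier → Carrier) → Set
  Poly zero f = ∃ λ c → ∀ s → f s ≈ c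
  Poly (suc n) f = ∃ λ c → ∃ λ g → Poly n g × (∀ s → f s ≈ c + s * g s)

  poly-cong : ∀ n {f g : Carrier → Carrier} → (∀ s → f s ≈ g s) → Poly n f → Poly n g
  poly-cong zero p (c , q) = c , λ s → trans (sym (p s)) (q s)
  poly-cong (suc n) p (c , g , P , q) = c , g , P , λ s → trans (sym (p s)) (q s)

  poly-const : ∀ n c → Poly n (λ _ → c)
  poly-const zero c = c , λ _ → refl
  poly-const (suc n) c = c , (λ _ → 0#) , poly-const n 0# , λ s → solve 2 (λ c s → c := c :+ s :* :0) refl c s

  poly-suc : ∀ n {f} → Poly n f → Poly (suc n) f
  poly-suc zero (c , p) = c , (λ _ → 0#) , poly-const 0 0# , λ s → trans (p s) (solve 2 (λ c s → c := c :+ s :* :0) refl c s)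
  poly-suc (suc n) (c , g , P , q) = c , g , poly-suc n P , q

  poly-raise : ∀ m {n f} → Poly n f → Poly (m ℕ.+ n) f
  poly-raise zero P = P
  poly-raise (suc m) {n} P = poly-suc (m ℕ.+ n) (poly-raise m P)

  poly-+ : ∀ n {f g : Carrier → Carrier} → Poly n f → Poly n g → Poly n (λ s → f s + g s)
  poly-+ zero (c , p) (c′ , p′) = c + c′ , λ s → +-cong (p s) (p′ s)
  poly-+ (suc n) (c , g , P , q) (c′ , g′ , P′ , q′) = c + c′ , (λ s → g s + g′ s) , poly-+ n P P′ , λ s →
    trans (+-cong (q s) (q′ s)) (solve 5 (λ c d s x y → (c :+ s :* x) :+ (d :+ s :* y) := (c :+ d) :+ s :* (x :+ y)) refl c c′ s (g s) (g′ s))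

  poly-scale : ∀ n c {f : Carrier → Carrier} → Poly n f → Poly n (λ s → c * f s)
  poly-scale zero c (b , p) = c * b , λ s → *-congˡ (p s)
  poly-scale (suc n) c (b , g , P , q) = c * b , (λ s → c * g s) , poly-scale n c P , λ s →
    trans (*-congˡ (q s)) (solve 4 (λ c b s x → c :* (b :+ s :* x) := c :* b :+ s :* (c :* x)) refl c b s (g s))

  poly-* : ∀ m n {f g : Carrier → Carrier} → Poly m f → Poly n g → Poly (m ℕ.+ n) (λ s → f s * g s)
  poly-* zero n (c , p) Q = poly-cong n (λ s → *-congʳ (sym (p s))) (poly-scale n c Q)
  poly-* (suc m) n {f} {g} (c , f′ , P , p) Q = poly-cong (suc m ℕ.+ n) (λ s → trans (solve 4 (λ c g s x → c :* g :+ (:0 :+ s :* (x :* g)) := (c :+ s :* x) :* g) refl c (g s) s (f′ s)) (*-congʳ (sym (p s))))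
    (poly-+ (suc m ℕ.+ n) (poly-raise (suc m) (poly-scale n c Q)) (0# , (λ s → f′ s * g s) , poly-* m n P Q , λ s → refl))

  factor : ∀ n {f} → Poly (suc n) f → ∀ r → ∃ λ g → Poly n g × (∀ s → f s - f r ≈ (s - r) * g s)
  factor zero {f} (c , g , (b , p) , q) r = g , (b , p) , λ s → trans (+-cong (q s) (-‿cong (trans (q r) (+-congˡ (*-congˡ (trans (p r) (sym (p s))))))))
    (solve 4 (λ c s r g → (c :+ s :* g) :- (c :+ r :* g) := (s :- r) :* g) refl c s r (g s))
  factor (suc n) {f} (c , g , P , q) r with factor n P r
  ... | h , H , p = (λ s → g s + r * h s) , poly-+ (suc n) P (poly-suc n (poly-scale n r H)) , λ s →
    trans (+-cong (q s) (-‿cong (q r))) (trans (solve 5 (λ c s r x y → (c :+ s :* x) :- (c :+ r :* y) := (s :- r) :* x :+ r :* (x :- y)) refl c s r (g s) (g r))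
      (trans (+-congˡ (*-congˡ (p s))) (solve 4 (λ s r x h → (s :- r) :* x :+ r :* ((s :- r) :* h) := (s :- r) :* (x :+ r :* h)) refl s r (g s) (h s))))

  -- A root r in the middle of the interval is divided out; the quotient has smaller degree and
  -- vanishes on the interval from 0 to r, where s - r is nonzero.
  poly-vanishes : ∀ n {f} → Poly n f → ∀ {u} → 0# < u → (∀ {s} → 0# < s → s < u → f s ≈ 0#) → ∀ s → f s ≈ 0#
  poly-vanishes zero (c , p) {u} u>0 z s = let r , r>0 , e = halve u>0 in
    trans (p s) (trans (sym (p r)) (z r>0 (<-respʳ e (<-by r>0 (solve 1 (λ r → (r :+ r) :- r := r) refl r)))))
  poly-vanishes (suc n) {f} P {u} u>0 z s = trans (split s) (trans (*-congˡ (poly-vanishes n G r>0 g-zero s)) (zeroʳ _))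
    where
    r : Carrier
    r = proj₁ (halve u>0)
    r>0 : 0# < r
    r>0 = proj₁ (proj₂ (halve u>0))
    r<u : r < u
    r<u = <-respʳ (proj₂ (proj₂ (halve u>0))) (<-by r>0 (solve 1 (λ r → (r :+ r) :- r := r) refl r))
    g : Carrier → Carrier
    g = proj₁ (factor n P r)
    G : Poly n g
    G = proj₁ (proj₂ (factor n P r))
    split : ∀ s → f s ≈ (s - r) * g s
    split s = trans (solve 2 (λ x y → x := (x :- y) :+ y) refl (f s) (f r)) (trans (+-cong (proj₂ (proj₂ (factor n P r)) s) (z r>0 r<u)) (+-identityʳ _))
    g-zero : ∀ {s} → 0# < s → s < r → g s ≈ 0#
    g-zero {s} s>0 s<r = *-cancelˡ-≈ {z = s - r} (<⇒≉ (<-by (<⇒0< s<r) (solve 2 (λ s r → :0 :- (s :- r) := r :- s) refl s r)))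
      (trans (sym (split s)) (trans (z s>0 (<-trans s<r r<u)) (sym (zeroʳ _))))

  IsPoly : (Carrier → Carrier) → Set
  IsPoly f = ∃ λ n → Poly n f

  isPoly-const : ∀ c → IsPoly (λ _ → c)
  isPoly-const c = 0 , poly-const 0 c

  isPoly-+ : ∀ {f g : Carrier → Carrier} → IsPoly f → IsPoly g → IsPoly (λ s → f s + g s)
  isPoly-+ {f} {g} (m , P) (n , Q) = m ℕ.+ n , poly-+ (m ℕ.+ n) (≡.subst (λ k → Poly k f) (ℕ.+-comm n m) (poly-raise n P)) (poly-raise m Q)

  isPoly-* : ∀ {f g : Carrier → Carrier} → IsPoly f → IsPoly g → IsPoly (λ s → f s * g s)
  isPoly-* (m , P) (n , Q) = m ℕ.+ n , poly-* m n P Q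

  isPoly-cong : ∀ {f g : Carrier → Carrier} → (∀ s → f s ≈ g s) → IsPoly f → IsPoly g
  isPoly-cong p (n , P) = n , poly-cong n p P

  isPoly-linear : ∀ a b → IsPoly (λ s → a + s * b)
  isPoly-linear a b = 1 , a , (λ _ → b) , (b , λ _ → refl) , λ _ → refl

  isPoly-product : (f : Fin n → Carrier → Carrier) → (∀ i → IsPoly (f i)) → IsPoly (λ s → product (λ i → f i s))
  isPoly-product {zero} f p = isPoly-const 1#
  isPoly-product {suc n} f p = isPoly-* (p zero) (isPoly-product (f ∘ suc) (p ∘ suc))

  isPoly-sumᴸ : {A : Set} (xs : List A) (f : A → Carrier → Carrier) → (∀ x → IsPoly (f x)) → IsPoly (λ s → sumᴸ xs (λ x → f x s))
  isPoly-sumᴸ [] f p = isPoly-const 0#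
  isPoly-sumᴸ (x ∷ xs) f p = isPoly-+ (p x) (isPoly-sumᴸ xs f p)

  isPoly-^ : ∀ {f : Carrier → Carrier} n → IsPoly f → IsPoly (λ s → f s ^ n)
  isPoly-^ zero p = isPoly-const 1#
  isPoly-^ (suc n) p = isPoly-* p (isPoly-^ n p)

  isPoly-eval : (p : HomPoly d k) (a b : ℝ^ d) → IsPoly (λ s → eval p (a ⊕ s ⊛ b))
  isPoly-eval [] a b = isPoly-const 0#
  isPoly-eval ((c , x) ∷ p) a b = isPoly-+ (isPoly-* (isPoly-const c) (isPoly-product (λ j s → (a j + s * b j) ^ lookup (proj₁ x) j) λ j → isPoly-^ (lookup (proj₁ x) j) (isPoly-linear (a j) (b j))))
    (isPoly-eval p a b)

  eval-cong : (p : HomPoly d k) {a b : ℝ^ d} → a ≋ b → eval p a ≈ eval p b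
  eval-cong [] q = refl
  eval-cong ((c , x) ∷ p) q = +-cong (*-congˡ (product-cong λ j → ^-congˡ (lookup (proj₁ x) j) (q j))) (eval-cong p q)

  productOut-cong : (σ : Subset n) {f g : Fin n → Carrier} → (∀ i → f i ≈ g i) → productOut σ f ≈ productOut σ g
  productOut-cong σ p = product-cong λ i → choose (does (i ∈? σ)) (p i)
    where
    choose : ∀ b {x y} → x ≈ y → (if b then 1# else x) ≈ (if b then 1# else y)
    choose true _ = refl
    choose false q = q

  isPoly-productOut : (σ : Subset n) (f : Fin n → Carrier → Carrier) → (∀ i → IsPoly (f i)) → IsPoly (λ s → productOut σ (λ i → f i s))
  isPoly-productOut σ f p = isPoly-product (λ i s → if does (i ∈? σ) then 1# else f i s) λ i → choose (does (i ∈? σ)) (f i) (p i)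
    where
    choose : ∀ b f → IsPoly f → IsPoly (λ s → if b then 1# else f s)
    choose true f q = isPoly-const 1#
    choose false f q = q

  -- By restriction to the line through ξ₀.
  abstract
    extend-identity : (p : HomPoly d k) (w : Fin n → ℝ^ d) (σs : List (Subset n)) (V : Subset n → Carrier) (ξ₀ : ℝ^ d) → (∀ i → 0# < ⟨ w i , ξ₀ ⟩) →
      (∀ ξ → (∀ i → 0# < ⟨ w i , ξ ⟩) → eval p ξ ≈ sumᴸ σs (λ σ → V σ * productOut σ (λ i → ⟨ w i , ξ ⟩))) →
      ∀ ξ → eval p ξ ≈ sumᴸ σs (λ σ → V σ * productOut σ (λ i → ⟨ w i , ξ ⟩))
    extend-identity {d} p w σs V ξ₀ w>0 identity ξ = trans (eval-cong p (λ j → sym (at-1 j)))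
        (trans (solve 2 (λ x y → x := (x :- y) :+ y) refl (eval p (line 1#)) (Q (line 1#))) (trans (+-congʳ (poly-vanishes (proj₁ isPoly) (proj₂ isPoly) (proj₁ (proj₂ st)) zero-near 1#))
          (trans (+-identityˡ _) (sumᴸ-cong σs λ σ → *-congˡ (productOut-cong σ λ i → trans (inner-comm (w i) (line 1#)) (trans (inner-cong (w i) at-1) (inner-comm ξ (w i))))))))
      where
      η : ℝ^ d
      η = ξ ⊖ ξ₀
      line : Carrier → ℝ^ d
      line s = ξ₀ ⊕ s ⊛ η
      at-1 : line 1# ≋ ξ
      at-1 j = solve 2 (λ a x → a :+ :1 :* (x :- a) := x) refl (ξ₀ j) (ξ j)
      Q : ℝ^ d → Carrier
      Q ξ = sumᴸ σs (λ σ → V σ * productOut σ (λ i → ⟨ w i , ξ ⟩))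
      on-line : ∀ s i → ⟨ w i , ξ₀ ⟩ + s * ⟨ w i , η ⟩ ≈ ⟨ w i , line s ⟩
      on-line s i = sym (trans (inner-⊕ʳ (w i) ξ₀ (s ⊛ η)) (+-congˡ (inner-⊛ʳ s (w i) η)))
      isPoly : IsPoly (λ s → eval p (line s) - Q (line s))
      isPoly = isPoly-+ (isPoly-eval p ξ₀ η) (isPoly-cong (λ s → solve 1 (λ x → (:- :1) :* x := :- x) refl (Q (line s)))
        (isPoly-* (isPoly-const (- 1#)) (isPoly-sumᴸ σs (λ σ s → V σ * productOut σ (λ i → ⟨ w i , line s ⟩)) λ σ →
          isPoly-* (isPoly-const (V σ)) (isPoly-productOut σ (λ i s → ⟨ w i , line s ⟩) λ i → isPoly-cong (λ s → on-line s i) (isPoly-linear ⟨ w i , ξ₀ ⟩ ⟨ w i , η ⟩)))))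
      st : ∃ λ δ → 0# < δ × (∀ {s} → 0# ≤ s → s ≤ δ → ∀ i → 0# < ⟨ w i , ξ₀ ⟩ - s * (- ⟨ w i , η ⟩))
      st = small-step (λ i → ⟨ w i , ξ₀ ⟩) (λ i → - ⟨ w i , η ⟩) w>0
      zero-near : ∀ {s} → 0# < s → s < proj₁ st → eval p (line s) - Q (line s) ≈ 0#
      zero-near {s} s>0 s<δ = trans (+-congʳ (identity (line s) λ i → <-respʳ (trans (solve 3 (λ a s x → a :- s :* (:- x) := a :+ s :* x) refl ⟨ w i , ξ₀ ⟩ s ⟨ w i , η ⟩) (on-line s i))
        (proj₂ (proj₂ st) (<⇒≤ s>0) (<⇒≤ s<δ) i))) (-‿inverseʳ _)

-- The value at `D*`.

module DiagonalValues (em : ExcludedMiddle 0ℓ) (ℝ : CompleteOrderedField) where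

  open OrderedField em ℝ
  open AbsoluteValue em ℝ
  open Determinants em ℝ
  open LinearAlgebra em ℝ
  open Progressions em ℝ
  open LatticePoints em ℝ
  open OptimalFaces em ℝ
  open ConeIntegrals em ℝ
  open ConvexCones em ℝ
  open PolynomialFunctions em ℝ
  open import Data.Fin.Subset using (Subset) renaming (_∈_ to _∈ˢ_; _∉_ to _∉ˢ_)
  open import Data.Fin.Subset.Properties using (_∈?_; ⊆-antisym)
  open import Data.List.Base using ([]; _∷_; _++_)
  open import Data.List.Membership.Propositional using (_∈_)
  open import Data.List.Membership.Propositional.Properties using (∈-++⁺ʳ; ∈-allFin; ∈-filter⁺; ∈-filter⁻)
  open import Data.List.Relation.Unary.Any using (here; there)
  import Data.List.Relation.Unary.All as All
  open import Data.List.Relation.Unary.Unique.Propositional using ([]; _∷_)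
  open import Data.Vec.Base as Vec using (Vec; lookup)
  import Data.Vec.Properties as Vec
  open import Data.Vec.Functional using (removeAt)

  private
    variable
      d n m k : ℕ

  injective⇒surjective : (g : Fin k → Fin k) → Injective _≡_ _≡_ g → ∀ q → ∃ λ p → g p ≡ q
  injective⇒surjective {suc k} g inj q with Fin.any? (λ p → g p Fin.≟ q)
  ... | yes hit = hit
  ... | no miss = ⊥-elim (ℕ.1+n≰n (Fin.injective⇒≤ {f = λ p → punchOut (avoid p)} λ {p} {p′} eq → inj (Fin.punchOut-injective (avoid p) (avoid p′) eq)))
    where
    avoid : ∀ p → q ≢ g p
    avoid p eq = miss (p , ≡.sym eq)

  sign≉0 : (i : Fin n) → ¬ sign i ≈ 0#
  sign≉0 i p = 1≉0 (trans (sym (∣sign∣ i)) (trans (∣∣-cong p) (∣∣-of-nonneg ≤-refl)))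

  e-punchOut : {i j : Fin (suc d)} (i≢j : i ≢ j) → removeAt (e j) i ≋ e (punchOut i≢j)
  e-punchOut {i = i} {j} i≢j l with j Fin.≟ punchIn i l | punchOut i≢j Fin.≟ l
  ... | yes p | yes q = trans (trans (reflexive (≡.cong (e j) (≡.sym p))) (e-diag j)) (sym (trans (reflexive (≡.cong (e (punchOut i≢j)) (≡.sym q))) (e-diag (punchOut i≢j))))
  ... | yes p | no q = ⊥-elim (q (Fin.punchIn-injective i _ l (≡.trans (Fin.punchIn-punchOut i≢j) p)))
  ... | no p | yes q = ⊥-elim (p (≡.trans (≡.sym (Fin.punchIn-punchOut i≢j)) (≡.cong (punchIn i) q)))
  ... | no p | no q = trans (e-off p) (sym (e-off q))

  -- The expansion along the first vector has a single nonzero term, and its minor is again a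
  -- permuted standard basis. Signs of permutations never have to be computed.
  det-e-permuted : (g : Fin d → Fin d) → Injective _≡_ _≡_ g → ¬ det (e ∘ g) ≈ 0#
  det-e-permuted {zero} g inj = 1≉0
  det-e-permuted {suc d} g inj p = *-≉0 (sign≉0 (g zero)) (*-≉0 (λ q → 1≉0 (trans (sym (e-diag (g zero))) q)) minor≉0)
      (trans (sym (sum-off {f = laplace-term (e ∘ g)} (g zero) λ l l≢ → trans (*-congˡ (trans (*-congʳ (e-off (l≢ ∘ ≡.sym))) (zeroˡ _))) (zeroʳ _))) p)
    where
    q : ∀ i → g zero ≢ g (suc i)
    q i eq with () ← inj eq
    g′ : Fin d → Fin d
    g′ i = punchOut (q i)
    minor≉0 : ¬ det (minor (e ∘ g) (g zero)) ≈ 0#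
    minor≉0 r = det-e-permuted g′ (λ {i} {j} eq → Fin.suc-injective (inj (Fin.punchOut-injective (q i) (q j) eq)))
      (trans (det-cong (e ∘ g′) (minor (e ∘ g) (g zero)) λ i l → sym (e-punchOut (q i) l)) r)

  -- Multiplicativity of the determinant: the linear map that takes the standard basis to `B`,
  -- followed by `det`, is an alternating form, evaluated at `e ∘ g`.
  det-permuted : (B : Fin d → ℝ^ d) (g : Fin d → Fin d) → Injective _≡_ _≡_ g → ¬ det B ≈ 0# → ¬ det (B ∘ g) ≈ 0#
  det-permuted {d} B g inj det≉0 p = *-≉0 det≉0 (det-e-permuted g inj) (begin
    det B * det (e ∘ g) ≈⟨ *-congʳ (det-cong B (φ ∘ e) λ i j → sym (combination-e B i j)) ⟩
    det (φ ∘ e) * det (e ∘ g) ≈⟨ alternating-unique d form (e ∘ g) ⟨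
    det (φ ∘ e ∘ g) ≈⟨ det-cong (φ ∘ e ∘ g) (B ∘ g) (λ i j → combination-e B (g i) j) ⟩
    det (B ∘ g) ≈⟨ p ⟩
    0# ∎)
    where
    open ≈-Reasoning
    φ : ℝ^ d → ℝ^ d
    φ y = combination y B
    form : Alternating (λ x → det (φ ∘ x))
    form = pullback (det-alternating d) φ (λ q → combination-cong {w = B} q) (λ u v → combination-+ u v B) (λ s u → combination-* s u B)

  -- Once an initial segment has nonnegative entries, not all zero, the rest of the list has no
  -- influence. This is how the coefficients outside D decide alone.
  lex-nonneg : ∀ (is js : List (Fin n)) {κ : Fin n → Carrier} → (∀ {i} → i ∈ is → 0# ≤ κ i) → ∀ {i₀} → i₀ ∈ is → 0# < κ i₀ → LexPos (is ++ js) κ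
  lex-nonneg (i ∷ is) js p (here ≡.refl) q = inj₁ q
  lex-nonneg (i ∷ is) js p (there i₀∈) q = [ inj₁ , (λ r → inj₂ (sym r , lex-nonneg is js (p ∘ there) i₀∈ q)) ]′ (p (here ≡.refl))

  product-filter : ∀ {P : Fin n → Set} (P? : ∀ i → Dec (P i)) (f : Fin n → Carrier) (g : Fin k → Fin n) →
                   List.foldr _*_ 1# (List.map f (List.filter P? (List.tabulate g))) ≈ product (λ q → if does (P? (g q)) then f (g q) else 1#)
  product-filter {k = zero} P? f g = refl
  product-filter {k = suc k} P? f g with does (P? (g zero))
  ... | true = *-congˡ (product-filter P? f (g ∘ suc))
  ... | false = trans (product-filter P? f (g ∘ suc)) (sym (*-identityˡ _))

  product-single : (f : Fin n → Carrier) (j : Fin n) → product (λ i → if does (i Fin.≟ j) then f i else 1#) ≈ f j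
  product-single {suc n} f j = trans (product-remove {i = j} h) (trans (*-cong at-j (trans (product-cong off) (ones n))) (*-identityʳ _))
    where
    h : Fin (suc n) → Carrier
    h i = if does (i Fin.≟ j) then f i else 1#
    at-j : h j ≈ f j
    at-j with j Fin.≟ j
    ... | yes _ = refl
    ... | no q = ⊥-elim (q ≡.refl)
    off : ∀ l → removeAt h j l ≈ 1#
    off l with punchIn j l Fin.≟ j
    ... | yes p = ⊥-elim (Fin.punchInᵢ≢i j l p)
    ... | no _ = refl
    ones : ∀ n → product {n} (λ _ → 1#) ≈ 1#
    ones zero = refl
    ones (suc n) = trans (*-identityˡ _) (ones n)

  image : (Fin k → Fin n) → Subset n
  image π = Vec.tabulate λ i → does (Fin.any? (λ q → π q Fin.≟ i))

  image-enumerates : (π : Fin k → Fin n) → Injective _≡_ _≡_ π → Enumerates π (image π)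
  image-enumerates π inj = inj , (λ q → Vec.lookup⇒[]= (π q) (image π) (≡.trans (Vec.lookup∘tabulate _ (π q)) (hit q))) ,
      λ {i} i∈ → preimage i (≡.trans (≡.sym (Vec.lookup∘tabulate _ i)) (Vec.[]=⇒lookup i∈))
    where
    hit : ∀ q → does (Fin.any? (λ p → π p Fin.≟ π q)) ≡ true
    hit q with Fin.any? (λ p → π p Fin.≟ π q)
    ... | yes _ = ≡.refl
    ... | no r = ⊥-elim (r (q , ≡.refl))
    preimage : ∀ i → does (Fin.any? (λ p → π p Fin.≟ i)) ≡ true → ∃ λ q → π q ≡ i
    preimage i _ with Fin.any? (λ p → π p Fin.≟ i)
    ... | yes r = r

  module Main (exp : Carrier → Carrier) (isExp : IsExp exp) {m n : ℕ} (n>m : n ℕ.≥ suc m) (v : ℝ^ (suc m)) (w : Fin n → ℝ^ (suc m))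
              (ξ₀ : ℝ^ (suc m)) (w>0 : ∀ i → 0# < ⟨ w i , ξ₀ ⟩)
              (p : HomPoly (suc m) (n ℕ.∸ suc m)) (p-cone : IsConePolynomial exp v w p)
              (D : Fin m → Fin n) (D-inj : Injective _≡_ _≡_ D) (D* : ℝ^ (suc m)) (D*-cross : IsCrossProduct (λ i → w (D i)) D*) where
    open Diagonal v w D D-inj D* D*-cross

    ∉D? : ∀ j → Dec (j ∉Image D)
    ∉D? j = ¬? (Fin.any? (λ i → D i Fin.≟ j))

    outs : List (Fin n)
    outs = List.filter ∉D? (List.allFin n)

    ∈-outs : ∀ {j} → j ∉Image D → j ∈ outs
    ∈-outs {j} j∉ = ∈-filter⁺ ∉D? (∈-allFin j) j∉

    outs-∉ : ∀ {j} → j ∈ outs → j ∉Image D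
    outs-∉ j∈ = proj₂ (∈-filter⁻ ∉D? {xs = List.allFin n} j∈)

    exists-∉ : ∃ λ j → j ∉Image D
    exists-∉ with Fin.any? ∉D?
    ... | yes q = q
    ... | no none = ⊥-elim (ℕ.1+n≰n (ℕ.≤-trans n>m (Fin.injective⇒≤ {f = λ j → proj₁ (pre j)} λ {i} {j} eq →
          ≡.trans (≡.sym (proj₂ (pre i))) (≡.trans (≡.cong D eq) (proj₂ (pre j))))))
      where
      pre : ∀ j → ∃ λ i → D i ≡ j
      pre j with Fin.any? (λ i → D i Fin.≟ j)
      ... | yes q = q
      ... | no q = ⊥-elim (none (j , q))

    -- All indices are appended so that a vector of coefficients vanishing along the list is zero;
    -- repetitions do not change the order.
    priority : List (Fin n)
    priority = outs ++ List.allFin n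

    all-∈ : ∀ i → i ∈ priority
    all-∈ i = ∈-++⁺ʳ outs (∈-allFin i)

    open Triangulation w ξ₀ w>0 priority all-∈

    FullD : Subset n → Fin n → Set
    FullD σ j = Full w σ (D ∷ʳ j)

    -- The absolute determinant of a face does not depend on its ordering, but the ordering (D , j) is the one which
    -- can be compared with D*.
    Spec : Subset n → Carrier → Set
    Spec σ V = (Optimal σ × ∃ λ j → FullD σ j × V ≈ ∣ det (w ∘ (D ∷ʳ j)) ∣)
             ⊎ ((Optimal σ × ∃ λ π → Full w σ π × V ≈ ∣ det (w ∘ π) ∣) × ¬ (∃ λ j → FullD σ j))
             ⊎ (¬ (Optimal σ × ∃ λ π → Full w σ π) × V ≈ 0#)

    abstract
      value : ∀ σ → ∃ (Spec σ)
      value σ with em {P = Optimal σ × ∃ λ j → FullD σ j}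
      ... | yes (opt , j , full) = _ , inj₁ (opt , j , full , refl)
      ... | no noD with em {P = Optimal σ × ∃ λ π → Full w σ π}
      ...   | yes (opt , π , full) = _ , inj₂ (inj₁ ((opt , π , full , refl) , λ q → noD (opt , q)))
      ...   | no none = _ , inj₂ (inj₂ (none , refl))

    V : Subset n → Carrier
    V σ = proj₁ (value σ)

    V-spec : ∀ σ → (Optimal σ × ∃ λ π → Full w σ π × V σ ≈ ∣ det (w ∘ π) ∣) ⊎ (¬ (Optimal σ × ∃ λ π → Full w σ π) × V σ ≈ 0#)
    V-spec σ = [ (λ { (opt , j , full , q) → inj₁ (opt , D ∷ʳ j , full , q) }) , [ (λ { (q , _) → inj₁ q }) , inj₂ ]′ ]′ (proj₂ (value σ))

    abstract
      -- `V` was chosen with optimality formulated at ξ₀, but that condition does not involve the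
      -- linear form. The same `V` is therefore valid for every ξ in the dual cone, as
      -- `extend-identity` requires.
      eval-D* : eval p D* ≈ sumᴸ (subsets n) (λ σ → V σ * productOut σ c)
      eval-D* = trans (extend-identity p w (subsets n) V ξ₀ w>0
          (λ ξ pos → Decomposition.cone-polynomial-value exp isExp v w ξ pos (proj₁ exists-∉) priority all-∈ V V-spec (p-cone ξ pos)) D*)
        (sumᴸ-cong (subsets n) λ σ → *-congˡ (productOut-cong σ λ i → sym (c≈ i)))

    -- A cell has m + 1 elements, so some element `a` lies outside D. The ordering (D, a) differs
    -- from the given one by an injection of the index set into itself, and `det-permuted` keeps the
    -- determinant nonzero.
    containing-D : ∀ {σ π} → Full w σ π → (∀ i → D i ∈ˢ σ) → ∃ λ j → FullD σ j
    containing-D {σ} {π} ((π-inj , into , onto) , det≉0) D⊆σ = a , (ρ-inj , ρ-into , ρ-onto) , λ r → det-permuted (w ∘ π) g g-inj det≉0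
        (trans (det-cong (w ∘ π ∘ g) (w ∘ ρ) (≡⇒≋ᶠ λ q → ≡.cong w (proj₂ (onto (ρ-into q))))) r)
      where
      other : ∃ λ q → π q ∉Image D
      other with Fin.any? (λ q → ∉D? (π q))
      ... | yes r = r
      ... | no none = ⊥-elim (ℕ.1+n≰n (Fin.injective⇒≤ {f = λ q → proj₁ (pre q)} λ {i} {j} eq →
            π-inj (≡.trans (≡.sym (proj₂ (pre i))) (≡.trans (≡.cong D eq) (proj₂ (pre j))))))
        where
        pre : ∀ q → ∃ λ i → D i ≡ π q
        pre q with Fin.any? (λ i → D i Fin.≟ π q)
        ... | yes r = r
        ... | no r = ⊥-elim (none (q , r))
      a : Fin n
      a = π (proj₁ other)
      ρ : Fin (suc m) → Fin n
      ρ = D ∷ʳ a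
      ρ-inj : Injective _≡_ _≡_ ρ
      ρ-inj = ∷ʳ-injective D-inj (proj₂ other)
      ρ-into : ∀ q → ρ q ∈ˢ σ
      ρ-into q with last-view q
      ... | last = ≡.subst (_∈ˢ σ) (≡.sym (∷ʳ-last D a)) (into (proj₁ other))
      ... | inner i = ≡.subst (_∈ˢ σ) (≡.sym (∷ʳ-inject₁ D a i)) (D⊆σ i)
      g : Fin (suc m) → Fin (suc m)
      g q = proj₁ (onto (ρ-into q))
      πg : ∀ q → π (g q) ≡ ρ q
      πg q = proj₂ (onto (ρ-into q))
      g-inj : Injective _≡_ _≡_ g
      g-inj {q} {q′} eq = ρ-inj (≡.trans (≡.sym (πg q)) (≡.trans (≡.cong π eq) (πg q′)))
      ρ-onto : ∀ {i} → i ∈ˢ σ → ∃ λ q → ρ q ≡ i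
      ρ-onto i∈ = let q , eq = onto i∈ ; q′ , eq′ = injective⇒surjective g g-inj q in
        q′ , ≡.trans (≡.sym (πg q′)) (≡.trans (≡.cong π eq′) eq)

    Surviving : Subset n → Set
    Surviving σ = ∃ λ j → Optimal σ × FullD σ j × V σ ≈ ∣ det (w ∘ (D ∷ʳ j)) ∣

    -- If a cell misses some `D i`, its product over the complement contains `c (D i)`, which is
    -- zero.
    only-D : ∀ σ → V σ * productOut σ c ≈ 0# ⊎ Surviving σ
    only-D σ = [ (λ { (opt , j , full , q) → inj₂ (j , opt , full , q) }) ,
                 [ (λ { ((opt , π , full , _) , noD) → inj₁ (no-D full noD) })
                 , (λ { (_ , q) → inj₁ (trans (*-congʳ q) (zeroˡ _)) }) ]′ ]′ (proj₂ (value σ))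
      where
      no-D : ∀ {π} → Full w σ π → ¬ (∃ λ j → FullD σ j) → V σ * productOut σ c ≈ 0#
      no-D full noD with Fin.any? (λ i → ¬? (D i ∈? σ))
      ... | yes (i , Di∉) = trans (*-congˡ (productOut-zero σ c Di∉ (c-D i))) (zeroʳ _)
      ... | no none = ⊥-elim (noD (containing-D full λ i → inside-σ i (D i ∈? σ)))
        where
        inside-σ : ∀ i → Dec (D i ∈ˢ σ) → D i ∈ˢ σ
        inside-σ i (yes r) = r
        inside-σ i (no r) = ⊥-elim (none (i , r))

    module Surv {σ j} (full : FullD σ j) where
      cj≉0 : ¬ c j ≈ 0#
      cj≉0 r = proj₂ full (trans (det-∷ʳ j) r)

      j∉ : j ∉Image D
      j∉ = c≉0⇒∉ cj≉0

      j∈ : j ∈ˢ σ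
      j∈ = ≡.subst (_∈ˢ σ) (∷ʳ-last D j) (proj₁ (proj₂ (proj₁ full)) (lastFin m))

      D∈ : ∀ i → D i ∈ˢ σ
      D∈ i = ≡.subst (_∈ˢ σ) (∷ʳ-inject₁ D j i) (proj₁ (proj₂ (proj₁ full)) (inject₁ i))

      outside-D : ∀ {i} → i ∉ˢ σ → i ∉Image D
      outside-D i∉ (q , ≡.refl) = i∉ (D∈ q)

      only-j : ∀ {i} → i ∈ˢ σ → i ∉Image D → i ≡ j
      only-j {i} i∈ i∉ = cases (proj₁ pre) (proj₂ pre) (last-view (proj₁ pre))
        where
        pre : ∃ λ q → (D ∷ʳ j) q ≡ i
        pre = proj₂ (proj₂ (proj₁ full)) i∈
        cases : ∀ q → (D ∷ʳ j) q ≡ i → LastView q → i ≡ j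
        cases .(lastFin m) eq last = ≡.trans (≡.sym eq) (∷ʳ-last D j)
        cases .(inject₁ q) eq (inner q) = ⊥-elim (i∉ (q , ≡.trans (≡.sym (∷ʳ-inject₁ D j q)) eq))

    total-zero : (∀ σ → Surviving σ → V σ * productOut σ c ≈ 0#) → eval p D* ≈ 0#
    total-zero q = trans eval-D* (trans (sumᴸ-cong (subsets n) λ σ → [ id , q σ ]′ (only-D σ)) (zeros (subsets n)))
      where
      zeros : ∀ (σs : List (Subset n)) → sumᴸ σs (λ _ → 0#) ≈ 0#
      zeros [] = refl
      zeros (σ ∷ σs) = trans (+-identityˡ _) (zeros σs)

    -- The element of a surviving cell outside D has a nonzero determinant, so it is not `j`; hence
    -- `c j` is among the factors of the complement.
    degenerate : ∀ {j} → j ∉Image D → c j ≈ 0# → eval p D* ≈ 0#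
    degenerate {j} j∉ cj≈0 = total-zero zero-term
      where
      zero-term : ∀ σ → Surviving σ → V σ * productOut σ c ≈ 0#
      zero-term σ (j′ , _ , full , _) with j ∈? σ
      ... | no j∉σ = trans (*-congˡ (productOut-zero σ c j∉σ cj≈0)) (zeroʳ _)
      ... | yes j∈σ = ⊥-elim (Surv.cj≉0 full (≡.subst (λ i → c i ≈ 0#) (Surv.only-j full j∈σ j∉) cj≈0))

    opposite-signs : ∀ {a b} → 0# < c a → c b < 0# → eval p D* ≈ 0#
    opposite-signs {a} {b} ca>0 cb<0 = total-zero λ { σ (j , opt , full , _) → ⊥-elim (not-optimal full opt) }
      where
      ca≉0 : ¬ c a ≈ 0#
      ca≉0 = >⇒≉ ca>0
      -- w b + μ w a lies in the hyperplane of D; the resulting relation improves every representation whose support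
      -- contains D.
      μ : Carrier
      μ = (- c b) / c a
      μ>0 : 0# < μ
      μ>0 = /-pos (neg-pos cb<0) ca>0
      t : Fin n → Carrier
      t i = e b i + μ * e a i
      t≥0 : ∀ i → 0# ≤ t i
      t≥0 i = +-nonneg (e-nonneg b i) (*-nonneg (<⇒≤ μ>0) (e-nonneg a i))
      x : ℝ^ (suc m)
      x = combination t w
      x≈ : x ≋ (w b ⊕ μ ⊛ w a)
      x≈ j = trans (combination-+ (e b) (λ i → μ * e a i) w j) (+-cong (combination-e w b j) (trans (combination-* μ (e a) w j) (*-congˡ (combination-e w a j))))
      x⊥ : ⟨ D* , x ⟩ ≈ 0#
      x⊥ = begin
        ⟨ D* , x ⟩ ≈⟨ trans (inner-comm D* x) (trans (inner-cong D* x≈) (inner-⊕ (w b) (μ ⊛ w a) D*)) ⟩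
        ⟨ w b , D* ⟩ + ⟨ μ ⊛ w a , D* ⟩ ≈⟨ +-cong (sym (c≈ b)) (trans (inner-⊛ μ (w a) D*) (*-congˡ (sym (c≈ a)))) ⟩
        c b + μ * c a ≈⟨ +-congˡ (/-*-cancel ca≉0) ⟩
        c b + - c b ≈⟨ -‿inverseʳ (c b) ⟩
        0# ∎
        where open ≈-Reasoning
      y κ : Fin n → Carrier
      y = spread (π ca≉0) (coord ca≉0 x)
      κ i = t i - y i
      κ-relation : Relation w κ
      κ-relation = difference-relation λ j → sym (spread-coord ca≉0 x j)
      κ≈t : ∀ {i} → i ∉Image D → κ i ≈ t i
      κ≈t {i} i∉ = trans (+-congˡ (-‿cong (spread-coord-off ca≉0 x⊥ i∉))) (solve 1 (λ t → t :- :0 := t) refl (t i))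
      κ>0 : 0# < κ a
      κ>0 = <-respʳ (sym (κ≈t (c≉0⇒∉ ca≉0))) (+-nonneg-pos (e-nonneg b a) (*-pos μ>0 (<-respʳ (sym (e-diag a)) 0<1)))
      not-optimal : ∀ {σ j} → FullD σ j → ¬ Optimal σ
      not-optimal full opt = opt κ κ-relation (λ {i} i∉ → ≤-trans (t≥0 i) (≈⇒≥ (κ≈t (Surv.outside-D full i∉))))
        (lex-nonneg outs (List.allFin n) (λ {i} i∈ → ≤-trans (t≥0 i) (≈⇒≥ (κ≈t (outs-∉ i∈)))) (∈-outs (c≉0⇒∉ ca≉0)) κ>0)

    same-sign : ∀ {ε} → ε ≈ 1# ⊎ ε ≈ - 1# → (∀ {j} → j ∉Image D → 0# < ε * c j) → eval p D* ≈ ε * productOutside D c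
    same-sign {ε} ε≈±1 same = from-first outs ≡.refl
      where
      εε : ε * ε ≈ 1#
      εε = [ (λ q → trans (*-cong q q) (*-identityˡ 1#)) , (λ q → trans (*-cong q q) (solve 0 ((:- :1) :* (:- :1) := :1) refl)) ]′ ε≈±1
      c≉0 : ∀ {j} → j ∉Image D → ¬ c j ≈ 0#
      c≉0 j∉ q = >⇒≉ (same j∉) (trans (*-congˡ q) (zeroʳ ε))
      ∣c∣ : ∀ {j} → j ∉Image D → ∣ c j ∣ ≈ ε * c j
      ∣c∣ {j} j∉ = trans (∣∣-cong (trans (sym (*-identityˡ (c j))) (trans (*-congʳ (sym εε)) (*-assoc ε ε (c j)))))
        (trans (∣∣-* ε (ε * c j)) (trans (*-cong ∣ε∣ (∣∣-of-nonneg (<⇒≤ (same j∉)))) (*-identityˡ _)))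
        where
        ∣ε∣ : ∣ ε ∣ ≈ 1#
        ∣ε∣ = [ (λ q → trans (∣∣-cong q) (∣∣-of-nonneg 0≤1)) , (λ q → trans (∣∣-cong q) (trans (∣∣-neg 1#) (∣∣-of-nonneg 0≤1))) ]′ ε≈±1
      -- The list is abstracted so that matching exposes the head of `outs`, the generator `j₁`
      -- outside D of highest priority. The surviving cell is D together with `j₁`.
      from-first : ∀ js → js ≡ outs → eval p D* ≈ ε * productOutside D c
      from-first [] eq with () ← ≡.subst (proj₁ exists-∉ ∈_) (≡.sym eq) (∈-outs (proj₂ exists-∉))
      from-first (j₁ ∷ js) eq = trans eval-D* (trans only-σ₁ value-σ₁)
        where
        j₁∉ : j₁ ∉Image D
        j₁∉ = outs-∉ (≡.subst (j₁ ∈_) eq (here ≡.refl))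
        σ₁ : Subset n
        σ₁ = image (D ∷ʳ j₁)
        full₁ : FullD σ₁ j₁
        full₁ = image-enumerates (D ∷ʳ j₁) (∷ʳ-injective D-inj j₁∉) , λ q → c≉0 j₁∉ (trans (sym (det-∷ʳ j₁)) q)

        head-lex : ∀ {κ} → LexPos priority κ → 0# ≤ κ j₁
        head-lex {κ} q = [ <⇒≤ , (λ { (r , _) → ≈⇒≥ r }) ]′ (≡.subst (λ is → LexPos (is ++ List.allFin n) κ) (≡.sym eq) q)

        -- Pairing with `D*` turns the relation into the sum of the terms κ(i) ε c(i), equal to
        -- zero. Off σ₁ the coefficients are nonnegative by hypothesis, at `j₁` because it is
        -- compared first, and on D the factor c vanishes. So all terms are zero, κ is supported on
        -- D, and independence gives κ = 0.
        optimal₁ : Optimal σ₁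
        optimal₁ κ r off pos = lex-nonzero priority pos (full-indep κ r λ {i} i∉ → κ-zero (Surv.outside-D full₁ i∉))
          where
          term : Fin n → Carrier
          term i = κ i * (ε * c i)
          term≥0 : ∀ i → 0# ≤ term i
          term≥0 i with Fin.any? (λ q → D q Fin.≟ i)
          ... | yes (q , ≡.refl) = ≈⇒≥ (trans (*-congˡ (trans (*-congˡ (c-D q)) (zeroʳ ε))) (zeroʳ _))
          ... | no i∉ = *-nonneg (κ≥0 (i ∈? σ₁)) (<⇒≤ (same i∉))
            where
            κ≥0 : Dec (i ∈ˢ σ₁) → 0# ≤ κ i
            κ≥0 (no i∉σ) = off i∉σ
            κ≥0 (yes i∈σ) = ≡.subst (λ l → 0# ≤ κ l) (≡.sym (Surv.only-j full₁ i∈σ i∉)) (head-lex pos)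
          sum≈0 : sum term ≈ 0#
          sum≈0 = begin
            sum (λ i → κ i * (ε * c i)) ≈⟨ sum-cong (λ i → solve 3 (λ k e c → k :* (e :* c) := e :* (k :* c)) refl (κ i) ε (c i)) ⟩
            sum (λ i → ε * (κ i * c i)) ≈⟨ *-distribˡ-sum ε (λ i → κ i * c i) ⟨
            ε * sum (λ i → κ i * c i) ≈⟨ *-congˡ (trans (sym (inner-combination-D* κ)) (trans (inner-comm D* (combination κ w)) (sum-zero {f = λ j → combination κ w j * D* j} λ j → trans (*-congʳ (r j)) (zeroˡ (D* j))))) ⟩
            ε * 0# ≈⟨ zeroʳ ε ⟩
            0# ∎
            where open ≈-Reasoning
          κ-zero : ∀ {i} → i ∉Image D → κ i ≈ 0#
          κ-zero {i} i∉ = *-cancelˡ-≈ (>⇒≉ (same i∉)) (trans (*-comm _ _) (trans (sum-nonneg-zero {f = term} term≥0 sum≈0 i) (sym (zeroʳ _))))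
          full-indep : Indep σ₁
          full-indep κ r off i with i ∈? σ₁
          ... | no i∉ = off i∉
          ... | yes i∈ with proj₂ (proj₂ (proj₁ full₁)) i∈
          ...   | q , ≡.refl = trans (sym (C.coord-unique (κ ∘ ρ) (λ j → trans (sym (r j)) (combination-reindex ρ (proj₁ (proj₁ full₁)) κ w off′ j)) q))
                   (C.coord-unique (λ _ → 0#) (λ j → sym (sum-zero {f = λ p → 0# * w (ρ p) j} λ p → zeroˡ (w (ρ p) j))) q)
            where
            ρ : Fin (suc m) → Fin n
            ρ = D ∷ʳ j₁
            module C = Coordinates (w ∘ ρ) (proj₂ full₁)
            off′ : ∀ l → l ∉Image ρ → κ l ≈ 0#
            off′ l l∉ = off (l∉ ∘ proj₂ (proj₂ (proj₁ full₁)))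

        -- Expressing w j₁ through D and w j gives a relation which increases the coefficient of top priority.
        not-other : ∀ {σ j} → FullD σ j → j ≢ j₁ → ¬ Optimal σ
        not-other {σ} {j} full j≢ opt = opt κ (difference-relation λ l → trans (combination-e w j₁ l) (sym (spread-coord cj≉0 (w j₁) l)))
            (λ {i} i∉ → ≤-trans (e-nonneg j₁ i) (≈⇒≥ (κ≈e (λ { (q , ≡.refl) → i∉ (proj₁ (proj₂ (proj₁ full)) q) }))))
            (≡.subst (λ is → LexPos (is ++ List.allFin n) κ) eq (inj₁ (<-respʳ (sym (trans (κ≈e j₁∉ρ) (e-diag j₁))) 0<1)))
          where
          cj≉0 : ¬ c j ≈ 0#
          cj≉0 = Surv.cj≉0 full
          κ : Fin n → Carrier
          κ i = e j₁ i - spread (π cj≉0) (coord cj≉0 (w j₁)) i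
          κ≈e : ∀ {i} → i ∉Image (π cj≉0) → κ i ≈ e j₁ i
          κ≈e {i} i∉ = trans (+-congˡ (-‿cong (spread-off (π cj≉0) (coord cj≉0 (w j₁)) i i∉))) (solve 1 (λ t → t :- :0 := t) refl (e j₁ i))
          j₁∉ρ : j₁ ∉Image (π cj≉0)
          j₁∉ρ (q , eq′) = j≢ (≡.sym (Surv.only-j full (≡.subst (_∈ˢ σ) eq′ (proj₁ (proj₂ (proj₁ full)) q)) j₁∉))

        same-subset : ∀ {σ j} → FullD σ j → j ≡ j₁ → σ ≡ σ₁
        same-subset {σ} full ≡.refl = ⊆-antisym
          (λ i∈ → let q , eq = proj₂ (proj₂ (proj₁ full)) i∈ in ≡.subst (_∈ˢ σ₁) eq (proj₁ (proj₂ (proj₁ full₁)) q))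
          (λ i∈ → let q , eq = proj₂ (proj₂ (proj₁ full₁)) i∈ in ≡.subst (_∈ˢ σ) eq (proj₁ (proj₂ (proj₁ full)) q))

        F : Subset n → Carrier
        F σ = V σ * productOut σ c

        off-σ₁ : ∀ {σ} → σ ≢ σ₁ → F σ ≈ 0#
        off-σ₁ {σ} σ≢ = [ id , (λ { (j , opt , full , _) → ⊥-elim (clash full opt (j Fin.≟ j₁)) }) ]′ (only-D σ)
          where
          clash : ∀ {j} → FullD σ j → Optimal σ → ¬ Dec (j ≡ j₁)
          clash full opt (yes q) = σ≢ (same-subset full q)
          clash full opt (no q) = not-other full q opt

        only-σ₁ : sumᴸ (subsets n) F ≈ F σ₁
        only-σ₁ = sumᴸ-single (subsets n) (subsets-unique n) (subsets-complete σ₁)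
          where
          open import Data.List.Relation.Unary.Unique.Propositional using (Unique)
          none : ∀ (σs : List (Subset n)) → All.All (σ₁ ≢_) σs → sumᴸ σs F ≈ 0#
          none [] _ = refl
          none (σ ∷ σs) (q All.∷ qs) = trans (+-cong (off-σ₁ (q ∘ ≡.sym)) (none σs qs)) (+-identityˡ 0#)
          sumᴸ-single : ∀ σs → Unique σs → σ₁ ∈ σs → sumᴸ σs F ≈ F σ₁
          sumᴸ-single (σ ∷ σs) (q ∷ u) (here ≡.refl) = trans (+-congˡ (none σs q)) (+-identityʳ _)
          sumᴸ-single (σ ∷ σs) (q ∷ u) (there r) = trans (+-cong (off-σ₁ (All.lookup q r)) (sumᴸ-single σs u r)) (+-identityˡ _)

        -- The ordering stored in `value` ends in some element of σ₁ outside D, which can only be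
        -- `j₁`.
        V₁ : V σ₁ ≈ ∣ c j₁ ∣
        V₁ = [ (λ { (_ , j , full , q) → trans q (∣∣-cong (trans (det-∷ʳ j) (reflexive (≡.cong c (Surv.only-j full₁ (Surv.j∈ full) (Surv.j∉ full)))))) })
             , [ (λ { (_ , noD) → ⊥-elim (noD (j₁ , full₁)) }) , (λ { (no-full , _) → ⊥-elim (no-full (optimal₁ , D ∷ʳ j₁ , full₁)) }) ]′ ]′ (proj₂ (value σ₁))

        outside-product : c j₁ * productOut σ₁ c ≈ productOutside D c
        outside-product = begin
          c j₁ * productOut σ₁ c ≈⟨ *-congʳ (product-single c j₁) ⟨
          product (λ i → if does (i Fin.≟ j₁) then c i else 1#) * productOut σ₁ c
            ≈⟨ product-distrib-* (λ i → if does (i Fin.≟ j₁) then c i else 1#) (λ i → if does (i ∈? σ₁) then 1# else c i) ⟨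
          product (λ i → (if does (i Fin.≟ j₁) then c i else 1#) * (if does (i ∈? σ₁) then 1# else c i))
            ≈⟨ product-cong (λ i → pointwise i (i Fin.≟ j₁) (i ∈? σ₁) (∉D? i)) ⟩
          product (λ i → if does (∉D? i) then c i else 1#) ≈⟨ product-filter ∉D? c id ⟨
          productOutside D c ∎
          where
          open ≈-Reasoning
          pointwise : ∀ i (p : Dec (i ≡ j₁)) (q : Dec (i ∈ˢ σ₁)) (r : Dec (i ∉Image D)) →
                      (if does p then c i else 1#) * (if does q then 1# else c i) ≈ (if does r then c i else 1#)
          pointwise i (yes ≡.refl) (yes q) (yes r) = *-identityʳ _
          pointwise i (yes ≡.refl) (no q) r = ⊥-elim (q (Surv.j∈ full₁))
          pointwise i (yes ≡.refl) q (no r) = ⊥-elim (r j₁∉)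
          pointwise i (no p) (yes q) (yes r) = ⊥-elim (p (Surv.only-j full₁ q r))
          pointwise i (no p) (yes q) (no r) = *-identityˡ 1#
          pointwise i (no p) (no q) (yes r) = *-identityˡ _
          pointwise i (no p) (no q) (no r) = ⊥-elim (r (Surv.outside-D full₁ q))

        value-σ₁ : F σ₁ ≈ ε * productOutside D c
        value-σ₁ = trans (*-congʳ (trans V₁ (∣c∣ j₁∉))) (trans (*-assoc ε (c j₁) (productOut σ₁ c)) (*-congˡ outside-product))

    productOutside-zero : ∀ {j} → j ∉Image D → c j ≈ 0# → productOutside D c ≈ 0#
    productOutside-zero {j} j∉ cj≈0 = go outs (∈-outs j∉)
      where
      go : ∀ js → j ∈ js → List.foldr _*_ 1# (List.map c js) ≈ 0#
      go (i ∷ js) (here ≡.refl) = trans (*-congʳ cj≈0) (zeroˡ _)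
      go (i ∷ js) (there j∈) = trans (*-congˡ (go js j∈)) (zeroʳ _)

    -- The position of the generators outside D relative to its hyperplane. Setting aside those on
    -- the hyperplane makes the inequalities of `one-side` strict.
    data Position : Set where
      flat     : ∀ {j} → j ∉Image D → c j ≈ 0# → Position
      crossed  : ∀ {a b} → 0# < c a → c b < 0# → Position
      one-side : ∀ {ε} → ε ≈ 1# ⊎ ε ≈ - 1# → (∀ {j} → j ∉Image D → 0# < ε * c j) → Position

    position : Position
    position with em {P = ∃ λ j → j ∉Image D × c j ≈ 0#} | em {P = ∃ λ a → 0# < c a} | em {P = ∃ λ b → c b < 0#}
    ... | yes (_ , j∉ , q) | _ | _ = flat j∉ q
    ... | no _ | yes (_ , p) | yes (_ , q) = crossed p q
    ... | no nz | no np | _ = one-side (inj₂ refl) λ {j} j∉ → [ (λ q → <-respʳ (solve 1 (λ x → :- x := (:- :1) :* x) refl (c j)) (neg-pos q))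
                                                         , (λ q → ⊥-elim ([ (λ r → np (j , r)) , (λ r → nz (j , j∉ , sym r)) ]′ q)) ]′ (<-or-≥ (c j) 0#)
    ... | no nz | yes _ | no nn = one-side (inj₁ refl) λ {j} j∉ → [ (λ q → ⊥-elim (nn (j , q)))
                                                         , (λ q → <-respʳ (sym (*-identityˡ (c j))) ([ id , (λ r → ⊥-elim (nz (j , j∉ , sym r))) ]′ q)) ]′ (<-or-≥ (c j) 0#)

    -- Generators strictly on one side would make D extremal; in the other two positions all terms
    -- vanish.
    interior : ¬ Extremal v w D → eval p D* ≈ 0#
    interior not-extremal with position
    ... | flat j∉ q = degenerate j∉ q
    ... | crossed p q = opposite-signs p q
    ... | one-side ε≈±1 same = ⊥-elim (not-extremal (same-sign⇒extremal (proj₂ exists-∉) same))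

    -- One negative determinant settles the sign, because a positive one beside it would put a point
    -- of the cone over D into the interior.
    common-sign : Extremal v w D → ∃ λ ε → (ε ≈ 1# ⊎ ε ≈ - 1#) × (∀ j → ¬ c j ≈ 0# → 0# < ε * c j)
    common-sign extremal with em {P = ∃ λ b → c b < 0#}
    ... | yes (b , cb<0) = - 1# , inj₂ refl , λ j cj≉0 → <-respʳ (solve 1 (λ x → :- x := (:- :1) :* x) refl (c j))
            (neg-pos ([ id , (λ q → ⊥-elim (opposite-signs⇒¬extremal (≤∧≉⇒< q (cj≉0 ∘ sym)) cb<0 extremal)) ]′ (<-or-≥ (c j) 0#)))
    ... | no none = 1# , inj₁ refl , λ j cj≉0 → <-respʳ (sym (*-identityˡ (c j))) (≤∧≉⇒< (≮⇒≥ λ q → none (j , q)) (cj≉0 ∘ sym))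

    extremal-value : Extremal v w D → ∃ λ ε → (ε ≈ 1# ⊎ ε ≈ - 1#) × (∀ j → j ∉Image D → ¬ c j ≈ 0# → 0# < ε * c j) × eval p D* ≈ ε * productOutside D c
    extremal-value extremal = let ε , ε≈±1 , signs = common-sign extremal in ε , ε≈±1 , (λ j _ → signs j) , evaluate ε ε≈±1 signs
      where
      evaluate : ∀ ε → (ε ≈ 1# ⊎ ε ≈ - 1#) → (∀ j → ¬ c j ≈ 0# → 0# < ε * c j) → eval p D* ≈ ε * productOutside D c
      evaluate ε ε≈±1 signs with em {P = ∃ λ j → j ∉Image D × c j ≈ 0#}
      -- A zero determinant makes both sides vanish, so the sign is irrelevant here.
      ... | yes (j , j∉ , q) = trans (degenerate j∉ q) (sym (trans (*-congˡ (productOutside-zero j∉ q)) (zeroʳ ε)))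
      ... | no none = same-sign ε≈±1 λ {j} j∉ → signs j λ q → none (j , j∉ , q)

mainTheorem1 :
  (em : ExcludedMiddle 0ℓ) (ℝ : CompleteOrderedField) →
  let open CompleteOrderedField ℝ
      open Real em ℝ
  in
  (exp : Carrier → Carrier) → IsExp exp →
  (m n : ℕ) → n ≥ suc m →
  (v : ℝ^ (suc m)) (w : Fin n → ℝ^ (suc m)) →
  (∀ i → ¬ w i ≋ 0ᵛ) → Injective _≡_ _≋_ w →
  StrictlyConvex (Cone v w) →
  (p : HomPoly (suc m) (n ∸ suc m)) → IsConePolynomial exp v w p →
  (D : Fin m → Fin n) → Injective _≡_ _≡_ D →
  (D* : ℝ^ (suc m)) → IsCrossProduct (λ i → w (D i)) D* →
  let detD = λ j → det ((λ i → w (D i)) ∷ʳ w j) in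
  (Extremal v w D →
    ∃ λ ε → (ε ≈ 1# ⊎ ε ≈ - 1#) ×
            (∀ j → j ∉Image D → ¬ detD j ≈ 0# → 0# < ε * detD j) ×
            eval p D* ≈ ε * productOutside D detD)
  ×
  (¬ Extremal v w D → eval p D* ≈ 0#)
mainTheorem1 em ℝ exp isExp m n n≥ v w w≉0 _ convex p p-cone D D-inj D* D*-cross =
  extremal-value , interior
  where
  open ConvexCones em ℝ using (strictly-convex⇒positive)
  positive : _
  positive = strictly-convex⇒positive v w w≉0 convex
  open DiagonalValues.Main em ℝ exp isExp n≥ v w (proj₁ positive) (proj₂ positive) p p-cone D D-inj D* D*-cross
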